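{- Let $n\ge 1$ and let $\lambda$ be a partition of $n$ with $l$ parts, and for each $i\ge1$ let $n_i$ be the number of parts of $\lambda$ equal to $i$. Let $S_\lambda$ be the set of dissections of a regular $(n+2)$-gon by noncrossing diagonals such that the multiset of numbers of sides of the pieces is $\{\lambda_1+2,\dots,\lambda_l+2\}$ (i.e. for each $i$ there are exactly $n_i$ pieces which are $(i+2)$-gons), and let $C_{n+2}$ act on $S_\lambda$ by rotation of the polygon (a generator rotating by one vertex). Let \[ \mu_\lambda(q)=\frac{1}{[n+1]_q}\begin{bmatrix} n+l\\ n_1,n_2,\dots,n_n,n\end{bmatrix}_q . \] Then $(S_\lambda, C_{n+2},\mu_\lambda(q))$ exhibits the cyclic sieving phenomenon.
   Context: $[a]_q=1+q+\dots+q^{a-1}$, $[a]_q!=[1]_q\cdots[a]_q$, and $\begin{bmatrix} N\\ a_1,\dots,a_r\end{bmatrix}_q=\frac{[N]_q!}{[a_1]_q!\cdots[a_r]_q!}$ when $a_1+\dots+a_r=N$. A triple $(S,C,P(q))$ with $C$ a finite cyclic group acting on a finite set $S$ exhibits the cyclic sieving phenomenon if for every $g\in C$ of order $d$, $P(e^{2i\pi/d})$ equals the number of elements of $S$ fixed by $g$. (In the paper, $S_\lambda$ is the set of faces of the cluster complex of type $A_{n-1}$ of parabolic type $\lambda$, i.e. of type $\prod_i\mathfrak{S}_{\lambda_i}$, and the rotation is the Fomin–Zelevinsky rotation.) -}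

module Defs where

open import Data.Bool using (Bool; true; false; _∧_; _∨_; not; if_then_else_)
open import Data.Nat as Nat using (ℕ; zero; suc; _≤ᵇ_; _<ᵇ_; _≡ᵇ_; _⊔_; _⊓_; _<_; _≤_)
open import Data.Nat.DivMod using (_%_)
open import Data.Nat.Divisibility using (_∣_; _∣?_)
open import Data.Integer as ℤ using (ℤ; 0ℤ; 1ℤ; +_)
open import Data.List as List using (List; []; _∷_; _++_; [_]; map; length; filter; filterᵇ; upTo; foldr; reverse; drop; replicate; concatMap)
open import Data.Bool.ListAction using (any; all)
open import Data.Nat.ListAction using (sum)
open import Data.List.Relation.Unary.All using (All)
open import Data.List.Relation.Unary.Linked using (Linked)
open import Data.Product using (_×_; _,_; proj₁; proj₂; Σ)
open import Relation.Binary.PropositionalEquality using (_≡_)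
open import Relation.Nullary using (¬_)

-- Integer polynomials in q, as coefficient lists (constant term first).

Poly : Set
Poly = List ℤ

infixl 6 _+ₚ_ _-ₚ_
infixl 7 _*ₚ_

_+ₚ_ : Poly → Poly → Poly
[] +ₚ q = q
(a ∷ p) +ₚ [] = a ∷ p
(a ∷ p) +ₚ (b ∷ q) = (a ℤ.+ b) ∷ (p +ₚ q)

negₚ : Poly → Poly
negₚ = map (λ x → ℤ.- x)

_-ₚ_ : Poly → Poly → Poly
p -ₚ q = p +ₚ negₚ q

scaleₚ : ℤ → Poly → Poly
scaleₚ c = map (c ℤ.*_)

_*ₚ_ : Poly → Poly → Poly
[] *ₚ q = []
(a ∷ p) *ₚ q = scaleₚ a q +ₚ (0ℤ ∷ (p *ₚ q))

oneₚ : Poly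
oneₚ = [ 1ℤ ]

prodₚ : List Poly → Poly
prodₚ = foldr _*ₚ_ oneₚ

Xpow : ℕ → Poly
Xpow k = replicate k 0ℤ ++ [ 1ℤ ]

-- polynomial equality (coefficientwise, ignoring trailing zeros)
IsZeroₚ : Poly → Set
IsZeroₚ p = All (_≡ 0ℤ) p

infix 4 _≈ₚ_ _∣ₚ_
_≈ₚ_ : Poly → Poly → Set
p ≈ₚ q = IsZeroₚ (p -ₚ q)

_∣ₚ_ : Poly → Poly → Set
d ∣ₚ f = Σ Poly (λ g → d *ₚ g ≈ₚ f)

qint : ℕ → Poly
qint a = replicate a 1ℤ

qfact : ℕ → Poly
qfact zero = oneₚ
qfact (suc a) = qfact a *ₚ qint (suc a)

-- Cyclotomic polynomials: Φ_d = (q^d - 1) / ∏_{e ∣ d, e < d} Φ_e,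
-- computed by long division by a monic polynomial.

private
  subFront : List ℤ → List ℤ → List ℤ
  subFront xs [] = xs
  subFront [] (y ∷ ys) = ℤ.- y ∷ subFront [] ys
  subFront (x ∷ xs) (y ∷ ys) = (x ℤ.- y) ∷ subFront xs ys

  -- dividend and divisor-tail in highest-degree-first order
  hdiv : ℕ → List ℤ → List ℤ → List ℤ
  hdiv zero f gt = []
  hdiv (suc k) [] gt = []
  hdiv (suc k) (c ∷ fs) gt =
    if length fs <ᵇ length gt then [] else c ∷ hdiv k (subFront fs (scaleₚ c gt)) gt

divMonic : Poly → Poly → Poly
divMonic f g = reverse (hdiv (length f) (reverse f) (drop 1 (reverse g)))

private
  newCyclo : ℕ → List (ℕ × Poly) → Poly
  newCyclo d tbl =
    divMonic (Xpow d -ₚ oneₚ)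
             (prodₚ (map proj₂ (filter (λ p → proj₁ p ∣? d) tbl)))

  cycloTable : ℕ → List (ℕ × Poly)
  cycloTable zero = []
  cycloTable (suc n) = cycloTable n ++ [ (suc n , newCyclo (suc n) (cycloTable n)) ]

-- d-th cyclotomic polynomial (d ≥ 1; value at 0 is junk)
cyclotomic : ℕ → Poly
cyclotomic zero = oneₚ
cyclotomic (suc n) = newCyclo (suc n) (cycloTable n)

-- Dissections of the (n+2)-gon with vertices 0,1,…,n+1.
-- A diagonal is a pair (a , b) with a < b, written with a < b.

Pair : Set
Pair = ℕ × ℕ

pairEq : Pair → Pair → Bool
pairEq (a , b) (c , d) = (a ≡ᵇ c) ∧ (b ≡ᵇ d)

memberᵇ : Pair → List Pair → Bool
memberᵇ x = any (pairEq x)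

diagonals : ℕ → List Pair
diagonals n =
  filterᵇ isDiag (concatMap (λ a → map (a ,_) (upTo N)) (upTo N))
  where
  N = suc (suc n)
  isDiag : Pair → Bool
  isDiag (a , b) = (suc (suc a) ≤ᵇ b) ∧ (b <ᵇ N) ∧ not ((a ≡ᵇ 0) ∧ (suc b ≡ᵇ N))

isEdge : ℕ → Pair → Bool
isEdge n (a , b) = (suc a ≡ᵇ b) ∨ ((a ≡ᵇ 0) ∧ (suc b ≡ᵇ suc (suc n)))

crosses : Pair → Pair → Bool
crosses (a , b) (c , d) =
  ((a <ᵇ c) ∧ (c <ᵇ b) ∧ (b <ᵇ d)) ∨ ((c <ᵇ a) ∧ (a <ᵇ d) ∧ (d <ᵇ b))

noncrossing : List Pair → Bool
noncrossing D = all (λ δ → all (λ ε → not (crosses δ ε)) D) D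

subsets : {A : Set} → List A → List (List A)
subsets [] = [ [] ]
subsets (x ∷ xs) = map (x ∷_) (subsets xs) ++ subsets xs

-- all sets of diagonals (each listed once, as a sublist of `diagonals n`)
diagonalSets : ℕ → List (List Pair)
diagonalSets n = subsets (diagonals n)

-- sides of the convex polygon with (increasingly listed) vertex set V
private
  consec : List ℕ → List Pair
  consec (x ∷ y ∷ r) = (x , y) ∷ consec (y ∷ r)
  consec _ = []

  lastOr : ℕ → List ℕ → ℕ
  lastOr v [] = v
  lastOr v (y ∷ r) = lastOr y r

sides : List ℕ → List Pair
sides [] = []
sides (v ∷ r) = consec (v ∷ r) ++ [ (v , lastOr v r) ]

-- V (an increasing list of vertices) spans a piece of the dissection D:
-- at least 3 vertices, every side of V is a boundary edge or a diagonal
-- of D, and no diagonal of D joins two vertices of V other than a side.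
isPiece : ℕ → List Pair → List ℕ → Bool
isPiece n D V =
  (3 ≤ᵇ length V)
  ∧ all (λ s → isEdge n s ∨ memberᵇ s D) (sides V)
  ∧ all (λ δ → not (inV (proj₁ δ) ∧ inV (proj₂ δ) ∧ not (memberᵇ δ (sides V)))) D
  where
  inV : ℕ → Bool
  inV a = any (a ≡ᵇ_) V

pieceCount : ℕ → List Pair → ℕ → ℕ
pieceCount n D s =
  length (filterᵇ (λ V → (length V ≡ᵇ s) ∧ isPiece n D V) (subsets (upTo (suc (suc n)))))

IsPartition : ℕ → List ℕ → Set
IsPartition n lam = (sum lam ≡ n) × All (0 <_) lam × Linked (λ x y → y ≤ x) lam

mult : ℕ → List ℕ → ℕ
mult i lam = length (filterᵇ (_≡ᵇ i) lam)

inS : ℕ → List ℕ → List Pair → Bool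
inS n lam D =
  noncrossing D ∧ all (λ j → pieceCount n D (suc j + 2) ≡ᵇ mult (suc j) lam) (upTo n)
  where open Nat using (_+_)

Slam : ℕ → List ℕ → List (List Pair)
Slam n lam = filterᵇ (inS n lam) (diagonalSets n)

rot : ℕ → ℕ → Pair → Pair
rot n k (a , b) = (a' ⊓ b') , (a' ⊔ b')
  where
  open Nat using (_+_)
  a' = (a + k) % suc (suc n)
  b' = (b + k) % suc (suc n)

-- D is fixed by rotation by k (rotation is injective on the finite set D)
fixedBy : ℕ → ℕ → List Pair → Bool
fixedBy n k D = all (λ δ → memberᵇ (rot n k δ) D) D

fixCount : ℕ → List ℕ → ℕ → ℕ
fixCount n lam k = length (filterᵇ (fixedBy n k) (Slam n lam))

IsOrderOf : ℕ → ℕ → ℕ → Set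
IsOrderOf n k d =
  (0 < d) × (suc (suc n) ∣ k Nat.* d) × (∀ m → 0 < m → m < d → ¬ (suc (suc n) ∣ k Nat.* m))

muNum : ℕ → List ℕ → Poly
muNum n lam = qfact (n Nat.+ length lam)

muDen : ℕ → List ℕ → Poly
muDen n lam =
  qint (suc n) *ₚ prodₚ (map (λ j → qfact (mult (suc j) lam)) (upTo n)) *ₚ qfact n

-- A polynomial P exhibits the CSP for S_λ under C_{n+2}:
-- for every ρ^k (0 ≤ k < n+2) of order d, P(ω_d) = #fixed points,
-- i.e. P - #Fix(ρ^k) vanishes at primitive d-th roots of unity,
-- i.e. Φ_d divides P - #Fix(ρ^k) in ℤ[q].
CSP : ℕ → List ℕ → Poly → Set
CSP n lam P =
  ∀ k → k < suc (suc n) → ∀ d → IsOrderOf n k d →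
  cyclotomic d ∣ₚ (P -ₚ [ + fixCount n lam k ])

{-# OPTIONS --safe #-}
-- Reading a plane tree in prefix order, a dissection becomes the set of arcs spanned by the nodes of a
-- Łukasiewicz word, a (j + 2)-gon being a node with label j. Rooted at a boundary edge, the dissections of
-- type λ are the words of a single tree with n_j labels j; there are u (k − 1)! / (r! ∏ b_j!) words of k
-- letters coding u trees with r leaves and b_j labels j, by recursion on the first letter. A dissection
-- invariant under a rotation of order d ≥ 2 has a central (d u)-gon (a diameter when d u = 2); if vertex 0
-- lies on it, the dissection is the d-fold repetition of a word of u trees with r = (n + 2) / d leaves, in
-- which label j occurs ⌊n_j / d⌋ times. Counting pairs of an invariant dissection and a vertex modulo r on
-- its central polygon removes the condition on vertex 0: |Fix| = (r − 1 + p)! / ((r − 1)! ∏ ⌊n_j / d⌋!),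
-- where p = Σ ⌊n_j / d⌋, if at most one n_j leaves a remainder modulo d and this remainder is 1, and |Fix|
-- = 0 otherwise.
--
-- Modulo Φ_d the polynomial [b d + ρ]! is [d]^b times an element congruent to ([d − 1]!)^b b! [ρ]!. The
-- powers of [d] cancel in μ_λ before reduction, and what is left is the same value, since [a] is a
-- nonzerodivisor modulo Φ_d for d ∤ a: the ideal (Φ_d , [a]) contains a nonzero integer, and ℤ[q] / (Φ_d)
-- is torsion free because Φ_d has constant term ±1.

module Submission where

open import Defs
open import Data.Bool using (Bool; true; false; _∧_; _∨_; not; T; if_then_else_)
open import Data.Bool.ListAction using (any; all)
open import Data.Bool.Properties using (T?)
open import Data.Nat
open import Data.Nat.DivMod
open import Data.Nat.Divisibility using (_∣_; divides; _∣?_; ∣-trans; ∣m+n∣m⇒∣n)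
import Data.Nat.Divisibility as Div
import Data.Nat.Properties as ℕₚ
open import Data.Nat.GCD using (gcd; gcd[m,n]∣m; gcd[m,n]∣n; gcd-GCD; module Bézout)
open import Data.Nat.Coprimality using (Coprime; coprime-Bézout)
open import Data.Nat.Induction using (<-rec)
open import Data.Nat.ListAction using (sum; product)
open import Data.Nat.Tactic.RingSolver using (solve-∀)
open import Data.Integer as ℤ using (ℤ; 0ℤ; 1ℤ)
import Data.Integer.Properties as ℤₚ
open import Data.Product using (Σ; ∃; _×_; _,_; proj₁; proj₂; uncurry)
open import Data.Sum using (_⊎_; inj₁; inj₂; [_,_]′)
import Data.Sum as Sum
open import Data.Empty using (⊥; ⊥-elim)
open import Data.Unit using (⊤; tt)
open import Data.List as List using (List; []; _∷_; _++_; [_]; map; length; filter; filterᵇ; upTo; reverse; drop; replicate; concatMap; concat)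
import Data.List.Properties as Listₚ
open import Data.List.Membership.Propositional using (_∈_; _∉_; find; lose)
open import Data.List.Membership.Propositional.Properties
open import Data.List.Relation.Unary.Any as Any using (here; there)
open import Data.List.Relation.Unary.All as All using (All; []; _∷_)
open import Data.List.Relation.Unary.AllPairs as AllPairs using (AllPairs; []; _∷_)
import Data.List.Relation.Unary.AllPairs.Properties as AllPairsₚ
open import Data.List.Relation.Unary.Unique.Propositional using (Unique)
import Data.List.Relation.Unary.Unique.Propositional.Properties as Uniqueₚ
open import Data.Vec as Vec using (Vec; []; _∷_)
open import Data.Vec.N-ary using (N-ary; _$ⁿ_)
open import Data.Fin as Fin using (Fin)
open import Function using (_∘_; id; case_of_)
open import Relation.Nullary using (¬_; Dec; yes; no)
open import Relation.Binary.PropositionalEquality hiding ([_])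
open import Algebra.Bundles using (CommutativeRing)
open import Level using (0ℓ)
open import Data.Maybe using (Maybe; just; nothing)
open import Tactic.RingSolver.Core.AlmostCommutativeRing using (AlmostCommutativeRing; fromCommutativeRing)
import Tactic.RingSolver as RingSolver
import Data.Integer.Tactic.RingSolver as ℤSolver
import Relation.Binary.Reasoning.Setoid as SetoidReasoning

-- The definitions are computational, and this shapes the proof. Pieces are found by testing every
-- subset of the vertices, so a type cannot be read off a word directly. The number of pieces of
-- each size is followed through two operations instead, rotation of the polygon and gluing of a
-- polygon onto a boundary edge; every word is reached from that of a single polygon by gluings. The
-- cyclotomic polynomials are the output of a long division whose exactness is not evident. With no
-- roots of unity to compare and no field to divide in, coprimality of two of them is replaced by a
-- positive integer in the ideal that they generate. Exactness, divisibility and regularity all come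
-- from this, because an integer can be cancelled against a polynomial with constant term ±1. Two
-- cases stand apart: for d = 1 no central polygon is distinguished and [d] is 1, and for d u = 2
-- the centre is a diagonal and not a piece. Counts are never written as quotients; each is
-- multiplied by the factorials of its denominator.

-- Linear arithmetic: a Fourier–Motzkin search proposes Farkas multipliers, and only the check of the
-- proposed certificate is proved sound.
module LinearArithmetic where

  infixl 6 _⊹_
  infixl 7 _⊛_
  infix 4 _≼_ _≺_ _≐_
  infixr 3 _⇛_

  data Expr (n : ℕ) : Set where
    var : Fin n → Expr n
    # : ℕ → Expr n
    _⊹_ : Expr n → Expr n → Expr n
    _⊛_ : ℕ → Expr n → Expr n

  data Atom (n : ℕ) : Set where
    _≼_ _≺_ _≐_ : Expr n → Expr n → Atom n

  data Sequent (n : ℕ) : Set where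
    ⊩_ : Atom n → Sequent n
    ⊩⊥ : Sequent n
    _⇛_ : Atom n → Sequent n → Sequent n
  infix 3 ⊩_

  Env : ℕ → Set
  Env = Vec ℕ

  ⟦_⟧ : ∀ {n} → Expr n → Env n → ℕ
  ⟦ var i ⟧ ρ = Vec.lookup ρ i
  ⟦ # k ⟧ ρ = k
  ⟦ e ⊹ f ⟧ ρ = ⟦ e ⟧ ρ + ⟦ f ⟧ ρ
  ⟦ k ⊛ e ⟧ ρ = k * ⟦ e ⟧ ρ

  ⟦_⟧ᵃ : ∀ {n} → Atom n → Env n → Set
  ⟦ e ≼ f ⟧ᵃ ρ = ⟦ e ⟧ ρ ≤ ⟦ f ⟧ ρ
  ⟦ e ≺ f ⟧ᵃ ρ = ⟦ e ⟧ ρ < ⟦ f ⟧ ρ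
  ⟦ e ≐ f ⟧ᵃ ρ = ⟦ e ⟧ ρ ≡ ⟦ f ⟧ ρ

  ⟦_⟧ˢ : ∀ {n} → Sequent n → Env n → Set
  ⟦ ⊩ a ⟧ˢ ρ = ⟦ a ⟧ᵃ ρ
  ⟦ ⊩⊥ ⟧ˢ ρ = ⊥
  ⟦ a ⇛ s ⟧ˢ ρ = ⟦ a ⟧ᵃ ρ → ⟦ s ⟧ˢ ρ

  -- constant term first
  Lin : ℕ → Set
  Lin n = Vec ℕ (suc n)

  zeros : ∀ n → Vec ℕ n
  zeros n = Vec.replicate n 0

  unit : ∀ {n} → Fin n → Vec ℕ n
  unit {suc n} Fin.zero = 1 ∷ zeros n
  unit (Fin.suc i) = 0 ∷ unit i

  plus : ∀ {n} → Vec ℕ n → Vec ℕ n → Vec ℕ n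
  plus = Vec.zipWith _+_

  times : ∀ {n} → ℕ → Vec ℕ n → Vec ℕ n
  times k = Vec.map (k *_)

  lin : ∀ {n} → Expr n → Lin n
  lin (var i) = 0 ∷ unit i
  lin (# k) = k ∷ zeros _
  lin (e ⊹ f) = plus (lin e) (lin f)
  lin (k ⊛ e) = times k (lin e)

  dot : ∀ {n} → Vec ℕ n → Env n → ℕ
  dot [] [] = 0
  dot (a ∷ v) (x ∷ ρ) = a * x + dot v ρ

  dot-zeros : ∀ {n} (ρ : Env n) → dot (zeros n) ρ ≡ 0
  dot-zeros [] = refl
  dot-zeros (x ∷ ρ) = dot-zeros ρ

  dot-unit : ∀ {n} (i : Fin n) ρ → dot (unit i) ρ ≡ Vec.lookup ρ i
  dot-unit Fin.zero (x ∷ ρ) rewrite dot-zeros ρ | ℕₚ.+-identityʳ x = ℕₚ.+-identityʳ x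
  dot-unit (Fin.suc i) (x ∷ ρ) = dot-unit i ρ

  dot-plus : ∀ {n} (v w : Vec ℕ n) ρ → dot (plus v w) ρ ≡ dot v ρ + dot w ρ
  dot-plus [] [] [] = refl
  dot-plus (a ∷ v) (b ∷ w) (x ∷ ρ) rewrite dot-plus v w ρ = interchange a b x (dot v ρ) (dot w ρ)
    where
    interchange : ∀ a b x c d → (a + b) * x + (c + d) ≡ (a * x + c) + (b * x + d)
    interchange = solve-∀

  dot-times : ∀ {n} k (v : Vec ℕ n) ρ → dot (times k v) ρ ≡ k * dot v ρ
  dot-times k [] [] = sym (ℕₚ.*-zeroʳ k)
  dot-times k (a ∷ v) (x ∷ ρ) rewrite dot-times k v ρ = factor k a x (dot v ρ)
    where
    factor : ∀ k a x d → (k * a) * x + k * d ≡ k * (a * x + d)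
    factor = solve-∀

  lin-sound : ∀ {n} (e : Expr n) ρ → dot (lin e) (1 ∷ ρ) ≡ ⟦ e ⟧ ρ
  lin-sound (var i) ρ = dot-unit i ρ
  lin-sound (# k) ρ rewrite dot-zeros ρ | ℕₚ.*-identityʳ k = ℕₚ.+-identityʳ k
  lin-sound (e ⊹ f) ρ rewrite dot-plus (lin e) (lin f) (1 ∷ ρ) | lin-sound e ρ | lin-sound f ρ = refl
  lin-sound (k ⊛ e) ρ rewrite dot-times k (lin e) (1 ∷ ρ) | lin-sound e ρ = refl

  -- Both sides keep natural coefficients, read against the environment extended by 1. Nothing is
  -- moved across the inequality, so the soundness proof involves no subtraction.
  Ineq : ℕ → Set
  Ineq n = Lin n × Lin n

  Holds : ∀ {n} → Env n → Ineq n → Set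
  Holds ρ (l , r) = dot l (1 ∷ ρ) ≤ dot r (1 ∷ ρ)

  AllHold : ∀ {n} → Env n → List (Ineq n) → Set
  AllHold ρ [] = ⊤
  AllHold ρ (i ∷ is) = Holds ρ i × AllHold ρ is

  combine : ∀ {n} → List ℕ → List (Ineq n) → Ineq n
  combine (m ∷ ms) ((l , r) ∷ is) with combine ms is
  ... | (l' , r') = plus (times m l) l' , plus (times m r) r'
  -- Missing multipliers count as 0, so the output of the unverified search need not have the right
  -- length.
  combine _ _ = zeros _ , zeros _

  combine-sound : ∀ {n} (ρ : Env n) ms is → AllHold ρ is → Holds ρ (combine ms is)
  combine-sound ρ [] is h = ℕₚ.≤-refl
  combine-sound ρ (m ∷ ms) [] h = ℕₚ.≤-refl
  combine-sound ρ (m ∷ ms) ((l , r) ∷ is) (h , hs)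
    with combine ms is | combine-sound ρ ms is hs
  ... | (l' , r') | h'
    rewrite dot-plus (times m l) l' (1 ∷ ρ) | dot-plus (times m r) r' (1 ∷ ρ)
          | dot-times m l (1 ∷ ρ) | dot-times m r (1 ∷ ρ)
    = ℕₚ.+-mono-≤ (ℕₚ.*-monoʳ-≤ m h) h'

  dominates : ∀ {n} → Vec ℕ n → Vec ℕ n → Bool
  dominates [] [] = true
  dominates (a ∷ v) (b ∷ w) = (b ≤ᵇ a) ∧ dominates v w

  T-∧ˡ : ∀ {a b} → T (a ∧ b) → T a
  T-∧ˡ {true} h = tt

  T-∧ʳ : ∀ {a b} → T (a ∧ b) → T b
  T-∧ʳ {true} h = h

  dominates-sound : ∀ {n} (v w : Vec ℕ n) ρ → T (dominates v w) → dot w ρ ≤ dot v ρ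
  dominates-sound [] [] [] h = z≤n
  dominates-sound (a ∷ v) (b ∷ w) (x ∷ ρ) h =
    ℕₚ.+-mono-≤ (ℕₚ.*-monoˡ-≤ x (ℕₚ.≤ᵇ⇒≤ b a (T-∧ˡ h))) (dominates-sound v w ρ (T-∧ʳ {b ≤ᵇ a} h))

  -- The variables range over ℕ, so dominating coefficients on the left suffice and nonnegativity
  -- never has to be listed as a hypothesis.
  contradictory : ∀ {n} → Ineq n → Bool
  contradictory (c ∷ l , d ∷ r) = (d <ᵇ c) ∧ dominates l r

  contradictory-sound : ∀ {n} (ρ : Env n) i → T (contradictory i) → Holds ρ i → ⊥
  contradictory-sound ρ (c ∷ l , d ∷ r) t h = ℕₚ.<-irrefl refl (ℕₚ.<-≤-trans
    (ℕₚ.+-mono-<-≤ (ℕₚ.*-monoˡ-< 1 (ℕₚ.<ᵇ⇒< d c (T-∧ˡ t))) (dominates-sound l r ρ (T-∧ʳ {d <ᵇ c} t))) h)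

  -- rows Σ aᵢ xᵢ ≤ Σ bᵢ xᵢ of pairs (aᵢ , bᵢ), the constant last, with their multipliers
  Row : Set
  Row = List (ℕ × ℕ) × List ℕ

  addL : List ℕ → List ℕ → List ℕ
  addL [] ys = ys
  addL xs [] = xs
  addL (x ∷ xs) (y ∷ ys) = (x + y) ∷ addL xs ys

  scaleR : ℕ → Row → Row
  scaleR k (cs , ms) = List.map (λ { (a , b) → k * a , k * b }) cs , List.map (k *_) ms

  addC : List (ℕ × ℕ) → List (ℕ × ℕ) → List (ℕ × ℕ)
  addC [] ys = ys
  addC xs [] = xs
  addC ((a , b) ∷ xs) ((c , d) ∷ ys) = ((a + c) ∸ (b + d) , (b + d) ∸ (a + c)) ∷ addC xs ys

  addR : Row → Row → Row
  addR (cs , ms) (ds , ns) = addC cs ds , addL ms ns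

  split : List Row → List (ℕ × Row) × List (ℕ × Row) × List Row
  split [] = [] , [] , []
  split (([] , ms) ∷ rs) = split rs
  split ((((a , b) ∷ cs) , ms) ∷ rs) with split rs
  ... | ps , ns , zs =
    if b <ᵇ a then ((a ∸ b) , cs , ms) ∷ ps , ns , zs
    else if a <ᵇ b then ps , ((b ∸ a) , cs , ms) ∷ ns , zs
    else ps , ns , (cs , ms) ∷ zs

  -- a variable occurring only positively on the left may be dropped, being nonnegative
  eliminate : List Row → List Row
  eliminate rs with split rs
  ... | ps , ns , zs =
    List.map proj₂ ps List.++ zs List.++
    List.concatMap (λ { (p , r) → List.map (λ { (q , s) → addR (scaleR q r) (scaleR p s) }) ns }) ps

  eliminateAll : ℕ → List Row → List Row
  eliminateAll zero rs = rs
  eliminateAll (suc k) rs = eliminateAll k (eliminate rs)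

  search : List Row → List ℕ
  search [] = []
  search (((a , b) ∷ _ , ms) ∷ rs) = if b <ᵇ a then ms else search rs
  search ((_ , ms) ∷ rs) = search rs

  -- `pre` holds one 0 for each earlier row. The multipliers thus start as unit vectors and record
  -- how a derived row was combined from the given ones.
  rows : ∀ {n} → List ℕ → List (Ineq n) → List Row
  rows pre [] = []
  rows pre ((c ∷ l , d ∷ r) ∷ is) =
    (addC [] (Vec.toList (Vec.zip l r) List.++ (c , d) ∷ []) , pre List.++ 1 ∷ []) ∷ rows (0 ∷ pre) is

  multipliers : ∀ {n} → List (Ineq n) → List ℕ
  multipliers {n} is = search (eliminateAll n (rows [] is))

  refutes : ∀ {n} → List (Ineq n) → Bool
  refutes is = contradictory (combine (multipliers is) is)

  refutes-sound : ∀ {n} (ρ : Env n) is → T (refutes is) → AllHold ρ is → ⊥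
  refutes-sound ρ is t h = contradictory-sound ρ (combine (multipliers is) is) t (combine-sound ρ (multipliers is) is h)

  leq : ∀ {n} → Expr n → Expr n → Ineq n
  leq e f = lin e , lin f

  leq-holds : ∀ {n} (ρ : Env n) e f → ⟦ e ⟧ ρ ≤ ⟦ f ⟧ ρ → Holds ρ (leq e f)
  leq-holds ρ e f h rewrite lin-sound e ρ | lin-sound f ρ = h

  valid : ∀ {n} → List (Ineq n) → Sequent n → Bool
  valid hs (⊩ e ≼ f) = refutes (leq (# 1 ⊹ f) e ∷ hs)
  valid hs (⊩ e ≺ f) = refutes (leq f e ∷ hs)
  valid hs (⊩ e ≐ f) = refutes (leq (# 1 ⊹ f) e ∷ hs) ∧ refutes (leq (# 1 ⊹ e) f ∷ hs)
  valid hs ⊩⊥ = refutes hs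
  valid hs (e ≼ f ⇛ s) = valid (leq e f ∷ hs) s
  valid hs (e ≺ f ⇛ s) = valid (leq (# 1 ⊹ e) f ∷ hs) s
  valid hs (e ≐ f ⇛ s) = valid (leq e f ∷ leq f e ∷ hs) s

  prove≤ : ∀ {n} (ρ : Env n) hs e f → T (refutes (leq (# 1 ⊹ f) e ∷ hs)) → AllHold ρ hs → ⟦ e ⟧ ρ ≤ ⟦ f ⟧ ρ
  prove≤ ρ hs e f t h with ⟦ e ⟧ ρ ≤? ⟦ f ⟧ ρ
  ... | yes p = p
  ... | no p = ⊥-elim (refutes-sound ρ _ t (leq-holds ρ (# 1 ⊹ f) e (ℕₚ.≰⇒> p) , h))

  valid-sound : ∀ {n} (ρ : Env n) hs s → T (valid hs s) → AllHold ρ hs → ⟦ s ⟧ˢ ρ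
  valid-sound ρ hs (⊩ e ≼ f) t h = prove≤ ρ hs e f t h
  valid-sound ρ hs (⊩ e ≺ f) t h with ⟦ e ⟧ ρ <? ⟦ f ⟧ ρ
  ... | yes p = p
  ... | no p = ⊥-elim (refutes-sound ρ _ t (leq-holds ρ f e (ℕₚ.≮⇒≥ p) , h))
  valid-sound ρ hs (⊩ e ≐ f) t h =
    ℕₚ.≤-antisym (prove≤ ρ hs e f (T-∧ˡ t) h)
      (prove≤ ρ hs f e (T-∧ʳ {refutes (leq (# 1 ⊹ f) e ∷ hs)} t) h)
  valid-sound ρ hs ⊩⊥ t h = refutes-sound ρ hs t h
  valid-sound ρ hs (e ≼ f ⇛ s) t h p = valid-sound ρ _ s t (leq-holds ρ e f p , h)
  valid-sound ρ hs (e ≺ f ⇛ s) t h p = valid-sound ρ _ s t (leq-holds ρ (# 1 ⊹ e) f p , h)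
  valid-sound ρ hs (e ≐ f ⇛ s) t h p =
    valid-sound ρ _ s t (leq-holds ρ e f (ℕₚ.≤-reflexive p) , leq-holds ρ f e (ℕₚ.≤-reflexive (sym p)) , h)

  allVars : ∀ n → Vec (Expr n) n
  allVars n = Vec.tabulate var

  close : ∀ n → N-ary n (Expr n) (Sequent n) → Sequent n
  close n f = f $ⁿ allVars n

  ∀Env : ∀ n → (Env n → Set) → Set
  ∀Env zero P = P []
  ∀Env (suc n) P = ∀ x → ∀Env n (λ ρ → P (x ∷ ρ))

  fromEnv : ∀ n {P : Env n → Set} → (∀ ρ → P ρ) → ∀Env n P
  fromEnv zero f = f []
  fromEnv (suc n) f x = fromEnv n (λ ρ → f (x ∷ ρ))

  -- For a concrete sequent `valid` evaluates to `true`, so `t` has type `⊤` and is filled in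
  -- automatically. Integrality enters only where x < y is read as 1 + x ≤ y, both in hypotheses and
  -- in the negated goal.
  lia : ∀ n (f : N-ary n (Expr n) (Sequent n)) {t : T (valid [] (close n f))} → ∀Env n ⟦ close n f ⟧ˢ
  lia n f {t} = fromEnv n (λ ρ → valid-sound ρ [] (close n f) t tt)

open LinearArithmetic using (lia; #; _⊹_; _⊛_; _≼_; _≺_; _≐_; ⊩_; ⊩⊥; _⇛_) public

-- Reflection of Boolean tests

∧-intro : ∀ {a b} → T a → T b → T (a ∧ b)
∧-intro {true} {true} _ _ = tt

∧-left : ∀ {a b} → T (a ∧ b) → T a
∧-left {true} _ = tt

∧-right : ∀ a {b} → T (a ∧ b) → T b
∧-right true h = h

∨-introˡ : ∀ {a b} → T a → T (a ∨ b)
∨-introˡ {true} _ = tt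

∨-introʳ : ∀ a {b} → T b → T (a ∨ b)
∨-introʳ true _ = tt
∨-introʳ false h = h

∨-elim : ∀ a {b} → T (a ∨ b) → T a ⊎ T b
∨-elim true h = inj₁ tt
∨-elim false h = inj₂ h

not-intro : ∀ {a} → ¬ T a → T (not a)
not-intro {true} h = ⊥-elim (h tt)
not-intro {false} h = tt

not-elim : ∀ {a} → T (not a) → ¬ T a
not-elim {false} _ ()

T-ext : ∀ {a b} → (T a → T b) → (T b → T a) → a ≡ b
T-ext {true} {true} f g = refl
T-ext {false} {false} f g = refl
T-ext {true} {false} f g = ⊥-elim (f tt)
T-ext {false} {true} f g = ⊥-elim (g tt)

module _ {A : Set} {p : A → Bool} where

  all-intro : ∀ xs → (∀ {x} → x ∈ xs → T (p x)) → T (all p xs)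
  all-intro [] h = tt
  all-intro (x ∷ xs) h = ∧-intro (h (here refl)) (all-intro xs (h ∘ there))

  all-elim : ∀ {xs x} → T (all p xs) → x ∈ xs → T (p x)
  all-elim h (here refl) = ∧-left h
  all-elim {y ∷ _} h (there q) = all-elim (∧-right (p y) h) q

  any-intro : ∀ {xs x} → x ∈ xs → T (p x) → T (any p xs)
  any-intro (here refl) h = ∨-introˡ h
  any-intro {y ∷ _} (there q) h = ∨-introʳ (p y) (any-intro q h)

  any-elim : ∀ xs → T (any p xs) → ∃ λ x → x ∈ xs × T (p x)
  any-elim (x ∷ xs) h with ∨-elim (p x) h
  ... | inj₁ t = x , here refl , t
  ... | inj₂ t with any-elim xs t
  ... | y , q , t' = y , there q , t'

  ∈-filterᵇ⁺ : ∀ {xs x} → x ∈ xs → T (p x) → x ∈ filterᵇ p xs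
  ∈-filterᵇ⁺ = ∈-filter⁺ (T? ∘ p)

  ∈-filterᵇ⁻ : ∀ {xs x} → x ∈ filterᵇ p xs → x ∈ xs × T (p x)
  ∈-filterᵇ⁻ = ∈-filter⁻ (T? ∘ p)

  Unique-filterᵇ : ∀ {xs} → Unique xs → Unique (filterᵇ p xs)
  Unique-filterᵇ = Uniqueₚ.filter⁺ (T? ∘ p)

pairEq-sound : ∀ p q → T (pairEq p q) → p ≡ q
pairEq-sound (a , b) (c , d) h = cong₂ _,_ (ℕₚ.≡ᵇ⇒≡ a c (∧-left h)) (ℕₚ.≡ᵇ⇒≡ b d (∧-right (a ≡ᵇ c) h))

pairEq-refl : ∀ p → T (pairEq p p)
pairEq-refl (a , b) = ∧-intro (ℕₚ.≡⇒≡ᵇ a a refl) (ℕₚ.≡⇒≡ᵇ b b refl)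

member⁺ : ∀ {p D} → p ∈ D → T (memberᵇ p D)
member⁺ {p} h = any-intro h (pairEq-refl p)

member⁻ : ∀ {p} D → T (memberᵇ p D) → p ∈ D
member⁻ {p} D h with any-elim D h
... | q , q∈ , t rewrite pairEq-sound p q t = q∈

∈ℕ⁺ : ∀ {x} {V : List ℕ} → x ∈ V → T (any (x ≡ᵇ_) V)
∈ℕ⁺ {x} h = any-intro h (ℕₚ.≡⇒≡ᵇ x x refl)

∈ℕ⁻ : ∀ {x} (V : List ℕ) → T (any (x ≡ᵇ_) V) → x ∈ V
∈ℕ⁻ {x} V h with any-elim V h
... | y , y∈ , t rewrite ℕₚ.≡ᵇ⇒≡ x y t = y∈

-- Finite lists as sets, sublists and increasing lists

infix 4 _⊑_ _≅_

_⊑_ : {A : Set} → List A → List A → Set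
xs ⊑ ys = ∀ {x} → x ∈ xs → x ∈ ys

_≅_ : {A : Set} → List A → List A → Set
xs ≅ ys = xs ⊑ ys × ys ⊑ xs

∈-removeAt : ∀ {A : Set} {x y : A} {ys} (p : y ∈ ys) → x ∈ ys → x ≢ y → x ∈ (ys Any.─ p)
∈-removeAt (here refl) (here refl) x≢y = ⊥-elim (x≢y refl)
∈-removeAt (here refl) (there q) _ = q
∈-removeAt (there p) (here refl) _ = here refl
∈-removeAt (there p) (there q) x≢y = there (∈-removeAt p q x≢y)

-- `f` receives the membership proof because the maps compared later, such as the encoding of a
-- dissection by a word, exist only on members of the list.
length-≤-injection : ∀ {A B : Set} {xs : List A} {ys : List B} → Unique xs →
  (f : ∀ {x} → x ∈ xs → B) → (∀ {x} (p : x ∈ xs) → f p ∈ ys) →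
  (∀ {x y} (p : x ∈ xs) (q : y ∈ xs) → f p ≡ f q → x ≡ y) → length xs ≤ length ys
length-≤-injection [] f into inj = z≤n
length-≤-injection {xs = x ∷ xs} {ys} (x∉ ∷ u) f into inj =
  subst (suc (length xs) ≤_) (sym (Listₚ.length-removeAt′ ys (Any.index y∈)))
    (s≤s (length-≤-injection u (f ∘ there)
      (λ p → ∈-removeAt y∈ (into (there p)) (λ e → All.lookup x∉ p (sym (inj (there p) (here refl) e))))
      (λ p q → inj (there p) (there q))))
  where y∈ = into (here refl)

length-≤-⊑ : ∀ {A : Set} {xs ys : List A} → Unique xs → xs ⊑ ys → length xs ≤ length ys
length-≤-⊑ u s = length-≤-injection u (λ {x} _ → x) s (λ _ _ e → e)

length-≡-≅ : ∀ {A : Set} {xs ys : List A} → Unique xs → Unique ys → xs ≅ ys → length xs ≡ length ys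
length-≡-≅ u v (s , t) = ℕₚ.≤-antisym (length-≤-⊑ u s) (length-≤-⊑ v t)

subsets-filterᵇ : ∀ {A : Set} (p : A → Bool) xs → filterᵇ p xs ∈ subsets xs
subsets-filterᵇ p [] = here refl
subsets-filterᵇ p (x ∷ xs) with p x
... | true = ∈-++⁺ˡ (∈-map⁺ (x ∷_) (subsets-filterᵇ p xs))
... | false = ∈-++⁺ʳ _ (subsets-filterᵇ p xs)

subsets-⊑ : ∀ {A : Set} {xs V : List A} → V ∈ subsets xs → V ⊑ xs
subsets-⊑ {xs = []} (here refl) ()
subsets-⊑ {xs = x ∷ xs} h q with ∈-++⁻ (map (x ∷_) (subsets xs)) h
... | inj₂ h' = there (subsets-⊑ h' q)
... | inj₁ h' with ∈-map⁻ (x ∷_) h'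
subsets-⊑ h (here refl) | inj₁ h' | V' , V'∈ , refl = here refl
subsets-⊑ h (there q) | inj₁ h' | V' , V'∈ , refl = there (subsets-⊑ V'∈ q)

subsets-AllPairs : ∀ {A : Set} {R : A → A → Set} {xs V : List A} → AllPairs R xs → V ∈ subsets xs → AllPairs R V
subsets-AllPairs {xs = []} [] (here refl) = []
subsets-AllPairs {xs = x ∷ xs} (r ∷ rs) h with ∈-++⁻ (map (x ∷_) (subsets xs)) h
... | inj₂ h' = subsets-AllPairs rs h'
... | inj₁ h' with ∈-map⁻ (x ∷_) h'
... | V' , V'∈ , refl = All.tabulate (λ q → All.lookup r (subsets-⊑ V'∈ q)) ∷ subsets-AllPairs rs V'∈

-- Sublists of one fixed list are canonical, so equality of dissections reduces to equality of sets
-- of diagonals.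
subsets-ext : ∀ {A : Set} {xs V W : List A} → Unique xs → V ∈ subsets xs → W ∈ subsets xs → V ≅ W → V ≡ W
subsets-ext {xs = []} [] (here refl) (here refl) e = refl
subsets-ext {xs = x ∷ xs} (x∉ ∷ u) h k (s , t)
  with ∈-++⁻ (map (x ∷_) (subsets xs)) h | ∈-++⁻ (map (x ∷_) (subsets xs)) k
... | inj₂ h' | inj₂ k' = subsets-ext u h' k' (s , t)
... | inj₁ h' | inj₂ k' with ∈-map⁻ (x ∷_) h'
... | V' , V'∈ , refl = ⊥-elim (All.lookup x∉ (subsets-⊑ k' (s (here refl))) refl)
subsets-ext {xs = x ∷ xs} (x∉ ∷ u) h k (s , t) | inj₂ h' | inj₁ k' with ∈-map⁻ (x ∷_) k'
... | W' , W'∈ , refl = ⊥-elim (All.lookup x∉ (subsets-⊑ h' (t (here refl))) refl)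
subsets-ext {xs = x ∷ xs} (x∉ ∷ u) h k (s , t) | inj₁ h' | inj₁ k' with ∈-map⁻ (x ∷_) h' | ∈-map⁻ (x ∷_) k'
... | V' , V'∈ , refl | W' , W'∈ , refl = cong (x ∷_) (subsets-ext u V'∈ W'∈ (strip V'∈ s , strip W'∈ t))
  where
  strip : ∀ {Y Z} → Y ∈ subsets xs → (x ∷ Y) ⊑ (x ∷ Z) → Y ⊑ Z
  strip Y∈ f q with f (there q)
  ... | here refl = ⊥-elim (All.lookup x∉ (subsets-⊑ Y∈ q) refl)
  ... | there q' = q'

subsets-Unique : ∀ {A : Set} {xs : List A} → Unique xs → Unique (subsets xs)
subsets-Unique {xs = []} [] = [] ∷ []
subsets-Unique {xs = x ∷ xs} (x∉ ∷ u) =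
  Uniqueₚ.++⁺ (Uniqueₚ.map⁺ Listₚ.∷-injectiveʳ (subsets-Unique u)) (subsets-Unique u) disjoint
  where
  disjoint : ∀ {V} → ¬ (V ∈ map (x ∷_) (subsets xs) × V ∈ subsets xs)
  disjoint (h , k) with ∈-map⁻ (x ∷_) h
  ... | V' , V'∈ , refl = All.lookup x∉ (subsets-⊑ k (here refl)) refl

Increasing : List ℕ → Set
Increasing = AllPairs _<_

Increasing⇒Unique : ∀ {V} → Increasing V → Unique V
Increasing⇒Unique = AllPairs.map ℕₚ.<⇒≢

-- A piece is thereby determined by its vertex set, which is how candidates for pieces are
-- identified below.
increasing-ext : ∀ {V W} → Increasing V → Increasing W → V ≅ W → V ≡ W
increasing-ext [] [] e = refl
increasing-ext [] (_ ∷ _) (s , t) with t (here refl)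
... | ()
increasing-ext (_ ∷ _) [] (s , t) with s (here refl)
... | ()
increasing-ext {v ∷ V} {w ∷ W} (v< ∷ i) (w< ∷ j) (s , t) = cong₂ _∷_ v≡w (increasing-ext i j (strip v< v≡w s , strip w< (sym v≡w) t))
  where
  least : ∀ {x y Y} → All (y <_) Y → x ∈ y ∷ Y → y ≤ x
  least h (here refl) = ℕₚ.≤-refl
  least h (there q) = ℕₚ.<⇒≤ (All.lookup h q)
  v≡w : v ≡ w
  v≡w = ℕₚ.≤-antisym (least v< (t (here refl))) (least w< (s (here refl)))
  strip : ∀ {x y X Y} → All (x <_) X → x ≡ y → (x ∷ X) ⊑ (y ∷ Y) → X ⊑ Y
  strip h refl f q with f (there q)
  ... | here refl = ⊥-elim (ℕₚ.<-irrefl refl (All.lookup h q))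
  ... | there q' = q'

upTo-increasing : ∀ N → Increasing (upTo N)
upTo-increasing N = AllPairsₚ.applyUpTo⁺₁ id N (λ i<j _ → i<j)

increasing-∈-subsets : ∀ {N V} → Increasing V → (∀ {x} → x ∈ V → x < N) → V ∈ subsets (upTo N)
increasing-∈-subsets {N} {V} i b = subst (_∈ subsets (upTo N)) eq (subsets-filterᵇ p (upTo N))
  where
  p : ℕ → Bool
  p x = any (x ≡ᵇ_) V
  eq : filterᵇ p (upTo N) ≡ V
  eq = increasing-ext (subsets-AllPairs (upTo-increasing N) (subsets-filterᵇ p (upTo N))) i
    ((λ q → ∈ℕ⁻ V (proj₂ (∈-filterᵇ⁻ {p = p} {xs = upTo N} q))) , (λ q → ∈-filterᵇ⁺ {p = p} (∈-upTo⁺ (b q)) (∈ℕ⁺ q)))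

-- Łukasiewicz words with prescribed labels

-- Łukasiewicz words: 0 is a leaf and suc j a node with j + 2 children, so that label suc j stands for a
-- (j + 3)-gon.  Forest u w says that w is the prefix code of u plane trees.
data Forest : ℕ → List ℕ → Set where
  [] : Forest 0 []
  leaf : ∀ {u w} → Forest u w → Forest (suc u) (0 ∷ w)
  node : ∀ {u j w} → Forest (suc (suc (j + u))) w → Forest (suc u) (suc j ∷ w)

leaves : List ℕ → ℕ
leaves [] = 0
leaves (zero ∷ w) = suc (leaves w)
leaves (suc _ ∷ w) = leaves w

nth : ℕ → List ℕ → ℕ
nth _ [] = 0
nth zero (x ∷ _) = x
nth (suc i) (_ ∷ xs) = nth i xs

count : ℕ → List ℕ → ℕ
count a w = length (filterᵇ (_≡ᵇ a) w)

-- m lists the multiplicities of the labels 1, 2, … (all further ones being 0)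
Content : List ℕ → List ℕ → Set
Content w m = ∀ j → count (suc j) w ≡ nth j m

-- This is Σ (j + 1) m_j, the sum of the letters of any word with content `m`; shifting the index by
-- one adds `sum m`.
weight : List ℕ → ℕ
weight [] = 0
weight (a ∷ m) = a + (sum m + weight m)

factorials : List ℕ → ℕ
factorials = product ∘ map _!

lower : ℕ × List ℕ → ℕ → ℕ × List ℕ
lower (j , m) a = suc j , a ∷ m

-- The possible first nodes of a word with content `m`, each with the content left for the remaining
-- letters.
removals : List ℕ → List (ℕ × List ℕ)
removals [] = []
removals (zero ∷ m) = map (λ c → lower c zero) (removals m)
removals (suc a ∷ m) = (0 , a ∷ m) ∷ map (λ c → lower c (suc a)) (removals m)

-- The number of leaves is not a parameter: `forest-leaves` and `content-stats` force it to be
-- `u + weight m`, and the list is empty unless `k` exceeds that by exactly `sum m`.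
words : ℕ → ℕ → List ℕ → List (List ℕ)
words zero zero m = if sum m ≡ᵇ 0 then [ [] ] else []
words zero (suc _) m = []
words (suc k) zero m = []
words (suc k) (suc u) m =
  map (0 ∷_) (words k u m) ++
  concatMap (λ c → map (suc (proj₁ c) ∷_) (words k (suc (suc (proj₁ c + u))) (proj₂ c))) (removals m)

-- Reading a leaf lowers the number of trees still to be read by 1, reading the label `suc j` raises
-- it by `suc j`, and at the end it is 0.
forest-leaves : ∀ {u w} → Forest u w → leaves w ≡ u + sum w
forest-leaves [] = refl
forest-leaves (leaf f) = cong suc (forest-leaves f)
forest-leaves (node {u} {j} {w} f) = trans (forest-leaves f) (shuffle j u (sum w))
  where
  shuffle : ∀ j u s → suc (suc (j + u)) + s ≡ suc u + (suc j + s)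
  shuffle = solve-∀

removals-sum : ∀ {j m'} m → (j , m') ∈ removals m → sum m ≡ suc (sum m')
removals-sum (zero ∷ m) h with ∈-map⁻ (λ c → lower c zero) h
... | c , c∈ , refl = removals-sum m c∈
removals-sum (suc a ∷ m) (here refl) = refl
removals-sum (suc a ∷ m) (there h) with ∈-map⁻ (λ c → lower c (suc a)) h
... | c , c∈ , refl = trans (cong (suc a +_) (removals-sum m c∈)) (ℕₚ.+-suc (suc a) (sum (proj₂ c)))

removals-weight : ∀ {j m'} m → (j , m') ∈ removals m → weight m ≡ suc j + weight m'
removals-weight (zero ∷ m) h with ∈-map⁻ (λ c → lower c zero) h
... | (j , m') , c∈ , refl rewrite removals-sum m c∈ | removals-weight m c∈ = shuffle (sum m') j (weight m')
  where
  shuffle : ∀ s j w → suc s + (suc j + w) ≡ suc (suc j) + (s + w)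
  shuffle = solve-∀
removals-weight (suc a ∷ m) (here refl) = refl
removals-weight (suc a ∷ m) (there h) with ∈-map⁻ (λ c → lower c (suc a)) h
... | (j , m') , c∈ , refl rewrite removals-sum m c∈ | removals-weight m c∈ = shuffle a (sum m') j (weight m')
  where
  shuffle : ∀ a s j w → suc a + (suc s + (suc j + w)) ≡ suc (suc j) + (suc a + (s + w))
  shuffle = solve-∀

removals-nth : ∀ {j m'} m → (j , m') ∈ removals m → ∀ i → nth i m ≡ (if j ≡ᵇ i then 1 else 0) + nth i m'
removals-nth (zero ∷ m) h with ∈-map⁻ (λ c → lower c zero) h
... | c , c∈ , refl = λ { zero → refl ; (suc i) → removals-nth m c∈ i }
removals-nth (suc a ∷ m) (here refl) = λ { zero → refl ; (suc i) → refl }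
removals-nth (suc a ∷ m) (there h) with ∈-map⁻ (λ c → lower c (suc a)) h
... | c , c∈ , refl = λ { zero → refl ; (suc i) → removals-nth m c∈ i }

removals-complete : ∀ j m → 0 < nth j m → ∃ λ m' → (j , m') ∈ removals m
removals-complete zero (suc a ∷ m) h = a ∷ m , here refl
removals-complete (suc j) (zero ∷ m) h with removals-complete j m h
... | m' , q = zero ∷ m' , ∈-map⁺ (λ c → lower c zero) q
removals-complete (suc j) (suc a ∷ m) h with removals-complete j m h
... | m' , q = suc a ∷ m' , there (∈-map⁺ (λ c → lower c (suc a)) q)

removals-Unique : ∀ m → Unique (map proj₁ (removals m))
removals-Unique [] = []
removals-Unique (zero ∷ m) = shifted zero m
  where
  shifted : ∀ a m → Unique (map proj₁ (map (λ c → lower c a) (removals m)))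
  shifted a m = subst Unique (trans (sym (Listₚ.map-∘ (removals m))) (Listₚ.map-∘ (removals m)))
    (Uniqueₚ.map⁺ ℕₚ.suc-injective (removals-Unique m))
removals-Unique (suc a ∷ m) = All.tabulate nonzero ∷ shifted
  where
  shifted : Unique (map proj₁ (map (λ c → lower c (suc a)) (removals m)))
  shifted = subst Unique (trans (sym (Listₚ.map-∘ (removals m))) (Listₚ.map-∘ (removals m)))
    (Uniqueₚ.map⁺ ℕₚ.suc-injective (removals-Unique m))
  nonzero : ∀ {x} → x ∈ map proj₁ (map (λ c → lower c (suc a)) (removals m)) → 0 ≢ x
  nonzero h with ∈-map⁻ proj₁ h
  ... | _ , h' , refl with ∈-map⁻ (λ c → lower c (suc a)) h'
  ... | _ , _ , refl = λ ()

sum≡0⇒nth : ∀ m → sum m ≡ 0 → ∀ j → nth j m ≡ 0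
sum≡0⇒nth [] e j = refl
sum≡0⇒nth (zero ∷ m) e zero = refl
sum≡0⇒nth (zero ∷ m) e (suc j) = sum≡0⇒nth m e j

nth≡0⇒sum : ∀ m → (∀ j → nth j m ≡ 0) → sum m ≡ 0
nth≡0⇒sum [] h = refl
nth≡0⇒sum (a ∷ m) h rewrite h 0 = nth≡0⇒sum m (h ∘ suc)

sum≡0⇒weight : ∀ m → sum m ≡ 0 → weight m ≡ 0
sum≡0⇒weight [] e = refl
sum≡0⇒weight (zero ∷ m) e rewrite e = sum≡0⇒weight m e

sum≡0⇒factorials : ∀ m → sum m ≡ 0 → factorials m ≡ 1
sum≡0⇒factorials [] e = refl
sum≡0⇒factorials (zero ∷ m) e rewrite sum≡0⇒factorials m e = refl

count-same : ∀ a w → count a (a ∷ w) ≡ suc (count a w)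
count-same a w with a ≡ᵇ a | ℕₚ.≡⇒≡ᵇ a a refl
... | true | _ = refl

count-∷ : ∀ j a w → count (suc a) (suc j ∷ w) ≡ (if j ≡ᵇ a then 1 else 0) + count (suc a) w
count-∷ j a w with j ≡ᵇ a
... | true = refl
... | false = refl

content-removal : ∀ {j w} m → Content (suc j ∷ w) m → ∃ λ m' → (j , m') ∈ removals m × Content w m'
content-removal {j} {w} m c with removals-complete j m (subst (0 <_) (trans (sym (count-same (suc j) w)) (c j)) (s≤s z≤n))
... | m' , q = m' , q , λ i → ℕₚ.+-cancelˡ-≡ (if j ≡ᵇ i then 1 else 0) _ _
  (trans (sym (count-∷ j i w)) (trans (c i) (removals-nth m q i)))

content-stats : ∀ w m → Content w m → sum w ≡ weight m × length w ≡ leaves w + sum m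
content-stats [] m c = sym (sum≡0⇒weight m m≡0) , sym m≡0
  where
  m≡0 : sum m ≡ 0
  m≡0 = nth≡0⇒sum m (λ j → sym (c j))
content-stats (zero ∷ w) m c with content-stats w m c
... | p , q = p , cong suc q
content-stats (suc j ∷ w) m c with content-removal m c
... | m' , r , c' with content-stats w m' c'
... | p , q rewrite removals-weight m r | removals-sum m r =
  cong (suc j +_) p , trans (cong suc q) (sym (ℕₚ.+-suc (leaves w) (sum m')))

words-sound : ∀ k u m {w} → w ∈ words k u m → Forest u w × length w ≡ k × Content w m
words-sound zero zero m h with sum m in e
words-sound zero zero m (here refl) | zero = [] , refl , λ j → sym (sum≡0⇒nth m e j)
words-sound (suc k) (suc u) m h with ∈-++⁻ (map (0 ∷_) (words k u m)) h
... | inj₁ h' with ∈-map⁻ (0 ∷_) h'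
... | w , w∈ , refl with words-sound k u m w∈
... | f , l , c = leaf f , cong suc l , c
words-sound (suc k) (suc u) m h | inj₂ h'
  with find (∈-concatMap⁻ _ {xs = removals m} h')
... | (j , m') , c∈ , w∈ with ∈-map⁻ (suc j ∷_) w∈
... | w , w∈' , refl with words-sound k _ m' w∈'
... | f , l , c = node f , cong suc l , λ i → trans (count-∷ j i w) (trans (cong (_ +_) (c i)) (sym (removals-nth m c∈ i)))

words-complete : ∀ {u w} m → Forest u w → Content w m → w ∈ words (length w) u m
words-complete m [] c rewrite nth≡0⇒sum m (λ j → sym (c j)) = here refl
words-complete m (leaf f) c = ∈-++⁺ˡ (∈-map⁺ (0 ∷_) (words-complete m f c))
words-complete m (node {u} {j} {w} f) c with content-removal m c
... | m' , q , c' = ∈-++⁺ʳ _ (∈-concatMap⁺ _ (lose q (∈-map⁺ (suc j ∷_) (words-complete m' f c'))))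

Unique-concatMap-heads : ∀ {A : Set} (h : A → ℕ) (g : A → List (List ℕ)) cs → Unique (map h cs) →
  (∀ c → Unique (g c)) → Unique (concatMap (λ c → map (h c ∷_) (g c)) cs)
Unique-concatMap-heads h g [] u v = []
Unique-concatMap-heads h g (c ∷ cs) (c∉ ∷ u) v =
  Uniqueₚ.++⁺ (Uniqueₚ.map⁺ Listₚ.∷-injectiveʳ (v c)) (Unique-concatMap-heads h g cs u v) disjoint
  where
  disjoint : ∀ {w} → ¬ (w ∈ map (h c ∷_) (g c) × w ∈ concatMap (λ c → map (h c ∷_) (g c)) cs)
  disjoint (p , q) with ∈-map⁻ (h c ∷_) p | find (∈-concatMap⁻ _ {xs = cs} q)
  ... | w , _ , refl | c' , c'∈ , q' with ∈-map⁻ (h c' ∷_) q'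
  ... | w' , _ , e = All.lookup c∉ (∈-map⁺ h c'∈) (Listₚ.∷-injectiveˡ e)

words-Unique : ∀ k u m → Unique (words k u m)
words-Unique zero zero m with sum m ≡ᵇ 0
... | true = [] ∷ []
... | false = []
words-Unique zero (suc u) m = []
words-Unique (suc k) zero m = []
words-Unique (suc k) (suc u) m = Uniqueₚ.++⁺
  (Uniqueₚ.map⁺ Listₚ.∷-injectiveʳ (words-Unique k u m))
  (Unique-concatMap-heads (suc ∘ proj₁) (λ c → words k _ (proj₂ c)) (removals m)
    (subst Unique (sym (Listₚ.map-∘ (removals m))) (Uniqueₚ.map⁺ ℕₚ.suc-injective (removals-Unique m)))
    (λ c → words-Unique k _ (proj₂ c)))
  disjoint
  where
  disjoint : ∀ {w} → ¬ (w ∈ map (0 ∷_) (words k u m) × w ∈ concatMap (λ c → map (suc (proj₁ c) ∷_) (words k (suc (suc (proj₁ c + u))) (proj₂ c))) (removals m))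
  disjoint (p , q) with ∈-map⁻ (0 ∷_) p | find (∈-concatMap⁻ _ {xs = removals m} q)
  ... | w , _ , refl | c' , c'∈ , q' with ∈-map⁻ (suc (proj₁ c') ∷_) q'
  ... | w' , _ , ()

-- Counting words

length-concatMap : ∀ {A B : Set} (f : A → List B) xs → length (concatMap f xs) ≡ sum (map (length ∘ f) xs)
length-concatMap f [] = refl
length-concatMap f (x ∷ xs) = trans (Listₚ.length-++ (f x)) (cong (length (f x) +_) (length-concatMap f xs))

-- Since `factorials m` is the multiplicity m_j times `factorials m'`, the hypothesis for j gets
-- multiplied by m_j, and the total is Σ m_j (c + j + 1). In the induction `c` takes up the shift of
-- the index and `A` the factorials of the entries passed over.
removals-total : ∀ (G : ℕ × List ℕ → ℕ) A B c m →
  (∀ {j m'} → (j , m') ∈ removals m → G (j , m') * A * factorials m' ≡ (c + suc j) * B) →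
  sum (map G (removals m)) * A * factorials m ≡ (c * sum m + weight m) * B
removals-total G A B c [] h = sym (trans (cong (λ z → (z + 0) * B) (ℕₚ.*-zeroʳ c)) refl)
removals-total G A B c (zero ∷ m) h
  rewrite sym (Listₚ.map-∘ {g = G} {f = λ c → lower c zero} (removals m)) =
  trans (trans (cong (sum (map (G ∘ (λ c → lower c zero)) (removals m)) * A *_) (ℕₚ.*-identityˡ (factorials m)))
    (removals-total (G ∘ (λ c → lower c zero)) A B (suc c) m step))
    (cong (_* B) (shuffle c (sum m) (weight m)))
  where
  shuffle : ∀ c s w → suc c * s + w ≡ c * s + (s + w)
  shuffle = solve-∀
  step : ∀ {j m'} → (j , m') ∈ removals m → G (suc j , zero ∷ m') * A * factorials m' ≡ (suc c + suc j) * B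
  step {j} {m'} q = trans (trans (cong (G (suc j , zero ∷ m') * A *_) (sym (ℕₚ.*-identityˡ (factorials m'))))
    (h (∈-map⁺ (λ c → lower c zero) q))) (cong (_* B) (ℕₚ.+-suc c (suc j)))
removals-total G A B c (suc a ∷ m) h
  rewrite sym (Listₚ.map-∘ {g = G} {f = λ c → lower c (suc a)} (removals m)) =
  trans (expand (G (0 , a ∷ m)) X A a (a !) (factorials m)) (trans
    (cong₂ (λ y z → suc a * y + z) (h (here refl))
      (trans (cong (X * A *_) refl) (trans (regroup X A ((suc a) !) (factorials m))
        (removals-total (G ∘ (λ c → lower c (suc a))) (A * (suc a) !) B (suc c) m step))))
    (shuffle a c (sum m) (weight m) B))
  where
  X = sum (map (G ∘ (λ c → lower c (suc a))) (removals m))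
  expand : ∀ g X A a f F → (g + X) * A * ((suc a * f) * F) ≡ suc a * (g * A * (f * F)) + X * A * ((suc a * f) * F)
  expand = solve-∀
  regroup : ∀ X A f F → X * A * (f * F) ≡ X * (A * f) * F
  regroup = solve-∀
  shuffle : ∀ a c s w B → suc a * ((c + 1) * B) + (suc c * s + w) * B ≡ (c * (suc a + s) + (suc a + (s + w))) * B
  shuffle = solve-∀
  step : ∀ {j m'} → (j , m') ∈ removals m → G (suc j , suc a ∷ m') * (A * (suc a) !) * factorials m' ≡ (suc c + suc j) * B
  step {j} {m'} q = trans (sym (regroup (G (suc j , suc a ∷ m')) A ((suc a) !) (factorials m')))
    (trans (h (there (∈-map⁺ (λ c → lower c (suc a)) q))) (cong (_* B) (ℕₚ.+-suc c (suc j))))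

sum-cong-∈ : ∀ {A : Set} {f g : A → ℕ} xs → (∀ {x} → x ∈ xs → f x ≡ g x) → sum (map f xs) ≡ sum (map g xs)
sum-cong-∈ [] h = refl
sum-cong-∈ (x ∷ xs) h = cong₂ _+_ (h (here refl)) (sum-cong-∈ xs (h ∘ there))

-- With w and s for `weight m` and `sum m`, the inductive step is the identity (u + 1 + w) u + (u +
-- 1) s + w = (u + 1) (u + w + s). The first summand comes from a leading leaf, the others from the
-- leading nodes by `removals-total`.
words-number : ∀ k u m → suc k ≡ (u + weight m) + sum m →
  length (words (suc k) u m) * (u + weight m) ! * factorials m ≡ u * k !
words-number k zero m e = refl
words-number zero (suc u) m e = only
  where
  u+w+s≡0 : 0 ≡ u + weight m + sum m
  u+w+s≡0 = ℕₚ.suc-injective e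
  s≡0 : sum m ≡ 0
  s≡0 = ℕₚ.m+n≡0⇒n≡0 (u + weight m) (sym u+w+s≡0)
  u≡0 : u ≡ 0
  u≡0 = ℕₚ.m+n≡0⇒m≡0 u (ℕₚ.m+n≡0⇒m≡0 (u + weight m) (sym u+w+s≡0))
  no-removals : ∀ m → sum m ≡ 0 → removals m ≡ []
  no-removals [] _ = refl
  no-removals (zero ∷ m) e rewrite no-removals m e = refl
  only : length (words 1 (suc u) m) * (suc u + weight m) ! * factorials m ≡ suc u * 1
  only rewrite u≡0 | no-removals m s≡0 | s≡0 | sum≡0⇒weight m s≡0 | sum≡0⇒factorials m s≡0 = refl
words-number (suc k) (suc u) m e = begin
  length (words (suc (suc k)) (suc u) m) * R ! * F
    ≡⟨ cong (λ z → z * R ! * F) (trans (Listₚ.length-++ (map (0 ∷_) (words (suc k) u m)))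
        (cong₂ _+_ (Listₚ.length-map (0 ∷_) (words (suc k) u m))
          (trans (length-concatMap branch (removals m)) (sum-cong-∈ {f = length ∘ branch} {g = G} (removals m) (λ {c} _ → Listₚ.length-map (suc (proj₁ c) ∷_) (words (suc k) (suc (suc (proj₁ c + u))) (proj₂ c))))))) ⟩
  (L + sum (map G (removals m))) * R ! * F
    ≡⟨ split-sum L (sum (map G (removals m))) (u + weight m) ((u + weight m) !) F ⟩
  R * (L * (u + weight m) ! * F) + sum (map G (removals m)) * R ! * F
    ≡⟨ cong₂ (λ y z → R * y + z) (words-number k u m (ℕₚ.suc-injective e))
        (removals-total G (R !) (k !) (suc u) m subtree) ⟩
  R * (u * k !) + (suc u * sum m + weight m) * k !
    ≡⟨ collect u (weight m) (sum m) (k !) ⟩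
  suc u * ((u + weight m + sum m) * k !)
    ≡⟨ cong (λ z → suc u * (z * k !)) (sym (ℕₚ.suc-injective e)) ⟩
  suc u * (suc k) ! ∎
  where
  open ≡-Reasoning
  R = suc u + weight m
  F = factorials m
  L = length (words (suc k) u m)
  branch : ℕ × List ℕ → List (List ℕ)
  branch c = map (suc (proj₁ c) ∷_) (words (suc k) (suc (suc (proj₁ c + u))) (proj₂ c))
  G : ℕ × List ℕ → ℕ
  G c = length (words (suc k) (suc (suc (proj₁ c + u))) (proj₂ c))
  split-sum : ∀ L X r f F → (L + X) * (suc r * f) * F ≡ suc r * (L * f * F) + X * (suc r * f) * F
  split-sum = solve-∀
  collect : ∀ u w s f → (suc u + w) * (u * f) + (suc u * s + w) * f ≡ suc u * ((u + w + s) * f)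
  collect = solve-∀
  subtree : ∀ {j m'} → (j , m') ∈ removals m → G (j , m') * R ! * factorials m' ≡ (suc u + suc j) * k !
  subtree {j} {m'} q = trans
    (cong (λ z → G (j , m') * z ! * factorials m') (trans (cong (suc u +_) (removals-weight m q)) (same-size j u (weight m'))))
    (trans (words-number k (suc (suc (j + u))) m' size) (cong (_* k !) (arity j u)))
    where
    same-size : ∀ j u w → suc u + (suc j + w) ≡ suc (suc (j + u)) + w
    same-size = solve-∀
    arity : ∀ j u → suc (suc (j + u)) ≡ suc u + suc j
    arity = solve-∀
    size : suc k ≡ suc (suc (j + u)) + weight m' + sum m'
    size = ℕₚ.suc-injective (trans e (trans (cong₂ (λ y z → suc (u + y) + z) (removals-weight m q) (removals-sum m q))
      (rearrange u j (weight m') (sum m'))))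
      where
      rearrange : ∀ u j w s → suc (u + (suc j + w)) + suc s ≡ suc (suc (suc (j + u)) + w + s)
      rearrange = solve-∀

-- Forests as noncrossing families of arcs

Pairs : Set
Pairs = List Pair

head₀ : List ℕ → ℕ
head₀ [] = 0
head₀ (x ∷ _) = x

-- The leaves of w are laid out as the segments [x , x + 1], [x + 1 , x + 2], …; ends lists the right end
-- points of the trees of w, and arcs the intervals spanned by the nodes.
ends : ℕ → List ℕ → List ℕ
ends x [] = []
ends x (zero ∷ w) = suc x ∷ ends (suc x) w
ends x (suc j ∷ w) = drop (suc j) (ends x w)

arcs : ℕ → List ℕ → Pairs
arcs x [] = []
arcs x (zero ∷ w) = arcs (suc x) w
arcs x (suc j ∷ w) = (x , head₀ (drop (suc j) (ends x w))) ∷ arcs x w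

drop-⊑ : ∀ {A : Set} k {xs : List A} → drop k xs ⊑ xs
drop-⊑ zero q = q
drop-⊑ (suc k) {x ∷ xs} q = there (drop-⊑ k q)

drop-∷ : ∀ k (xs : List ℕ) → k < length xs → ∃ λ rest → drop k xs ≡ head₀ (drop k xs) ∷ rest
drop-∷ zero (x ∷ xs) h = xs , refl
drop-∷ (suc k) (x ∷ xs) h = drop-∷ k xs (s≤s⁻¹ h)

head-drop-∈ : ∀ k (xs : List ℕ) → k < length xs → head₀ (drop k xs) ∈ drop k xs
head-drop-∈ k xs h with drop k xs | drop-∷ k xs h
... | y ∷ ys | _ = here refl

head-least : ∀ {e} xs → Increasing xs → e ∈ xs → head₀ xs ≤ e
head-least (x ∷ xs) (x< ∷ _) (here refl) = ℕₚ.≤-refl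
head-least (x ∷ xs) (x< ∷ _) (there q) = ℕₚ.<⇒≤ (All.lookup x< q)

head-drop-≥ : ∀ {y} k xs → Increasing xs → (∀ {e} → e ∈ xs → y ≤ e) → k < length xs → y + k ≤ head₀ (drop k xs)
head-drop-≥ {y} zero (x ∷ xs) i h l = subst (_≤ x) (sym (ℕₚ.+-identityʳ y)) (h (here refl))
head-drop-≥ {y} (suc k) (x ∷ xs) (x< ∷ i) h l = subst (_≤ head₀ (drop k xs)) (sym (ℕₚ.+-suc y k))
  (head-drop-≥ k xs i (λ q → ℕₚ.≤-<-trans (h (here refl)) (All.lookup x< q)) (s≤s⁻¹ l))

∈-drop : ∀ {e} k xs → Increasing xs → e ∈ xs → k < length xs → head₀ (drop k xs) ≤ e → e ∈ drop k xs
∈-drop zero xs i q l h = q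
∈-drop (suc k) (x ∷ xs) (x< ∷ i) (here refl) l h =
  ⊥-elim (ℕₚ.<⇒≱ (All.lookup x< (drop-⊑ k (head-drop-∈ k xs (s≤s⁻¹ l)))) h)
∈-drop (suc k) (x ∷ xs) (x< ∷ i) (there q) l h = ∈-drop k xs i q (s≤s⁻¹ l) h

drop-index : ∀ {e} (xs : List ℕ) → e ∈ xs → ∃ λ k → k < length xs × head₀ (drop k xs) ≡ e
drop-index (x ∷ xs) (here refl) = 0 , s≤s z≤n , refl
drop-index (x ∷ xs) (there q) with drop-index xs q
... | k , l , e = suc k , s≤s l , e

head-drop-injective : ∀ i j xs → Increasing xs → i < length xs → j < length xs →
  head₀ (drop i xs) ≡ head₀ (drop j xs) → i ≡ j
head-drop-injective zero zero xs inc l m e = refl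
head-drop-injective zero (suc j) (x ∷ xs) (x< ∷ inc) l m e =
  ⊥-elim (ℕₚ.<-irrefl e (All.lookup x< (drop-⊑ j (head-drop-∈ j xs (s≤s⁻¹ m)))))
head-drop-injective (suc i) zero (x ∷ xs) (x< ∷ inc) l m e =
  ⊥-elim (ℕₚ.<-irrefl (sym e) (All.lookup x< (drop-⊑ i (head-drop-∈ i xs (s≤s⁻¹ l)))))
head-drop-injective (suc i) (suc j) (x ∷ xs) (x< ∷ inc) l m e =
  cong suc (head-drop-injective i j xs inc (s≤s⁻¹ l) (s≤s⁻¹ m) e)

ends-length : ∀ {u w} x → Forest u w → length (ends x w) ≡ u
ends-length x [] = refl
ends-length x (leaf f) = cong suc (ends-length (suc x) f)
ends-length x (node {u} {j} {w} f) = trans (Listₚ.length-drop (suc j) (ends x w))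
  (trans (cong (_∸ suc j) (ends-length x f)) (cancel j u))
  where
  cancel : ∀ j u → suc (j + u) ∸ j ≡ suc u
  cancel j u = trans (cong (_∸ j) (sym (ℕₚ.+-suc j u))) (ℕₚ.m+n∸m≡n j (suc u))

ends-lower : ∀ x w {e} → e ∈ ends x w → x < e
ends-lower x (zero ∷ w) (here refl) = ℕₚ.≤-refl
ends-lower x (zero ∷ w) (there q) = ℕₚ.<-trans ℕₚ.≤-refl (ends-lower (suc x) w q)
ends-lower x (suc j ∷ w) q = ends-lower x w (drop-⊑ (suc j) q)

ends-upper : ∀ x w {e} → e ∈ ends x w → e ≤ x + leaves w
ends-upper x (zero ∷ w) {e} (here refl) = lia 2 (λ x l → ⊩ # 1 ⊹ x ≼ x ⊹ (# 1 ⊹ l)) x (leaves w)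
ends-upper x (zero ∷ w) {e} (there q) = subst (e ≤_) (sym (ℕₚ.+-suc x (leaves w))) (ends-upper (suc x) w q)
ends-upper x (suc j ∷ w) q = ends-upper x w (drop-⊑ (suc j) q)

ends-increasing : ∀ x w → Increasing (ends x w)
ends-increasing x [] = []
ends-increasing x (zero ∷ w) = All.tabulate (ends-lower (suc x) w) ∷ ends-increasing (suc x) w
ends-increasing x (suc j ∷ w) = AllPairsₚ.drop⁺ (suc j) (ends-increasing x w)

-- A node with label `suc j` takes `j + 2` trees but drops only `j + 1` of their ends: the last
-- child ends where the node does. The inequality keeps the default value of `head₀` from being
-- used.
node-arity : ∀ {u j w} x → Forest (suc (suc (j + u))) w → suc j < length (ends x w)
node-arity {u} {j} x f = subst (suc j <_) (sym (ends-length x f)) (lia 2 (λ j u → ⊩ # 1 ⊹ j ≺ # 2 ⊹ (j ⊹ u)) j u)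

arcs-bounds : ∀ {u w a b} x → Forest u w → (a , b) ∈ arcs x w → x ≤ a × suc (suc a) ≤ b × b ≤ x + leaves w
arcs-bounds {w = _ ∷ w} {b = b} x (leaf f) q with arcs-bounds (suc x) f q
... | p₁ , p₂ , p₃ = ℕₚ.<⇒≤ p₁ , p₂ , subst (b ≤_) (sym (ℕₚ.+-suc x (leaves w))) p₃
arcs-bounds x (node {u} {j} {w} f) (here refl) = ℕₚ.≤-refl ,
  ℕₚ.≤-trans (lia 2 (λ x j → ⊩ # 2 ⊹ x ≼ (# 1 ⊹ x) ⊹ (# 1 ⊹ j)) x j)
    (head-drop-≥ (suc j) (ends x w) (ends-increasing x w) (ends-lower x w) (node-arity x f)) ,
  ends-upper x w (drop-⊑ (suc j) (head-drop-∈ (suc j) (ends x w) (node-arity x f)))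
arcs-bounds x (node f) (there q) = arcs-bounds x f q

-- The ends separate the top-level trees, and an arc belongs to a single one of them.
arcs-uncovered : ∀ {u w a b e} x → Forest u w → e ∈ ends x w → (a , b) ∈ arcs x w → a < e → e < b → ⊥
arcs-uncovered x (leaf f) (here refl) q p₁ p₂ = ℕₚ.<⇒≱ p₁ (proj₁ (arcs-bounds (suc x) f q))
arcs-uncovered x (leaf f) (there e∈) q p₁ p₂ = arcs-uncovered (suc x) f e∈ q p₁ p₂
arcs-uncovered x (node {j = j} {w} f) e∈ (here refl) p₁ p₂ =
  ℕₚ.<⇒≱ p₂ (head-least (drop (suc j) (ends x w)) (ends-increasing x (suc j ∷ w)) e∈)
arcs-uncovered x (node {j = j} f) e∈ (there q) p₁ p₂ = arcs-uncovered x f (drop-⊑ (suc j) e∈) q p₁ p₂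

Noncrossing : Pairs → Set
Noncrossing D = ∀ {a b c e} → (a , b) ∈ D → (c , e) ∈ D → a < c → c < b → b < e → ⊥

arcs-noncrossing : ∀ {u w} x → Forest u w → Noncrossing (arcs x w)
arcs-noncrossing x (leaf f) p q = arcs-noncrossing (suc x) f p q
arcs-noncrossing x (node {j = j} {w} f) (here refl) (here refl) h₁ h₂ h₃ = ℕₚ.<-irrefl refl h₁
arcs-noncrossing x (node {j = j} {w} f) (here refl) (there q) h₁ h₂ h₃ =
  arcs-uncovered x f (drop-⊑ (suc j) (head-drop-∈ (suc j) (ends x w) (node-arity x f))) q h₂ h₃
arcs-noncrossing x (node f) (there p) (here refl) h₁ h₂ h₃ = ℕₚ.<⇒≱ h₁ (proj₁ (arcs-bounds x f p))
arcs-noncrossing x (node f) (there p) (there q) = arcs-noncrossing x f p q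

-- Together with `arcs-uncovered` this recovers the ends, and hence the number of trees, from the
-- arcs alone.
uncovered⇒end : ∀ {u w t} x → Forest u w → x < t → t ≤ x + leaves w →
  (∀ {a b} → (a , b) ∈ arcs x w → a < t → t < b → ⊥) → t ∈ ends x w
uncovered⇒end {t = t} x [] h k unc = ⊥-elim (lia 2 (λ x t → x ≺ t ⇛ t ≼ x ⊹ # 0 ⇛ ⊩⊥) x t h k)
uncovered⇒end {w = _ ∷ w} {t} x (leaf f) h k unc with ℕₚ.m≤n⇒m<n∨m≡n h
... | inj₂ refl = here refl
... | inj₁ h' = there (uncovered⇒end (suc x) f h' (subst (t ≤_) (ℕₚ.+-suc x (leaves w)) k) unc)
uncovered⇒end {t = t} x (node {j = j} {w} f) h k unc =
  ∈-drop (suc j) (ends x w) (ends-increasing x w) (uncovered⇒end x f h k (unc ∘ there)) (node-arity x f)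
    (ℕₚ.≮⇒≥ (unc (here refl) h))

longest : ∀ x D → (∀ {b} → (x , b) ∉ D) ⊎ (∃ λ b → (x , b) ∈ D × (∀ {c} → (x , c) ∈ D → c ≤ b))
longest x [] = inj₁ λ ()
longest x ((a , b) ∷ D) with a ≟ x | longest x D
... | no a≢x | inj₁ none = inj₁ λ { (here refl) → a≢x refl ; (there q) → none q }
... | no a≢x | inj₂ (c , c∈ , m) = inj₂ (c , there c∈ , λ { (here refl) → ⊥-elim (a≢x refl) ; (there q) → m q })
... | yes refl | inj₁ none = inj₂ (b , here refl , λ { (here refl) → ℕₚ.≤-refl ; (there q) → ⊥-elim (none q) })
... | yes refl | inj₂ (c , c∈ , m) with ℕₚ.≤-total b c
... | inj₁ b≤c = inj₂ (c , there c∈ , λ { (here refl) → b≤c ; (there q) → m q })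
... | inj₂ c≤b = inj₂ (b , here refl , λ { (here refl) → ℕₚ.≤-refl ; (there q) → ℕₚ.≤-trans (m q) c≤b })

remove : Pair → Pairs → Pairs
remove p = filterᵇ (not ∘ pairEq p)

∈-remove⁺ : ∀ {p q D} → q ∈ D → q ≢ p → q ∈ remove p D
∈-remove⁺ {p} {q} q∈ q≢p = ∈-filterᵇ⁺ q∈ (not-intro (λ t → q≢p (sym (pairEq-sound p q t))))

∈-remove⁻ : ∀ p {q} D → q ∈ remove p D → q ∈ D × q ≢ p
∈-remove⁻ p {q} D h with ∈-filterᵇ⁻ {p = not ∘ pairEq p} {xs = D} h
... | q∈ , t = q∈ , λ { refl → not-elim t (pairEq-refl q) }

remove-shorter : ∀ {p D} → p ∈ D → length (remove p D) < length D
remove-shorter {p} {D} h = Listₚ.filter-notAll _ D (Any.map (λ { refl t → not-elim t (pairEq-refl p) }) h)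

-- Only the outermost arc starting at x has to be detached to expose the rest of the forest.
parse : ∀ fuel x l D → l + length D ≤ fuel → (∀ {a b} → (a , b) ∈ D → x ≤ a × suc (suc a) ≤ b × b ≤ x + l) →
  Noncrossing D → ∃ λ u → ∃ λ w → Forest u w × leaves w ≡ l × arcs x w ≅ D
parse fuel x zero [] le bd nc = 0 , [] , [] , refl , (λ ()) , (λ ())
parse fuel x zero ((a , b) ∷ D) le bd nc with bd (here refl)
... | p , q , r = ⊥-elim (lia 3 (λ x a b → x ≼ a ⇛ # 2 ⊹ a ≼ b ⇛ b ≼ x ⊹ # 0 ⇛ ⊩⊥) x a b p q r)
parse (suc fuel) x (suc l) D le bd nc with longest x D
... | inj₁ none with parse fuel (suc x) l D (s≤s⁻¹ le) bd' nc
  where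
  bd' : ∀ {a b} → (a , b) ∈ D → suc x ≤ a × suc (suc a) ≤ b × b ≤ suc x + l
  bd' {b = b} q with bd q
  ... | p₁ , p₂ , p₃ = ℕₚ.≤∧≢⇒< p₁ (λ { refl → none q }) , p₂ , subst (b ≤_) (ℕₚ.+-suc x l) p₃
... | u , w , f , e , s = suc u , 0 ∷ w , leaf f , cong suc e , s
parse (suc fuel) x (suc l) D le bd nc | inj₂ (b , b∈ , m)
  with parse fuel x (suc l) (remove (x , b) D) shorter (bd ∘ proj₁ ∘ ∈-remove⁻ (x , b) D)
         (λ p q → nc (proj₁ (∈-remove⁻ (x , b) D p)) (proj₁ (∈-remove⁻ (x , b) D q)))
  where
  shorter : suc l + length (remove (x , b) D) ≤ fuel
  shorter = lia 4 (λ l r d f → # 1 ⊹ l ⊹ d ≼ # 1 ⊹ f ⇛ r ≺ d ⇛ ⊩ # 1 ⊹ l ⊹ r ≼ f) l _ (length D) fuel le (remove-shorter b∈)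
... | u , w , f , e , (s , t) = attach u f (drop-index (ends x w) b∈ends)
  where
  x<b : x < b
  x<b = ℕₚ.<-trans ℕₚ.≤-refl (proj₁ (proj₂ (bd b∈)))
  b∈ends : b ∈ ends x w
  b∈ends = uncovered⇒end x f x<b (subst (λ z → b ≤ x + z) (sym e) (proj₂ (proj₂ (bd b∈)))) λ {a} {c} q p₁ p₂ →
    let (q∈ , q≢) = ∈-remove⁻ (x , b) D (s q) in
    case ℕₚ.m≤n⇒m<n∨m≡n (proj₁ (bd q∈)) of λ
      { (inj₁ x<a) → nc b∈ q∈ x<a p₁ p₂
      ; (inj₂ refl) → ℕₚ.<⇒≱ p₂ (m q∈) }
  not-first : ∀ {u w} → Forest u w → 0 < length (ends x w) → suc (suc x) ≤ head₀ (ends x w) → (x , head₀ (ends x w)) ∈ arcs x w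
  not-first (leaf f) p h = ⊥-elim (ℕₚ.<-irrefl refl h)
  not-first (node f) p h = here refl
  attach : ∀ u → Forest u w → (∃ λ k → k < length (ends x w) × head₀ (drop k (ends x w)) ≡ b) →
    ∃ λ u → ∃ λ w → Forest u w × leaves w ≡ suc l × arcs x w ≅ D
  -- If `b` were the first end, the first tree would already span [x , b]. It is no leaf, as b ≥ x +
  -- 2, so (x , b) would still be among the arcs after its removal.
  attach u f (zero , k< , k≡) = ⊥-elim (proj₂ (∈-remove⁻ (x , b) D (s
    (not-first f k< (subst (suc (suc x) ≤_) (sym k≡) (proj₁ (proj₂ (bd b∈))))))) (cong (x ,_) k≡))
  attach u f (suc j , k< , k≡) with ℕₚ.m≤n⇒∃[o]m+o≡n (subst (suc j <_) (ends-length x f) k<)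
  ... | v , refl = suc v , suc j ∷ w , node f , e ,
    (λ { (here refl) → subst (λ z → (x , z) ∈ D) (sym k≡) b∈ ; (there q) → proj₁ (∈-remove⁻ (x , b) D (s q)) }) ,
    back
    where
    back : ∀ {p} → p ∈ D → p ∈ arcs x (suc j ∷ w)
    back {p} q with pairEq (x , b) p in eq
    ... | true = here (trans (sym (pairEq-sound (x , b) p (subst T (sym eq) tt))) (cong (x ,_) (sym k≡)))
    ... | false = there (t (∈-remove⁺ {x , b} q (λ { refl → subst T eq (pairEq-refl p) })))

first-arc : ∀ {u w b} x → Forest u w → (x , b) ∈ arcs x w → ∀ {e} → e ∈ ends x w → b ≤ e
first-arc {w = w} x f q e∈ = ℕₚ.≮⇒≥ (arcs-uncovered x f e∈ q (ends-lower x w e∈))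

forest-0 : ∀ {w} → Forest 0 w → w ≡ []
forest-0 [] = refl

-- The first letter is a node exactly when an arc starts at `x`. Its own arc is the longest of
-- these, hence the same for both words, and can be stripped; the label is then the position of its
-- right end among the ends of the rest.
arcs-injective : ∀ {u v w z} x → Forest u w → Forest v z → leaves w ≡ leaves z → arcs x w ≅ arcs x z → w ≡ z
arcs-injective x [] [] e s = refl
arcs-injective x [] (node g) e (s , t) with t (here refl)
... | ()
arcs-injective x (node f) [] e (s , t) with s (here refl)
... | ()
arcs-injective x (leaf f) (leaf g) e s = cong (0 ∷_) (arcs-injective (suc x) f g (ℕₚ.suc-injective e) s)
arcs-injective x (leaf f) (node g) e (s , t) = ⊥-elim (ℕₚ.<-irrefl refl (proj₁ (arcs-bounds (suc x) f (t (here refl)))))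
arcs-injective x (node f) (leaf g) e (s , t) = ⊥-elim (ℕₚ.<-irrefl refl (proj₁ (arcs-bounds (suc x) g (s (here refl)))))
arcs-injective x (node {j = i} {w} f) (node {j = j} {z} g) e (s , t) = finish (arcs-injective x f g e (strip f g b≡c s , strip g f (sym b≡c) t))
  where
  top : List ℕ → ℕ → ℕ
  top w i = head₀ (drop (suc i) (ends x w))
  top-greatest : ∀ {u w i c} → Forest (suc (suc (i + u))) w → (x , c) ∈ arcs x w → c < top w i
  top-greatest {u} {w} {i} {c} f q = ℕₚ.≤-<-trans (first-arc x f q (head-drop-∈ 0 (ends x w) (ℕₚ.<-trans (s≤s z≤n) (node-arity {u} x f))))
    (later (ends x w) (ends-increasing x w) (node-arity {u} x f))
    where
    later : ∀ es → Increasing es → suc i < length es → head₀ es < head₀ (drop (suc i) es)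
    later (e ∷ es) (e< ∷ _) l = All.lookup e< (drop-⊑ i (head-drop-∈ i es (s≤s⁻¹ l)))
  at-most : ∀ {u w i c} → Forest (suc (suc (i + u))) w → (x , c) ∈ (x , top w i) ∷ arcs x w → c ≤ top w i
  at-most f (here refl) = ℕₚ.≤-refl
  at-most {u} f (there q) = ℕₚ.<⇒≤ (top-greatest {u} f q)
  b≡c : top w i ≡ top z j
  b≡c = ℕₚ.≤-antisym (at-most g (s (here refl))) (at-most f (t (here refl)))
  strip : ∀ {u v w z i j} → Forest (suc (suc (i + u))) w → Forest (suc (suc (j + v))) z → top w i ≡ top z j →
    ((x , top w i) ∷ arcs x w) ⊑ ((x , top z j) ∷ arcs x z) → arcs x w ⊑ arcs x z
  strip {u} f g e h q with h (there q)
  ... | there q' = q'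
  ... | here refl = ⊥-elim (ℕₚ.<-irrefl (sym e) (top-greatest {u} f q))
  finish : w ≡ z → suc i ∷ w ≡ suc j ∷ z
  finish refl = cong (_∷ w) (head-drop-injective (suc i) (suc j) (ends x w) (ends-increasing x w) (node-arity x f) (node-arity x g) b≡c)

drop-++ : ∀ {A : Set} k (xs ys : List A) → k ≤ length xs → drop k (xs ++ ys) ≡ drop k xs ++ ys
drop-++ zero xs ys h = refl
drop-++ (suc k) (x ∷ xs) ys h = drop-++ k xs ys (s≤s⁻¹ h)

head-++ : ∀ xs ys → 0 < length xs → head₀ (xs ++ ys) ≡ head₀ xs
head-++ (x ∷ xs) ys h = refl

-- That `w` is a complete code is essential: otherwise a node of `w` could take children from `v`,
-- and `drop` would reach into the second list.
ends-++ : ∀ {u w} x v → Forest u w → ends x (w ++ v) ≡ ends x w ++ ends (x + leaves w) v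
ends-++ x v [] rewrite ℕₚ.+-identityʳ x = refl
ends-++ x v (leaf {w = w} f) rewrite ℕₚ.+-suc x (leaves w) = cong (suc x ∷_) (ends-++ (suc x) v f)
ends-++ x v (node {j = j} {w} f) = trans (cong (drop (suc j)) (ends-++ x v f)) (drop-++ (suc j) (ends x w) _ (ℕₚ.<⇒≤ (node-arity x f)))

arcs-++ : ∀ {u w} x v → Forest u w → arcs x (w ++ v) ≡ arcs x w ++ arcs (x + leaves w) v
arcs-++ x v [] rewrite ℕₚ.+-identityʳ x = refl
arcs-++ x v (leaf {w = w} f) rewrite ℕₚ.+-suc x (leaves w) = arcs-++ (suc x) v f
arcs-++ x v (node {j = j} {w} f) = cong₂ _∷_
  (cong (x ,_) (trans (cong head₀ (ends-++ x v (node f)))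
    (head-++ (drop (suc j) (ends x w)) _ (subst (0 <_) (sym (ends-length x (node f))) (s≤s z≤n)))))
  (arcs-++ x v f)

ends-shift : ∀ k x w → ends (k + x) w ≡ map (k +_) (ends x w)
ends-shift k x [] = refl
ends-shift k x (zero ∷ w) = cong₂ _∷_ (sym (ℕₚ.+-suc k x)) (trans (cong (λ z → ends z w) (sym (ℕₚ.+-suc k x))) (ends-shift k (suc x) w))
ends-shift k x (suc j ∷ w) = trans (cong (drop (suc j)) (ends-shift k x w)) (Listₚ.drop-map {f = k +_} (suc j) (ends x w))

translate : ℕ → Pair → Pair
translate k (a , b) = k + a , k + b

arcs-shift : ∀ {u w} k x → Forest u w → arcs (k + x) w ≡ map (translate k) (arcs x w)
arcs-shift k x [] = refl
arcs-shift k x (leaf {w = w} f) = trans (cong (λ z → arcs z w) (sym (ℕₚ.+-suc k x))) (arcs-shift k (suc x) f)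
arcs-shift k x (node {j = j} {w} f) = cong₂ _∷_
  (cong (k + x ,_) (trans (cong head₀ (ends-shift k x (suc j ∷ w)))
    (head-map (drop (suc j) (ends x w)) (subst (0 <_) (sym (ends-length x (node f))) (s≤s z≤n)))))
  (arcs-shift k x f)
  where
  head-map : ∀ xs → 0 < length xs → head₀ (map (k +_) xs) ≡ k + head₀ xs
  head-map (x ∷ xs) h = refl

-- Pieces of a dissection

consecutive : List ℕ → Pairs
consecutive [] = []
consecutive (x ∷ []) = []
consecutive (x ∷ y ∷ r) = (x , y) ∷ consecutive (y ∷ r)

final : ℕ → List ℕ → ℕ
final v [] = v
final v (y ∷ r) = final y r

-- The auxiliary functions inside `sides` are private, so the induction does not name them. The
-- value of `sides (y ∷ r)` determines both of them by its initial segment and its last entry.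
sides≡ : ∀ v r → sides (v ∷ r) ≡ consecutive (v ∷ r) ++ [ (v , final v r) ]
sides≡ v [] = refl
sides≡ v (y ∷ r) with Listₚ.∷ʳ-injective _ (consecutive (y ∷ r)) (sides≡ y r)
... | p , q = cong ((v , y) ∷_) (cong₂ (λ xs z → xs ++ [ (v , z) ]) p (cong proj₂ q))

-- a and b follow each other in the cyclic order of V
Adjacent : List ℕ → ℕ → ℕ → Set
Adjacent V a b = (∀ {x} → x ∈ V → a < x → x < b → ⊥) ⊎ (∀ {x} → x ∈ V → a ≤ x × x ≤ b)

Edge : ℕ → ℕ → ℕ → Set
Edge N a b = suc a ≡ b ⊎ (a ≡ 0 × suc b ≡ N)

-- The test `isPiece` restated through `Adjacent`, which depends on the vertex set and not on the
-- list of sides, so that it can be carried along rotations and order embeddings.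
record Piece (N : ℕ) (D : Pairs) (V : List ℕ) : Set where
  field
    big : 3 ≤ length V
    side : ∀ {a b} → a ∈ V → b ∈ V → a < b → Adjacent V a b → Edge N a b ⊎ (a , b) ∈ D
    chordless : ∀ {a b} → (a , b) ∈ D → a ∈ V → b ∈ V → Adjacent V a b

WellFormed : ℕ → Pairs → Set
WellFormed N D = ∀ {a b} → (a , b) ∈ D → a < b × b < N

consecutive⁻ : ∀ {a b} V → Increasing V → (a , b) ∈ consecutive V →
  a ∈ V × b ∈ V × a < b × (∀ {x} → x ∈ V → a < x → x < b → ⊥)
consecutive⁻ (v ∷ w ∷ V) ((v<w ∷ _) ∷ (w< ∷ _)) (here refl) = here refl , there (here refl) , v<w , none
  where
  none : ∀ {x} → x ∈ v ∷ w ∷ V → v < x → x < w → ⊥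
  none (here refl) p q = ℕₚ.<-irrefl refl p
  none (there (here refl)) p q = ℕₚ.<-irrefl refl q
  none (there (there r)) p q = ℕₚ.<-asym q (All.lookup w< r)
consecutive⁻ (v ∷ w ∷ V) (v< ∷ i) (there h) with consecutive⁻ (w ∷ V) i h
... | a∈ , b∈ , a<b , none = there a∈ , there b∈ , a<b ,
  λ { (here refl) p q → ℕₚ.<-asym p (All.lookup v< a∈) ; (there r) p q → none r p q }

consecutive⁺ : ∀ {a b} V → Increasing V → a ∈ V → b ∈ V → a < b → (∀ {x} → x ∈ V → a < x → x < b → ⊥) →
  (a , b) ∈ consecutive V
consecutive⁺ (v ∷ []) i (here refl) (here refl) a<b none = ⊥-elim (ℕₚ.<-irrefl refl a<b)
consecutive⁺ (v ∷ w ∷ V) i (here refl) (here refl) a<b none = ⊥-elim (ℕₚ.<-irrefl refl a<b)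
consecutive⁺ (v ∷ w ∷ V) (v< ∷ i) (here refl) (there (here refl)) a<b none = here refl
consecutive⁺ (v ∷ w ∷ V) (v< ∷ (w< ∷ _)) (here refl) (there (there q)) a<b none =
  ⊥-elim (none (there (here refl)) (All.lookup v< (here refl)) (All.lookup w< q))
consecutive⁺ (v ∷ w ∷ V) (v< ∷ i) (there p) (here refl) a<b none = ⊥-elim (ℕₚ.<-asym a<b (All.lookup v< p))
consecutive⁺ (v ∷ w ∷ V) (v< ∷ i) (there p) (there q) a<b none = there (consecutive⁺ (w ∷ V) i p q a<b (none ∘ there))

final-∈ : ∀ v r → final v r ∈ v ∷ r
final-∈ v [] = here refl
final-∈ v (y ∷ r) = there (final-∈ y r)

final-greatest : ∀ v r {x} → Increasing (v ∷ r) → x ∈ v ∷ r → x ≤ final v r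
final-greatest v [] i (here refl) = ℕₚ.≤-refl
final-greatest v (y ∷ r) ((v<y ∷ _) ∷ i) (here refl) = ℕₚ.≤-trans (ℕₚ.<⇒≤ v<y) (final-greatest y r i (here refl))
final-greatest v (y ∷ r) (v< ∷ i) (there q) = final-greatest y r i q

first-least : ∀ v r {x} → Increasing (v ∷ r) → x ∈ v ∷ r → v ≤ x
first-least v r = head-least (v ∷ r)

sides⁻ : ∀ {a b} V → Increasing V → 2 ≤ length V → (a , b) ∈ sides V → a ∈ V × b ∈ V × a < b × Adjacent V a b
sides⁻ {a} {b} (v ∷ r) i l h with ∈-++⁻ (consecutive (v ∷ r)) (subst ((a , b) ∈_) (sides≡ v r) h)
... | inj₁ q with consecutive⁻ (v ∷ r) i q
... | a∈ , b∈ , a<b , none = a∈ , b∈ , a<b , inj₁ none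
sides⁻ (v ∷ []) i (s≤s ()) h | inj₂ _
sides⁻ (v ∷ y ∷ r) ((v<y ∷ v<) ∷ i) l h | inj₂ (here refl) = here refl , final-∈ v (y ∷ r) ,
  ℕₚ.<-≤-trans v<y (final-greatest y r i (here refl)) ,
  inj₂ (λ q → first-least v (y ∷ r) ((v<y ∷ v<) ∷ i) q , final-greatest v (y ∷ r) ((v<y ∷ v<) ∷ i) q)

sides⁺ : ∀ {a b} V → Increasing V → a ∈ V → b ∈ V → a < b → Adjacent V a b → (a , b) ∈ sides V
sides⁺ {a} {b} (v ∷ r) i a∈ b∈ a<b (inj₁ none) =
  subst ((a , b) ∈_) (sym (sides≡ v r)) (∈-++⁺ˡ (consecutive⁺ (v ∷ r) i a∈ b∈ a<b none))
sides⁺ {a} {b} (v ∷ r) i a∈ b∈ a<b (inj₂ within) =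
  subst ((a , b) ∈_) (sym (sides≡ v r)) (∈-++⁺ʳ (consecutive (v ∷ r)) (here (cong₂ _,_
    (ℕₚ.≤-antisym (proj₁ (within (here refl))) (first-least v r i a∈))
    (ℕₚ.≤-antisym (final-greatest v r i b∈) (proj₂ (within (final-∈ v r)))))))

isEdge⁺ : ∀ {n a b} → Edge (suc (suc n)) a b → T (isEdge n (a , b))
isEdge⁺ {a = a} {b} (inj₁ e) = ∨-introˡ (ℕₚ.≡⇒≡ᵇ (suc a) b e)
isEdge⁺ {n} {a} {b} (inj₂ (p , q)) = ∨-introʳ (suc a ≡ᵇ b) (∧-intro (ℕₚ.≡⇒≡ᵇ a 0 p) (ℕₚ.≡⇒≡ᵇ (suc b) (suc (suc n)) q))

isEdge⁻ : ∀ {n a b} → T (isEdge n (a , b)) → Edge (suc (suc n)) a b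
isEdge⁻ {n} {a} {b} h with ∨-elim (suc a ≡ᵇ b) h
... | inj₁ t = inj₁ (ℕₚ.≡ᵇ⇒≡ (suc a) b t)
... | inj₂ t = inj₂ (ℕₚ.≡ᵇ⇒≡ a 0 (∧-left t) , ℕₚ.≡ᵇ⇒≡ (suc b) (suc (suc n)) (∧-right (a ≡ᵇ 0) t))

isPiece⁻ : ∀ {n D V} → Increasing V → T (isPiece n D V) → Piece (suc (suc n)) D V
isPiece⁻ {n} {D} {V} i h = record
  { big = big
  ; side = λ {a} {b} a∈ b∈ a<b adj →
      Sum.map isEdge⁻ (member⁻ D) (∨-elim (isEdge n (a , b)) (all-elim (∧-left rest) (sides⁺ V i a∈ b∈ a<b adj)))
  ; chordless = chordless }
  where
  big : 3 ≤ length V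
  big = ℕₚ.≤ᵇ⇒≤ 3 (length V) (∧-left h)
  rest = ∧-right (3 ≤ᵇ length V) h
  chordless : ∀ {a b} → (a , b) ∈ D → a ∈ V → b ∈ V → Adjacent V a b
  chordless {a} {b} p a∈ b∈ with memberᵇ (a , b) (sides V) in eq
  ... | true = proj₂ (proj₂ (proj₂ (sides⁻ V i (ℕₚ.<⇒≤ big) (member⁻ (sides V) (subst T (sym eq) tt)))))
  ... | false = ⊥-elim (not-elim
    (all-elim (∧-right (all (λ s → isEdge n s ∨ memberᵇ s D) (sides V)) rest) p)
    (∧-intro (∈ℕ⁺ a∈) (∧-intro (∈ℕ⁺ b∈) (not-intro (λ t → subst T eq t)))))

isPiece⁺ : ∀ {n D V} → Increasing V → WellFormed (suc (suc n)) D → Piece (suc (suc n)) D V → T (isPiece n D V)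
isPiece⁺ {n} {D} {V} i wf P = ∧-intro (ℕₚ.≤⇒≤ᵇ big) (∧-intro
  (all-intro (sides V) sided)
  (all-intro D λ {δ} p → not-intro λ t → not-elim
    (∧-right (any (proj₂ δ ≡ᵇ_) V) (∧-right (any (proj₁ δ ≡ᵇ_) V) t))
    (member⁺ (sides⁺ V i (∈ℕ⁻ V (∧-left t)) (∈ℕ⁻ V (∧-left (∧-right (any (proj₁ δ ≡ᵇ_) V) t))) (proj₁ (wf p))
      (chordless p (∈ℕ⁻ V (∧-left t)) (∈ℕ⁻ V (∧-left (∧-right (any (proj₁ δ ≡ᵇ_) V) t))))))))
  where
  open Piece P
  sided : ∀ {s} → s ∈ sides V → T (isEdge n s ∨ memberᵇ s D)
  sided {a , b} q with sides⁻ V i (ℕₚ.<⇒≤ big) q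
  ... | a∈ , b∈ , a<b , adj with side a∈ b∈ a<b adj
  ... | inj₁ e = ∨-introˡ (isEdge⁺ e)
  ... | inj₂ d = ∨-introʳ (isEdge n (a , b)) (member⁺ d)

pieces : ℕ → Pairs → ℕ → List (List ℕ)
pieces n D s = filterᵇ (λ V → (length V ≡ᵇ s) ∧ isPiece n D V) (subsets (upTo (suc (suc n))))

record PieceOf (N : ℕ) (D : Pairs) (s : ℕ) (V : List ℕ) : Set where
  field
    increasing : Increasing V
    bounded : ∀ {x} → x ∈ V → x < N
    size : length V ≡ s
    piece : Piece N D V
  open Piece piece public

pieces⁻ : ∀ n D s {V} → V ∈ pieces n D s → PieceOf (suc (suc n)) D s V
pieces⁻ n D s {V} h with ∈-filterᵇ⁻ {p = λ V → (length V ≡ᵇ s) ∧ isPiece n D V} {xs = subsets (upTo (suc (suc n)))} h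
... | V∈ , t = record
  { increasing = i ; bounded = ∈-upTo⁻ ∘ subsets-⊑ V∈
  ; size = ℕₚ.≡ᵇ⇒≡ (length V) s (∧-left t) ; piece = isPiece⁻ i (∧-right (length V ≡ᵇ s) t) }
  where i = subsets-AllPairs (upTo-increasing (suc (suc n))) V∈

pieces⁺ : ∀ n D s {V} → WellFormed (suc (suc n)) D → PieceOf (suc (suc n)) D s V → V ∈ pieces n D s
pieces⁺ n D s {V} wf P = ∈-filterᵇ⁺ {p = λ V → (length V ≡ᵇ s) ∧ isPiece n D V} (increasing-∈-subsets increasing bounded)
  (∧-intro (ℕₚ.≡⇒≡ᵇ (length V) s size) (isPiece⁺ increasing wf piece))
  where open PieceOf P

pieces-Unique : ∀ n D s → Unique (pieces n D s)
pieces-Unique n D s = Unique-filterᵇ (subsets-Unique (Increasing⇒Unique (upTo-increasing (suc (suc n)))))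

pieceCount-cong : ∀ n {D E} s → WellFormed (suc (suc n)) D → WellFormed (suc (suc n)) E → D ≅ E → pieceCount n D s ≡ pieceCount n E s
pieceCount-cong n {D} {E} s wfD wfE (f , g) = length-≡-≅ (pieces-Unique n D s) (pieces-Unique n E s)
  (transfer wfE f g , transfer wfD g f)
  where
  transfer : ∀ {D E} → WellFormed (suc (suc n)) E → D ⊑ E → E ⊑ D → pieces n D s ⊑ pieces n E s
  transfer {D} {E} wf f g h = pieces⁺ n E s wf (record
    { increasing = P.increasing ; bounded = P.bounded ; size = P.size ; piece = record
      { big = P.big ; side = λ a∈ b∈ a<b adj → Sum.map id f (P.side a∈ b∈ a<b adj) ; chordless = P.chordless ∘ g } })
    where module P = PieceOf (pieces⁻ n D s h)

-- Rotation by one vertex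

next : ℕ → ℕ → ℕ
next n x = if x ≡ᵇ suc n then 0 else suc x

nextPair : ℕ → Pair → Pair
nextPair n (a , b) = if b ≡ᵇ suc n then (0 , suc a) else (suc a , suc b)

≡ᵇ-dec : ∀ a b → (a ≡ b × (a ≡ᵇ b) ≡ true) ⊎ (a ≢ b × (a ≡ᵇ b) ≡ false)
≡ᵇ-dec a b with a ≡ᵇ b in eq
... | true = inj₁ (ℕₚ.≡ᵇ⇒≡ a b (subst T (sym eq) tt) , refl)
... | false = inj₂ ((λ e → subst T eq (ℕₚ.≡⇒≡ᵇ a b e)) , refl)

next-view : ∀ n x → (x ≡ suc n × next n x ≡ 0) ⊎ (x ≢ suc n × next n x ≡ suc x)
next-view n x with ≡ᵇ-dec x (suc n)
... | inj₁ (e , q) rewrite q = inj₁ (e , refl)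
... | inj₂ (e , q) rewrite q = inj₂ (e , refl)

nextPair-view : ∀ n a b → (b ≡ suc n × nextPair n (a , b) ≡ (0 , suc a)) ⊎ (b ≢ suc n × nextPair n (a , b) ≡ (suc a , suc b))
nextPair-view n a b with ≡ᵇ-dec b (suc n)
... | inj₁ (e , q) rewrite q = inj₁ (e , refl)
... | inj₂ (e , q) rewrite q = inj₂ (e , refl)

next-injective : ∀ n {x y} → next n x ≡ next n y → x ≡ y
next-injective n {x} {y} e with next-view n x | next-view n y
... | inj₁ (p , _) | inj₁ (q , _) = trans p (sym q)
... | inj₁ (_ , p) | inj₂ (_ , q) with trans (sym p) (trans e q)
... | ()
next-injective n e | inj₂ (_ , p) | inj₁ (_ , q) with trans (sym p) (trans e q)
... | ()
next-injective n e | inj₂ (_ , p) | inj₂ (_ , q) = ℕₚ.suc-injective (trans (sym p) (trans e q))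

next-< : ∀ n {x} → x < suc (suc n) → next n x < suc (suc n)
next-< n {x} h with next-view n x
... | inj₁ (_ , q) rewrite q = s≤s z≤n
... | inj₂ (x≢ , q) rewrite q = s≤s (ℕₚ.≤∧≢⇒< (s≤s⁻¹ h) x≢)

nextPair-WellFormed : ∀ n D → WellFormed (suc (suc n)) D → WellFormed (suc (suc n)) (map (nextPair n) D)
nextPair-WellFormed n D wf h with ∈-map⁻ (nextPair n) h
... | (a , b) , p , e with nextPair-view n a b
... | inj₁ (refl , q) with trans e q
... | refl = s≤s z≤n , s≤s (proj₁ (wf p))
nextPair-WellFormed n D wf h | (a , b) , p , e | inj₂ (b≢ , q) with trans e q
... | refl = s≤s (proj₁ (wf p)) , s≤s (ℕₚ.≤∧≢⇒< (s≤s⁻¹ (proj₂ (wf p))) b≢)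

-- Filtering `upTo`, as opposed to mapping `next` over `V`, keeps the vertices in increasing order
-- when the last one wraps around to 0.
rotated : ℕ → List ℕ → List ℕ
rotated n V = filterᵇ (λ y → any (y ≡ᵇ_) (map (next n) V)) (upTo (suc (suc n)))

module _ (n : ℕ) {V : List ℕ} where

  rotated⁻ : ∀ {y} → y ∈ rotated n V → ∃ λ x → x ∈ V × y ≡ next n x
  rotated⁻ {y} h = ∈-map⁻ (next n) (∈ℕ⁻ (map (next n) V) (proj₂ (∈-filterᵇ⁻ {p = λ y → any (y ≡ᵇ_) (map (next n) V)} {xs = upTo (suc (suc n))} h)))

  rotated⁺ : ∀ {x} → x < suc (suc n) → x ∈ V → next n x ∈ rotated n V
  rotated⁺ {x} x<N x∈ = ∈-filterᵇ⁺ {p = λ y → any (y ≡ᵇ_) (map (next n) V)} (∈-upTo⁺ (next-< n x<N)) (∈ℕ⁺ (∈-map⁺ (next n) x∈))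

  next∈rotated : ∀ {x} → next n x ∈ rotated n V → x ∈ V
  next∈rotated h with rotated⁻ h
  ... | y , y∈ , e = subst (_∈ V) (sym (next-injective n e)) y∈

rotated-increasing : ∀ n V → Increasing (rotated n V)
rotated-increasing n V = AllPairsₚ.filter⁺ (T? ∘ (λ y → any (y ≡ᵇ_) (map (next n) V))) (upTo-increasing (suc (suc n)))

-- For pairs containing the last vertex, which moves to 0, the two alternatives of `Adjacent`
-- exchange their roles; both functions `flip` do this. For all other pairs, treated by `back` and
-- `forth`, they persist.
rotate-piece : ∀ n D s {V} → WellFormed (suc (suc n)) D → PieceOf (suc (suc n)) D s V →
  PieceOf (suc (suc n)) (map (nextPair n) D) s (rotated n V)
rotate-piece n D s {V} wf P = record
  { increasing = rotated-increasing n V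
  ; bounded = λ h → ∈-upTo⁻ (proj₁ (∈-filterᵇ⁻ {p = λ y → any (y ≡ᵇ_) (map (next n) V)} {xs = upTo N} h))
  ; size = trans same-length size
  ; piece = record { big = subst (3 ≤_) (sym same-length) big ; side = side′ ; chordless = chordless′ } }
  where
  N = suc (suc n)
  open PieceOf P
  same-length : length (rotated n V) ≡ length V
  same-length = trans
    (length-≡-≅ (Increasing⇒Unique (rotated-increasing n V)) (Uniqueₚ.map⁺ (next-injective n) (Increasing⇒Unique increasing))
      ((λ h → let (x , x∈ , e) = rotated⁻ n {V = V} h in subst (_∈ map (next n) V) (sym e) (∈-map⁺ (next n) x∈)) ,
       (λ h → let (x , x∈ , e) = ∈-map⁻ (next n) h in subst (_∈ rotated n V) (sym e) (rotated⁺ n (bounded x∈) x∈))))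
    (Listₚ.length-map (next n) V)
  rotates : ∀ {a b} → b ≢ suc n → (a , b) ∈ D → (suc a , suc b) ∈ map (nextPair n) D
  rotates {a} {b} b≢ p with nextPair-view n a b
  ... | inj₁ (e , _) = ⊥-elim (b≢ e)
  ... | inj₂ (_ , q) = subst (_∈ map (nextPair n) D) q (∈-map⁺ (nextPair n) p)
  wraps : ∀ {a} → (a , suc n) ∈ D → (0 , suc a) ∈ map (nextPair n) D
  wraps {a} p with nextPair-view n a (suc n)
  ... | inj₁ (_ , q) = subst (_∈ map (nextPair n) D) q (∈-map⁺ (nextPair n) p)
  ... | inj₂ (b≢ , _) = ⊥-elim (b≢ refl)
  inside : ∀ {x} → x ∈ V → x ≢ suc n → suc x ∈ rotated n V
  inside {x} x∈ x≢ with next-view n x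
  ... | inj₁ (e , _) = ⊥-elim (x≢ e)
  ... | inj₂ (_ , q) = subst (_∈ rotated n V) q (rotated⁺ n (bounded x∈) x∈)
  origin : suc n ∈ V → 0 ∈ rotated n V
  origin x∈ with next-view n (suc n)
  ... | inj₁ (_ , q) = subst (_∈ rotated n V) q (rotated⁺ n (bounded x∈) x∈)
  ... | inj₂ (b≢ , _) = ⊥-elim (b≢ refl)
  <last : ∀ {x} → x ∈ V → x ≢ suc n → x < suc n
  <last x∈ x≢ = ℕₚ.≤∧≢⇒< (s≤s⁻¹ (bounded x∈)) x≢
  side′ : ∀ {a b} → a ∈ rotated n V → b ∈ rotated n V → a < b → Adjacent (rotated n V) a b →
    Edge N a b ⊎ (a , b) ∈ map (nextPair n) D
  side′ a∈ b∈ a<b adj with rotated⁻ n {V = V} a∈ | rotated⁻ n {V = V} b∈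
  ... | x , x∈ , e | y , y∈ , f with next-view n x | next-view n y
  ... | _ | inj₁ (_ , q) rewrite f | q with a<b
  ... | ()
  side′ a∈ b∈ a<b adj | x , x∈ , e | y , y∈ , f | inj₁ (refl , p) | inj₂ (y≢ , q) rewrite e | f | p | q
    with side y∈ x∈ (<last y∈ y≢) (flip adj)
    where
    flip : Adjacent (rotated n V) 0 (suc y) → Adjacent V y (suc n)
    flip (inj₁ none) = inj₂ λ {z} z∈ → ℕₚ.≮⇒≥ (λ z<y → none (inside z∈ (λ { refl → ℕₚ.<-asym z<y (<last y∈ y≢) })) (s≤s z≤n) (s≤s z<y)) , s≤s⁻¹ (bounded z∈)
    flip (inj₂ all′) = inj₁ λ {z} z∈ y<z z<n → ℕₚ.<⇒≱ y<z (s≤s⁻¹ (proj₂ (all′ (inside z∈ (ℕₚ.<⇒≢ z<n)))))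
  ... | inj₂ d = inj₂ (wraps d)
  ... | inj₁ (inj₁ g) = inj₁ (inj₂ (refl , cong suc g))
  ... | inj₁ (inj₂ (refl , _)) = inj₁ (inj₁ refl)
  side′ a∈ b∈ a<b adj | x , x∈ , e | y , y∈ , f | inj₂ (x≢ , p) | inj₂ (y≢ , q) rewrite e | f | p | q
    with side x∈ y∈ (s≤s⁻¹ a<b) (back adj)
    where
    back : Adjacent (rotated n V) (suc x) (suc y) → Adjacent V x y
    back (inj₁ none) = inj₁ λ {z} z∈ x<z z<y → none (inside z∈ (λ { refl → ℕₚ.<-asym z<y (<last y∈ y≢) })) (s≤s x<z) (s≤s z<y)
    back (inj₂ all′) = inj₂ λ {z} z∈ → case z ≟ suc n of λ
      { (yes refl) → case proj₁ (all′ (origin z∈)) of λ ()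
      ; (no z≢) → s≤s⁻¹ (proj₁ (all′ (inside z∈ z≢))) , s≤s⁻¹ (proj₂ (all′ (inside z∈ z≢))) }
  ... | inj₂ d = inj₂ (rotates y≢ d)
  ... | inj₁ (inj₁ g) = inj₁ (inj₁ (cong suc g))
  ... | inj₁ (inj₂ (_ , g)) = ⊥-elim (y≢ (ℕₚ.suc-injective g))
  chordless′ : ∀ {a b} → (a , b) ∈ map (nextPair n) D → a ∈ rotated n V → b ∈ rotated n V → Adjacent (rotated n V) a b
  chordless′ {a} {b} h a∈ b∈ with ∈-map⁻ (nextPair n) h
  ... | (x , y) , p , e with nextPair-view n x y
  ... | inj₁ (refl , q) with trans e q
  ... | refl = flip (chordless p (next∈rotated n x∈′) (next∈rotated n y∈′))
    where
    x<n : x < suc n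
    x<n = proj₁ (wf p)
    x∈′ : next n x ∈ rotated n V
    x∈′ with next-view n x
    ... | inj₁ (e′ , _) = ⊥-elim (ℕₚ.<-irrefl e′ x<n)
    ... | inj₂ (_ , q′) = subst (_∈ rotated n V) (sym q′) b∈
    y∈′ : next n (suc n) ∈ rotated n V
    y∈′ with next-view n (suc n)
    ... | inj₁ (_ , q′) = subst (_∈ rotated n V) (sym q′) a∈
    ... | inj₂ (b≢ , _) = ⊥-elim (b≢ refl)
    flip : Adjacent V x (suc n) → Adjacent (rotated n V) 0 (suc x)
    flip (inj₁ none) = inj₂ λ {z} z∈ → z≤n , upper z∈
      where
      upper : ∀ {z} → z ∈ rotated n V → z ≤ suc x
      upper z∈ with rotated⁻ n {V = V} z∈
      ... | w , w∈ , e′ with next-view n w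
      ... | inj₁ (_ , q′) rewrite e′ | q′ = z≤n
      ... | inj₂ (w≢ , q′) rewrite e′ | q′ = s≤s (ℕₚ.≮⇒≥ (λ x<w → none w∈ x<w (<last w∈ w≢)))
    flip (inj₂ all′) = inj₁ none
      where
      none : ∀ {z} → z ∈ rotated n V → 0 < z → z < suc x → ⊥
      none z∈ 0<z z<x with rotated⁻ n {V = V} z∈
      ... | w , w∈ , e′ with next-view n w
      ... | inj₁ (_ , q′) rewrite e′ | q′ = ℕₚ.<-irrefl refl 0<z
      ... | inj₂ (w≢ , q′) rewrite e′ | q′ = ℕₚ.<⇒≱ (s≤s⁻¹ z<x) (proj₁ (all′ w∈))
  chordless′ {a} {b} h a∈ b∈ | (x , y) , p , e | inj₂ (y≢ , q) with trans e q
  ... | refl = forth (chordless p (next∈rotated n x∈′) (next∈rotated n y∈′))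
    where
    y<n : y < suc n
    y<n = ℕₚ.≤∧≢⇒< (s≤s⁻¹ (proj₂ (wf p))) y≢
    x∈′ : next n x ∈ rotated n V
    x∈′ with next-view n x
    ... | inj₁ (e′ , _) = ⊥-elim (ℕₚ.<-irrefl e′ (ℕₚ.<-trans (proj₁ (wf p)) y<n))
    ... | inj₂ (_ , q′) = subst (_∈ rotated n V) (sym q′) a∈
    y∈′ : next n y ∈ rotated n V
    y∈′ with next-view n y
    ... | inj₁ (e′ , _) = ⊥-elim (y≢ e′)
    ... | inj₂ (_ , q′) = subst (_∈ rotated n V) (sym q′) b∈
    forth : Adjacent V x y → Adjacent (rotated n V) (suc x) (suc y)
    forth (inj₁ none) = inj₁ none′
      where
      none′ : ∀ {z} → z ∈ rotated n V → suc x < z → z < suc y → ⊥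
      none′ z∈ x<z z<y with rotated⁻ n {V = V} z∈
      ... | w , w∈ , e′ with next-view n w
      ... | inj₁ (_ , q′) rewrite e′ | q′ with x<z
      ... | ()
      none′ z∈ x<z z<y | w , w∈ , e′ | inj₂ (w≢ , q′) rewrite e′ | q′ = none w∈ (s≤s⁻¹ x<z) (s≤s⁻¹ z<y)
    forth (inj₂ all′) = inj₂ within
      where
      within : ∀ {z} → z ∈ rotated n V → suc x ≤ z × z ≤ suc y
      within z∈ with rotated⁻ n {V = V} z∈
      ... | w , w∈ , e′ with next-view n w
      ... | inj₁ (refl , q′) = ⊥-elim (ℕₚ.<⇒≱ y<n (proj₂ (all′ w∈)))
      ... | inj₂ (w≢ , q′) rewrite e′ | q′ = s≤s (proj₁ (all′ w∈)) , s≤s (proj₂ (all′ w∈))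

-- An inequality is enough: a full turn leads back to `D`, and this forces equality in
-- `pieceCount-rotateBy`.
pieceCount-≤-rotation : ∀ n D s → WellFormed (suc (suc n)) D → pieceCount n D s ≤ pieceCount n (map (nextPair n) D) s
pieceCount-≤-rotation n D s wf = length-≤-injection (pieces-Unique n D s) (λ {V} _ → rotated n V)
  (λ p → pieces⁺ n (map (nextPair n) D) s (nextPair-WellFormed n D wf) (rotate-piece n D s wf (pieces⁻ n D s p)))
  (λ {V} {W} p q e → increasing-ext (PieceOf.increasing (pieces⁻ n D s p)) (PieceOf.increasing (pieces⁻ n D s q))
    (unrotate e p , unrotate (sym e) q))
  where
  unrotate : ∀ {V W} → rotated n V ≡ rotated n W → V ∈ pieces n D s → V ⊑ W
  unrotate e p x∈ = next∈rotated n (subst (_ ∈_) e (rotated⁺ n (PieceOf.bounded (pieces⁻ n D s p) x∈) x∈))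

-- Rotation by any number of vertices, with endpoints as lifts of residues modulo n + 2

nrm : ℕ → ℕ → ℕ → Pair
nrm n a b = (a % suc (suc n)) ⊓ (b % suc (suc n)) , (a % suc (suc n)) ⊔ (b % suc (suc n))

nrm-< : ∀ n {a b} → a < b → b < suc (suc n) → nrm n a b ≡ (a , b)
nrm-< n {a} {b} a<b b<N rewrite m<n⇒m%n≡m b<N | m<n⇒m%n≡m (ℕₚ.<-trans a<b b<N) =
  cong₂ _,_ (ℕₚ.m≤n⇒m⊓n≡m (ℕₚ.<⇒≤ a<b)) (ℕₚ.m≤n⇒m⊔n≡n (ℕₚ.<⇒≤ a<b))

nrm-last : ∀ n {a} → a < suc (suc n) → nrm n a (suc (suc n)) ≡ (0 , a)
nrm-last n {a} a<N rewrite n%n≡0 (suc (suc n)) {{_}} | m<n⇒m%n≡m a<N = cong₂ _,_ (ℕₚ.⊓-zeroʳ a) (ℕₚ.⊔-identityʳ a)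

nrm-comm : ∀ n a b → nrm n a b ≡ nrm n b a
nrm-comm n a b = cong₂ _,_ (ℕₚ.⊓-comm (a % suc (suc n)) _) (ℕₚ.⊔-comm (a % suc (suc n)) _)

suc-% : ∀ n a → suc a % suc (suc n) ≡ next n (a % suc (suc n))
suc-% n a with next-view n (a % suc (suc n))
... | inj₁ (e , q) = trans (%-distribˡ-+ 1 a (suc (suc n))) (trans (cong (λ z → suc z % suc (suc n)) e)
  (trans (n%n≡0 (suc (suc n))) (sym q)))
... | inj₂ (e , q) = trans (%-distribˡ-+ 1 a (suc (suc n))) (trans
  (m<n⇒m%n≡m (s≤s (ℕₚ.≤∧≢⇒< (s≤s⁻¹ (m%n<n a (suc (suc n)))) e))) (sym q))

nextPair-sorted : ∀ n {x y} → x < suc (suc n) → y < suc (suc n) → x ≢ y →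
  nextPair n (x ⊓ y , x ⊔ y) ≡ (next n x ⊓ next n y , next n x ⊔ next n y)
nextPair-sorted n {x} {y} x<N y<N x≢y with ℕₚ.≤-total x y
... | inj₁ x≤y rewrite ℕₚ.m≤n⇒m⊓n≡m x≤y | ℕₚ.m≤n⇒m⊔n≡n x≤y = go (ℕₚ.≤∧≢⇒< x≤y x≢y) y<N
  where
  go : ∀ {x y} → x < y → y < suc (suc n) → nextPair n (x , y) ≡ (next n x ⊓ next n y , next n x ⊔ next n y)
  go {x} {y} x<y y<N with nextPair-view n x y | next-view n x | next-view n y
  ... | _ | inj₁ (refl , _) | _ = ⊥-elim (ℕₚ.<⇒≱ x<y (s≤s⁻¹ y<N))
  ... | inj₁ (e , _) | _ | inj₂ (e′ , _) = ⊥-elim (e′ e)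
  ... | inj₂ (e , _) | _ | inj₁ (e′ , _) = ⊥-elim (e e′)
  ... | inj₁ (_ , p) | inj₂ (_ , q) | inj₁ (_ , r) rewrite p | q | r = refl
  ... | inj₂ (_ , p) | inj₂ (_ , q) | inj₂ (_ , r) rewrite p | q | r =
    cong₂ _,_ (cong suc (sym (ℕₚ.m≤n⇒m⊓n≡m (ℕₚ.<⇒≤ x<y)))) (cong suc (sym (ℕₚ.m≤n⇒m⊔n≡n (ℕₚ.<⇒≤ x<y))))
... | inj₂ y≤x rewrite ℕₚ.m≥n⇒m⊓n≡n y≤x | ℕₚ.m≥n⇒m⊔n≡m y≤x = trans
  (trans (cong (nextPair n) (sym (cong₂ _,_ (ℕₚ.m≤n⇒m⊓n≡m y≤x) (ℕₚ.m≤n⇒m⊔n≡n y≤x)))) (nextPair-sorted′ y≤x))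
  (cong₂ _,_ (ℕₚ.⊓-comm (next n y) (next n x)) (ℕₚ.⊔-comm (next n y) (next n x)))
  where
  nextPair-sorted′ : y ≤ x → nextPair n (y ⊓ x , y ⊔ x) ≡ (next n y ⊓ next n x , next n y ⊔ next n x)
  nextPair-sorted′ h with nextPair-view n y x | next-view n y | next-view n x
  ... | _ | inj₁ (refl , _) | _ = ⊥-elim (x≢y (ℕₚ.≤-antisym (s≤s⁻¹ x<N) h))
  ... | inj₁ (e , _) | _ | inj₂ (e′ , _) = ⊥-elim (e′ e)
  ... | inj₂ (e , _) | _ | inj₁ (e′ , _) = ⊥-elim (e e′)
  ... | inj₁ (_ , p) | inj₂ (_ , q) | inj₁ (_ , r) rewrite ℕₚ.m≤n⇒m⊓n≡m h | ℕₚ.m≤n⇒m⊔n≡n h | p | q | r = refl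
  ... | inj₂ (_ , p) | inj₂ (_ , q) | inj₂ (_ , r) rewrite ℕₚ.m≤n⇒m⊓n≡m h | ℕₚ.m≤n⇒m⊔n≡n h | p | q | r =
    cong₂ _,_ (cong suc (sym (ℕₚ.m≤n⇒m⊓n≡m h))) (cong suc (sym (ℕₚ.m≤n⇒m⊔n≡n h)))

nextPair-nrm : ∀ n a b → a % suc (suc n) ≢ b % suc (suc n) → nextPair n (nrm n a b) ≡ nrm n (suc a) (suc b)
nextPair-nrm n a b a≢b = trans (nextPair-sorted n (m%n<n a (suc (suc n))) (m%n<n b (suc (suc n))) a≢b)
  (sym (cong₂ (λ x y → x ⊓ y , x ⊔ y) (suc-% n a) (suc-% n b)))

-- On lifts a rotation is an addition. The case distinctions of `nextPair` are confined to `nrm`,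
-- and `rotateBy-suc` links the two descriptions.
rotateBy : ℕ → ℕ → Pairs → Pairs
rotateBy n k = map (λ p → nrm n (k + proj₁ p) (k + proj₂ p))

rotateBy-0 : ∀ n D → WellFormed (suc (suc n)) D → rotateBy n 0 D ≡ D
rotateBy-0 n D wf = trans (Listₚ.map-cong-local (All.tabulate λ p → uncurry (nrm-< n) (wf p))) (Listₚ.map-id D)

distinct-% : ∀ n k {a b} → a < b → b < suc (suc n) → (k + a) % suc (suc n) ≢ (k + b) % suc (suc n)
distinct-% n zero a<b b<N e = ℕₚ.<-irrefl (trans (sym (m<n⇒m%n≡m (ℕₚ.<-trans a<b b<N))) (trans e (m<n⇒m%n≡m b<N))) a<b
distinct-% n (suc k) {a} {b} a<b b<N e = distinct-% n k a<b b<N (next-injective n (trans (sym (suc-% n (k + a))) (trans e (suc-% n (k + b)))))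

rotateBy-suc : ∀ n k D → WellFormed (suc (suc n)) D → map (nextPair n) (rotateBy n k D) ≡ rotateBy n (suc k) D
rotateBy-suc n k D wf = trans (sym (Listₚ.map-∘ D)) (Listₚ.map-cong-local (All.tabulate λ {q} p →
  nextPair-nrm n (k + proj₁ q) (k + proj₂ q) (distinct-% n k (proj₁ (wf p)) (proj₂ (wf p)))))

rotateBy-WellFormed : ∀ n k D → WellFormed (suc (suc n)) D → WellFormed (suc (suc n)) (rotateBy n k D)
rotateBy-WellFormed n zero D wf = subst (WellFormed (suc (suc n))) (sym (rotateBy-0 n D wf)) wf
rotateBy-WellFormed n (suc k) D wf = subst (WellFormed (suc (suc n))) (rotateBy-suc n k D wf)
  (nextPair-WellFormed n _ (rotateBy-WellFormed n k D wf))

rotateBy-full : ∀ n D → WellFormed (suc (suc n)) D → rotateBy n (suc (suc n)) D ≡ D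
rotateBy-full n D wf = trans (Listₚ.map-cong (λ p → cong₂ (λ x y → x ⊓ y , x ⊔ y)
  (trans (cong (_% suc (suc n)) (ℕₚ.+-comm (suc (suc n)) (proj₁ p))) ([m+n]%n≡m%n (proj₁ p) (suc (suc n))))
  (trans (cong (_% suc (suc n)) (ℕₚ.+-comm (suc (suc n)) (proj₂ p))) ([m+n]%n≡m%n (proj₂ p) (suc (suc n))))) D) (rotateBy-0 n D wf)

pieceCount-≤-rotateBy : ∀ n k j D s → WellFormed (suc (suc n)) D → pieceCount n (rotateBy n j D) s ≤ pieceCount n (rotateBy n (k + j) D) s
pieceCount-≤-rotateBy n zero j D s wf = ℕₚ.≤-refl
pieceCount-≤-rotateBy n (suc k) j D s wf = ℕₚ.≤-trans (pieceCount-≤-rotateBy n k j D s wf)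
  (subst (λ E → pieceCount n (rotateBy n (k + j) D) s ≤ pieceCount n E s) (rotateBy-suc n (k + j) D wf)
    (pieceCount-≤-rotation n (rotateBy n (k + j) D) s (rotateBy-WellFormed n (k + j) D wf)))

pieceCount-rotateBy : ∀ n k D s → k ≤ suc (suc n) → WellFormed (suc (suc n)) D → pieceCount n (rotateBy n k D) s ≡ pieceCount n D s
pieceCount-rotateBy n k D s k≤N wf = ℕₚ.≤-antisym
  (subst (λ E → pieceCount n (rotateBy n k D) s ≤ pieceCount n E s)
    (trans (cong (λ z → rotateBy n z D) (ℕₚ.m∸n+n≡m k≤N)) (rotateBy-full n D wf))
    (pieceCount-≤-rotateBy n (suc (suc n) ∸ k) k D s wf))
  (subst₂ (λ E z → pieceCount n E s ≤ pieceCount n (rotateBy n z D) s) (rotateBy-0 n D wf) (ℕₚ.+-identityʳ k)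
    (pieceCount-≤-rotateBy n k 0 D s wf))

-- Gluing a polygon onto a boundary edge

next-element : ∀ x V → (∀ {y} → y ∈ V → y ≤ x) ⊎ (∃ λ y → y ∈ V × x < y × (∀ {z} → z ∈ V → x < z → y ≤ z))
next-element x [] = inj₁ λ ()
next-element x (v ∷ V) with ℕₚ.≤-<-connex v x | next-element x V
... | inj₁ v≤x | inj₁ h = inj₁ λ { (here refl) → v≤x ; (there q) → h q }
... | inj₁ v≤x | inj₂ (y , y∈ , x<y , h) = inj₂ (y , there y∈ , x<y ,
  λ { (here refl) x<v → ⊥-elim (ℕₚ.<⇒≱ x<v v≤x) ; (there q) → h q })
... | inj₂ x<v | inj₁ h = inj₂ (v , here refl , x<v , λ { (here refl) _ → ℕₚ.≤-refl ; (there q) x<z → ⊥-elim (ℕₚ.<⇒≱ x<z (h q)) })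
... | inj₂ x<v | inj₂ (y , y∈ , x<y , h) with ℕₚ.≤-total v y
... | inj₁ v≤y = inj₂ (v , here refl , x<v , λ { (here refl) _ → ℕₚ.≤-refl ; (there q) x<z → ℕₚ.≤-trans v≤y (h q x<z) })
... | inj₂ y≤v = inj₂ (y , there y∈ , x<y , λ { (here refl) _ → y≤v ; (there q) x<z → h q x<z })

previous-element : ∀ x V → (∀ {y} → y ∈ V → x ≤ y) ⊎ (∃ λ y → y ∈ V × y < x × (∀ {z} → z ∈ V → z < x → z ≤ y))
previous-element x [] = inj₁ λ ()
previous-element x (v ∷ V) with ℕₚ.≤-<-connex x v | previous-element x V
... | inj₁ x≤v | inj₁ h = inj₁ λ { (here refl) → x≤v ; (there q) → h q }
... | inj₁ x≤v | inj₂ (y , y∈ , y<x , h) = inj₂ (y , there y∈ , y<x ,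
  λ { (here refl) v<x → ⊥-elim (ℕₚ.<⇒≱ v<x x≤v) ; (there q) → h q })
... | inj₂ v<x | inj₁ h = inj₂ (v , here refl , v<x , λ { (here refl) _ → ℕₚ.≤-refl ; (there q) z<x → ⊥-elim (ℕₚ.<⇒≱ z<x (h q)) })
... | inj₂ v<x | inj₂ (y , y∈ , y<x , h) with ℕₚ.≤-total y v
... | inj₁ y≤v = inj₂ (v , here refl , v<x , λ { (here refl) _ → ℕₚ.≤-refl ; (there q) z<x → ℕₚ.≤-trans (h q z<x) y≤v })
... | inj₂ v≤y = inj₂ (y , there y∈ , y<x , λ { (here refl) _ → v≤y ; (there q) z<x → h q z<x })

three-elements : ∀ {a b V} → Increasing V → 3 ≤ length V → (∀ {x} → x ∈ V → x ≡ a ⊎ x ≡ b) → ⊥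
three-elements {a} {b} {V} i h within = ℕₚ.<⇒≱ h (length-≤-⊑ {ys = a ∷ b ∷ []} (Increasing⇒Unique i)
  (λ q → [ (λ { refl → here refl }) , (λ { refl → there (here refl) }) ]′ (within q)))

least-element : ∀ {x V} → Increasing V → x ∈ V → ∃ λ v → v ∈ V × (∀ {y} → y ∈ V → v ≤ y)
least-element {V = v ∷ V} i _ = v , here refl , first-least v V i

module _ {N D s V} (P : PieceOf N D s V) {x} (0<x : 0 < x) (x<N : suc x < N) (x∈ : x ∈ V)
  (lonely : ∀ {a b} → (a , b) ∈ D → a ≢ x × b ≢ x) where
  open PieceOf P

  private
    edge : ∀ {a b} → a ≡ x ⊎ b ≡ x → Edge N a b ⊎ (a , b) ∈ D → suc a ≡ b
    edge _ (inj₁ (inj₁ e)) = e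
    edge (inj₁ refl) (inj₁ (inj₂ (refl , _))) = ⊥-elim (ℕₚ.<-irrefl refl 0<x)
    edge (inj₂ refl) (inj₁ (inj₂ (_ , refl))) = ⊥-elim (ℕₚ.<-irrefl refl x<N)
    edge (inj₁ e) (inj₂ p) = ⊥-elim (proj₁ (lonely p) e)
    edge (inj₂ e) (inj₂ p) = ⊥-elim (proj₂ (lonely p) e)

    two : ∀ a → (∀ {y} → y ∈ V → a ≤ y) → (∀ {y} → y ∈ V → y ≤ suc a) → ⊥
    two a h k = three-elements {a} {suc a} increasing big λ q →
      case ℕₚ.m≤n⇒m<n∨m≡n (h q) of λ { (inj₁ a<y) → inj₂ (ℕₚ.≤-antisym (k q) a<y) ; (inj₂ e) → inj₁ (sym e) }

  -- No diagonal ends at `x`, so both sides of the piece at `x` are boundary edges, and as 0 < x < N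
  -- - 1 neither is the edge (0 , N - 1). Were `x` the largest vertex, the side from it to the
  -- smallest would be an edge (x - 1 , x) and leave room for two vertices only.
  successor-∈ : suc x ∈ V
  successor-∈ with next-element x V
  ... | inj₂ (y , y∈ , x<y , h) = subst (_∈ V)
    (sym (edge (inj₁ refl) (side x∈ y∈ x<y (inj₁ λ z∈ x<z z<y → ℕₚ.<⇒≱ z<y (h z∈ x<z))))) y∈
  ... | inj₁ h with least-element increasing x∈
  ... | v , v∈ , k with v ≟ x
  ... | yes refl = ⊥-elim (two v k (λ q → ℕₚ.m≤n⇒m≤1+n (h q)))
  ... | no v≢x = ⊥-elim (two v k (λ {y} q → subst (y ≤_) (sym (edge (inj₂ refl)
    (side v∈ x∈ (ℕₚ.≤∧≢⇒< (k x∈) v≢x) (inj₂ λ z∈ → k z∈ , h z∈)))) (h q)))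

  predecessor-∈ : pred x ∈ V
  predecessor-∈ with previous-element x V
  ... | inj₂ (y , y∈ , y<x , h) = subst (_∈ V)
    (cong pred (edge (inj₂ refl) (side y∈ x∈ y<x (inj₁ λ z∈ y<z z<x → ℕₚ.<⇒≱ y<z (h z∈ z<x))))) y∈
  ... | inj₁ h with previous-element N V
  ... | inj₁ k = ⊥-elim (ℕₚ.<⇒≱ (bounded x∈) (k x∈))
  ... | inj₂ (m , m∈ , _ , k) with x ≟ m
  ... | yes refl = ⊥-elim (two x h (λ q → ℕₚ.m≤n⇒m≤1+n (k q (bounded q))))
  ... | no x≢m = ⊥-elim (two x h (λ {y} q → subst (y ≤_) (sym (edge (inj₁ refl)
    (side x∈ m∈ (ℕₚ.≤∧≢⇒< (h m∈) x≢m) (inj₂ λ z∈ → h z∈ , k z∈ (bounded z∈))))) (k q (bounded q))))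

-- The order embedding of the old vertices that makes room for new vertices i + 1, ..., i + h.
shiftPast : ℕ → ℕ → ℕ → ℕ
shiftPast i h v = if v ≤ᵇ i then v else h + v

shiftPair : ℕ → ℕ → Pair → Pair
shiftPair i h (a , b) = shiftPast i h a , shiftPast i h b

shift-view : ∀ i h v → (v ≤ i × shiftPast i h v ≡ v) ⊎ (i < v × shiftPast i h v ≡ h + v)
shift-view i h v with v ≤ᵇ i in eq
... | true = inj₁ (ℕₚ.≤ᵇ⇒≤ v i (subst T (sym eq) tt) , refl)
... | false = inj₂ (ℕₚ.≰⇒> (λ p → subst T eq (ℕₚ.≤⇒≤ᵇ p)) , refl)

shift-low : ∀ i h v → v ≤ i → shiftPast i h v ≡ v
shift-low i h v p with shift-view i h v
... | inj₁ (_ , e) = e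
... | inj₂ (q , _) = ⊥-elim (ℕₚ.<⇒≱ q p)

shift-high : ∀ i h v → i < v → shiftPast i h v ≡ h + v
shift-high i h v p with shift-view i h v
... | inj₁ (q , _) = ⊥-elim (ℕₚ.<⇒≱ p q)
... | inj₂ (_ , e) = e

shift-mono : ∀ i h {x y} → x < y → shiftPast i h x < shiftPast i h y
shift-mono i h {x} {y} p with shift-view i h x | shift-view i h y
... | inj₁ (_ , e) | inj₁ (_ , f) rewrite e | f = p
... | inj₁ (_ , e) | inj₂ (_ , f) rewrite e | f = ℕₚ.<-≤-trans p (ℕₚ.m≤n+m y h)
... | inj₂ (q , e) | inj₁ (r , f) = ⊥-elim (ℕₚ.<⇒≱ (ℕₚ.<-trans q p) r)
... | inj₂ (_ , e) | inj₂ (_ , f) rewrite e | f = ℕₚ.+-monoʳ-< h p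

shift-mono-≤ : ∀ i h {x y} → x ≤ y → shiftPast i h x ≤ shiftPast i h y
shift-mono-≤ i h p with ℕₚ.m≤n⇒m<n∨m≡n p
... | inj₁ q = ℕₚ.<⇒≤ (shift-mono i h q)
... | inj₂ refl = ℕₚ.≤-refl

shift-reflect : ∀ i h {x y} → shiftPast i h x < shiftPast i h y → x < y
shift-reflect i h {x} {y} p with ℕₚ.≤-<-connex y x
... | inj₁ q = ⊥-elim (ℕₚ.<⇒≱ p (shift-mono-≤ i h q))
... | inj₂ q = q

shift-reflect-≤ : ∀ i h {x y} → shiftPast i h x ≤ shiftPast i h y → x ≤ y
shift-reflect-≤ i h {x} {y} p with ℕₚ.≤-<-connex x y
... | inj₁ q = q
... | inj₂ q = ⊥-elim (ℕₚ.<⇒≱ (shift-mono i h q) p)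

shift-injective : ∀ i h {x y} → shiftPast i h x ≡ shiftPast i h y → x ≡ y
shift-injective i h e = ℕₚ.≤-antisym (shift-reflect-≤ i h (ℕₚ.≤-reflexive e)) (shift-reflect-≤ i h (ℕₚ.≤-reflexive (sym e)))

-- The edge (i , i + 1) is replaced by h + 1 edges and a new diagonal cuts off the new vertices.
glue : ℕ → ℕ → Pairs → Pairs
glue i h D = map (shiftPair i h) D ++ [ (i , suc (h + i)) ]

interval : ℕ → ℕ → List ℕ
interval i k = map (i +_) (upTo k)

interval⁺ : ∀ i k {x} → i ≤ x → x < i + k → x ∈ interval i k
interval⁺ i k {x} p q = subst (_∈ interval i k) (ℕₚ.m+[n∸m]≡n p) (∈-map⁺ (i +_) (∈-upTo⁺
  (ℕₚ.+-cancelˡ-< i _ _ (subst (_< i + k) (sym (ℕₚ.m+[n∸m]≡n p)) q))))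

interval⁻ : ∀ i k {x} → x ∈ interval i k → i ≤ x × x < i + k
interval⁻ i k h with ∈-map⁻ (i +_) h
... | y , y∈ , refl = ℕₚ.m≤m+n i y , ℕₚ.+-monoʳ-< i (∈-upTo⁻ y∈)

interval-increasing : ∀ i k → Increasing (interval i k)
interval-increasing i k = AllPairsₚ.map⁺ (AllPairs.map (ℕₚ.+-monoʳ-< i) (upTo-increasing k))

interval-length : ∀ i k → length (interval i k) ≡ k
interval-length i k = trans (Listₚ.length-map (i +_) (upTo k)) (Listₚ.length-upTo k)

climb : ∀ {V : List ℕ} x k → x ∈ V → (∀ {y} → x ≤ y → y < x + k → y ∈ V → suc y ∈ V) → x + k ∈ V
climb {V} x zero x∈ step = subst (_∈ V) (sym (ℕₚ.+-identityʳ x)) x∈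
climb {V} x (suc k) x∈ step = subst (_∈ V) (sym (ℕₚ.+-suc x k))
  (step (ℕₚ.m≤m+n x k) (ℕₚ.+-monoʳ-< x ℕₚ.≤-refl)
    (climb x k x∈ (λ p q → step p (ℕₚ.<-trans q (ℕₚ.+-monoʳ-< x ℕₚ.≤-refl)))))

descend : ∀ {V : List ℕ} x k → k ≤ x → x ∈ V → (∀ {y} → x ∸ k < y → y ≤ x → y ∈ V → pred y ∈ V) → x ∸ k ∈ V
descend x zero k≤x x∈ step = x∈
descend {V} x (suc k) k<x x∈ step = subst (_∈ V) (ℕₚ.pred[m∸n]≡m∸[1+n] x k)
  (step (ℕₚ.∸-monoʳ-< (ℕₚ.n<1+n k) k<x) (ℕₚ.m∸n≤m x k)
    (descend x k (ℕₚ.<⇒≤ k<x) x∈ (λ p → step (ℕₚ.<-trans (ℕₚ.∸-monoʳ-< (ℕₚ.n<1+n k) k<x) p))))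

fills : ∀ {V : List ℕ} lo hi x → lo ≤ x → x ≤ hi → x ∈ V →
  (∀ {y} → x ≤ y → y < hi → y ∈ V → suc y ∈ V) → (∀ {y} → lo < y → y ≤ x → y ∈ V → pred y ∈ V) →
  ∀ {y} → lo ≤ y → y ≤ hi → y ∈ V
fills {V} lo hi x lo≤x x≤hi x∈ up down {y} lo≤y y≤hi with ℕₚ.≤-total x y
... | inj₁ x≤y = subst (_∈ V) (ℕₚ.m+[n∸m]≡n x≤y) (climb x (y ∸ x) x∈
  (λ p q → up p (ℕₚ.<-≤-trans q (ℕₚ.≤-trans (ℕₚ.≤-reflexive (ℕₚ.m+[n∸m]≡n x≤y)) y≤hi))))
... | inj₂ y≤x = subst (_∈ V) (ℕₚ.m∸[m∸n]≡n y≤x) (descend x (x ∸ y) (ℕₚ.m∸n≤m x y) x∈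
  (λ p → down (ℕₚ.≤-<-trans lo≤y (subst (_< _) (ℕₚ.m∸[m∸n]≡n y≤x) p))))

indicator : Bool → ℕ
indicator b = if b then 1 else 0

module Glue (n i h : ℕ) (D : Pairs) (wf : WellFormed (suc (suc n)) D) (i<N : suc i < suc (suc n)) (0<h : 0 < h) where
  N N′ : ℕ
  N = suc (suc n)
  N′ = suc (suc (h + n))

  D′ : Pairs
  D′ = glue i h D

  φ : ℕ → ℕ
  φ = shiftPast i h

  N′≡ : N′ ≡ h + N
  N′≡ = sym (trans (ℕₚ.+-suc h (suc n)) (cong suc (ℕₚ.+-suc h n)))

  φ-i : φ i ≡ i
  φ-i = shift-low i h i ℕₚ.≤-refl

  φ-suc-i : φ (suc i) ≡ suc (h + i)
  φ-suc-i = trans (shift-high i h (suc i) ℕₚ.≤-refl) (ℕₚ.+-suc h i)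

  φ-bound : ∀ {v} → v < N → φ v < N′
  φ-bound {v} p with shift-view i h v
  ... | inj₁ (_ , e) = subst₂ _<_ (sym e) (sym N′≡) (ℕₚ.<-≤-trans p (ℕₚ.m≤n+m N h))
  ... | inj₂ (_ , e) = subst₂ _<_ (sym e) (sym N′≡) (ℕₚ.+-monoʳ-< h p)

  new-bound : suc (h + i) < N′
  new-bound = s≤s (subst (_≤ suc (h + n)) (ℕₚ.+-suc h i) (subst (h + suc i ≤_) (ℕₚ.+-suc h n) (ℕₚ.+-monoʳ-≤ h (s≤s⁻¹ i<N))))

  glue-cases : ∀ {p} → p ∈ D′ → (∃ λ q → q ∈ D × p ≡ shiftPair i h q) ⊎ p ≡ (i , suc (h + i))
  glue-cases p∈ with ∈-++⁻ (map (shiftPair i h) D) p∈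
  ... | inj₁ q = inj₁ (∈-map⁻ (shiftPair i h) q)
  ... | inj₂ (here e) = inj₂ e

  new∈ : (i , suc (h + i)) ∈ D′
  new∈ = ∈-++⁺ʳ (map (shiftPair i h) D) (here refl)

  wf′ : WellFormed N′ D′
  wf′ p with glue-cases p
  ... | inj₁ ((a , b) , q , refl) = shift-mono i h (proj₁ (wf q)) , φ-bound (proj₂ (wf q))
  ... | inj₂ refl = s≤s (ℕₚ.m≤n+m i h) , new-bound

  module _ {V : List ℕ} where

    φ-∈ : ∀ {v} → φ v ∈ map φ V → v ∈ V
    φ-∈ q with ∈-map⁻ φ q
    ... | w , w∈ , e = subst (_∈ V) (sym (shift-injective i h e)) w∈

    adjacent⁺ : ∀ {a b} → Adjacent V a b → Adjacent (map φ V) (φ a) (φ b)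
    adjacent⁺ (inj₁ none) = inj₁ λ q p r → case ∈-map⁻ φ q of λ
      { (w , w∈ , refl) → none w∈ (shift-reflect i h p) (shift-reflect i h r) }
    adjacent⁺ (inj₂ all′) = inj₂ λ q → case ∈-map⁻ φ q of λ
      { (w , w∈ , refl) → shift-mono-≤ i h (proj₁ (all′ w∈)) , shift-mono-≤ i h (proj₂ (all′ w∈)) }

    adjacent⁻ : ∀ {a b} → Adjacent (map φ V) (φ a) (φ b) → Adjacent V a b
    adjacent⁻ (inj₁ none) = inj₁ λ q p r → none (∈-map⁺ φ q) (shift-mono i h p) (shift-mono i h r)
    adjacent⁻ (inj₂ all′) = inj₂ λ q → shift-reflect-≤ i h (proj₁ (all′ (∈-map⁺ φ q))) , shift-reflect-≤ i h (proj₂ (all′ (∈-map⁺ φ q)))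

  -- Only (i , i + 1) stops being an edge, and it turns into the new diagonal. The sides of old
  -- pieces therefore remain admissible.
  edge⁺ : ∀ {a b} → Edge N a b → Edge N′ (φ a) (φ b) ⊎ (φ a , φ b) ≡ (i , suc (h + i))
  edge⁺ {a} (inj₁ refl) with a ≟ i
  ... | yes refl = inj₂ (cong₂ _,_ φ-i φ-suc-i)
  ... | no a≢i with shift-view i h a | shift-view i h (suc a)
  ... | inj₁ (_ , e) | inj₁ (_ , f) rewrite e | f = inj₁ (inj₁ refl)
  ... | inj₁ (p , e) | inj₂ (q , f) = ⊥-elim (a≢i (ℕₚ.≤-antisym p (s≤s⁻¹ q)))
  ... | inj₂ (p , e) | inj₁ (q , f) = ⊥-elim (ℕₚ.<-asym p q)
  ... | inj₂ (_ , e) | inj₂ (_ , f) rewrite e | f = inj₁ (inj₁ (sym (ℕₚ.+-suc h a)))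
  edge⁺ {b = b} (inj₂ (refl , e)) = inj₁ (inj₂ (refl , trans (cong suc (shift-high i h b (s≤s⁻¹ (subst (suc i <_) (sym e) i<N))))
    (trans (sym (ℕₚ.+-suc h b)) (trans (cong (h +_) e) (sym N′≡)))))

  edge⁻ : ∀ {a b} → a < b → b < N → Edge N′ (φ a) (φ b) → Edge N a b
  edge⁻ {a} {b} a<b b<N (inj₁ e) with shift-view i h a | shift-view i h b
  ... | inj₁ (_ , f) | inj₁ (_ , g) = inj₁ (trans (cong suc (sym f)) (trans e g))
  ... | inj₁ (p , f) | inj₂ (q , g) = ⊥-elim
    (lia 4 (λ a b h i → # 1 ⊹ a ≐ h ⊹ b ⇛ a ≼ i ⇛ i ≺ b ⇛ # 0 ≺ h ⇛ ⊩⊥) a b h i (trans (cong suc (sym f)) (trans e g)) p q 0<h)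
  ... | inj₂ (p , _) | inj₁ (q , _) = ⊥-elim (ℕₚ.<⇒≱ (ℕₚ.<-trans p a<b) q)
  ... | inj₂ (_ , f) | inj₂ (_ , g) = inj₁ (ℕₚ.+-cancelˡ-≡ h _ _ (trans (ℕₚ.+-suc h a) (trans (cong suc (sym f)) (trans e g))))
  edge⁻ {a} {b} a<b b<N (inj₂ (e , f)) = inj₂ (shift-injective i h e , suc-b)
    where
    suc-b : suc b ≡ N
    suc-b with shift-view i h b
    ... | inj₁ (p , g) = ⊥-elim (ℕₚ.<-irrefl (trans (cong suc (sym g)) f) (ℕₚ.≤-<-trans (s≤s p) (subst (suc i <_) (sym N′≡) (ℕₚ.<-≤-trans i<N (ℕₚ.m≤n+m N h)))))
    ... | inj₂ (_ , g) = ℕₚ.+-cancelˡ-≡ h _ _ (trans (ℕₚ.+-suc h b) (trans (cong suc (sym g)) (trans f N′≡)))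

  piece⁺ : ∀ {V} → (∀ {x} → x ∈ V → x < N) → Piece N D V → Piece N′ D′ (map φ V)
  piece⁺ {V} bd P = record
    { big = subst (3 ≤_) (sym (Listₚ.length-map φ V)) big
    ; side = side′
    ; chordless = chordless′ }
    where
    open Piece P
    side′ : ∀ {a b} → a ∈ map φ V → b ∈ map φ V → a < b → Adjacent (map φ V) a b → Edge N′ a b ⊎ (a , b) ∈ D′
    side′ a∈ b∈ a<b adj with ∈-map⁻ φ a∈ | ∈-map⁻ φ b∈
    ... | x , x∈ , refl | y , y∈ , refl with side x∈ y∈ (shift-reflect i h a<b) (adjacent⁻ adj)
    ... | inj₂ d = inj₂ (∈-++⁺ˡ (∈-map⁺ (shiftPair i h) d))
    ... | inj₁ e with edge⁺ e
    ... | inj₁ e′ = inj₁ e′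
    ... | inj₂ e′ = inj₂ (subst (_∈ D′) (sym e′) new∈)
    chordless′ : ∀ {a b} → (a , b) ∈ D′ → a ∈ map φ V → b ∈ map φ V → Adjacent (map φ V) a b
    chordless′ p a∈ b∈ with glue-cases p
    ... | inj₁ ((x , y) , q , refl) = adjacent⁺ (chordless q (φ-∈ {V} {x} a∈) (φ-∈ {V} {y} b∈))
    ... | inj₂ refl = subst₂ (Adjacent (map φ V)) φ-i φ-suc-i
      (adjacent⁺ (inj₁ λ _ p q → ℕₚ.<⇒≱ p (s≤s⁻¹ q)))

  piece⁻ : ∀ {V} → (∀ {x} → x ∈ V → x < N) → Piece N′ D′ (map φ V) → Piece N D V
  piece⁻ {V} bd P = record
    { big = subst (3 ≤_) (Listₚ.length-map φ V) big
    ; side = side′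
    ; chordless = λ p a∈ b∈ → adjacent⁻ (chordless (∈-++⁺ˡ (∈-map⁺ (shiftPair i h) p)) (∈-map⁺ φ a∈) (∈-map⁺ φ b∈)) }
    where
    open Piece P
    side′ : ∀ {a b} → a ∈ V → b ∈ V → a < b → Adjacent V a b → Edge N a b ⊎ (a , b) ∈ D
    side′ {a} {b} a∈ b∈ a<b adj with side (∈-map⁺ φ a∈) (∈-map⁺ φ b∈) (shift-mono i h a<b) (adjacent⁺ adj)
    ... | inj₁ e = inj₁ (edge⁻ a<b (bd b∈) e)
    ... | inj₂ p with glue-cases p
    ... | inj₁ ((x , y) , q , e) = inj₂ (subst (_∈ D) (sym (cong₂ _,_
      (shift-injective i h (cong proj₁ e)) (shift-injective i h (cong proj₂ e)))) q)
    ... | inj₂ e = inj₁ (inj₁ (sym (trans (shift-injective i h (trans (cong proj₂ e) (sym φ-suc-i)))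
      (cong suc (sym (shift-injective i h (trans (cong proj₁ e) (sym φ-i))))))))

  new : List ℕ
  new = interval i (suc (suc h))

  hi≡ : i + suc (suc h) ≡ suc (suc (h + i))
  hi≡ = trans (ℕₚ.+-suc i (suc h)) (cong suc (trans (ℕₚ.+-suc i h) (cong suc (ℕₚ.+-comm i h))))

  new⁻ : ∀ {x} → x ∈ new → i ≤ x × x ≤ suc (h + i)
  new⁻ {x} q with interval⁻ i (suc (suc h)) q
  ... | p , r = p , s≤s⁻¹ (subst (x <_) hi≡ r)

  new⁺ : ∀ {x} → i ≤ x → x ≤ suc (h + i) → x ∈ new
  new⁺ {x} p q = interval⁺ i (suc (suc h)) p (subst (x <_) (sym hi≡) (s≤s q))

  φ-avoids : ∀ {v} → i < φ v → φ v ≤ h + i → ⊥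
  φ-avoids {v} p q with shift-view i h v
  ... | inj₁ (r , e) = ℕₚ.<⇒≱ (subst (i <_) e p) r
  ... | inj₂ (r , e) = ℕₚ.<⇒≱ (ℕₚ.+-monoʳ-< h r) (subst (_≤ h + i) e q)

  new-piece : Piece N′ D′ new
  new-piece = record
    { big = subst (3 ≤_) (sym (interval-length i (suc (suc h)))) (s≤s (s≤s 0<h))
    ; side = side′
    ; chordless = chordless′ }
    where
    side′ : ∀ {a b} → a ∈ new → b ∈ new → a < b → Adjacent new a b → Edge N′ a b ⊎ (a , b) ∈ D′
    side′ {a} {b} a∈ b∈ a<b (inj₁ none) with ℕₚ.m≤n⇒m<n∨m≡n a<b
    ... | inj₂ e = inj₁ (inj₁ e)
    ... | inj₁ p = ⊥-elim (none (new⁺ (ℕₚ.≤-trans (proj₁ (new⁻ a∈)) (ℕₚ.n≤1+n a)) (ℕₚ.≤-trans (ℕₚ.<⇒≤ p) (proj₂ (new⁻ b∈)))) ℕₚ.≤-refl p)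
    side′ {a} {b} a∈ b∈ a<b (inj₂ all′) = inj₂ (subst (_∈ D′) (cong₂ _,_
      (ℕₚ.≤-antisym (proj₁ (new⁻ a∈)) (proj₁ (all′ (new⁺ ℕₚ.≤-refl (ℕₚ.m≤n⇒m≤1+n (ℕₚ.m≤n+m i h))))))
      (ℕₚ.≤-antisym (proj₂ (all′ (new⁺ (ℕₚ.m≤n⇒m≤1+n (ℕₚ.m≤n+m i h)) ℕₚ.≤-refl))) (proj₂ (new⁻ b∈)))) new∈)
    within : ∀ {v} → φ v ∈ new → v ≡ i ⊎ v ≡ suc i
    within {v} q with shift-view i h v
    ... | inj₁ (r , e) = inj₁ (ℕₚ.≤-antisym r (subst (i ≤_) e (proj₁ (new⁻ q))))
    ... | inj₂ (r , e) = inj₂ (ℕₚ.≤-antisym (ℕₚ.+-cancelˡ-≤ h _ _ (subst₂ _≤_ e (sym (ℕₚ.+-suc h i)) (proj₂ (new⁻ q)))) r)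
    chordless′ : ∀ {a b} → (a , b) ∈ D′ → a ∈ new → b ∈ new → Adjacent new a b
    chordless′ p a∈ b∈ with glue-cases p
    ... | inj₂ refl = inj₂ new⁻
    ... | inj₁ ((x , y) , q , refl) with within {x} a∈ | within {y} b∈
    ... | inj₁ refl | inj₂ refl = inj₂ λ z∈ → subst (_≤ _) (sym φ-i) (proj₁ (new⁻ z∈)) , subst (_ ≤_) (sym φ-suc-i) (proj₂ (new⁻ z∈))
    ... | inj₁ refl | inj₁ refl = ⊥-elim (ℕₚ.<-irrefl refl (proj₁ (wf q)))
    ... | inj₂ refl | inj₁ refl = ⊥-elim (ℕₚ.<-asym (proj₁ (wf q)) ℕₚ.≤-refl)
    ... | inj₂ refl | inj₂ refl = ⊥-elim (ℕₚ.<-irrefl refl (proj₁ (wf q)))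

  module _ {s V} (P : PieceOf N′ D′ s V) where
    open PieceOf P

    -- A new vertex meets no diagonal, so membership in `V` spreads along boundary edges in both
    -- directions up to `i` and i + h + 1. Both ends of the new diagonal then lie in `V`, and
    -- `chordless` leaves no vertex beyond it.
    is-new : ∀ {x} → x ∈ V → i < x → x ≤ h + i → V ≡ new
    is-new {x} x∈ p q = increasing-ext increasing (interval-increasing i (suc (suc h)))
      ((λ z∈ → new⁺ (proj₁ (span z∈)) (proj₂ (span z∈))) , (λ z∈ → filled (proj₁ (new⁻ z∈)) (proj₂ (new⁻ z∈))))
      where
      lonely : ∀ {y} → i < y → y ≤ h + i → ∀ {a b} → (a , b) ∈ D′ → a ≢ y × b ≢ y
      lonely r t d with glue-cases d
      ... | inj₁ ((u , v) , _ , refl) = (λ { refl → φ-avoids {u} r t }) , (λ { refl → φ-avoids {v} r t })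
      ... | inj₂ refl = (λ { refl → ℕₚ.<-irrefl refl r }) , (λ { refl → ℕₚ.<-irrefl refl t })
      filled : ∀ {y} → i ≤ y → y ≤ suc (h + i) → y ∈ V
      filled = fills i (suc (h + i)) x (ℕₚ.<⇒≤ p) (ℕₚ.m≤n⇒m≤1+n q) x∈
        (λ x≤y y<hi y∈ → successor-∈ P (ℕₚ.≤-<-trans z≤n (ℕₚ.<-≤-trans p x≤y)) (ℕₚ.≤-<-trans y<hi new-bound) y∈
          (lonely (ℕₚ.<-≤-trans p x≤y) (s≤s⁻¹ y<hi)))
        (λ i<y y≤x y∈ → predecessor-∈ P (ℕₚ.≤-<-trans z≤n i<y) (ℕₚ.≤-<-trans (s≤s (ℕₚ.≤-trans y≤x q)) new-bound) y∈
          (lonely i<y (ℕₚ.≤-trans y≤x q)))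
      span : ∀ {z} → z ∈ V → i ≤ z × z ≤ suc (h + i)
      span with chordless new∈ (filled ℕₚ.≤-refl (ℕₚ.m≤n⇒m≤1+n (ℕₚ.m≤n+m i h))) (filled (ℕₚ.m≤n⇒m≤1+n (ℕₚ.m≤n+m i h)) ℕₚ.≤-refl)
      ... | inj₁ none = ⊥-elim (none x∈ p (s≤s q))
      ... | inj₂ all′ = all′

    is-old : (∀ {x} → x ∈ V → i < x → x ≤ h + i → ⊥) → ∃ λ W → W ∈ pieces n D s × V ≡ map φ W
    is-old avoids = W , pieces⁺ n D s wf (record
      { increasing = W-inc ; bounded = W-bd
      ; size = trans (sym (Listₚ.length-map φ W)) (trans (cong length (sym V≡)) size)
      ; piece = piece⁻ W-bd (subst (Piece N′ D′) V≡ piece) }) , V≡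
      where
      p : ℕ → Bool
      p v = any (φ v ≡ᵇ_) V
      W = filterᵇ p (upTo N)
      W-inc : Increasing W
      W-inc = AllPairsₚ.filter⁺ (T? ∘ p) (upTo-increasing N)
      W-bd : ∀ {x} → x ∈ W → x < N
      W-bd q = ∈-upTo⁻ (proj₁ (∈-filterᵇ⁻ {p = p} {xs = upTo N} q))
      preimage : ∀ {y} → y ∈ V → ∃ λ v → v < N × φ v ≡ y
      preimage {y} y∈ with ℕₚ.≤-<-connex y i
      ... | inj₁ y≤i = y , ℕₚ.≤-<-trans y≤i (ℕₚ.<-trans ℕₚ.≤-refl i<N) , shift-low i h y y≤i
      ... | inj₂ i<y with ℕₚ.≤-<-connex y (h + i)
      ... | inj₁ q = ⊥-elim (avoids y∈ i<y q)
      ... | inj₂ q = y ∸ h ,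
        ℕₚ.+-cancelˡ-< h _ _ (subst₂ _<_ (sym (ℕₚ.m+[n∸m]≡n h≤y)) N′≡ (bounded y∈)) ,
        trans (shift-high i h (y ∸ h) (ℕₚ.+-cancelˡ-< h _ _ (subst (h + i <_) (sym (ℕₚ.m+[n∸m]≡n h≤y)) q))) (ℕₚ.m+[n∸m]≡n h≤y)
        where
        h≤y : h ≤ y
        h≤y = ℕₚ.≤-trans (ℕₚ.m≤m+n h i) (ℕₚ.<⇒≤ q)
      V≡ : V ≡ map φ W
      V≡ = increasing-ext increasing (AllPairsₚ.map⁺ (AllPairs.map (shift-mono i h) W-inc))
        ((λ y∈ → let (v , v<N , e) = preimage y∈ in
            subst (_∈ map φ W) e (∈-map⁺ φ (∈-filterᵇ⁺ {p = p} (∈-upTo⁺ v<N) (∈ℕ⁺ (subst (_∈ V) (sym e) y∈))))) ,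
         (λ y∈ → case ∈-map⁻ φ y∈ of λ { (v , v∈ , refl) → ∈ℕ⁻ V (proj₂ (∈-filterᵇ⁻ {p = p} {xs = upTo N} v∈)) }))

    classify : (∃ λ W → W ∈ pieces n D s × V ≡ map φ W) ⊎ V ≡ new
    classify with any (λ x → (i <ᵇ x) ∧ (x ≤ᵇ h + i)) V in eq
    ... | false = inj₁ (is-old λ {x} x∈ p q → subst T eq (any-intro x∈ (∧-intro (ℕₚ.<⇒<ᵇ p) (ℕₚ.≤⇒≤ᵇ q))))
    ... | true with any-elim V (subst T (sym eq) tt)
    ... | x , x∈ , t = inj₂ (is-new x∈ (ℕₚ.<ᵇ⇒< i x (∧-left t)) (ℕₚ.≤ᵇ⇒≤ x (h + i) (∧-right (i <ᵇ x) t)))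

  -- By `classify` the pieces are the images of the old ones together with the glued polygon, which
  -- has h + 2 vertices.
  pieceCount-glue : ∀ s → pieceCount (h + n) D′ s ≡ pieceCount n D s + indicator (suc (suc h) ≡ᵇ s)
  pieceCount-glue s = trans (length-≡-≅ (pieces-Unique (h + n) D′ s) unique (forth , back))
    (trans (Listₚ.length-++ (map (map φ) (pieces n D s))) (cong₂ _+_ (Listₚ.length-map (map φ) (pieces n D s)) extra-length))
    where
    extra : List (List ℕ)
    extra = if suc (suc h) ≡ᵇ s then [ new ] else []
    extra-length : length extra ≡ indicator (suc (suc h) ≡ᵇ s)
    extra-length with suc (suc h) ≡ᵇ s
    ... | true = refl
    ... | false = refl
    extra⁻ : ∀ {V} → V ∈ extra → V ≡ new × suc (suc h) ≡ s
    extra⁻ q with ≡ᵇ-dec (suc (suc h)) s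
    ... | inj₁ (e , f) rewrite f with q
    ... | here g = g , e
    extra⁻ q | inj₂ (_ , f) rewrite f with q
    ... | ()
    extra⁺ : suc (suc h) ≡ s → new ∈ extra
    extra⁺ e with ≡ᵇ-dec (suc (suc h)) s
    ... | inj₁ (_ , f) rewrite f = here refl
    ... | inj₂ (g , _) = ⊥-elim (g e)
    unique : Unique (map (map φ) (pieces n D s) ++ extra)
    unique = Uniqueₚ.++⁺ (Uniqueₚ.map⁺ (Listₚ.map-injective (shift-injective i h)) (pieces-Unique n D s)) extra-unique
      λ { (p , q) → disjoint p (extra⁻ q) }
      where
      extra-unique : Unique extra
      extra-unique with suc (suc h) ≡ᵇ s
      ... | true = [] ∷ []
      ... | false = []
      disjoint : ∀ {V} → V ∈ map (map φ) (pieces n D s) → V ≡ new × suc (suc h) ≡ s → ⊥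
      disjoint p (refl , _) with ∈-map⁻ (map φ) p
      ... | W , _ , e with ∈-map⁻ φ (subst (suc i ∈_) e (new⁺ (ℕₚ.n≤1+n i) (s≤s (ℕₚ.m≤n+m i h))))
      ... | v , _ , f = φ-avoids {v} (subst (i <_) f ℕₚ.≤-refl) (subst (_≤ h + i) f (ℕₚ.+-monoˡ-≤ i 0<h))
    forth : pieces (h + n) D′ s ⊑ (map (map φ) (pieces n D s) ++ extra)
    forth {V} q with classify (pieces⁻ (h + n) D′ s q)
    ... | inj₁ (W , W∈ , refl) = ∈-++⁺ˡ (∈-map⁺ (map φ) W∈)
    ... | inj₂ refl = ∈-++⁺ʳ (map (map φ) (pieces n D s)) (extra⁺ (trans (sym (interval-length i (suc (suc h)))) (PieceOf.size (pieces⁻ (h + n) D′ s q))))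
    back : (map (map φ) (pieces n D s) ++ extra) ⊑ pieces (h + n) D′ s
    back q with ∈-++⁻ (map (map φ) (pieces n D s)) q
    ... | inj₁ q′ with ∈-map⁻ (map φ) q′
    ... | W , W∈ , refl = pieces⁺ (h + n) D′ s wf′ (record
      { increasing = AllPairsₚ.map⁺ (AllPairs.map (shift-mono i h) P.increasing)
      ; bounded = λ r → case ∈-map⁻ φ r of λ { (v , v∈ , refl) → φ-bound (P.bounded v∈) }
      ; size = trans (Listₚ.length-map φ W) P.size
      ; piece = piece⁺ P.bounded P.piece })
      where module P = PieceOf (pieces⁻ n D s W∈)
    back q | inj₂ q′ with extra⁻ q′
    ... | refl , e = pieces⁺ (h + n) D′ s wf′ (record
      { increasing = interval-increasing i (suc (suc h))
      ; bounded = λ r → ℕₚ.≤-<-trans (proj₂ (new⁻ r)) new-bound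
      ; size = trans (interval-length i (suc (suc h))) e
      ; piece = new-piece })

-- The pieces of the dissection coded by a word

-- Bends the segment [0 , n + 2] carrying the arcs into a polygon: its end point n + 2 becomes
-- vertex 0.
closed : ℕ → Pairs → Pairs
closed n = map (λ p → nrm n (proj₁ p) (proj₂ p))

whole-piece : ∀ n → Piece (suc (suc (suc n))) [] (upTo (suc (suc (suc n))))
whole-piece n = record
  { big = subst (3 ≤_) (sym (Listₚ.length-upTo (suc (suc (suc n))))) (s≤s (s≤s (s≤s z≤n)))
  ; side = side′
  ; chordless = λ () }
  where
  N = suc (suc (suc n))
  side′ : ∀ {a b} → a ∈ upTo N → b ∈ upTo N → a < b → Adjacent (upTo N) a b → Edge N a b ⊎ (a , b) ∈ []
  side′ {a} {b} a∈ b∈ a<b (inj₁ none) with ℕₚ.m≤n⇒m<n∨m≡n a<b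
  ... | inj₂ e = inj₁ (inj₁ e)
  ... | inj₁ p = ⊥-elim (none (∈-upTo⁺ (ℕₚ.<-trans p (∈-upTo⁻ b∈))) ℕₚ.≤-refl p)
  side′ {a} {b} a∈ b∈ a<b (inj₂ within) = inj₁ (inj₂
    (ℕₚ.n≤0⇒n≡0 (proj₁ (within (∈-upTo⁺ {N} (s≤s z≤n)))) ,
     ℕₚ.≤-antisym (∈-upTo⁻ b∈) (s≤s (proj₂ (within (∈-upTo⁺ {N} ℕₚ.≤-refl))))))

-- The second of three vertices is neither 0 nor the last vertex of the polygon, so it can serve as
-- the starting point from which membership spreads along the boundary.
undissected : ∀ {N s V} → PieceOf N [] s V → V ≡ upTo N
undissected {zero} {s} {v ∷ V} P with PieceOf.bounded P (here refl)
... | ()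
undissected {suc n} {s} {a ∷ b ∷ c ∷ V} P = increasing-ext increasing (upTo-increasing (suc n))
  ((λ q → ∈-upTo⁺ (bounded q)) , (λ q → filled z≤n (s≤s⁻¹ (∈-upTo⁻ q))))
  where
  open PieceOf P
  a<b : a < b
  a<b = All.lookup (AllPairs.head increasing) (here refl)
  b<c : b < c
  b<c = All.lookup (AllPairs.head (AllPairs.tail increasing)) (here refl)
  filled : ∀ {y} → 0 ≤ y → y ≤ n → y ∈ a ∷ b ∷ c ∷ V
  filled = fills 0 n b z≤n (s≤s⁻¹ (bounded (there (here refl)))) (there (here refl))
    (λ b≤y y<n y∈ → successor-∈ P (ℕₚ.<-≤-trans (ℕₚ.≤-<-trans z≤n a<b) b≤y) (s≤s y<n) y∈ λ ())
    (λ 0<y y≤b y∈ → predecessor-∈ P 0<y (ℕₚ.≤-<-trans (ℕₚ.≤-trans (s≤s y≤b) b<c) (bounded (there (there (here refl))))) y∈ λ ())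
undissected {N} {s} {[]} P with PieceOf.big P
... | ()
undissected {suc n} {s} {a ∷ []} P with PieceOf.big P
... | s≤s ()
undissected {suc n} {s} {a ∷ b ∷ []} P with PieceOf.big P
... | s≤s (s≤s ())

pieceCount-undissected : ∀ n s → pieceCount (suc n) [] s ≡ indicator (suc (suc (suc n)) ≡ᵇ s)
pieceCount-undissected n s with ≡ᵇ-dec (suc (suc (suc n))) s
... | inj₁ (e , f) rewrite f = length-≡-≅ (pieces-Unique (suc n) [] s) ([] ∷ [])
  ((λ q → here (undissected (pieces⁻ (suc n) [] s q))) ,
   (λ { (here refl) → pieces⁺ (suc n) [] s (λ ()) (record
      { increasing = upTo-increasing N ; bounded = ∈-upTo⁻
      ; size = trans (Listₚ.length-upTo N) e ; piece = whole-piece n }) }))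
  where N = suc (suc (suc n))
... | inj₂ (e , f) rewrite f = empty (pieces (suc n) [] s) λ q → let P = pieces⁻ (suc n) [] s q in
  e (trans (sym (Listₚ.length-upTo (suc (suc (suc n))))) (trans (cong length (sym (undissected P))) (PieceOf.size P)))
  where
  empty : ∀ {A : Set} (xs : List A) → (∀ {x} → x ∈ xs → ⊥) → length xs ≡ 0
  empty [] h = refl
  empty (x ∷ xs) h = ⊥-elim (h (here refl))

zeros : ℕ → List ℕ
zeros k = replicate k 0

-- All children of the last node are leaves. Its piece is innermost, cut off by the single diagonal
-- that its arc becomes.
lastNode : ∀ w → w ≡ zeros (length w) ⊎ (∃ λ v → ∃ λ j → ∃ λ k → w ≡ v ++ suc j ∷ zeros k)
lastNode [] = inj₁ refl
lastNode (a ∷ w) with lastNode w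
... | inj₂ (v , j , k , e) = inj₂ (a ∷ v , j , k , cong (a ∷_) e)
lastNode (zero ∷ w) | inj₁ e = inj₁ (cong (0 ∷_) e)
lastNode (suc j ∷ w) | inj₁ e = inj₂ ([] , j , length w , cong (suc j ∷_) e)

forest-zeros : ∀ {u} k → Forest u (zeros k) → u ≡ k
forest-zeros zero [] = refl
forest-zeros (suc k) (leaf f) = cong suc (forest-zeros k f)

zeros-forest : ∀ k → Forest k (zeros k)
zeros-forest zero = []
zeros-forest (suc k) = leaf (zeros-forest k)

-- The prefix sees only the number of trees that the rest codes, so the rest may be exchanged; this
-- is used to turn the last node into a leaf.
forest-suffix : ∀ {u} w {v} → Forest u (w ++ v) → ∃ λ t → Forest t v × (∀ {v′} → Forest t v′ → Forest u (w ++ v′))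
forest-suffix [] f = _ , f , id
forest-suffix (zero ∷ w) (leaf f) with forest-suffix w f
... | t , g , r = t , g , leaf ∘ r
forest-suffix (suc j ∷ w) (node f) with forest-suffix w f
... | t , g , r = t , g , node ∘ r

leaves-++ : ∀ w v → leaves (w ++ v) ≡ leaves w + leaves v
leaves-++ [] v = refl
leaves-++ (zero ∷ w) v = cong suc (leaves-++ w v)
leaves-++ (suc j ∷ w) v = leaves-++ w v

leaves-zeros : ∀ k → leaves (zeros k) ≡ k
leaves-zeros zero = refl
leaves-zeros (suc k) = cong suc (leaves-zeros k)

count-++ : ∀ a w v → count a (w ++ v) ≡ count a w + count a v
count-++ a w v = trans (cong length (Listₚ.filter-++ (T? ∘ (_≡ᵇ a)) w v)) (Listₚ.length-++ (filterᵇ (_≡ᵇ a) w))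

count-zeros : ∀ a k → count (suc a) (zeros k) ≡ 0
count-zeros a zero = refl
count-zeros a (suc k) = count-zeros a k

arcs-zeros : ∀ x k → arcs x (zeros k) ≡ []
arcs-zeros x zero = refl
arcs-zeros x (suc k) = arcs-zeros (suc x) k

drop-ends-zeros : ∀ m x k → drop m (ends x (zeros (m + k))) ≡ ends (m + x) (zeros k)
drop-ends-zeros zero x k = refl
drop-ends-zeros (suc m) x k = trans (drop-ends-zeros m (suc x) k) (cong (λ z → ends z (zeros k)) (ℕₚ.+-suc m x))

drop-ends-leaves : ∀ j i t → drop (suc j) (ends i (zeros (suc (suc (j + t))))) ≡ ends (suc j + i) (zeros (suc t))
drop-ends-leaves j i t = trans (cong (λ z → drop (suc j) (ends i (zeros (suc z)))) (sym (ℕₚ.+-suc j t))) (drop-ends-zeros (suc j) i (suc t))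

-- Turning the leaf after w into a node with leaves for children.
ends-expand : ∀ w j t x i → i ≡ x + leaves w →
  ends x (w ++ suc j ∷ zeros (suc (suc (j + t)))) ≡ map (shiftPast i (suc j)) (ends x (w ++ zeros (suc t)))
ends-expand [] j t x i e rewrite trans e (ℕₚ.+-identityʳ x) =
  trans (drop-ends-leaves j x t) (trans (ends-shift (suc j) x (zeros (suc t)))
    (Listₚ.map-cong-local (All.tabulate λ q → sym (shift-high x (suc j) _ (ends-lower x (zeros (suc t)) q)))))
ends-expand (zero ∷ w) j t x i e = cong₂ _∷_
  (sym (shift-low i (suc j) (suc x) (subst (suc x ≤_) (sym e) (subst (_≤ x + suc (leaves w)) (ℕₚ.+-comm x 1) (ℕₚ.+-monoʳ-≤ x (s≤s z≤n))))))
  (ends-expand w j t (suc x) i (trans e (ℕₚ.+-suc x (leaves w))))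
ends-expand (suc l ∷ w) j t x i e = trans (cong (drop (suc l)) (ends-expand w j t x i e)) (Listₚ.drop-map (suc l) (ends x (w ++ zeros (suc t))))

arcs-expand : ∀ w j t x i → i ≡ x + leaves w →
  arcs x (w ++ suc j ∷ zeros (suc (suc (j + t)))) ≡ glue i (suc j) (arcs x (w ++ zeros (suc t)))
arcs-expand [] j t x i e rewrite trans e (ℕₚ.+-identityʳ x) | arcs-zeros (suc x) t =
  cong₂ (λ y z → (x , y) ∷ z) (cong head₀ (drop-ends-leaves j x t)) (arcs-zeros x (suc (suc (j + t))))
arcs-expand (zero ∷ w) j t x i e = arcs-expand w j t (suc x) i (trans e (ℕₚ.+-suc x (leaves w)))
arcs-expand (suc l ∷ w) j t x i e = cong₂ _∷_
  (cong₂ _,_ (sym (shift-low i (suc j) x (subst (x ≤_) (sym e) (ℕₚ.m≤m+n x (leaves w)))))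
    (trans (cong head₀ (trans (cong (drop (suc l)) (ends-expand w j t x i e)) (Listₚ.drop-map (suc l) (ends x (w ++ zeros (suc t))))))
      (head-map (drop (suc l) (ends x (w ++ zeros (suc t)))))))
  (arcs-expand w j t x i e)
  where
  head-map : ∀ xs → head₀ (map (shiftPast i (suc j)) xs) ≡ shiftPast i (suc j) (head₀ xs)
  head-map [] = refl
  head-map (x ∷ xs) = refl

-- Excludes the one arc that closing the segment would collapse to the pair (0 , 0).
no-root-arc : ∀ {u w} → Forest (suc (suc u)) w → (0 , leaves w) ∉ arcs 0 w
no-root-arc {u} {w} f q with ends 0 w | ends-length 0 f | ends-increasing 0 w | (λ {e} → first-arc 0 f q {e}) | (λ {e} → ends-upper 0 w {e})
... | e₁ ∷ e₂ ∷ es | _ | (e< ∷ _) | h | k = ℕₚ.<⇒≱ (All.lookup e< (here refl)) (ℕₚ.≤-trans (k (there (here refl))) (h (here refl)))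

closed-WellFormed : ∀ {u w} n → Forest (suc (suc u)) w → leaves w ≡ suc (suc n) → WellFormed (suc (suc n)) (closed n (arcs 0 w))
closed-WellFormed {w = w} n f e h with ∈-map⁻ (λ p → nrm n (proj₁ p) (proj₂ p)) h
... | (a , b) , q , r with arcs-bounds 0 f q
... | _ , a+2≤b , b≤N with ℕₚ.m≤n⇒m<n∨m≡n (subst (b ≤_) e b≤N)
... | inj₁ b<N with trans r (nrm-< n (ℕₚ.<-trans ℕₚ.≤-refl a+2≤b) b<N)
... | refl = ℕₚ.<-trans ℕₚ.≤-refl a+2≤b , b<N
closed-WellFormed {w = w} n f e h | (a , b) , q , r | _ , a+2≤b , b≤N | inj₂ refl
  with trans r (nrm-last n (ℕₚ.<-trans ℕₚ.≤-refl a+2≤b))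
... | refl = ℕₚ.n≢0⇒n>0 (λ { refl → no-root-arc f (subst (λ z → (0 , z) ∈ arcs 0 w) (sym e) q) }) , ℕₚ.<-trans ℕₚ.≤-refl a+2≤b

closed-glue : ∀ n i h A → i < suc n → (∀ {a b} → (a , b) ∈ A → a < b × b ≤ suc (suc n)) →
  closed (h + n) (glue i h A) ≡ glue i h (closed n A)
closed-glue n i h A i<n bd = trans (Listₚ.map-++ _ (map (shiftPair i h) A) _) (cong₂ _++_
  (trans (sym (Listₚ.map-∘ A)) (trans (Listₚ.map-cong-local (All.tabulate λ { {a , b} q → pointwise a b (proj₁ (bd q)) (proj₂ (bd q)) })) (Listₚ.map-∘ A)))
  (cong [_] (nrm-< (h + n) (s≤s (ℕₚ.m≤n+m i h)) (s≤s (subst (_≤ suc (h + n)) (ℕₚ.+-suc h i) (subst (h + suc i ≤_) (ℕₚ.+-suc h n) (ℕₚ.+-monoʳ-≤ h i<n)))))))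
  where
  N′≡ : h + suc (suc n) ≡ suc (suc (h + n))
  N′≡ = trans (ℕₚ.+-suc h (suc n)) (cong suc (ℕₚ.+-suc h n))
  bound : ∀ {v} → v < suc (suc n) → shiftPast i h v < suc (suc (h + n))
  bound p = subst (_ <_) (trans (shift-high i h (suc (suc n)) (ℕₚ.m<n⇒m<1+n i<n)) N′≡) (shift-mono i h p)
  pointwise : ∀ a b → a < b → b ≤ suc (suc n) → nrm (h + n) (shiftPast i h a) (shiftPast i h b) ≡ shiftPair i h (nrm n a b)
  pointwise a b a<b b≤N with ℕₚ.m≤n⇒m<n∨m≡n b≤N
  ... | inj₁ b<N = trans (nrm-< (h + n) (shift-mono i h a<b) (bound b<N)) (cong (shiftPair i h) (sym (nrm-< n a<b b<N)))
  ... | inj₂ refl = trans (cong (nrm (h + n) (shiftPast i h a)) (trans (shift-high i h (suc (suc n)) (ℕₚ.m<n⇒m<1+n i<n)) N′≡))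
    (trans (nrm-last (h + n) (bound a<b)) (cong (shiftPair i h) (sym (nrm-last n a<b))))

-- The module `Glue` treats edges (i , i + 1) and not the edge from the last vertex back to 0.
-- Rotation by h + 1 takes the polygon glued there to the edge (0 , 1), while the remaining
-- diagonals appear as `E` rotated by one vertex and shifted.
pieceCount-glue-last : ∀ n h E s → WellFormed (suc (suc n)) E → 0 < h →
  pieceCount (h + n) (E ++ [ (0 , suc n) ]) s ≡ pieceCount n E s + indicator (suc (suc h) ≡ᵇ s)
pieceCount-glue-last n h E s wf 0<h = begin
  pieceCount (h + n) X s
    ≡⟨ sym (pieceCount-rotateBy (h + n) (suc h) X s h<N wfX) ⟩
  pieceCount (h + n) (rotateBy (h + n) (suc h) X) s
    ≡⟨ cong (λ Y → pieceCount (h + n) Y s) rotated≡ ⟩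
  pieceCount (h + n) (glue 0 h (map (nextPair n) E)) s
    ≡⟨ Glue.pieceCount-glue n 0 h (map (nextPair n) E) (nextPair-WellFormed n E wf) (s≤s (s≤s z≤n)) 0<h s ⟩
  pieceCount n (map (nextPair n) E) s + indicator (suc (suc h) ≡ᵇ s)
    ≡⟨ cong (λ Y → pieceCount n Y s + indicator (suc (suc h) ≡ᵇ s))
        (trans (cong (map (nextPair n)) (sym (rotateBy-0 n E wf))) (rotateBy-suc n 0 E wf)) ⟩
  pieceCount n (rotateBy n 1 E) s + indicator (suc (suc h) ≡ᵇ s)
    ≡⟨ cong (_+ indicator (suc (suc h) ≡ᵇ s)) (pieceCount-rotateBy n 1 E s (s≤s z≤n) wf) ⟩
  pieceCount n E s + indicator (suc (suc h) ≡ᵇ s) ∎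
  where
  open ≡-Reasoning
  X = E ++ [ (0 , suc n) ]
  h<N : suc h ≤ suc (suc (h + n))
  h<N = s≤s (ℕₚ.m≤n⇒m≤1+n (ℕₚ.m≤m+n h n))
  N≤N′ : suc (suc n) ≤ suc (suc (h + n))
  N≤N′ = s≤s (s≤s (ℕₚ.m≤n+m n h))
  wfX : WellFormed (suc (suc (h + n))) X
  wfX q with ∈-++⁻ E q
  ... | inj₁ q′ = proj₁ (wf q′) , ℕₚ.<-≤-trans (proj₂ (wf q′)) N≤N′
  ... | inj₂ (here refl) = s≤s z≤n , N≤N′
  top : suc h + suc n ≡ suc (suc (h + n))
  top = cong suc (ℕₚ.+-suc h n)
  pointwise : ∀ a b → a < b → b < suc (suc n) → nrm (h + n) (suc h + a) (suc h + b) ≡ shiftPair 0 h (nextPair n (a , b))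
  pointwise a b a<b b<N with nextPair-view n a b
  ... | inj₁ (refl , e) = trans (cong (nrm (h + n) (suc h + a)) top) (trans (nrm-last (h + n) (subst (suc h + a <_) top (ℕₚ.+-monoʳ-< (suc h) a<b)))
    (trans (cong (0 ,_) (sym (trans (shift-high 0 h (suc a) (s≤s z≤n)) (ℕₚ.+-suc h a)))) (cong (shiftPair 0 h) (sym e))))
  ... | inj₂ (b≢ , e) = trans (nrm-< (h + n) (ℕₚ.+-monoʳ-< (suc h) a<b) (subst (suc h + b <_) top (ℕₚ.+-monoʳ-< (suc h) (ℕₚ.≤∧≢⇒< (s≤s⁻¹ b<N) b≢))))
    (trans (cong₂ _,_ (sym (trans (shift-high 0 h (suc a) (s≤s z≤n)) (ℕₚ.+-suc h a))) (sym (trans (shift-high 0 h (suc b) (s≤s z≤n)) (ℕₚ.+-suc h b))))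
      (cong (shiftPair 0 h) (sym e)))
  rotated≡ : rotateBy (h + n) (suc h) X ≡ glue 0 h (map (nextPair n) E)
  rotated≡ = trans (Listₚ.map-++ _ E _) (cong₂ _++_
    (trans (Listₚ.map-cong-local (All.tabulate λ { {a , b} q → pointwise a b (proj₁ (wf q)) (proj₂ (wf q)) })) (Listₚ.map-∘ E))
    (cong [_] (trans (cong (nrm (h + n) (suc h + 0)) top)
      (nrm-last (h + n) (s≤s (s≤s (ℕₚ.+-monoʳ-≤ h z≤n)))))))

closed-glue-last : ∀ n h A → 0 < h → (∀ {a b} → (a , b) ∈ A → a < b × b ≤ suc (suc n)) →
  closed (h + n) (glue (suc n) h A) ≡ closed n A ++ [ (0 , suc n) ]
closed-glue-last n h A 0<h bd = trans (Listₚ.map-++ _ (map (shiftPair (suc n) h) A) _) (cong₂ _++_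
  (trans (sym (Listₚ.map-∘ A)) (Listₚ.map-cong-local (All.tabulate λ { {a , b} q → pointwise a b (proj₁ (bd q)) (proj₂ (bd q)) })))
  (cong [_] (trans (cong (λ z → nrm (h + n) (suc n) (suc z)) (ℕₚ.+-suc h n)) (nrm-last (h + n) (s≤s (s≤s (ℕₚ.m≤n+m n h)))))))
  where
  N′≡ : h + suc (suc n) ≡ suc (suc (h + n))
  N′≡ = trans (ℕₚ.+-suc h (suc n)) (cong suc (ℕₚ.+-suc h n))
  N≤N′ : suc (suc n) ≤ suc (suc (h + n))
  N≤N′ = s≤s (s≤s (ℕₚ.m≤n+m n h))
  pointwise : ∀ a b → a < b → b ≤ suc (suc n) → nrm (h + n) (shiftPast (suc n) h a) (shiftPast (suc n) h b) ≡ nrm n a b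
  pointwise a b a<b b≤N rewrite shift-low (suc n) h a (s≤s⁻¹ (ℕₚ.<-≤-trans a<b b≤N)) with ℕₚ.m≤n⇒m<n∨m≡n b≤N
  ... | inj₁ b<N rewrite shift-low (suc n) h b (s≤s⁻¹ b<N) = trans (nrm-< (h + n) a<b (ℕₚ.<-≤-trans b<N N≤N′)) (sym (nrm-< n a<b b<N))
  ... | inj₂ refl = trans (cong (nrm (h + n) a) (trans (shift-high (suc n) h (suc (suc n)) ℕₚ.≤-refl) N′≡))
    (trans (nrm-last (h + n) (ℕₚ.<-≤-trans a<b N≤N′)) (sym (nrm-last n a<b)))

-- Cutting off an innermost piece removes the last node of the word.
word-pieces : ∀ fuel n {u} w a → length w ≤ fuel → Forest (suc (suc (suc u))) w → leaves w ≡ suc (suc n) →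
  pieceCount n (closed n (arcs 0 w)) (suc (suc (suc a))) ≡ count (suc a) w + indicator (u ≡ᵇ a)
word-pieces fuel n {u} w a le f e with lastNode w
... | inj₁ w≡ = trans (cong₂ (λ m D → pieceCount m (closed m D) (suc (suc (suc a)))) n≡ arcs≡)
  (trans (pieceCount-undissected u (suc (suc (suc a)))) (cong (_+ indicator (u ≡ᵇ a)) (sym count≡)))
  where
  arcs≡ : arcs 0 w ≡ []
  arcs≡ = trans (cong (arcs 0) w≡) (arcs-zeros 0 (length w))
  count≡ : count (suc a) w ≡ 0
  count≡ = trans (cong (count (suc a)) w≡) (count-zeros a (length w))
  len : suc (suc (suc u)) ≡ length w
  len = forest-zeros (length w) (subst (Forest _) w≡ f)
  n≡ : n ≡ suc u
  n≡ = ℕₚ.suc-injective (ℕₚ.suc-injective (trans (sym e) (trans (trans (cong leaves w≡) (leaves-zeros (length w))) (sym len))))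
... | inj₂ (v , j , k , refl) with forest-suffix v f
... | suc t , node g , r with forest-zeros k g
word-pieces zero n {u} .(v ++ suc j ∷ zeros (suc (suc (j + t)))) a le f e | inj₂ (v , j , .(suc (suc (j + t))) , refl) | suc t , node g , r | refl =
  ⊥-elim (lia 2 (λ l k → l ⊹ (# 1 ⊹ k) ≼ # 0 ⇛ ⊩⊥) (length v) (length (zeros (suc (suc (j + t))))) (subst (_≤ 0) (Listₚ.length-++ v) le))
word-pieces (suc fuel) n {u} .(v ++ suc j ∷ zeros (suc (suc (j + t)))) a le f e | inj₂ (v , j , .(suc (suc (j + t))) , refl) | suc t , node g , r | refl =
  subst (λ m → pieceCount m (closed m (arcs 0 (v ++ suc j ∷ zeros (suc (suc (j + t)))))) s ≡ _) (sym n≡) (trans main count≡)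
  where
  s = suc (suc (suc a))
  w₀ = v ++ zeros (suc t)
  f₀ : Forest (suc (suc (suc u))) w₀
  f₀ = r (zeros-forest (suc t))
  leaves₀ : leaves w₀ ≡ leaves v + suc t
  leaves₀ = trans (leaves-++ v (zeros (suc t))) (cong (leaves v +_) (leaves-zeros (suc t)))
  big : ∃ λ m → leaves w₀ ≡ suc (suc m)
  big = _ , forest-leaves f₀
  n₀ = proj₁ big
  leaves₁ : leaves (v ++ suc j ∷ zeros (suc (suc (j + t)))) ≡ leaves v + suc (suc (j + t))
  leaves₁ = trans (leaves-++ v (suc j ∷ zeros (suc (suc (j + t))))) (cong (leaves v +_) (leaves-zeros (suc (suc (j + t)))))
  n≡ : n ≡ suc j + n₀
  n≡ = lia 5 (λ n j t n₀ l → l ⊹ (# 2 ⊹ (j ⊹ t)) ≐ # 2 ⊹ n ⇛ l ⊹ (# 1 ⊹ t) ≐ # 2 ⊹ n₀ ⇛ ⊩ n ≐ # 1 ⊹ (j ⊹ n₀)) n j t n₀ (leaves v)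
    (trans (sym leaves₁) e) (trans (sym leaves₀) (proj₂ big))
  shorter : length w₀ ≤ fuel
  shorter = s≤s⁻¹ (ℕₚ.≤-trans (subst₂ (λ y z → suc y ≤ z) (sym (trans (Listₚ.length-++ v) (cong (length v +_) (Listₚ.length-replicate (suc t)))))
    (sym (trans (Listₚ.length-++ v) (cong (λ z → length v + suc z) (Listₚ.length-replicate (suc (suc (j + t)))))))
    (lia 3 (λ l j t → ⊩ # 1 ⊹ (l ⊹ (# 1 ⊹ t)) ≼ l ⊹ (# 3 ⊹ (j ⊹ t))) (length v) j t)) le)
  bd : ∀ {a b} → (a , b) ∈ arcs 0 w₀ → a < b × b ≤ suc (suc n₀)
  bd {b = b} q with arcs-bounds 0 f₀ q
  ... | _ , p₂ , p₃ = ℕₚ.<-trans ℕₚ.≤-refl p₂ , subst (b ≤_) (proj₂ big) p₃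
  wf₀ : WellFormed (suc (suc n₀)) (closed n₀ (arcs 0 w₀))
  wf₀ = closed-WellFormed n₀ f₀ (proj₂ big)
  main : pieceCount (suc j + n₀) (closed (suc j + n₀) (arcs 0 (v ++ suc j ∷ zeros (suc (suc (j + t)))))) s ≡
    count (suc a) w₀ + indicator (u ≡ᵇ a) + indicator (j ≡ᵇ a)
  -- For `t` = 0 nothing follows the last node, whose polygon then sits on the edge from vertex n₀ +
  -- 1 back to 0.
  main with ℕₚ.m≤n⇒m<n∨m≡n (z≤n {t})
  ... | inj₁ 0<t = trans
    (cong (λ D → pieceCount (suc j + n₀) D s) (trans (cong (closed (suc j + n₀)) (arcs-expand v j t 0 (leaves v) refl))
      (closed-glue n₀ (leaves v) (suc j) (arcs 0 w₀) i<n bd)))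
    (trans (Glue.pieceCount-glue n₀ (leaves v) (suc j) (closed n₀ (arcs 0 w₀)) wf₀ (s≤s i<n) (s≤s z≤n) s)
      (cong (_+ indicator (j ≡ᵇ a)) (word-pieces fuel n₀ w₀ a shorter f₀ (proj₂ big))))
    where
    i<n : leaves v < suc n₀
    i<n = lia 3 (λ l t n₀ → l ⊹ (# 1 ⊹ t) ≐ # 2 ⊹ n₀ ⇛ # 0 ≺ t ⇛ ⊩ l ≺ # 1 ⊹ n₀) (leaves v) t n₀ (trans (sym leaves₀) (proj₂ big)) 0<t
  ... | inj₂ 0≡t = trans
    (cong (λ D → pieceCount (suc j + n₀) D s) (trans (cong (closed (suc j + n₀)) (arcs-expand v j t 0 (suc n₀) i≡))
      (closed-glue-last n₀ (suc j) (arcs 0 w₀) (s≤s z≤n) bd)))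
    (trans (pieceCount-glue-last n₀ (suc j) (closed n₀ (arcs 0 w₀)) s wf₀ (s≤s z≤n))
      (cong (_+ indicator (j ≡ᵇ a)) (word-pieces fuel n₀ w₀ a shorter f₀ (proj₂ big))))
    where
    i≡ : suc n₀ ≡ leaves v
    i≡ = lia 3 (λ l t n₀ → l ⊹ (# 1 ⊹ t) ≐ # 2 ⊹ n₀ ⇛ # 0 ≐ t ⇛ ⊩ # 1 ⊹ n₀ ≐ l) (leaves v) t n₀ (trans (sym leaves₀) (proj₂ big)) 0≡t
  count≡ : count (suc a) w₀ + indicator (u ≡ᵇ a) + indicator (j ≡ᵇ a) ≡ count (suc a) (v ++ suc j ∷ zeros (suc (suc (j + t)))) + indicator (u ≡ᵇ a)
  count≡ = trans (cong (λ z → z + indicator (u ≡ᵇ a) + indicator (j ≡ᵇ a)) (trans (count-++ (suc a) v (zeros (suc t))) (cong (count (suc a) v +_) (count-zeros a (suc t)))))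
    (trans (lia 3 (λ c x y → ⊩ c ⊹ # 0 ⊹ x ⊹ y ≐ c ⊹ (y ⊹ # 0) ⊹ x) (count (suc a) v) (indicator (u ≡ᵇ a)) (indicator (j ≡ᵇ a)))
      (cong (_+ indicator (u ≡ᵇ a)) (sym (trans (count-++ (suc a) v (suc j ∷ zeros (suc (suc (j + t)))))
        (cong (count (suc a) v +_) (trans (count-∷ j a (zeros (suc (suc (j + t))))) (cong (indicator (j ≡ᵇ a) +_) (count-zeros a (suc (suc (j + t)))))))))))

-- Dissections of type λ and words

record Diagonal (n : ℕ) (p : Pair) : Set where
  constructor diagonal
  field
    apart : suc (suc (proj₁ p)) ≤ proj₂ p
    inside : proj₂ p < suc (suc n)
    proper : proj₁ p ≡ 0 → suc (proj₂ p) ≡ suc (suc n) → ⊥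

diagonalᵇ : ℕ → Pair → Bool
diagonalᵇ n (a , b) = (suc (suc a) ≤ᵇ b) ∧ (b <ᵇ suc (suc n)) ∧ not ((a ≡ᵇ 0) ∧ (suc b ≡ᵇ suc (suc n)))

diagonals⁻ : ∀ n {p} → p ∈ diagonals n → Diagonal n p
diagonals⁻ n {a , b} h with ∈-filterᵇ⁻ {p = diagonalᵇ n} {xs = concatMap (λ a → map (a ,_) (upTo (suc (suc n)))) (upTo (suc (suc n)))} h
... | _ , t = diagonal (ℕₚ.≤ᵇ⇒≤ (suc (suc a)) b (∧-left t)) (ℕₚ.<ᵇ⇒< b (suc (suc n)) (∧-left rest))
  (λ e f → not-elim (∧-right (b <ᵇ suc (suc n)) rest) (∧-intro (ℕₚ.≡⇒≡ᵇ a 0 e) (ℕₚ.≡⇒≡ᵇ (suc b) (suc (suc n)) f)))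
  where rest = ∧-right (suc (suc a) ≤ᵇ b) t

diagonals⁺ : ∀ n {p} → Diagonal n p → p ∈ diagonals n
diagonals⁺ n {a , b} (diagonal p q r) = ∈-filterᵇ⁺ {p = diagonalᵇ n} {xs = concatMap (λ a → map (a ,_) (upTo (suc (suc n)))) (upTo (suc (suc n)))}
  (∈-concatMap⁺ (λ a → map (a ,_) (upTo (suc (suc n)))) (lose (∈-upTo⁺ (ℕₚ.<-trans (ℕₚ.<-trans ℕₚ.≤-refl p) q)) (∈-map⁺ (a ,_) (∈-upTo⁺ q))))
  (∧-intro (ℕₚ.≤⇒≤ᵇ p) (∧-intro (ℕₚ.<⇒<ᵇ q) (not-intro λ t →
    r (ℕₚ.≡ᵇ⇒≡ a 0 (∧-left t)) (ℕₚ.≡ᵇ⇒≡ (suc b) (suc (suc n)) (∧-right (a ≡ᵇ 0) t)))))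

diagonals-Unique : ∀ n → Unique (diagonals n)
diagonals-Unique n = Unique-filterᵇ {p = diagonalᵇ n} (grid (upTo (suc (suc n))) (Uniqueₚ.upTo⁺ (suc (suc n))))
  where
  ys = upTo (suc (suc n))
  grid : ∀ xs → Unique xs → Unique (concatMap (λ a → map (a ,_) ys) xs)
  grid [] _ = []
  grid (x ∷ xs) (x∉ ∷ u) = Uniqueₚ.++⁺ (Uniqueₚ.map⁺ (cong proj₂) (Uniqueₚ.upTo⁺ (suc (suc n)))) (grid xs u)
    λ { (p , q) → disjoint p (find (∈-concatMap⁻ _ {xs = xs} q)) }
    where
    disjoint : ∀ {v} → v ∈ map (x ,_) ys → (∃ λ a → a ∈ xs × v ∈ map (a ,_) ys) → ⊥
    disjoint p (a , a∈ , q) with ∈-map⁻ (x ,_) p | ∈-map⁻ (a ,_) q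
    ... | _ , _ , refl | _ , _ , refl = All.lookup x∉ a∈ refl

-- The canonical listing of a set of diagonals: members of `Slam` are sublists of `diagonals n`,
-- while arcs and rotations produce their pairs in another order.
restrict : ℕ → Pairs → Pairs
restrict n A = filterᵇ (λ p → memberᵇ p A) (diagonals n)

restrict-∈ : ∀ n A → restrict n A ∈ subsets (diagonals n)
restrict-∈ n A = subsets-filterᵇ (λ p → memberᵇ p A) (diagonals n)

restrict-≅ : ∀ n {A} → (∀ {p} → p ∈ A → Diagonal n p) → restrict n A ≅ A
restrict-≅ n {A} h = (λ q → member⁻ A (proj₂ (∈-filterᵇ⁻ {p = λ p → memberᵇ p A} {xs = diagonals n} q))) ,
  (λ q → ∈-filterᵇ⁺ {p = λ p → memberᵇ p A} (diagonals⁺ n (h q)) (member⁺ q))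

record InSlam (n : ℕ) (lam : List ℕ) (D : Pairs) : Set where
  constructor inSlam
  field
    subset : D ∈ subsets (diagonals n)
    uncrossed : Noncrossing D
    typed : ∀ j → j < n → pieceCount n D (suc (suc (suc j))) ≡ count (suc j) lam

  isDiagonal : ∀ {p} → p ∈ D → Diagonal n p
  isDiagonal q = diagonals⁻ n (subsets-⊑ subset q)

  wellFormed : WellFormed (suc (suc n)) D
  wellFormed q = ℕₚ.<-trans ℕₚ.≤-refl (Diagonal.apart (isDiagonal q)) , Diagonal.inside (isDiagonal q)

crosses⁻ : ∀ {a b c e} → T (crosses (a , b) (c , e)) → (a < c × c < b × b < e) ⊎ (c < a × a < e × e < b)
crosses⁻ {a} {b} {c} {e} t with ∨-elim ((a <ᵇ c) ∧ (c <ᵇ b) ∧ (b <ᵇ e)) t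
... | inj₁ s = inj₁ (ℕₚ.<ᵇ⇒< a c (∧-left s) , ℕₚ.<ᵇ⇒< c b (∧-left (∧-right (a <ᵇ c) s)) , ℕₚ.<ᵇ⇒< b e (∧-right (c <ᵇ b) (∧-right (a <ᵇ c) s)))
... | inj₂ s = inj₂ (ℕₚ.<ᵇ⇒< c a (∧-left s) , ℕₚ.<ᵇ⇒< a e (∧-left (∧-right (c <ᵇ a) s)) , ℕₚ.<ᵇ⇒< e b (∧-right (a <ᵇ e) (∧-right (c <ᵇ a) s)))

noncrossing⁻ : ∀ {D} → T (noncrossing D) → Noncrossing D
noncrossing⁻ {D} t {a} {b} {c} {e} p q h₁ h₂ h₃ = not-elim {crosses (a , b) (c , e)}
  (all-elim {p = λ ε → not (crosses (a , b) ε)} (all-elim {p = λ δ → all (λ ε → not (crosses δ ε)) D} t p) q)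
  (∨-introˡ (∧-intro (ℕₚ.<⇒<ᵇ h₁) (∧-intro (ℕₚ.<⇒<ᵇ h₂) (ℕₚ.<⇒<ᵇ h₃))))

noncrossing⁺ : ∀ {D} → Noncrossing D → T (noncrossing D)
noncrossing⁺ {D} nc = all-intro D λ {δ} p → all-intro D λ {ε} q → not-intro λ t →
  [ (λ { (h₁ , h₂ , h₃) → nc p q h₁ h₂ h₃ }) , (λ { (h₁ , h₂ , h₃) → nc q p h₁ h₂ h₃ }) ]′ (crosses⁻ {proj₁ δ} {proj₂ δ} {proj₁ ε} {proj₂ ε} t)

Slam⁻ : ∀ n lam {D} → D ∈ Slam n lam → InSlam n lam D
Slam⁻ n lam {D} h with ∈-filterᵇ⁻ {p = inS n lam} {xs = diagonalSets n} h
... | s , t = inSlam s (noncrossing⁻ (∧-left t)) λ j j<n →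
  trans (cong (pieceCount n D) (cong suc (ℕₚ.+-comm 2 j)))
    (ℕₚ.≡ᵇ⇒≡ (pieceCount n D (suc j + 2)) (mult (suc j) lam) (all-elim (∧-right (noncrossing D) t) (∈-upTo⁺ j<n)))

Slam⁺ : ∀ n lam {D} → InSlam n lam D → D ∈ Slam n lam
Slam⁺ n lam {D} (inSlam s nc c) = ∈-filterᵇ⁺ {p = inS n lam} s (∧-intro (noncrossing⁺ nc) (all-intro (upTo n) λ {j} j∈ →
  ℕₚ.≡⇒≡ᵇ (pieceCount n D (suc j + 2)) (mult (suc j) lam) (trans (cong (pieceCount n D) (cong suc (ℕₚ.+-comm j 2))) (c j (∈-upTo⁻ j∈)))))

Slam-Unique : ∀ n lam → Unique (Slam n lam)
Slam-Unique n lam = Unique-filterᵇ (subsets-Unique (diagonals-Unique n))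

mults : ℕ → List ℕ → List ℕ
mults n lam = map (λ j → count (suc j) lam) (upTo n)

nth-map-applyUpTo : ∀ (f g : ℕ → ℕ) n j → j < n → nth j (map f (List.applyUpTo g n)) ≡ f (g j)
nth-map-applyUpTo f g (suc n) zero h = refl
nth-map-applyUpTo f g (suc n) (suc j) h = nth-map-applyUpTo f (g ∘ suc) n j (s≤s⁻¹ h)

nth-beyond : ∀ (xs : List ℕ) j → length xs ≤ j → nth j xs ≡ 0
nth-beyond [] j h = refl
nth-beyond (x ∷ xs) (suc j) h = nth-beyond xs j (s≤s⁻¹ h)

letter-≤-sum : ∀ {x} w → x ∈ w → x ≤ sum w
letter-≤-sum (x ∷ w) (here refl) = ℕₚ.m≤m+n x (sum w)
letter-≤-sum (y ∷ w) (there q) = ℕₚ.≤-trans (letter-≤-sum w q) (ℕₚ.m≤n+m (sum w) y)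

count-absent : ∀ a w → (∀ {x} → x ∈ w → x ≢ a) → count a w ≡ 0
count-absent a [] h = refl
count-absent a (x ∷ w) h with ≡ᵇ-dec x a
... | inj₁ (e , _) = ⊥-elim (h (here refl) e)
... | inj₂ (_ , f) rewrite f = count-absent a w (h ∘ there)

-- Types are compared for the labels 1, ..., n only. A letter is at most the sum of its word, so no
-- larger label occurs.
content-upTo : ∀ n (f : ℕ → ℕ) w → sum w ≤ n → (∀ j → j < n → count (suc j) w ≡ f j) → Content w (map f (upTo n))
content-upTo n f w s h j with ℕₚ.<-≤-connex j n
... | inj₁ j<n = trans (h j j<n) (sym (nth-map-applyUpTo f id n j j<n))
... | inj₂ n≤j = trans
  (count-absent (suc j) w (λ { q refl → ℕₚ.<⇒≱ (ℕₚ.≤-trans (letter-≤-sum w q) s) n≤j }))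
  (sym (nth-beyond (map f (upTo n)) j (subst (_≤ j) (sym (trans (Listₚ.length-map f (upTo n)) (Listₚ.length-upTo n))) n≤j)))

leaves-positive : ∀ {w} → All (0 <_) w → leaves w ≡ 0
leaves-positive [] = refl
leaves-positive {suc j ∷ w} (_ ∷ h) = leaves-positive h

-- The partition is itself read as a word without leaves, its parts being the letters.
partition-stats : ∀ {n lam} → IsPartition n lam → weight (mults n lam) ≡ n × sum (mults n lam) ≡ length lam
partition-stats {n} {lam} (e , pos , _) with content-stats lam (mults n lam) (content-upTo n (λ j → count (suc j) lam) lam (ℕₚ.≤-reflexive e) (λ j _ → refl))
... | p , q = trans (sym p) e , sym (trans q (cong (_+ sum (mults n lam)) (leaves-positive pos)))

forest-++ : ∀ {u v w z} → Forest u w → Forest v z → Forest (u + v) (w ++ z)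
forest-++ [] g = g
forest-++ (leaf f) g = leaf (forest-++ f g)
forest-++ {v = v} {z = z} (node {u} {j} {w} f) g = node (subst (λ k → Forest (suc (suc k)) (w ++ z)) (ℕₚ.+-assoc j u v) (forest-++ f g))

module Rooted (n : ℕ) {j w} (f : Forest (suc (suc j)) w) (e : leaves w ≡ suc n) where

  bounds : ∀ {a b} → (a , b) ∈ arcs 0 w → suc (suc a) ≤ b × b < suc (suc n)
  bounds {b = b} q with arcs-bounds 0 f q
  ... | _ , p₂ , p₃ = p₂ , s≤s (subst (b ≤_) e p₃)

  arc-diagonal : ∀ {p} → p ∈ arcs 0 w → Diagonal n p
  arc-diagonal q = diagonal (proj₁ (bounds q)) (proj₂ (bounds q))
    (λ { refl g → no-root-arc f (subst (λ z → (0 , z) ∈ arcs 0 w) (trans (ℕₚ.suc-injective g) (sym e)) q) })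

  -- The root node is the central piece of the cyclic word obtained by adding one more leaf.
  closed-rooted : closed n (arcs 0 (w ++ [ 0 ])) ≡ arcs 0 w
  closed-rooted = trans (cong (closed n) (trans (arcs-++ 0 [ 0 ] f) (Listₚ.++-identityʳ (arcs 0 w))))
    (trans (Listₚ.map-cong-local (All.tabulate λ { q → nrm-< n (ℕₚ.<-trans ℕₚ.≤-refl (proj₁ (bounds q))) (proj₂ (bounds q)) }))
      (Listₚ.map-id (arcs 0 w)))

  rooted-pieces : ∀ {D} → WellFormed (suc (suc n)) D → D ≅ arcs 0 w → ∀ a →
    pieceCount n D (suc (suc (suc a))) ≡ count (suc a) (suc j ∷ w)
  rooted-pieces {D} wf s a = trans
    (pieceCount-cong n (suc (suc (suc a))) wf (λ q → ℕₚ.<-trans ℕₚ.≤-refl (proj₁ (bounds q)) , proj₂ (bounds q)) s)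
    (trans (cong (λ X → pieceCount n X (suc (suc (suc a)))) (sym closed-rooted))
      (trans (word-pieces (length (w ++ [ 0 ])) n (w ++ [ 0 ]) a ℕₚ.≤-refl
          (subst (λ k → Forest k (w ++ [ 0 ])) (ℕₚ.+-comm (suc (suc j)) 1) (forest-++ f (leaf [])))
          (trans (leaves-++ w [ 0 ]) (trans (cong (_+ 1) e) (ℕₚ.+-comm (suc n) 1))))
        (trans (cong (_+ indicator (j ≡ᵇ a)) (trans (count-++ (suc a) w [ 0 ]) (ℕₚ.+-identityʳ (count (suc a) w))))
          (trans (ℕₚ.+-comm (count (suc a) w) _) (sym (count-∷ j a w))))))

forest-root : ∀ {w} → Forest 1 w → head₀ (ends 0 w) ≡ leaves w
forest-root {w} f = single (ends 0 w) (ends-length 0 f) (uncovered⇒end 0 f (subst (0 <_) (sym (forest-leaves f)) (s≤s z≤n)) ℕₚ.≤-refl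
  (λ q _ r → ℕₚ.<⇒≱ r (proj₂ (proj₂ (arcs-bounds 0 f q)))))
  where
  single : ∀ {y} xs → length xs ≡ 1 → y ∈ xs → head₀ xs ≡ y
  single (x ∷ []) _ (here r) = sym r

module _ {n lam} (1≤n : 1 ≤ n) (part : IsPartition n lam) where

  private
    m = mults n lam
    size = suc n + length lam

  -- The root of the tree spans [0 , n + 1], which is a boundary edge and no diagonal. Hence `D`
  -- consists of the arcs of the forest `w` below the root.
  record Coded (D : Pairs) (t : List ℕ) : Set where
    constructor coded
    field
      {j} : ℕ
      {w} : List ℕ
      shape : t ≡ suc j ∷ w
      forest : Forest (suc (suc j)) w
      total : leaves w ≡ suc n
      same : arcs 0 w ≅ D

  encode : ∀ {D} → D ∈ Slam n lam → ∃ λ t → t ∈ words size 1 m × Coded D t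
  encode {D} D∈ with Slam⁻ n lam D∈
  ... | S with parse (suc n + length D) 0 (suc n) D ℕₚ.≤-refl
              (λ q → z≤n , Diagonal.apart (InSlam.isDiagonal S q) , s≤s⁻¹ (Diagonal.inside (InSlam.isDiagonal S q))) (InSlam.uncrossed S)
  ... | zero , w , f , e , s with forest-0 f
  ... | refl with e
  ... | ()
  encode {D} D∈ | S | suc zero , .(0 ∷ _) , leaf f , e , s with forest-0 f
  ... | refl = ⊥-elim (ℕₚ.<-irrefl (ℕₚ.suc-injective e) 1≤n)
  -- A single tree with a root node would put the boundary edge (0 , n + 1) into `D`.
  encode {D} D∈ | S | suc zero , .(suc _ ∷ _) , f@(node {j = j} {w} g) , e , (s , _) =
    ⊥-elim (Diagonal.proper (InSlam.isDiagonal S (s (here refl))) refl (cong suc (trans (forest-root f) e)))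
  encode {D} D∈ | S | suc (suc j) , w , f , e , s = suc j ∷ w , t∈ , coded refl f e s
    where
    open Rooted n f e
    t : Forest 1 (suc j ∷ w)
    t = node (subst (λ k → Forest (suc (suc k)) w) (sym (ℕₚ.+-identityʳ j)) f)
    content : Content (suc j ∷ w) m
    content = content-upTo n (λ a → count (suc a) lam) (suc j ∷ w) (ℕₚ.≤-reflexive (ℕₚ.suc-injective (trans (sym (forest-leaves t)) e))) λ a a<n →
      trans (sym (rooted-pieces (InSlam.wellFormed S) (proj₂ s , proj₁ s) a)) (InSlam.typed S a a<n)
    t∈ : suc j ∷ w ∈ words size 1 m
    t∈ = subst (λ k → suc j ∷ w ∈ words k 1 m) (trans (proj₂ (content-stats (suc j ∷ w) m content)) (cong₂ _+_ e (proj₂ (partition-stats part))))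
      (words-complete m t content)

  decode : ∀ {t} → t ∈ words size 1 m → ∃ λ D → D ∈ Slam n lam × Coded D t
  decode {t} t∈ with words-sound size 1 m t∈
  ... | f , l , c = go refl f
    where
    leaves≡ : leaves t ≡ suc n
    leaves≡ = trans (forest-leaves f) (cong suc (trans (proj₁ (content-stats t m c)) (proj₁ (partition-stats part))))
    go : ∀ {t′} → t′ ≡ t → Forest 1 t′ → ∃ λ D → D ∈ Slam n lam × Coded D t
    go refl (leaf g) with forest-0 g
    ... | refl = ⊥-elim (ℕₚ.<-irrefl (ℕₚ.suc-injective leaves≡) 1≤n)
    go refl (node {j = j} {w} g) = D , Slam⁺ n lam (inSlam (restrict-∈ n (arcs 0 w)) nc typed) , coded refl g′ leaves≡ (proj₂ s , proj₁ s)
      where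
      g′ : Forest (suc (suc j)) w
      g′ = subst (λ k → Forest (suc (suc k)) w) (ℕₚ.+-identityʳ j) g
      open Rooted n g′ leaves≡
      D = restrict n (arcs 0 w)
      s : D ≅ arcs 0 w
      s = restrict-≅ n arc-diagonal
      nc : Noncrossing D
      nc p q = arcs-noncrossing 0 g (proj₁ s p) (proj₁ s q)
      typed : ∀ a → a < n → pieceCount n D (suc (suc (suc a))) ≡ count (suc a) lam
      typed a a<n = trans (rooted-pieces (λ q → let (p₁ , p₂) = bounds (proj₁ s q) in ℕₚ.<-trans ℕₚ.≤-refl p₁ , p₂) s a)
        (trans (c a) (nth-map-applyUpTo (λ a → count (suc a) lam) id n a a<n))

  coded-injective : ∀ D {t u} → Coded D t → Coded D u → t ≡ u
  coded-injective D (coded {i} {w} refl f e (s , s′)) (coded {j} {z} refl g h (t , t′)) with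
    arcs-injective 0 f g (trans e (sym h)) ((λ q → t′ (s q)) , (λ q → s′ (t q)))
  ... | refl with trans (sym (ends-length 0 f)) (ends-length 0 g)
  ... | refl = refl

  Slam-length : length (Slam n lam) ≡ length (words size 1 m)
  Slam-length = ℕₚ.≤-antisym
    (length-≤-injection (Slam-Unique n lam) (λ p → proj₁ (encode p)) (λ p → proj₁ (proj₂ (encode p)))
      (λ p q e → same-set (Slam⁻ n lam p) (Slam⁻ n lam q) (proj₂ (proj₂ (encode p))) (subst (Coded _) (sym e) (proj₂ (proj₂ (encode q))))))
    (length-≤-injection (words-Unique size 1 m) (λ p → proj₁ (decode p)) (λ p → proj₁ (proj₂ (decode p)))
      (λ {x} {y} p q e → coded-injective _ (proj₂ (proj₂ (decode p))) (subst (λ D → Coded D y) (sym e) (proj₂ (proj₂ (decode q))))))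
    where
    same-set : ∀ {D E t} → InSlam n lam D → InSlam n lam E → Coded D t → Coded E t → D ≡ E
    same-set S R (coded refl f e (s , s′)) (coded refl g h (t , t′)) =
      subsets-ext (diagonals-Unique n) (InSlam.subset S) (InSlam.subset R) ((λ q → t (s′ q)) , (λ q → s (t′ q)))

  Slam-number : length (Slam n lam) * (suc n) ! * factorials m ≡ (n + length lam) !
  Slam-number = trans (cong₂ (λ L k → L * k ! * factorials m) Slam-length (cong suc (sym (proj₁ (partition-stats part)))))
    (trans (words-number (n + length lam) 1 m (cong₂ (λ x y → suc (x + y)) (sym (proj₁ (partition-stats part))) (sym (proj₂ (partition-stats part)))))
      (ℕₚ.+-identityʳ _))

-- Rotation-invariant dissections

nrm-full : ∀ n a b → nrm n (suc (suc n) + a) (suc (suc n) + b) ≡ nrm n a b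
nrm-full n a b = cong₂ (λ x y → x ⊓ y , x ⊔ y)
  (trans (cong (_% suc (suc n)) (ℕₚ.+-comm (suc (suc n)) a)) ([m+n]%n≡m%n a (suc (suc n))))
  (trans (cong (_% suc (suc n)) (ℕₚ.+-comm (suc (suc n)) b)) ([m+n]%n≡m%n b (suc (suc n))))

nrm-fullʳ : ∀ n a b → nrm n a (suc (suc n) + b) ≡ nrm n a b
nrm-fullʳ n a b = cong (λ y → (a % suc (suc n)) ⊓ y , (a % suc (suc n)) ⊔ y)
  (trans (cong (_% suc (suc n)) (ℕₚ.+-comm (suc (suc n)) b)) ([m+n]%n≡m%n b (suc (suc n))))

nrm-multiple : ∀ n q a b → nrm n (q * suc (suc n) + a) (q * suc (suc n) + b) ≡ nrm n a b
nrm-multiple n zero a b = refl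
nrm-multiple n (suc q) a b = trans
  (cong₂ (nrm n) (ℕₚ.+-assoc (suc (suc n)) (q * suc (suc n)) a) (ℕₚ.+-assoc (suc (suc n)) (q * suc (suc n)) b))
  (trans (nrm-full n (q * suc (suc n) + a) (q * suc (suc n) + b)) (nrm-multiple n q a b))

nrm-rotate : ∀ n k a b → nrm n (k + proj₁ (nrm n a b)) (k + proj₂ (nrm n a b)) ≡ nrm n (k + a) (k + b)
nrm-rotate n k a b with ℕₚ.≤-total (a % suc (suc n)) (b % suc (suc n))
... | inj₁ h rewrite ℕₚ.m≤n⇒m⊓n≡m h | ℕₚ.m≤n⇒m⊔n≡n h = cong₂ (λ x y → x ⊓ y , x ⊔ y) (absorb a) (absorb b)
  where
  absorb : ∀ a → (k + a % suc (suc n)) % suc (suc n) ≡ (k + a) % suc (suc n)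
  absorb a = trans (cong (_% suc (suc n)) (ℕₚ.+-comm k (a % suc (suc n)))) (trans (%-distribˡ-+ (a % suc (suc n)) k (suc (suc n)))
    (trans (cong (λ z → (z + k % suc (suc n)) % suc (suc n)) (m%n%n≡m%n a (suc (suc n)))) (trans (sym (%-distribˡ-+ a k (suc (suc n))))
      (cong (_% suc (suc n)) (ℕₚ.+-comm a k)))))
... | inj₂ h rewrite ℕₚ.m≥n⇒m⊓n≡n h | ℕₚ.m≥n⇒m⊔n≡m h = trans (cong₂ (λ x y → x ⊓ y , x ⊔ y) (absorb b) (absorb a)) (nrm-comm n (k + b) (k + a))
  where
  absorb : ∀ a → (k + a % suc (suc n)) % suc (suc n) ≡ (k + a) % suc (suc n)
  absorb a = trans (cong (_% suc (suc n)) (ℕₚ.+-comm k (a % suc (suc n)))) (trans (%-distribˡ-+ (a % suc (suc n)) k (suc (suc n)))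
    (trans (cong (λ z → (z + k % suc (suc n)) % suc (suc n)) (m%n%n≡m%n a (suc (suc n)))) (trans (sym (%-distribˡ-+ a k (suc (suc n))))
      (cong (_% suc (suc n)) (ℕₚ.+-comm a k)))))

nrm-congruent : ∀ n k {a b c e} → nrm n a b ≡ nrm n c e → nrm n (k + a) (k + b) ≡ nrm n (k + c) (k + e)
nrm-congruent n k {a} {b} {c} {e} h = trans (sym (nrm-rotate n k a b))
  (trans (cong (λ p → nrm n (k + proj₁ p) (k + proj₂ p)) h) (nrm-rotate n k c e))

-- Stated for all lifts, so that periods can be added without renormalising. Only one direction is
-- demanded; the inverse rotation is obtained by iteration.
Period : ℕ → Pairs → ℕ → Set
Period n D k = ∀ a b → nrm n a b ∈ D → nrm n (k + a) (k + b) ∈ D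

period-multiple : ∀ n {D} k j → Period n D k → Period n D (j * k)
period-multiple n k zero P a b q = q
period-multiple n {D} k (suc j) P a b q = subst₂ (λ x y → nrm n x y ∈ D) (sym (ℕₚ.+-assoc k (j * k) a)) (sym (ℕₚ.+-assoc k (j * k) b))
  (P (j * k + a) (j * k + b) (period-multiple n k j P a b q))

period-mod : ∀ n {D} k r α β → k + α * suc (suc n) ≡ r + β * suc (suc n) → Period n D k → Period n D r
period-mod n {D} k r α β e P a b q = subst (_∈ D) same (P a b q)
  where
  N = suc (suc n)
  move : ∀ k α a → α * N + (k + a) ≡ (k + α * N) + a
  move k α a = trans (sym (ℕₚ.+-assoc (α * N) k a)) (cong (_+ a) (ℕₚ.+-comm (α * N) k))
  same : nrm n (k + a) (k + b) ≡ nrm n (r + a) (r + b)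
  same = trans (sym (nrm-multiple n α (k + a) (k + b))) (trans
    (cong₂ (nrm n) (trans (move k α a) (trans (cong (_+ a) e) (sym (move r β a)))) (trans (move k α b) (trans (cong (_+ b) e) (sym (move r β b)))))
    (nrm-multiple n β (r + a) (r + b)))

fixedBy⁻ : ∀ n k D → T (fixedBy n k D) → WellFormed (suc (suc n)) D → Period n D k
fixedBy⁻ n k D t wf a b q = subst (_∈ D)
  (trans (cong₂ (nrm n) (ℕₚ.+-comm (proj₁ (nrm n a b)) k) (ℕₚ.+-comm (proj₂ (nrm n a b)) k)) (nrm-rotate n k a b))
  (member⁻ D (all-elim {p = λ δ → memberᵇ (rot n k δ) D} t q))

fixedBy⁺ : ∀ n k D → WellFormed (suc (suc n)) D → Period n D k → T (fixedBy n k D)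
fixedBy⁺ n k D wf P = all-intro D λ { {a , b} q → member⁺ (subst (_∈ D) (cong₂ (nrm n) (ℕₚ.+-comm k a) (ℕₚ.+-comm k b))
  (P a b (subst (_∈ D) (sym (uncurry (nrm-< n) (wf q))) q))) }

-- The cases record how many of the lifts `e`, `b`, `c` have passed n + 2. In each of them the
-- residues form a crossing pair, with the two diagonals in one order or the other.
lifts-noncrossing₀ : ∀ n D → Noncrossing D → ∀ {a b c e} → a < suc (suc n) → a < c → c < b → b < e → e < suc (suc n) + a →
  nrm n a b ∈ D → nrm n c e ∈ D → ⊥
lifts-noncrossing₀ n D nc {a} {b} {c} {e} a<N a<c c<b b<e e<a+N p q with ℕₚ.<-≤-connex e (suc (suc n))
... | inj₁ e<N = nc (subst (_∈ D) (nrm-< n (ℕₚ.<-trans a<c c<b) (ℕₚ.<-trans b<e e<N)) p) (subst (_∈ D) (nrm-< n (ℕₚ.<-trans c<b b<e) e<N) q) a<c c<b b<e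
... | inj₂ N≤e with ℕₚ.m≤n⇒∃[o]m+o≡n N≤e
... | e₁ , refl with ℕₚ.+-cancelˡ-< (suc (suc n)) e₁ a e<a+N | ℕₚ.<-≤-connex b (suc (suc n))
... | e₁<a | inj₁ b<N = nc
  (subst (_∈ D) (trans (nrm-fullʳ n c e₁) (trans (nrm-comm n c e₁) (nrm-< n (ℕₚ.<-trans e₁<a a<c) (ℕₚ.<-trans c<b b<N)))) q)
  (subst (_∈ D) (nrm-< n (ℕₚ.<-trans a<c c<b) b<N) p) e₁<a a<c c<b
... | e₁<a | inj₂ N≤b with ℕₚ.m≤n⇒∃[o]m+o≡n N≤b
... | b₁ , refl with ℕₚ.+-cancelˡ-< (suc (suc n)) b₁ e₁ b<e | ℕₚ.<-≤-connex c (suc (suc n))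
... | b₁<e₁ | inj₁ c<N = nc
  (subst (_∈ D) (trans (nrm-fullʳ n a b₁) (trans (nrm-comm n a b₁) (nrm-< n (ℕₚ.<-trans b₁<e₁ e₁<a) a<N))) p)
  (subst (_∈ D) (trans (nrm-fullʳ n c e₁) (trans (nrm-comm n c e₁) (nrm-< n (ℕₚ.<-trans e₁<a a<c) c<N))) q)
  b₁<e₁ e₁<a a<c
... | b₁<e₁ | inj₂ N≤c with ℕₚ.m≤n⇒∃[o]m+o≡n N≤c
... | c₁ , refl with ℕₚ.+-cancelˡ-< (suc (suc n)) c₁ b₁ c<b
... | c₁<b₁ = nc
  (subst (_∈ D) (trans (nrm-full n c₁ e₁) (nrm-< n (ℕₚ.<-trans c₁<b₁ b₁<e₁) (ℕₚ.<-trans e₁<a a<N))) q)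
  (subst (_∈ D) (trans (nrm-fullʳ n a b₁) (trans (nrm-comm n a b₁) (nrm-< n (ℕₚ.<-trans b₁<e₁ e₁<a) a<N))) p)
  c₁<b₁ b₁<e₁ e₁<a

lifts-noncrossing : ∀ n D → Noncrossing D → ∀ {a b c e} → a < c → c < b → b < e → e < suc (suc n) + a →
  nrm n a b ∈ D → nrm n c e ∈ D → ⊥
lifts-noncrossing n D nc {a} {b} {c} {e} a<c c<b b<e e<a+N p q =
  lifts-noncrossing₀ n D nc (m%n<n a N) (ℕₚ.+-cancelˡ-< (Q * N) _ _ (subst₂ _<_ a≡ c≡ a<c)) (ℕₚ.+-cancelˡ-< (Q * N) _ _ (subst₂ _<_ c≡ b≡ c<b))
    (ℕₚ.+-cancelˡ-< (Q * N) _ _ (subst₂ _<_ b≡ e≡ b<e))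
    (ℕₚ.+-cancelˡ-< (Q * N) _ _ (subst₂ _<_ e≡ (trans (cong (N +_) a≡) (swap N (Q * N) (a % N))) e<a+N))
    (subst (_∈ D) (trans (cong₂ (nrm n) a≡ b≡) (nrm-multiple n Q (a % N) (b ∸ Q * N))) p)
    (subst (_∈ D) (trans (cong₂ (nrm n) c≡ e≡) (nrm-multiple n Q (c ∸ Q * N) (e ∸ Q * N))) q)
  where
  N = suc (suc n)
  Q = a / N
  swap : ∀ x y z → x + (y + z) ≡ y + (x + z)
  swap = solve-∀
  a≡ : a ≡ Q * N + a % N
  a≡ = trans (m≡m%n+[m/n]*n a N) (ℕₚ.+-comm (a % N) (Q * N))
  Q≤a : Q * N ≤ a
  Q≤a = m/n*n≤m a N
  c≡ : c ≡ Q * N + (c ∸ Q * N)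
  c≡ = sym (ℕₚ.m+[n∸m]≡n (ℕₚ.≤-trans Q≤a (ℕₚ.<⇒≤ a<c)))
  b≡ : b ≡ Q * N + (b ∸ Q * N)
  b≡ = sym (ℕₚ.m+[n∸m]≡n (ℕₚ.≤-trans Q≤a (ℕₚ.<⇒≤ (ℕₚ.<-trans a<c c<b))))
  e≡ : e ≡ Q * N + (e ∸ Q * N)
  e≡ = sym (ℕₚ.m+[n∸m]≡n (ℕₚ.≤-trans Q≤a (ℕₚ.<⇒≤ (ℕₚ.<-trans a<c (ℕₚ.<-trans c<b b<e)))))

record Good (n : ℕ) (D : Pairs) : Set where
  constructor good
  field
    isDiagonal : ∀ {p} → p ∈ D → Diagonal n p
    uncrossed : Noncrossing D

  wellFormed : WellFormed (suc (suc n)) D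
  wellFormed q = ℕₚ.<-trans ℕₚ.≤-refl (Diagonal.apart (isDiagonal q)) , Diagonal.inside (isDiagonal q)

good-next : ∀ n {D} → Good n D → Good n (map (nextPair n) D)
good-next n {D} G = good diag nc
  where
  open Good G
  diag : ∀ {p} → p ∈ map (nextPair n) D → Diagonal n p
  diag h with ∈-map⁻ (nextPair n) h
  ... | (a , b) , q , refl with nextPair-view n a b | isDiagonal q
  ... | inj₁ (refl , e) | diagonal x y z rewrite e = diagonal
    (s≤s (ℕₚ.n≢0⇒n>0 (λ { refl → z refl refl }))) (ℕₚ.<-trans x (s≤s ℕₚ.≤-refl)) (λ { _ refl → ℕₚ.<-irrefl refl x })
  ... | inj₂ (b≢ , e) | diagonal x y z rewrite e = diagonal (s≤s x) (s≤s (ℕₚ.≤∧≢⇒< (s≤s⁻¹ y) b≢)) λ ()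
  nc : Noncrossing (map (nextPair n) D)
  nc h k h₁ h₂ h₃ with ∈-map⁻ (nextPair n) h | ∈-map⁻ (nextPair n) k
  ... | (a , b) , p , e | (c , f) , q , g with nextPair-view n a b | nextPair-view n c f
  ... | inj₁ (_ , e′) | inj₁ (_ , g′) with trans e e′ | trans g g′
  ... | refl | refl = ℕₚ.<-irrefl refl h₁
  nc h k h₁ h₂ h₃ | (a , b) , p , e | (c , f) , q , g | inj₁ (refl , e′) | inj₂ (f≢ , g′) with trans e e′ | trans g g′
  ... | refl | refl = uncrossed q p (s≤s⁻¹ h₂) (s≤s⁻¹ h₃) (ℕₚ.≤∧≢⇒< (s≤s⁻¹ (Diagonal.inside (isDiagonal q))) f≢)
  nc h k h₁ h₂ h₃ | (a , b) , p , e | (c , f) , q , g | inj₂ (_ , e′) | inj₁ (_ , g′) with trans e e′ | trans g g′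
  ... | refl | refl = case h₁ of λ ()
  nc h k h₁ h₂ h₃ | (a , b) , p , e | (c , f) , q , g | inj₂ (_ , e′) | inj₂ (_ , g′) with trans e e′ | trans g g′
  ... | refl | refl = uncrossed p q (s≤s⁻¹ h₁) (s≤s⁻¹ h₂) (s≤s⁻¹ h₃)

good-rotateBy : ∀ n k {D} → Good n D → Good n (rotateBy n k D)
good-rotateBy n zero {D} G = subst (Good n) (sym (rotateBy-0 n D (Good.wellFormed G))) G
good-rotateBy n (suc k) {D} G = subst (Good n) (rotateBy-suc n k D (Good.wellFormed G)) (good-next n (good-rotateBy n k G))

good-≅ : ∀ n {D E} → D ⊑ E → Good n E → Good n D
good-≅ n s (good d c) = good (λ q → d (s q)) (λ p q → c (s p) (s q))

InSlam⇒Good : ∀ {n lam D} → InSlam n lam D → Good n D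
InSlam⇒Good S = good (InSlam.isDiagonal S) (InSlam.uncrossed S)

record Rotates (n : ℕ) (D : Pairs) (c : ℕ) (D′ : Pairs) : Set where
  constructor rotates
  field
    there⁺ : ∀ a b → nrm n a b ∈ D → nrm n (c + a) (c + b) ∈ D′
    there⁻ : ∀ a b → nrm n (c + a) (c + b) ∈ D′ → nrm n a b ∈ D

unrotate-nrm : ∀ n c x → c ≤ suc (suc n) → (suc (suc n) ∸ c) + (c + x) ≡ suc (suc n) + x
unrotate-nrm n c x h = trans (sym (ℕₚ.+-assoc (suc (suc n) ∸ c) c x)) (cong (_+ x) (ℕₚ.m∸n+n≡m h))

rerotate-nrm : ∀ n c x → c ≤ suc (suc n) → c + ((suc (suc n) ∸ c) + x) ≡ suc (suc n) + x
rerotate-nrm n c x h = trans (sym (ℕₚ.+-assoc c (suc (suc n) ∸ c) x)) (cong (_+ x) (ℕₚ.m+[n∸m]≡n h))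

rotates-inverse : ∀ n {D c D′} → c ≤ suc (suc n) → Rotates n D c D′ → Rotates n D′ (suc (suc n) ∸ c) D
rotates-inverse n {D} {c} {D′} h (rotates f g) = rotates
  (λ a b q → g _ _ (subst (_∈ D′) (sym (trans (cong₂ (nrm n) (rerotate-nrm n c a h) (rerotate-nrm n c b h)) (nrm-full n a b))) q))
  (λ a b q → subst (_∈ D′) (trans (cong₂ (nrm n) (rerotate-nrm n c a h) (rerotate-nrm n c b h)) (nrm-full n a b)) (f _ _ q))

rotates-period : ∀ n {D c D′} k → c ≤ suc (suc n) → Rotates n D c D′ → Period n D k → Period n D′ k
rotates-period n {D} {c} {D′} k h R P a b q = subst (_∈ D′) back
  (Rotates.there⁺ R _ _ (P _ _ (Rotates.there⁺ (rotates-inverse n h R) a b q)))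
  where
  C = suc (suc n) ∸ c
  swap : ∀ c k C x → c + (k + (C + x)) ≡ k + (c + (C + x))
  swap = solve-∀
  lemma : ∀ x → c + (k + (C + x)) ≡ suc (suc n) + (k + x)
  lemma x = trans (swap c k C x) (trans (cong (k +_) (rerotate-nrm n c x h)) (swap′ k (suc (suc n)) x))
    where
    swap′ : ∀ k N x → k + (N + x) ≡ N + (k + x)
    swap′ = solve-∀
  back : nrm n (c + (k + (C + a))) (c + (k + (C + b))) ≡ nrm n (k + a) (k + b)
  back = trans (cong₂ (nrm n) (lemma a) (lemma b)) (nrm-full n (k + a) (k + b))

rotate-InSlam : ∀ n lam c D → c ≤ suc (suc n) → InSlam n lam D → ∃ λ D′ → InSlam n lam D′ × Rotates n D c D′
rotate-InSlam n lam c D c≤N S = D′ , inSlam (restrict-∈ n R) (Good.uncrossed good′) typed , rotates forth back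
  where
  R = rotateBy n c D
  D′ = restrict n R
  goodR : Good n R
  goodR = good-rotateBy n c (InSlam⇒Good S)
  s : D′ ≅ R
  s = restrict-≅ n (Good.isDiagonal goodR)
  good′ : Good n D′
  good′ = good-≅ n (proj₁ s) goodR
  typed : ∀ j → j < n → pieceCount n D′ (suc (suc (suc j))) ≡ count (suc j) lam
  typed j j<n = trans (pieceCount-cong n (suc (suc (suc j))) (Good.wellFormed good′) (Good.wellFormed goodR) s)
    (trans (pieceCount-rotateBy n c D (suc (suc (suc j))) c≤N (InSlam.wellFormed S)) (InSlam.typed S j j<n))
  forth : ∀ a b → nrm n a b ∈ D → nrm n (c + a) (c + b) ∈ D′
  forth a b q = proj₂ s (subst (_∈ R) (nrm-rotate n c a b) (∈-map⁺ (λ p → nrm n (c + proj₁ p) (c + proj₂ p)) q))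
  back : ∀ a b → nrm n (c + a) (c + b) ∈ D′ → nrm n a b ∈ D
  back a b q with ∈-map⁻ (λ p → nrm n (c + proj₁ p) (c + proj₂ p)) (proj₁ s q)
  ... | (x , y) , p , e = subst (_∈ D) (sym (trans same (uncurry (nrm-< n) (InSlam.wellFormed S p)))) p
    where
    C = suc (suc n) ∸ c
    undo : ∀ u v → nrm n (C + (c + u)) (C + (c + v)) ≡ nrm n u v
    undo u v = trans (cong₂ (nrm n) (unrotate-nrm n c u c≤N) (unrotate-nrm n c v c≤N)) (nrm-full n u v)
    same : nrm n a b ≡ nrm n x y
    same = trans (sym (undo a b)) (trans (nrm-congruent n C e) (undo x y))

-- Repetition of a word

power : ℕ → List ℕ → List ℕ
power d w = concat (replicate d w)

power-forest : ∀ {u w} d → Forest u w → Forest (d * u) (power d w)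
power-forest zero f = []
power-forest (suc d) f = forest-++ f (power-forest d f)

power-leaves : ∀ d w → leaves (power d w) ≡ d * leaves w
power-leaves zero w = refl
power-leaves (suc d) w = trans (leaves-++ w (power d w)) (cong (leaves w +_) (power-leaves d w))

power-count : ∀ a d w → count a (power d w) ≡ d * count a w
power-count a zero w = refl
power-count a (suc d) w = trans (count-++ a w (power d w)) (cong (count a w +_) (power-count a d w))

translate-∈ : ∀ {u w x a b} → Forest u w → (a , b) ∈ arcs 0 w → (x + a , x + b) ∈ arcs x w
translate-∈ {w = w} {x} {a} {b} f q = subst ((x + a , x + b) ∈_)
  (trans (sym (arcs-shift x 0 f)) (cong (λ z → arcs z w) (ℕₚ.+-identityʳ x))) (∈-map⁺ (translate x) q)

power-arcs⁺ : ∀ {u w a b} d x i → Forest u w → i < d → (a , b) ∈ arcs 0 w →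
  (x + (i * leaves w + a) , x + (i * leaves w + b)) ∈ arcs x (power d w)
power-arcs⁺ {w = w} {a} {b} (suc d) x zero f h q = subst ((x + a , x + b) ∈_) (sym (arcs-++ x (power d w) f)) (∈-++⁺ˡ (translate-∈ f q))
power-arcs⁺ {w = w} {a} {b} (suc d) x (suc i) f h q = subst (_ ∈_) (sym (arcs-++ x (power d w) f)) (∈-++⁺ʳ (arcs x w)
  (subst (_∈ arcs (x + leaves w) (power d w)) (cong₂ _,_ (shuffle x (leaves w) (i * leaves w) a) (shuffle x (leaves w) (i * leaves w) b))
    (power-arcs⁺ d (x + leaves w) i f (s≤s⁻¹ h) q)))
  where
  shuffle : ∀ x l m a → (x + l) + (m + a) ≡ x + ((l + m) + a)
  shuffle = solve-∀

power-arcs⁻ : ∀ {u w p} d x → Forest u w → p ∈ arcs x (power d w) →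
  ∃ λ i → ∃ λ a → ∃ λ b → i < d × (a , b) ∈ arcs 0 w × p ≡ (x + (i * leaves w + a) , x + (i * leaves w + b))
power-arcs⁻ {w = w} {p} (suc d) x f q with ∈-++⁻ (arcs x w) (subst (p ∈_) (arcs-++ x (power d w) f) q)
... | inj₁ q′ with ∈-map⁻ (translate x) (subst (p ∈_) (trans (cong (λ z → arcs z w) (sym (ℕₚ.+-identityʳ x))) (arcs-shift x 0 f)) q′)
... | (a , b) , r , e = 0 , a , b , s≤s z≤n , r , e
power-arcs⁻ {w = w} {p} (suc d) x f q | inj₂ q′ with power-arcs⁻ d (x + leaves w) f q′
... | i , a , b , i<d , r , e = suc i , a , b , s≤s i<d , r ,
  trans e (cong₂ _,_ (shuffle x (leaves w) (i * leaves w) a) (shuffle x (leaves w) (i * leaves w) b))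
  where
  shuffle : ∀ x l m a → (x + l) + (m + a) ≡ x + ((l + m) + a)
  shuffle = solve-∀

closed-noncrossing : ∀ n A → (∀ {a b} → (a , b) ∈ A → a < b × b ≤ suc (suc n)) → Noncrossing A → Noncrossing (closed n A)
closed-noncrossing n A bd nc h k h₁ h₂ h₃ with ∈-map⁻ (λ p → nrm n (proj₁ p) (proj₂ p)) h | ∈-map⁻ (λ p → nrm n (proj₁ p) (proj₂ p)) k
... | (a , b) , p , e | (c , f) , q , g with bd p | bd q
... | a<b , b≤N | c<f , f≤N with ℕₚ.m≤n⇒m<n∨m≡n b≤N | ℕₚ.m≤n⇒m<n∨m≡n f≤N
... | inj₁ b<N | inj₁ f<N with trans e (nrm-< n a<b b<N) | trans g (nrm-< n c<f f<N)
... | refl | refl = nc p q h₁ h₂ h₃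
closed-noncrossing n A bd nc h k h₁ h₂ h₃ | (a , b) , p , e | (c , f) , q , g | a<b , b≤N | c<f , f≤N | inj₁ b<N | inj₂ refl
  with trans g (nrm-last n c<f)
... | refl = case h₁ of λ ()
closed-noncrossing n A bd nc h k h₁ h₂ h₃ | (a , b) , p , e | (c , f) , q , g | a<b , b≤N | c<f , f≤N | inj₂ refl | inj₁ f<N
  with trans e (nrm-last n a<b) | trans g (nrm-< n c<f f<N)
... | refl | refl = nc q p h₂ h₃ f<N
closed-noncrossing n A bd nc h k h₁ h₂ h₃ | (a , b) , p , e | (c , f) , q , g | a<b , b≤N | c<f , f≤N | inj₂ refl | inj₂ refl
  with trans e (nrm-last n a<b) | trans g (nrm-last n c<f)
... | refl | refl = ℕₚ.<-irrefl refl h₁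

-- Invariant dissections with vertex 0 on the central piece

module Symmetric (n d r : ℕ) (N≡ : suc (suc n) ≡ d * r) (2≤d : 2 ≤ d) (1≤n : 1 ≤ n) where

  N : ℕ
  N = suc (suc n)

  2r≤N : r + r ≤ N
  2r≤N = subst₂ _≤_ (cong (r +_) (ℕₚ.+-identityʳ r)) (sym N≡) (ℕₚ.*-monoˡ-≤ r 2≤d)

  r≤N : r ≤ N
  r≤N = ℕₚ.≤-trans (ℕₚ.m≤m+n r r) 2r≤N

  0<r : 0 < r
  0<r = ℕₚ.n≢0⇒n>0 λ { refl → case trans N≡ (ℕₚ.*-zeroʳ d) of λ () }

  r<N : r < N
  r<N = ℕₚ.<-≤-trans (ℕₚ.m<m+n r 0<r) 2r≤N

  -- The bound `b ≤ r + a` selects a side of the diagonal away from the centre: in a noncrossing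
  -- family with period `r` every diagonal spans at most `r` on one side, or it would cross its own
  -- rotation. The uncovered vertices are those of the central polygon or diameter.
  Covers : Pairs → ℕ → Set
  Covers D t = ∃ λ a → ∃ λ b → a < t × t < b × b ≤ r + a × nrm n a b ∈ D

  -- t is covered modulo r; adding r keeps the left end of the arc nonnegative
  cov : Pairs → ℕ → Bool
  cov D t = any (λ a → any (λ b → (a <ᵇ r + t) ∧ (r + t <ᵇ b) ∧ (b ≤ᵇ r + a) ∧ memberᵇ (nrm n a b) D) (upTo (r + (r + t)))) (upTo (r + t))

  cov⁻ : ∀ D t → T (cov D t) → Covers D (r + t)
  cov⁻ D t h with any-elim (upTo (r + t)) h
  ... | a , _ , h′ with any-elim {p = λ b → (a <ᵇ r + t) ∧ (r + t <ᵇ b) ∧ (b ≤ᵇ r + a) ∧ memberᵇ (nrm n a b) D} (upTo (r + (r + t))) h′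
  ... | b , _ , h″ = a , b , ℕₚ.<ᵇ⇒< a (r + t) (∧-left h″) , ℕₚ.<ᵇ⇒< (r + t) b (∧-left q₁) , ℕₚ.≤ᵇ⇒≤ b (r + a) (∧-left q₂) , member⁻ D (∧-right (b ≤ᵇ r + a) q₂)
    where
    q₁ = ∧-right (a <ᵇ r + t) h″
    q₂ = ∧-right (r + t <ᵇ b) q₁

  cov⁺ : ∀ D t → Covers D (r + t) → T (cov D t)
  cov⁺ D t (a , b , p₁ , p₂ , p₃ , q) = any-intro {xs = upTo (r + t)} (∈-upTo⁺ p₁)
    (any-intro {p = λ b → (a <ᵇ r + t) ∧ (r + t <ᵇ b) ∧ (b ≤ᵇ r + a) ∧ memberᵇ (nrm n a b) D} {xs = upTo (r + (r + t))}
      (∈-upTo⁺ (ℕₚ.≤-<-trans p₃ (ℕₚ.+-monoʳ-< r p₁)))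
      (∧-intro (ℕₚ.<⇒<ᵇ p₁) (∧-intro (ℕₚ.<⇒<ᵇ p₂) (∧-intro (ℕₚ.≤⇒≤ᵇ p₃) (member⁺ q)))))

  module _ {D : Pairs} (P : Period n D r) where

    unshift : ∀ a b → nrm n (r + a) (r + b) ∈ D → nrm n a b ∈ D
    unshift a b q = subst (_∈ D) (trans (cong₂ (nrm n) (back a) (back b)) (nrm-full n a b))
      (period-multiple n r (pred d) P (r + a) (r + b) q)
      where
      back : ∀ a → pred d * r + (r + a) ≡ N + a
      back a = trans (sym (ℕₚ.+-assoc (pred d * r) r a)) (cong (_+ a) (trans (ℕₚ.+-comm (pred d * r) r)
        (trans (cong (_* r) (ℕₚ.suc-pred d {{>-nonZero (ℕₚ.<-trans (s≤s z≤n) 2≤d)}})) (sym N≡))))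

    unshift-multiple : ∀ i a b → nrm n (i * r + a) (i * r + b) ∈ D → nrm n a b ∈ D
    unshift-multiple zero a b q = q
    unshift-multiple (suc i) a b q = unshift-multiple i a b (unshift _ _
      (subst₂ (λ x y → nrm n x y ∈ D) (ℕₚ.+-assoc r (i * r) a) (ℕₚ.+-assoc r (i * r) b) q))

    covers-shift : ∀ t → Covers D t → Covers D (r + t)
    covers-shift t (a , b , p₁ , p₂ , p₃ , q) = r + a , r + b , ℕₚ.+-monoʳ-< r p₁ , ℕₚ.+-monoʳ-< r p₂ , ℕₚ.+-monoʳ-≤ r p₃ , P a b q

    covers-unshift : ∀ t → Covers D (r + (r + t)) → Covers D (r + t)
    covers-unshift t (a , b , p₁ , p₂ , p₃ , q) with ℕₚ.m≤n⇒∃[o]m+o≡n r≤a | ℕₚ.m≤n⇒∃[o]m+o≡n r≤b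
      where
      r≤a : r ≤ a
      r≤a = lia 4 (λ r t a b → r ⊹ (r ⊹ t) ≺ b ⇛ b ≼ r ⊹ a ⇛ ⊩ r ≼ a) r t a b p₂ p₃
      r≤b : r ≤ b
      r≤b = lia 3 (λ r t b → r ⊹ (r ⊹ t) ≺ b ⇛ ⊩ r ≼ b) r t b p₂
    ... | a′ , refl | b′ , refl = a′ , b′ , ℕₚ.+-cancelˡ-< r _ _ p₁ , ℕₚ.+-cancelˡ-< r _ _ p₂ , ℕₚ.+-cancelˡ-≤ r _ _ p₃ , unshift a′ b′ q

    cov-period : ∀ t → cov D (r + t) ≡ cov D t
    cov-period t = T-ext (λ h → cov⁺ D t (covers-unshift t (cov⁻ D (r + t) h))) (λ h → cov⁺ D (r + t) (covers-shift (r + t) (cov⁻ D t h)))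

    multiples-uncovered : T (not (cov D 0)) → ∀ i → ¬ Covers D (r + i * r)
    multiples-uncovered h i c = not-elim h (descent i c)
      where
      descent : ∀ i → Covers D (r + i * r) → T (cov D 0)
      descent zero c = cov⁺ D 0 c
      descent (suc i) c = descent i (covers-unshift (i * r) c)

  cov-rotate : ∀ {D D₀} t → t ≤ N → Rotates n D (N ∸ t) D₀ → ∀ s → cov D (t + s) ≡ cov D₀ s
  cov-rotate {D} {D₀} t t≤N (rotates f g) s = T-ext forth back
    where
    C = N ∸ t
    forth : T (cov D (t + s)) → T (cov D₀ s)
    forth h with cov⁻ D (t + s) h
    ... | a , b , p₁ , p₂ , p₃ , q with ℕₚ.m≤n⇒∃[o]m+o≡n t≤a | ℕₚ.m≤n⇒∃[o]m+o≡n t≤b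
      where
      t≤a : t ≤ a
      t≤a = lia 5 (λ r t s a b → r ⊹ (t ⊹ s) ≺ b ⇛ b ≼ r ⊹ a ⇛ ⊩ t ≼ a) r t s a b p₂ p₃
      t≤b : t ≤ b
      t≤b = lia 4 (λ r t s b → r ⊹ (t ⊹ s) ≺ b ⇛ ⊩ t ≼ b) r t s b p₂
    ... | a′ , refl | b′ , refl = cov⁺ D₀ s (a′ , b′ ,
      lia 4 (λ r t s a → t ⊹ a ≺ r ⊹ (t ⊹ s) ⇛ ⊩ a ≺ r ⊹ s) r t s a′ p₁ ,
      lia 4 (λ r t s b → r ⊹ (t ⊹ s) ≺ t ⊹ b ⇛ ⊩ r ⊹ s ≺ b) r t s b′ p₂ ,
      lia 4 (λ r t a b → t ⊹ b ≼ r ⊹ (t ⊹ a) ⇛ ⊩ b ≼ r ⊹ a) r t a′ b′ p₃ ,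
      subst (_∈ D₀) (trans (cong₂ (nrm n) (unrotate-nrm n t a′ t≤N) (unrotate-nrm n t b′ t≤N)) (nrm-full n a′ b′)) (f _ _ q))
    back : T (cov D₀ s) → T (cov D (t + s))
    back h with cov⁻ D₀ s h
    ... | a , b , p₁ , p₂ , p₃ , q = cov⁺ D (t + s) (t + a , t + b ,
      lia 4 (λ r t s a → a ≺ r ⊹ s ⇛ ⊩ t ⊹ a ≺ r ⊹ (t ⊹ s)) r t s a p₁ ,
      lia 4 (λ r t s b → r ⊹ s ≺ b ⇛ ⊩ r ⊹ (t ⊹ s) ≺ t ⊹ b) r t s b p₂ ,
      lia 4 (λ r t a b → b ≼ r ⊹ a ⇛ ⊩ t ⊹ b ≼ r ⊹ (t ⊹ a)) r t a b p₃ ,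
      g _ _ (subst (_∈ D₀) (sym (trans (cong₂ (nrm n) (unrotate-nrm n t a t≤N) (unrotate-nrm n t b t≤N)) (nrm-full n a b))) q))

  -- The right end of an arc of maximal length is uncovered.
  some-uncovered : ∀ {D} → Noncrossing D → Period n D r → ∃ λ t → ¬ T (cov D t)
  some-uncovered {D} nc P with T? (cov D 0)
  ... | no h = 0 , h
  ... | yes h with cov⁻ D 0 h
  ... | a , b , p₁ , p₂ , p₃ , q = ascend r a b (ℕₚ.<-trans p₁ p₂) p₃ q (ℕₚ.m≤m+n r (b ∸ a))
    where
    ascend : ∀ fuel a b → a < b → b ≤ r + a → nrm n a b ∈ D → r ≤ fuel + (b ∸ a) → ∃ λ t → ¬ T (cov D t)
    ascend fuel a b a<b b≤ q le with T? (cov D b)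
    ... | no h = b , h
    ... | yes h with cov⁻ D b h
    ... | a′ , b′ , p₁ , p₂ , p₃ , q′ with ℕₚ.≤-<-connex a′ (r + a)
    -- The covering arc contains the right end of the rotated arc (r + a , r + b). Starting inside
    -- the latter it would cross it, so it starts no later and is strictly longer.
    ... | inj₂ a<a′ = ⊥-elim (lifts-noncrossing n D nc a<a′ p₁ p₂
      (lia 6 (λ r a b a′ b′ N → b ≼ r ⊹ a ⇛ a′ ≺ r ⊹ b ⇛ b′ ≼ r ⊹ a′ ⇛ r ⊹ r ≼ N ⇛ ⊩ b′ ≺ N ⊹ (r ⊹ a)) r a b a′ b′ N b≤ p₁ p₃ 2r≤N)
      (P a b q) q′)
    ascend zero a b a<b b≤ q le | yes h | a′ , b′ , p₁ , p₂ , p₃ , q′ | inj₁ a′≤a =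
      ⊥-elim (lia 6 (λ r a b a′ b′ x → r ≼ x ⇛ b ≐ a ⊹ x ⇛ a′ ≼ r ⊹ a ⇛ r ⊹ b ≺ b′ ⇛ b′ ≼ r ⊹ a′ ⇛ ⊩⊥) r a b a′ b′ (b ∸ a) le
        (sym (ℕₚ.m+[n∸m]≡n (ℕₚ.<⇒≤ a<b))) a′≤a p₂ p₃)
    ascend (suc fuel) a b a<b b≤ q le | yes h | a′ , b′ , p₁ , p₂ , p₃ , q′ | inj₁ a′≤a = ascend fuel a′ b′ (ℕₚ.<-trans p₁ p₂) p₃ q′
      (lia 8 (λ r a b a′ b′ x y f → r ≼ # 1 ⊹ (f ⊹ x) ⇛ b ≐ a ⊹ x ⇛ b′ ≐ a′ ⊹ y ⇛ a′ ≼ r ⊹ a ⇛ r ⊹ b ≺ b′ ⇛ ⊩ r ≼ f ⊹ y)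
        r a b a′ b′ (b ∸ a) (b′ ∸ a′) fuel le (sym (ℕₚ.m+[n∸m]≡n (ℕₚ.<⇒≤ a<b))) (sym (ℕₚ.m+[n∸m]≡n (ℕₚ.<⇒≤ (ℕₚ.<-trans p₁ p₂)))) a′≤a p₂)

  -- When vertex 0 is uncovered, the `u` trees of `w` stand over the sides of the central polygon
  -- within the period [0 , r], and `w` determines `D`.
  record Central (D : Pairs) (u : ℕ) (w : List ℕ) : Set where
    constructor central
    field
      forest : Forest u w
      total : leaves w ≡ r
      inner⁺ : ∀ {a b} → (a , b) ∈ arcs 0 w → (a , b) ∈ D
      inner⁻ : ∀ {a b} → b ≤ r → (a , b) ∈ D → (a , b) ∈ arcs 0 w

  central-word : ∀ {D} → Good n D → ∃ λ u → ∃ λ w → Central D u w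
  central-word {D} G with parse (r + length A) 0 r A ℕₚ.≤-refl bd (λ p q → Good.uncrossed G (A⊑ p) (A⊑ q))
    where
    A = filterᵇ (λ p → proj₂ p ≤ᵇ r) D
    A⊑ : A ⊑ D
    A⊑ q = proj₁ (∈-filterᵇ⁻ {p = λ p → proj₂ p ≤ᵇ r} {xs = D} q)
    bd : ∀ {a b} → (a , b) ∈ A → 0 ≤ a × suc (suc a) ≤ b × b ≤ 0 + r
    bd {a} {b} q = z≤n , Diagonal.apart (Good.isDiagonal G (A⊑ q)) , ℕₚ.≤ᵇ⇒≤ b r (proj₂ (∈-filterᵇ⁻ {p = λ p → proj₂ p ≤ᵇ r} {xs = D} q))
  ... | u , w , f , e , (s , t) = u , w , central f e
    (λ q → proj₁ (∈-filterᵇ⁻ {p = λ p → proj₂ p ≤ᵇ r} {xs = D} (s q)))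
    (λ b≤r q → t (∈-filterᵇ⁺ {p = λ p → proj₂ p ≤ᵇ r} q (ℕₚ.≤⇒≤ᵇ b≤r)))

  module _ {D u w} (G : Good n D) (P : Period n D r) (C : Central D u w) where
    open Central C

    inner-lift : ∀ {a b} → a < b → b ≤ r → nrm n a b ∈ D → (a , b) ∈ arcs 0 w
    inner-lift a<b b≤r q = inner⁻ b≤r (subst (_∈ D) (nrm-< n a<b (ℕₚ.≤-<-trans b≤r r<N)) q)

    inner-bounds : ∀ {a b} → (a , b) ∈ arcs 0 w → suc (suc a) ≤ b × b ≤ r
    inner-bounds {b = b} q with arcs-bounds 0 forest q
    ... | _ , p₂ , p₃ = p₂ , subst (b ≤_) total p₃

    inner-nrm : ∀ {a b} → (a , b) ∈ arcs 0 w → nrm n a b ∈ D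
    inner-nrm q = subst (_∈ D) (sym (nrm-< n (ℕₚ.<-trans ℕₚ.≤-refl (proj₁ (inner-bounds q))) (ℕₚ.≤-<-trans (proj₂ (inner-bounds q)) r<N))) (inner⁺ q)

    module _ (aligned : T (not (cov D 0))) where

      -- Multiples of `r` are uncovered, so a diagonal spanning at most `r` stays inside one period
      -- [i r , (i + 1) r] and translates back to an arc of `w`.
      lifted : ∀ {x y} → x < N → x < y → y ≤ r + x → nrm n x y ∈ D → nrm n x y ∈ closed n (arcs 0 (power d w))
      lifted {x} {y} x<N x<y y≤ q = subst (λ z → nrm n x y ∈ closed n z) refl
        (∈-map⁺ (λ p → nrm n (proj₁ p) (proj₂ p)) (subst (_∈ arcs 0 (power d w)) (cong₂ _,_ (trans (cong (λ z → i * z + a) total) (sym x≡)) (trans (cong (λ z → i * z + b) total) (sym y≡)))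
          (power-arcs⁺ d 0 i forest i<d (inner-lift a<b b≤r (unshift-multiple P i a b (subst₂ (λ u v → nrm n u v ∈ D) x≡ y≡ q))))))
        where
        instance
          r-nonZero : NonZero r
          r-nonZero = >-nonZero 0<r
        i = x / r
        a = x % r
        b = y ∸ i * r
        x≡ : x ≡ i * r + a
        x≡ = trans (m≡m%n+[m/n]*n x r) (ℕₚ.+-comm a (i * r))
        y≡ : y ≡ i * r + b
        y≡ = sym (ℕₚ.m+[n∸m]≡n (ℕₚ.≤-trans (m/n*n≤m x r) (ℕₚ.<⇒≤ x<y)))
        a<r : a < r
        a<r = m%n<n x r
        a<b : a < b
        a<b = ℕₚ.+-cancelˡ-< (i * r) _ _ (subst₂ _<_ x≡ y≡ x<y)
        b≤r : b ≤ r
        b≤r = ℕₚ.≮⇒≥ λ r<b → multiples-uncovered P aligned i (x , y ,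
          subst₂ _<_ (sym x≡) (ℕₚ.+-comm (i * r) r) (ℕₚ.+-monoʳ-< (i * r) a<r) ,
          subst₂ _<_ (ℕₚ.+-comm (i * r) r) (sym y≡) (ℕₚ.+-monoʳ-< (i * r) r<b) , y≤ , q)
        i<d : i < d
        i<d = ℕₚ.*-cancelʳ-< r i d (ℕₚ.≤-<-trans (m/n*n≤m x r) (subst (x <_) N≡ x<N))

      closed-power : D ≅ closed n (arcs 0 (power d w))
      closed-power = forth , back
        where
        forth : ∀ {p} → p ∈ D → p ∈ closed n (arcs 0 (power d w))
        forth {x , y} q with Good.wellFormed G q
        ... | x<y , y<N with ℕₚ.≤-<-connex y (r + x)
        ... | inj₁ y≤ = subst (_∈ closed n (arcs 0 (power d w))) (nrm-< n x<y y<N)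
          (lifted (ℕₚ.<-trans x<y y<N) x<y y≤ (subst (_∈ D) (sym (nrm-< n x<y y<N)) q))
        ... | inj₂ x+r<y with ℕₚ.≤-<-connex (N + x) (r + y)
        -- Spanning more than `r` on both sides, the diagonal crosses its own rotation by `r`.
        ... | inj₂ y+r<x = ⊥-elim (lifts-noncrossing n D (Good.uncrossed G) (ℕₚ.m<n+m x 0<r) x+r<y (ℕₚ.m<n+m y 0<r) y+r<x q′ (P x y q′))
          where q′ = subst (_∈ D) (sym (nrm-< n x<y y<N)) q
        ... | inj₁ le = subst (_∈ closed n (arcs 0 (power d w))) around
          (lifted y<N (ℕₚ.<-≤-trans y<N (ℕₚ.m≤m+n N x)) le (subst (_∈ D) (sym around) q))
          where
          around : nrm n y (N + x) ≡ (x , y)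
          around = trans (nrm-fullʳ n y x) (trans (nrm-comm n y x) (nrm-< n x<y y<N))
        back : ∀ {p} → p ∈ closed n (arcs 0 (power d w)) → p ∈ D
        back q with ∈-map⁻ (λ p → nrm n (proj₁ p) (proj₂ p)) q
        ... | _ , q′ , refl with power-arcs⁻ d 0 forest q′
        ... | i , a , b , i<d , q″ , refl = subst (_∈ D) (sym (cong (λ z → nrm n (i * z + a) (i * z + b)) total)) (period-multiple n r i P a b (inner-nrm q″))

      covered-inside : ∀ s → 0 < s → s ≤ r → Covers D (r + s) → ∃ λ a → ∃ λ b → a < s × s < b × (a , b) ∈ arcs 0 w
      covered-inside s 0<s s≤r (x , y , p₁ , p₂ , p₃ , q) with ℕₚ.≤-<-connex r x
      ... | inj₂ x<r = ⊥-elim (not-elim aligned (cov⁺ D 0 (x , y , subst (x <_) (sym (ℕₚ.+-identityʳ r)) x<r ,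
        subst (_< y) (sym (ℕₚ.+-identityʳ r)) (ℕₚ.≤-<-trans (ℕₚ.m≤m+n r s) p₂) , p₃ , q)))
      ... | inj₁ r≤x with ℕₚ.≤-<-connex y (r + r)
      ... | inj₂ 2r<y = ⊥-elim (multiples-uncovered P aligned 1 (x , y , subst (λ z → x < r + z) (sym (ℕₚ.+-identityʳ r)) (ℕₚ.<-≤-trans p₁ (ℕₚ.+-monoʳ-≤ r s≤r)) ,
        subst (λ z → r + z < y) (sym (ℕₚ.+-identityʳ r)) 2r<y , p₃ , q))
      ... | inj₁ y≤2r with ℕₚ.m≤n⇒∃[o]m+o≡n r≤x | ℕₚ.m≤n⇒∃[o]m+o≡n (ℕₚ.≤-trans (ℕₚ.m≤m+n r s) (ℕₚ.<⇒≤ p₂))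
      ... | a , refl | b , refl = a , b , ℕₚ.+-cancelˡ-< r _ _ p₁ , ℕₚ.+-cancelˡ-< r _ _ p₂ ,
        inner-lift (ℕₚ.+-cancelˡ-< r _ _ (ℕₚ.<-trans p₁ p₂)) (ℕₚ.+-cancelˡ-≤ r _ _ y≤2r) (unshift P a b q)

      uncovered-ends : ∀ t → t < r → (T (not (cov D (suc t))) → suc t ∈ ends 0 w) × (suc t ∈ ends 0 w → T (not (cov D (suc t))))
      uncovered-ends t t<r =
        (λ h → uncovered⇒end 0 forest (s≤s z≤n) (subst (suc t ≤_) (sym total) t<r) λ {a} {b} q p₁ p₂ →
          not-elim h (cov⁺ D (suc t) (r + a , r + b , ℕₚ.+-monoʳ-< r p₁ , ℕₚ.+-monoʳ-< r p₂ ,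
            ℕₚ.+-monoʳ-≤ r (ℕₚ.≤-trans (proj₂ (inner-bounds q)) (ℕₚ.m≤m+n r a)) , P a b (inner-nrm q)))) ,
        (λ e → not-intro λ h → case covered-inside (suc t) (s≤s z≤n) t<r (cov⁻ D (suc t) h) of λ
          { (a , b , p₁ , p₂ , q) → arcs-uncovered 0 forest e q p₁ p₂ })

      -- `ends` lists right end points, hence the window 1, ..., r in place of 0, ..., r - 1;
      -- periodicity of `cov` makes up for the shift later.
      uncovered-number′ : length (filterᵇ (λ t → not (cov D (suc t))) (upTo r)) ≡ u
      uncovered-number′ = trans (sym (Listₚ.length-map suc (filterᵇ q (upTo r))))
        (trans (length-≡-≅ (Uniqueₚ.map⁺ ℕₚ.suc-injective (Unique-filterᵇ {p = q} (Uniqueₚ.upTo⁺ r))) (Increasing⇒Unique (ends-increasing 0 w)) (forth , back))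
          (ends-length 0 forest))
        where
        q : ℕ → Bool
        q t = not (cov D (suc t))
        forth : map suc (filterᵇ q (upTo r)) ⊑ ends 0 w
        forth h with ∈-map⁻ suc h
        ... | t , t∈ , refl with ∈-filterᵇ⁻ {p = q} {xs = upTo r} t∈
        ... | t∈′ , g = proj₁ (uncovered-ends t (∈-upTo⁻ t∈′)) g
        back : ends 0 w ⊑ map suc (filterᵇ q (upTo r))
        back {zero} h = case ends-lower 0 w h of λ ()
        back {suc t} h = ∈-map⁺ suc (∈-filterᵇ⁺ {p = q} (∈-upTo⁺ t<r) (proj₂ (uncovered-ends t t<r) h))
          where
          t<r : t < r
          t<r = subst (suc t ≤_) total (ends-upper 0 w h)

      central-positive : 0 < u
      central-positive = ℕₚ.n≢0⇒n>0 λ { refl → case forest-0 forest of λ { refl → ℕₚ.<-irrefl total 0<r } }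

      -- For d u ≥ 3 this is `word-pieces` for the repeated word. For d u = 2 the indicator is 0 at
      -- every size, in agreement with a centre that is not a piece.
      central-pieces : ∀ a → pieceCount n D (suc (suc (suc a))) ≡ d * count (suc a) w + indicator (d * u ≡ᵇ suc (suc (suc a)))
      central-pieces a = go (d * u) refl (subst (2 ≤_) refl (ℕₚ.*-mono-≤ 2≤d central-positive))
        where
        W = power d w
        fW : Forest (d * u) W
        fW = power-forest d forest
        leavesW : leaves W ≡ N
        leavesW = trans (power-leaves d w) (trans (cong (d *_) total) (sym N≡))
        go : ∀ U → d * u ≡ U → 2 ≤ U → pieceCount n D (suc (suc (suc a))) ≡ d * count (suc a) w + indicator (U ≡ᵇ suc (suc (suc a)))
        go (suc zero) e (s≤s ())
        go (suc (suc (suc U))) e _ = trans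
          (pieceCount-cong n _ (Good.wellFormed G) (closed-WellFormed n (subst (λ k → Forest k W) e fW) leavesW) closed-power)
          (trans (word-pieces (length W) n W a ℕₚ.≤-refl (subst (λ k → Forest k W) e fW) leavesW)
            (cong (_+ indicator (U ≡ᵇ a)) (power-count (suc a) d w)))
        go (suc (suc zero)) e _ = digon u d e N≡ forest total closed-power
          where
          -- The central digon degenerates to a diagonal; the piece on one side of it serves as the centre instead.
          digon : ∀ u d {w} → d * u ≡ 2 → N ≡ d * r → Forest u w → leaves w ≡ r → D ≅ closed n (arcs 0 (power d w)) →
            pieceCount n D (suc (suc (suc a))) ≡ d * count (suc a) w + 0
          digon zero d e _ _ _ _ = case trans (sym (ℕₚ.*-zeroʳ d)) e of λ ()
          digon (suc (suc u)) zero () _ _ _ _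
          digon (suc (suc u)) (suc d) {w} e g f t s = ⊥-elim (four d u e g)
            where
            four : ∀ d u → suc d * suc (suc u) ≡ 2 → N ≡ suc d * r → ⊥
            four zero u _ g = ℕₚ.<-irrefl (sym (trans g (ℕₚ.+-identityʳ r))) r<N
            four (suc d) u e _ = lia 2 (λ u x → # 2 ⊹ u ⊹ (# 2 ⊹ u ⊹ x) ≐ # 2 ⇛ ⊩⊥) u (d * suc (suc u)) e
          digon (suc zero) d e g f t s with trans (sym (ℕₚ.*-identityʳ d)) e
          digon (suc zero) .2 e g (leaf f) t s | refl with forest-0 f
          ... | refl = ⊥-elim (ℕₚ.<-irrefl (sym (ℕₚ.suc-injective (ℕₚ.suc-injective (trans g (cong (2 *_) (sym t)))))) 1≤n)
          digon (suc zero) .2 e g h@(node {j = j} {w′} f) t (s , s′) | refl = trans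
            (pieceCount-cong n _ (Good.wellFormed G) (closed-WellFormed n f₂ leaves₂) (smaller ∘ s , s′ ∘ there))
            (trans (word-pieces (length W₂) n W₂ a ℕₚ.≤-refl f₂ leaves₂)
              (trans (cong (_+ indicator (j ≡ᵇ a)) (trans (count-++ (suc a) w′ (w₁ ++ [])) (cong (count (suc a) w′ +_) (cong (count (suc a)) (Listₚ.++-identityʳ w₁)))))
                (trans (cong (λ z → count (suc a) w′ + z + indicator (j ≡ᵇ a)) (count-∷ j a w′))
                  (trans (rearrange (count (suc a) w′) (indicator (j ≡ᵇ a))) (cong (λ z → 2 * z + 0) (sym (count-∷ j a w′)))))))
            where
            w₁ = suc j ∷ w′
            W₂ = w′ ++ (w₁ ++ [])
            f₂ : Forest (suc (suc (suc j))) W₂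
            f₂ = subst (λ k → Forest k W₂) (arity j) (forest-++ f (forest-++ h []))
              where
              arity : ∀ j → suc (suc (j + 0)) + (1 + 0) ≡ suc (suc (suc j))
              arity = solve-∀
            leaves₂ : leaves W₂ ≡ N
            leaves₂ = trans (leaves-++ w′ (w₁ ++ [])) (trans (cong₂ _+_ t (trans (cong leaves (Listₚ.++-identityʳ w₁)) t))
              (sym (trans g (cong (r +_) (ℕₚ.+-identityʳ r)))))
            rearrange : ∀ c i → c + (i + c) + i ≡ 2 * (i + c) + 0
            rearrange = solve-∀
            top : head₀ (drop (suc j) (ends 0 w′)) ≡ r
            top = trans (forest-root h) t
            first : arcs 0 (power 2 w₁) ≡ arcs 0 w₁ ++ arcs (leaves w′) (w₁ ++ [])
            first = arcs-++ 0 (w₁ ++ []) h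
            -- Closing identifies the root arcs [0 , r] and [r , n + 2] of the two copies, so the
            -- diagonal survives the removal of the first root.
            opposite : (r , N) ∈ arcs 0 W₂
            opposite = subst ((r , N) ∈_) (sym (arcs-++ 0 (w₁ ++ []) f)) (∈-++⁺ʳ (arcs 0 w′)
              (subst₂ (λ x v → (r , N) ∈ arcs x v) (sym t) (sym (Listₚ.++-identityʳ w₁))
                (subst (_∈ arcs r w₁) (cong₂ _,_ (ℕₚ.+-identityʳ r) (trans (cong (r +_) top) (sym (trans g (cong (r +_) (ℕₚ.+-identityʳ r))))))
                  (translate-∈ {x = r} h (here refl)))))
            smaller : ∀ {p} → p ∈ closed n (arcs 0 (power 2 w₁)) → p ∈ closed n (arcs 0 W₂)
            smaller (there q) = q
            smaller (here refl) = subst (_∈ closed n (arcs 0 W₂))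
              (trans (nrm-last n r<N) (sym (trans (cong (λ z → nrm n 0 z) (trans (cong proj₂ (Listₚ.∷-injectiveˡ first)) top)) (nrm-< n 0<r r<N))))
              (∈-map⁺ (λ p → nrm n (proj₁ p) (proj₂ p)) opposite)

-- Averaging over the vertices

tally : (ℕ → Bool) → ℕ → ℕ
tally f zero = 0
tally f (suc r) = indicator (f 0) + tally (f ∘ suc) r

tally-filterᵇ : ∀ f (g : ℕ → ℕ) r → length (filterᵇ f (List.applyUpTo g r)) ≡ tally (f ∘ g) r
tally-filterᵇ f g zero = refl
tally-filterᵇ f g (suc r) with f (g 0)
... | true = cong suc (tally-filterᵇ f (g ∘ suc) r)
... | false = tally-filterᵇ f (g ∘ suc) r

tally-last : ∀ f r → tally f (suc r) ≡ tally f r + indicator (f r)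
tally-last f zero = ℕₚ.+-comm (indicator (f 0)) 0
tally-last f (suc r) = trans (cong (indicator (f 0) +_) (tally-last (f ∘ suc) r)) (sym (ℕₚ.+-assoc (indicator (f 0)) (tally (f ∘ suc) r) _))

tally-cong : ∀ {f g} r → (∀ t → f t ≡ g t) → tally f r ≡ tally g r
tally-cong zero h = refl
tally-cong (suc r) h = cong₂ (λ x y → indicator x + y) (h 0) (tally-cong r (h ∘ suc))

tally-shift : ∀ f r c → (∀ t → f (r + t) ≡ f t) → tally (λ t → f (c + t)) r ≡ tally f r
tally-shift f r zero h = refl
tally-shift f r (suc c) h = trans (tally-shift (f ∘ suc) r c (λ t → trans (cong f (sym (ℕₚ.+-suc r t))) (h (suc t))))
  (ℕₚ.+-cancelˡ-≡ (indicator (f 0)) _ _ (trans (tally-last f r) (trans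
    (cong (λ b → tally f r + indicator b) (trans (cong f (sym (ℕₚ.+-identityʳ r))) (h 0))) (ℕₚ.+-comm (tally f r) _))))

double-count : ∀ {A B : Set} (R : A → B → Bool) xs ys u v →
  (∀ {x} → x ∈ xs → length (filterᵇ (R x) ys) ≡ u) → (∀ {y} → y ∈ ys → length (filterᵇ (λ x → R x y) xs) ≡ v) →
  length xs * u ≡ length ys * v
double-count R xs ys u v f g = trans (sym (constant xs f)) (trans (swap xs ys) (constant ys g))
  where
  constant : ∀ {A : Set} {h : A → ℕ} {c} zs → (∀ {z} → z ∈ zs → h z ≡ c) → sum (map h zs) ≡ length zs * c
  constant [] e = refl
  constant (z ∷ zs) e = cong₂ _+_ (e (here refl)) (constant zs (e ∘ there))
  zero-row : ∀ ys → 0 ≡ sum (map (λ y → length (filterᵇ (λ x → R x y) [])) ys)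
  zero-row [] = refl
  zero-row (y ∷ ys) = zero-row ys
  add-row : ∀ x xs ys → length (filterᵇ (R x) ys) + sum (map (λ y → length (filterᵇ (λ x → R x y) xs)) ys) ≡
    sum (map (λ y → length (filterᵇ (λ x → R x y) (x ∷ xs))) ys)
  add-row x xs [] = refl
  add-row x xs (y ∷ ys) with R x y
  ... | true = trans (shuffle (length (filterᵇ (R x) ys)) (length (filterᵇ (λ x → R x y) xs)) _) (cong (λ z → suc (length (filterᵇ (λ x → R x y) xs) + z)) (add-row x xs ys))
    where
    shuffle : ∀ a b c → suc a + (b + c) ≡ suc (b + (a + c))
    shuffle = solve-∀
  ... | false = trans (shuffle (length (filterᵇ (R x) ys)) (length (filterᵇ (λ x → R x y) xs)) _) (cong (length (filterᵇ (λ x → R x y) xs) +_) (add-row x xs ys))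
    where
    shuffle : ∀ a b c → a + (b + c) ≡ b + (a + c)
    shuffle = solve-∀
  swap : ∀ xs ys → sum (map (λ x → length (filterᵇ (R x) ys)) xs) ≡ sum (map (λ y → length (filterᵇ (λ x → R x y) xs)) ys)
  swap [] ys = zero-row ys
  swap (x ∷ xs) ys = trans (cong (length (filterᵇ (R x) ys) +_) (swap xs ys)) (add-row x xs ys)

indicator-≤1 : ∀ b → indicator b ≤ 1
indicator-≤1 true = ℕₚ.≤-refl
indicator-≤1 false = z≤n

module Averaging (n d r : ℕ) (N≡ : suc (suc n) ≡ d * r) (2≤d : 2 ≤ d) (1≤n : 1 ≤ n)
  (lam : List ℕ) (part : IsPartition n lam) (k : ℕ)
  (k⇒r : ∀ {D} → Period n D k → Period n D r) (r⇒k : ∀ {D} → Period n D r → Period n D k) where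

  open Symmetric n d r N≡ 2≤d 1≤n

  instance
    d-nonZero : NonZero d
    d-nonZero = >-nonZero (ℕₚ.<-trans (s≤s z≤n) 2≤d)

  b : List ℕ
  b = map (λ j → count (suc j) lam / d) (upTo n)

  fixed : List Pairs
  fixed = filterᵇ (fixedBy n k) (Slam n lam)

  record Fixed (D : Pairs) : Set where
    constructor isFixed
    field
      slam : InSlam n lam D
      period : Period n D r

  fixed⁻ : ∀ {D} → D ∈ fixed → Fixed D
  fixed⁻ {D} q with ∈-filterᵇ⁻ {p = fixedBy n k} {xs = Slam n lam} q
  ... | D∈ , t = isFixed (Slam⁻ n lam D∈) (k⇒r (fixedBy⁻ n k D t (InSlam.wellFormed (Slam⁻ n lam D∈))))

  fixed⁺ : ∀ {D} → Fixed D → D ∈ fixed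
  fixed⁺ {D} (isFixed S P) = ∈-filterᵇ⁺ {p = fixedBy n k} (Slam⁺ n lam S) (fixedBy⁺ n k D (InSlam.wellFormed S) (r⇒k P))

  fixed-Unique : Unique fixed
  fixed-Unique = Unique-filterᵇ {p = fixedBy n k} (Slam-Unique n lam)

  fixed-ext : ∀ {D E} → Fixed D → Fixed E → D ≅ E → D ≡ E
  fixed-ext F G = subsets-ext (diagonals-Unique n) (InSlam.subset (Fixed.slam F)) (InSlam.subset (Fixed.slam G))

  -- The conditions that an invariant dissection imposes on λ: apart from the central (d u)-gon,
  -- pieces come in orbits of size `d`. By `size`, λ and `d` determine `u`, so all invariant
  -- dissections have equally large centres and the double count has a constant factor.
  record Compatible (u : ℕ) : Set where
    constructor compatible
    field
      positive : 0 < u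
      typed : ∀ a → a < n → count (suc a) lam ≡ d * (count (suc a) lam / d) + indicator (d * u ≡ᵇ suc (suc (suc a)))
      size : u + weight b ≡ r

  quotient : ∀ c e → e < d → (d * c + e) / d ≡ c
  quotient c e e<d = trans (cong (λ z → (z + e) / d) (ℕₚ.*-comm d c)) (trans (+-distrib-/-∣ˡ e (divides c refl))
    (trans (cong₂ _+_ (m*n/n≡m c d) (m<n⇒m/n≡0 e<d)) (ℕₚ.+-identityʳ c)))

  compatible-unique : ∀ {u v} → Compatible u → Compatible v → u ≡ v
  compatible-unique (compatible _ _ e) (compatible _ _ f) = ℕₚ.+-cancelʳ-≡ (weight b) _ _ (trans e (sym f))

  module _ {D u w} (F : Fixed D) (C : Central D u w) (aligned : T (not (cov D 0))) where
    open Fixed F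
    open Central C

    private
      G : Good n D
      G = InSlam⇒Good slam

      counts : ∀ a → a < n → count (suc a) lam ≡ d * count (suc a) w + indicator (d * u ≡ᵇ suc (suc (suc a)))
      counts a a<n = trans (sym (InSlam.typed slam a a<n)) (central-pieces G period C aligned a)

      quotients : ∀ a → a < n → count (suc a) w ≡ count (suc a) lam / d
      -- The indicator is at most 1 < d, so division by `d` recovers the multiplicity in `w`.
      quotients a a<n = sym (trans (cong (_/ d) (counts a a<n)) (quotient (count (suc a) w) _ (ℕₚ.≤-<-trans (indicator-≤1 _) 2≤d)))

      sum-w : sum w ≤ n
      sum-w = s≤s⁻¹ (s≤s⁻¹ (ℕₚ.≤-trans (s≤s (subst (suc (sum w) ≤_) (trans (sym (forest-leaves forest)) total) (ℕₚ.+-monoˡ-≤ (sum w) (central-positive G period C aligned)))) r<N))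

    central-content : Content w b
    central-content = content-upTo n (λ j → count (suc j) lam / d) w sum-w quotients

    central-compatible : Compatible u
    central-compatible = compatible (central-positive G period C aligned)
      (λ a a<n → trans (counts a a<n) (cong (λ z → d * z + indicator (d * u ≡ᵇ suc (suc (suc a)))) (quotients a a<n)))
      (trans (cong (u +_) (sym (proj₁ (content-stats w b central-content)))) (trans (sym (forest-leaves forest)) total))

    central-∈-words : w ∈ words (r + sum b) u b
    central-∈-words = subst (λ z → w ∈ words z u b) (trans (proj₂ (content-stats w b central-content)) (cong (_+ sum b) total))
      (words-complete b forest central-content)

  module FromWord {u w} (0<u : 0 < u) (f : Forest u w) (e : leaves w ≡ r) where

    W : List ℕ
    W = power d w

    D : Pairs
    D = restrict n (closed n (arcs 0 W))

    inside : ∀ {a b} → (a , b) ∈ arcs 0 w → suc (suc a) ≤ b × b ≤ r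
    inside {b = b} q with arcs-bounds 0 f q
    ... | _ , p₂ , p₃ = p₂ , subst (b ≤_) e p₃

    -- the arc (a , b) of w in the i-th copy of the fundamental interval
    data Copy : Pair → Set where
      copy : ∀ i a b → i < d → (a , b) ∈ arcs 0 w → Copy (nrm n (i * r + a) (i * r + b))

    copy⁻ : ∀ {p} → p ∈ closed n (arcs 0 W) → Copy p
    copy⁻ q with ∈-map⁻ (λ p → nrm n (proj₁ p) (proj₂ p)) q
    ... | _ , q′ , refl with power-arcs⁻ d 0 f q′
    ... | i , a , b , i<d , q″ , refl = subst (λ z → Copy (nrm n (i * z + a) (i * z + b))) (sym e) (copy i a b i<d q″)

    copy⁺ : ∀ {p} → Copy p → p ∈ closed n (arcs 0 W)
    copy⁺ (copy i a b i<d q) = ∈-map⁺ (λ p → nrm n (proj₁ p) (proj₂ p))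
      (subst (λ z → (i * z + a , i * z + b) ∈ arcs 0 W) e (power-arcs⁺ d 0 i f i<d q))

    copy-bound : ∀ {i b} → i < d → b ≤ r → i * r + b ≤ N
    copy-bound {i} {b} i<d b≤r = ℕₚ.≤-trans (ℕₚ.+-monoʳ-≤ (i * r) b≤r)
      (subst₂ _≤_ (ℕₚ.+-comm r (i * r)) (sym N≡) (ℕₚ.*-monoˡ-≤ r i<d))

    copy-view : ∀ {p} → Copy p → ∃ λ i → ∃ λ a → ∃ λ b → i < d × (a , b) ∈ arcs 0 w ×
      ((i * r + b < N × p ≡ (i * r + a , i * r + b)) ⊎ (i * r + b ≡ N × p ≡ (0 , i * r + a)))
    copy-view (copy i a b i<d q) with ℕₚ.m≤n⇒m<n∨m≡n (copy-bound i<d (proj₂ (inside q)))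
    ... | inj₁ h = i , a , b , i<d , q , inj₁ (h , nrm-< n (ℕₚ.+-monoʳ-< (i * r) (ℕₚ.<-trans ℕₚ.≤-refl (proj₁ (inside q)))) h)
    ... | inj₂ h = i , a , b , i<d , q , inj₂ (h , trans (cong (nrm n (i * r + a)) h)
      (nrm-last n (subst (i * r + a <_) h (ℕₚ.+-monoʳ-< (i * r) (ℕₚ.<-trans ℕₚ.≤-refl (proj₁ (inside q)))))))

    copy-diagonal : ∀ {p} → Copy p → Diagonal n p
    copy-diagonal c with copy-view c
    ... | i , a , b , i<d , q , inj₁ (h , refl) = diagonal (subst (_≤ i * r + b) (trans (ℕₚ.+-suc (i * r) (suc a)) (cong suc (ℕₚ.+-suc (i * r) a))) (ℕₚ.+-monoʳ-≤ (i * r) (proj₁ (inside q)))) h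
      (λ e₀ e₁ → lia 5 (λ x a b r n → x ⊹ a ≐ # 0 ⇛ # 1 ⊹ (x ⊹ b) ≐ # 2 ⊹ n ⇛ # 2 ⊹ a ≼ b ⇛ b ≼ r ⇛ r ⊹ r ≼ # 2 ⊹ n ⇛ ⊩⊥)
        (i * r) a b r n e₀ e₁ (proj₁ (inside q)) (proj₂ (inside q)) 2r≤N)
    ... | i , a , b , i<d , q , inj₂ (h , refl) = diagonal
      (lia 5 (λ x a b r n → x ⊹ b ≐ # 2 ⊹ n ⇛ # 2 ⊹ a ≼ b ⇛ b ≼ r ⇛ r ⊹ r ≼ # 2 ⊹ n ⇛ ⊩ # 2 ≼ x ⊹ a) (i * r) a b r n h (proj₁ (inside q)) (proj₂ (inside q)) 2r≤N)
      (lia 4 (λ x a b n → x ⊹ b ≐ # 2 ⊹ n ⇛ # 2 ⊹ a ≼ b ⇛ ⊩ x ⊹ a ≺ # 2 ⊹ n) (i * r) a b n h (proj₁ (inside q)))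
      (λ _ e₁ → lia 4 (λ x a b n → x ⊹ b ≐ # 2 ⊹ n ⇛ # 2 ⊹ a ≼ b ⇛ # 1 ⊹ (x ⊹ a) ≐ # 2 ⊹ n ⇛ ⊩⊥) (i * r) a b n h (proj₁ (inside q)) e₁)

    D≅ : D ≅ closed n (arcs 0 W)
    D≅ = restrict-≅ n (λ q → copy-diagonal (copy⁻ q))

    leavesW : leaves W ≡ N
    leavesW = trans (power-leaves d w) (trans (cong (d *_) e) (sym N≡))

    good-D : Good n D
    good-D = good (λ q → copy-diagonal (copy⁻ (proj₁ D≅ q))) λ p q →
      closed-noncrossing n (arcs 0 W) (λ {a} {b} s → let (_ , p₂ , p₃) = arcs-bounds 0 (power-forest d f) s in ℕₚ.<-trans ℕₚ.≤-refl p₂ , subst (b ≤_) leavesW p₃)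
        (arcs-noncrossing 0 (power-forest d f)) (proj₁ D≅ p) (proj₁ D≅ q)

    period-D : Period n D r
    period-D x y q = proj₂ D≅ (copy⁺ (subst Copy (nrm-rotate n r x y) (step (copy⁻ (proj₁ D≅ q)))))
      where
      step : ∀ {p} → Copy p → Copy (nrm n (r + proj₁ p) (r + proj₂ p))
      step (copy i a b i<d q) with ℕₚ.m≤n⇒m<n∨m≡n i<d
      ... | inj₁ h = subst Copy (sym (trans (nrm-rotate n r (i * r + a) (i * r + b)) (cong₂ (nrm n) (sym (ℕₚ.+-assoc r (i * r) a)) (sym (ℕₚ.+-assoc r (i * r) b))))) (copy (suc i) a b h q)
      ... | inj₂ h = subst Copy (sym (trans (nrm-rotate n r (i * r + a) (i * r + b)) (trans (cong₂ (nrm n) (wrap a) (wrap b)) (nrm-full n a b)))) (copy 0 a b (ℕₚ.≤-<-trans z≤n i<d) q)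
        where
        wrap : ∀ a → r + (i * r + a) ≡ N + a
        wrap a = trans (sym (ℕₚ.+-assoc r (i * r) a)) (cong (_+ a) (trans (cong (_* r) h) (sym N≡)))

    low-copy : ∀ i x → i * r + x < r → i ≡ 0
    low-copy zero x h = refl
    low-copy (suc i) x h = ⊥-elim (ℕₚ.<⇒≱ h (ℕₚ.≤-trans (ℕₚ.m≤m+n r (i * r)) (ℕₚ.m≤m+n (r + i * r) x)))

    aligned-D : T (not (cov D 0))
    aligned-D = not-intro λ h → case cov⁻ D 0 h of λ { (x , y , p₁ , p₂ , p₃ , q) →
      contradict x y (subst (x <_) (ℕₚ.+-identityʳ r) p₁) (subst (_< y) (ℕₚ.+-identityʳ r) p₂) p₃ (proj₁ D≅ q) }
      where
      contradict : ∀ x y → x < r → r < y → y ≤ r + x → nrm n x y ∈ closed n (arcs 0 W) → ⊥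
      contradict x y x<r r<y y≤ q with copy-view (subst Copy (nrm-< n (ℕₚ.<-trans x<r r<y) (ℕₚ.≤-<-trans y≤ (ℕₚ.<-≤-trans (ℕₚ.+-monoʳ-< r x<r) 2r≤N))) (copy⁻ q))
      ... | i , a , b , i<d , q′ , inj₁ (h , refl) = ℕₚ.<⇒≱ r<y (subst (λ z → z * r + b ≤ r) (sym (low-copy i a x<r)) (proj₂ (inside q′)))
      ... | i , a , b , i<d , q′ , inj₂ (h , refl) = ℕₚ.<⇒≱ r<y (subst (i * r + a ≤_) (ℕₚ.+-identityʳ r) y≤)

    central-D : Central D u w
    central-D = central f e inner⁺ inner⁻
      where
      inner⁺ : ∀ {a b} → (a , b) ∈ arcs 0 w → (a , b) ∈ D
      inner⁺ {a} {b} q = proj₂ D≅ (copy⁺ (subst Copy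
        (nrm-< n (ℕₚ.<-trans ℕₚ.≤-refl (proj₁ (inside q))) (ℕₚ.≤-<-trans (proj₂ (inside q)) r<N)) (copy 0 a b (ℕₚ.<-trans (s≤s z≤n) 2≤d) q)))
      inner⁻ : ∀ {a b} → b ≤ r → (a , b) ∈ D → (a , b) ∈ arcs 0 w
      inner⁻ b≤r q with copy-view (copy⁻ (proj₁ D≅ q))
      ... | zero , a , b , i<d , q′ , inj₁ (h , refl) = q′
      ... | suc i , a , b , i<d , q′ , inj₁ (h , refl) = ⊥-elim (lia 4 (λ r x a b → r ⊹ x ⊹ b ≼ r ⇛ # 2 ⊹ a ≼ b ⇛ ⊩⊥) r (i * r) a b b≤r (proj₁ (inside q′)))
      ... | zero , a , b , i<d , q′ , inj₂ (h , refl) = ⊥-elim (ℕₚ.<⇒≱ r<N (subst (_≤ r) h (proj₂ (inside q′))))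
      -- Only a diameter arrives here: an arc ending at n + 2 closes to a pair starting at 0, and
      -- the bound `r` together with 2 r ≤ n + 2 forces `a` = 0 and `b` = `r`. The arc (0 , r) of
      -- `w` is then the same diagonal.
      ... | suc i , a , b , i<d , q′ , inj₂ (h , refl) = subst (_∈ arcs 0 w) (cong₂ _,_
        (lia 5 (λ r x a b n → r ⊹ x ⊹ a ≼ r ⇛ ⊩ a ≐ # 0) r (i * r) a b n b≤r)
        (lia 5 (λ r x a b n → r ⊹ x ⊹ a ≼ r ⇛ r ⊹ x ⊹ b ≐ # 2 ⊹ n ⇛ r ⊹ r ≼ # 2 ⊹ n ⇛ b ≼ r ⇛ ⊩ b ≐ r ⊹ x ⊹ a) r (i * r) a b n b≤r h 2r≤N (proj₂ (inside q′)))) q′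

  aligned : ℕ → List Pairs
  aligned t = filterᵇ (λ D → not (cov D t)) fixed

  aligned⁻ : ∀ t {D} → D ∈ aligned t → Fixed D × T (not (cov D t))
  aligned⁻ t q with ∈-filterᵇ⁻ {p = λ D → not (cov D t)} {xs = fixed} q
  ... | D∈ , h = fixed⁻ D∈ , h

  aligned⁺ : ∀ t {D} → Fixed D → T (not (cov D t)) → D ∈ aligned t
  aligned⁺ t F h = ∈-filterᵇ⁺ {p = λ D → not (cov D t)} (fixed⁺ F) h

  aligned-Unique : ∀ t → Unique (aligned t)
  aligned-Unique t = Unique-filterᵇ {p = λ D → not (cov D t)} fixed-Unique

  module _ {u} (K : Compatible u) where
    open Compatible K

    encode-central : ∀ {D} → D ∈ aligned 0 → ∃ λ w → w ∈ words (r + sum b) u b × Central D u w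
    encode-central {D} q with aligned⁻ 0 q
    ... | F , h with central-word (InSlam⇒Good (Fixed.slam F))
    ... | v , w , C with compatible-unique K (central-compatible F C h)
    ... | refl = w , central-∈-words F C h , C

    decode-central : ∀ {w} → w ∈ words (r + sum b) u b → ∃ λ D → D ∈ aligned 0 × Central D u w
    decode-central {w} q with words-sound (r + sum b) u b q
    ... | f , _ , c = D , aligned⁺ 0 (isFixed (inSlam (restrict-∈ n (closed n (arcs 0 W))) (Good.uncrossed good-D) types) period-D) aligned-D , central-D
      where
      open FromWord positive f (trans (forest-leaves f) (trans (cong (u +_) (proj₁ (content-stats w b c))) size))
      types : ∀ j → j < n → pieceCount n D (suc (suc (suc j))) ≡ count (suc j) lam
      types j j<n = trans (central-pieces good-D period-D central-D aligned-D j)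
        (trans (cong (λ z → d * z + indicator (d * u ≡ᵇ suc (suc (suc j)))) (trans (c j) (nth-map-applyUpTo (λ j → count (suc j) lam / d) id n j j<n)))
          (sym (typed j j<n)))

    aligned-length : length (aligned 0) ≡ length (words (r + sum b) u b)
    aligned-length = ℕₚ.≤-antisym
      (length-≤-injection (aligned-Unique 0) (λ p → proj₁ (encode-central p)) (λ p → proj₁ (proj₂ (encode-central p)))
        (λ {x} {y} p q e → same-dissection (aligned⁻ 0 p) (aligned⁻ 0 q) (proj₂ (proj₂ (encode-central p))) (subst (Central y u) (sym e) (proj₂ (proj₂ (encode-central q))))))
      (length-≤-injection (words-Unique (r + sum b) u b) (λ p → proj₁ (decode-central p)) (λ p → proj₁ (proj₂ (decode-central p)))
        (λ {x} {y} p q e → same-word (proj₂ (proj₂ (decode-central p))) (subst (λ D → Central D u y) (sym e) (proj₂ (proj₂ (decode-central q))))))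
      where
      same-dissection : ∀ {D E w} → Fixed D × T (not (cov D 0)) → Fixed E × T (not (cov E 0)) → Central D u w → Central E u w → D ≡ E
      same-dissection (F , h) (G , g) C B = fixed-ext F G ((λ q → proj₂ s (proj₁ t q)) , (λ q → proj₂ t (proj₁ s q)))
        where
        t = closed-power (InSlam⇒Good (Fixed.slam F)) (Fixed.period F) C h
        s = closed-power (InSlam⇒Good (Fixed.slam G)) (Fixed.period G) B g
      same-word : ∀ {D w z} → Central D u w → Central D u z → w ≡ z
      same-word (central f e p₁ p₂) (central g h q₁ q₂) = arcs-injective 0 f g (trans e (sym h))
        ((λ s → q₂ (subst (_ ≤_) e (proj₂ (proj₂ (arcs-bounds 0 f s)))) (p₁ s)) , (λ s → p₂ (subst (_ ≤_) h (proj₂ (proj₂ (arcs-bounds 0 g s)))) (q₁ s)))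

  rotate-fixed : ∀ c {D} → c ≤ N → Fixed D → ∃ λ D′ → Fixed D′ × Rotates n D c D′
  rotate-fixed c {D} c≤N (isFixed S P) = proj₁ rotation , isFixed (proj₁ (proj₂ rotation)) (rotates-period n {D} {c} r c≤N (proj₂ (proj₂ rotation)) P) , proj₂ (proj₂ rotation)
    where
    rotation : ∃ λ D′ → InSlam n lam D′ × Rotates n D c D′
    rotation = rotate-InSlam n lam c D c≤N S

  rotates-injective : ∀ {D E c X} → Fixed D → Fixed E → Rotates n D c X → Rotates n E c X → D ≡ E
  rotates-injective F G R S = fixed-ext F G (half F G R S , half G F S R)
    where
    half : ∀ {D E c X} → Fixed D → Fixed E → Rotates n D c X → Rotates n E c X → D ⊑ E
    half {D} {E} F G (rotates f _) (rotates _ g) {a , b} q = subst (_∈ E) e (g a b (f a b (subst (_∈ D) (sym e) q)))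
      where e = uncurry (nrm-< n) (InSlam.wellFormed (Fixed.slam F) q)

  -- Rotation by -t carries the invariant dissections with `t` on the centre injectively to those
  -- with 0 on the centre, and rotation by `t` goes back.
  aligned-rotate : ∀ t → t ≤ N → length (aligned t) ≡ length (aligned 0)
  aligned-rotate t t≤N = ℕₚ.≤-antisym
    (length-≤-injection (aligned-Unique t) (λ p → proj₁ (back p)) (λ p → proj₁ (proj₂ (back p)))
      (λ {x} {y} p q e → rotates-injective (proj₁ (aligned⁻ t p)) (proj₁ (aligned⁻ t q)) (proj₂ (proj₂ (back p))) (subst (Rotates n y (N ∸ t)) (sym e) (proj₂ (proj₂ (back q))))))
    (length-≤-injection (aligned-Unique 0) (λ p → proj₁ (forth p)) (λ p → proj₁ (proj₂ (forth p)))
      (λ {x} {y} p q e → rotates-injective (proj₁ (aligned⁻ 0 p)) (proj₁ (aligned⁻ 0 q)) (proj₂ (proj₂ (forth p))) (subst (Rotates n y t) (sym e) (proj₂ (proj₂ (forth q))))))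
    where
    back : ∀ {D} → D ∈ aligned t → ∃ λ D′ → D′ ∈ aligned 0 × Rotates n D (N ∸ t) D′
    back {D} q = D′ , aligned⁺ 0 (proj₁ (proj₂ rotation))
      (subst (T ∘ not) (trans (cong (cov D) (sym (ℕₚ.+-identityʳ t))) (cov-rotate t t≤N (proj₂ (proj₂ rotation)) 0)) (proj₂ (aligned⁻ t q))) , proj₂ (proj₂ rotation)
      where
      rotation = rotate-fixed (N ∸ t) (ℕₚ.m∸n≤m N t) (proj₁ (aligned⁻ t q))
      D′ = proj₁ rotation
    forth : ∀ {D} → D ∈ aligned 0 → ∃ λ D′ → D′ ∈ aligned t × Rotates n D t D′
    forth {D} q = D′ , aligned⁺ t (proj₁ (proj₂ rotation))
      (subst (T ∘ not) (sym (trans (cong (cov D′) (sym (ℕₚ.+-identityʳ t))) (cov-rotate t t≤N (rotates-inverse n {D} {t} {D′} t≤N (proj₂ (proj₂ rotation))) 0))) (proj₂ (aligned⁻ 0 q))) , proj₂ (proj₂ rotation)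
      where
      rotation = rotate-fixed t t≤N (proj₁ (aligned⁻ 0 q))
      D′ = proj₁ rotation

  -- Rotating an uncovered vertex to 0 makes the word of the centre available, whose ends are the
  -- uncovered vertices of one period. Since `cov` has period `r`, the count does not depend on
  -- where the window of length `r` begins.
  uncovered-number : ∀ {D} → Fixed D → ∃ λ u → Compatible u × length (filterᵇ (λ t → not (cov D t)) (upTo r)) ≡ u
  uncovered-number {D} F with some-uncovered (InSlam.uncrossed (Fixed.slam F)) (Fixed.period F)
  ... | t , h = u , central-compatible F₀ C aligned₀ , counted
    where
    instance
      r-nonZero : NonZero r
      r-nonZero = >-nonZero 0<r
    t₀ = t % r
    t₀≤N : t₀ ≤ N
    t₀≤N = ℕₚ.<⇒≤ (ℕₚ.<-trans (m%n<n t r) r<N)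
    reduce : ∀ i s → cov D (i * r + s) ≡ cov D s
    reduce zero s = refl
    reduce (suc i) s = trans (cong (cov D) (ℕₚ.+-assoc r (i * r) s)) (trans (cov-period (Fixed.period F) (i * r + s)) (reduce i s))
    rotation = rotate-fixed (N ∸ t₀) (ℕₚ.m∸n≤m N t₀) F
    D₀ = proj₁ rotation
    F₀ : Fixed D₀
    F₀ = proj₁ (proj₂ rotation)
    same : ∀ s → cov D (t₀ + s) ≡ cov D₀ s
    same = cov-rotate t₀ t₀≤N (proj₂ (proj₂ rotation))
    aligned₀ : T (not (cov D₀ 0))
    aligned₀ = not-intro λ g → h (subst T (trans (trans (sym (same 0)) (cong (cov D) (ℕₚ.+-identityʳ t₀)))
      (trans (sym (reduce (t / r) t₀)) (cong (cov D) (trans (ℕₚ.+-comm (t / r * r) t₀) (sym (m≡m%n+[m/n]*n t r)))))) g)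
    word = central-word (InSlam⇒Good (Fixed.slam F₀))
    u = proj₁ word
    C : Central D₀ u (proj₁ (proj₂ word))
    C = proj₂ (proj₂ word)
    counted : length (filterᵇ (λ t → not (cov D t)) (upTo r)) ≡ u
    counted = trans (tally-filterᵇ (not ∘ cov D) id r)
      (trans (sym (tally-shift (not ∘ cov D) r t₀ (λ s → cong not (cov-period (Fixed.period F) s))))
        (trans (tally-cong r (λ s → cong not (same s)))
          (trans (sym (tally-shift (not ∘ cov D₀) r 1 (λ s → cong not (cov-period (Fixed.period F₀) s))))
            (trans (sym (tally-filterᵇ (λ t → not (cov D₀ (suc t))) id r))
              (uncovered-number′ (InSlam⇒Good (Fixed.slam F₀)) (Fixed.period F₀) C aligned₀)))))

  fixed-average : ∀ {u} → Compatible u → length fixed * u ≡ r * length (words (r + sum b) u b)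
  fixed-average {u} K = trans
    (double-count (λ D t → not (cov D t)) fixed (upTo r) u (length (aligned 0))
      (λ q → let (v , L , e) = uncovered-number (fixed⁻ q) in trans e (compatible-unique L K))
      (λ {t} q → aligned-rotate t (ℕₚ.<⇒≤ (ℕₚ.<-≤-trans (∈-upTo⁻ q) r≤N))))
    (cong₂ _*_ (Listₚ.length-upTo r) (aligned-length K))

  -- The factor `u` of `words-number` cancels against the `u` uncovered vertices per period, and the
  -- factor `r` of the average turns r! into (r - 1)!.
  fixed-number : ∀ {u} → Compatible u → fixCount n lam k * (pred r) ! * factorials b ≡ (pred r + sum b) !
  fixed-number {u} K = ℕₚ.*-cancelʳ-≡ _ _ u {{>-nonZero positive}} (begin
    length fixed * (pred r) ! * factorials b * u
      ≡⟨ rearrange (length fixed) ((pred r) !) (factorials b) u ⟩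
    (length fixed * u) * ((pred r) ! * factorials b)
      ≡⟨ cong (_* ((pred r) ! * factorials b)) (fixed-average K) ⟩
    r * length (words (r + sum b) u b) * ((pred r) ! * factorials b)
      ≡⟨ cong (λ z → z * length (words (z + sum b) u b) * ((pred r) ! * factorials b)) (sym r≡) ⟩
    suc (pred r) * L * ((pred r) ! * factorials b)
      ≡⟨ rearrange′ (pred r) L ((pred r) !) (factorials b) ⟩
    L * (suc (pred r)) ! * factorials b
      ≡⟨ cong (λ z → L * z ! * factorials b) (trans r≡ (sym size)) ⟩
    L * (u + weight b) ! * factorials b
      ≡⟨ words-number (pred r + sum b) u b (cong (_+ sum b) (trans r≡ (sym size))) ⟩
    u * (pred r + sum b) !
      ≡⟨ ℕₚ.*-comm u _ ⟩
    (pred r + sum b) ! * u ∎)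
    where
    open ≡-Reasoning
    open Compatible K
    r≡ : suc (pred r) ≡ r
    r≡ = ℕₚ.suc-pred r {{>-nonZero 0<r}}
    L = length (words (suc (pred r) + sum b) u b)
    rearrange : ∀ f p q u → f * p * q * u ≡ (f * u) * (p * q)
    rearrange = solve-∀
    rearrange′ : ∀ r L p q → suc r * L * (p * q) ≡ L * (suc r * p) * q
    rearrange′ = solve-∀

  fixed-compatible : ∀ {D} → D ∈ fixed → ∃ Compatible
  fixed-compatible q = let (u , K , _) = uncovered-number (fixed⁻ q) in u , K

-- N = n + 2 divides k d and k N, hence k times the remainder of N modulo `d`; minimality of `d`
-- makes this remainder 0.
order-divides : ∀ {n k d} → IsOrderOf n k d → ∃ λ r → suc (suc n) ≡ d * r
order-divides {n} {k} {d} (0<d , N∣kd , least) = N / d , trans (trans (m≡m%n+[m/n]*n N d) (cong (_+ N / d * d) remainder)) (ℕₚ.*-comm (N / d) d)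
  where
  N = suc (suc n)
  instance
    d-nonZero : NonZero d
    d-nonZero = >-nonZero 0<d
  N∣remainder : N ∣ k * (N % d)
  N∣remainder = ∣m+n∣m⇒∣n {m = (N / d) * (k * d)} (subst (N ∣_) expand (Div.n∣m*n k)) (∣-trans N∣kd (Div.n∣m*n (N / d)))
    where
    distribute : ∀ k x q d → k * (x + q * d) ≡ q * (k * d) + k * x
    distribute = solve-∀
    expand : k * N ≡ (N / d) * (k * d) + k * (N % d)
    expand = trans (cong (k *_) (m≡m%n+[m/n]*n N d)) (distribute k (N % d) (N / d) d)
  remainder : N % d ≡ 0
  remainder with N % d | m%n<n N d | N∣remainder
  ... | zero | _ | _ = refl
  ... | suc m | m<d | h = ⊥-elim (least (suc m) (s≤s z≤n) m<d h)

-- k and r = N / d generate the same subgroup of ℤ / N.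
order-period : ∀ {n k d r} → IsOrderOf n k d → suc (suc n) ≡ d * r →
  (∀ {D} → Period n D k → Period n D r) × (∀ {D} → Period n D r → Period n D k)
order-period {n} {k} {d} {r} (0<d , divides c kd≡ , least) N≡ = k⇒r , r⇒k
  where
  N = suc (suc n)
  k≡ : k ≡ c * r
  k≡ = ℕₚ.*-cancelʳ-≡ k (c * r) d {{>-nonZero 0<d}} (trans kd≡ (trans (cong (c *_) N≡) (shuffle c d r)))
    where
    shuffle : ∀ c d r → c * (d * r) ≡ c * r * d
    shuffle = solve-∀
  r⇒k : ∀ {D} → Period n D r → Period n D k
  r⇒k {D} P = subst (Period n D) (sym k≡) (period-multiple n r c P)
  coprime : Coprime c d
  coprime {zero} (_ , divides e d≡) = ⊥-elim (ℕₚ.<-irrefl (sym (trans d≡ (ℕₚ.*-zeroʳ e))) 0<d)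
  coprime {suc zero} _ = refl
  coprime {suc (suc i)} (divides f c≡ , divides zero d≡) = ⊥-elim (ℕₚ.<-irrefl (sym d≡) 0<d)
  -- A common factor of `c` and `d` would let a multiple of `k` by fewer than `d` be divisible by N.
  coprime {suc (suc i)} (divides f c≡ , divides (suc e) d≡) = ⊥-elim (least (suc e) (s≤s z≤n)
    (subst (suc e <_) (sym d≡) (subst (_< suc e * suc (suc i)) (ℕₚ.*-identityʳ (suc e)) (ℕₚ.*-monoʳ-< (suc e) (s≤s (s≤s z≤n)))))
    (divides f (trans (cong (_* suc e) (trans k≡ (cong (_* r) c≡))) (trans (shuffle f (suc (suc i)) r (suc e)) (cong (f *_) (sym (trans N≡ (cong (_* r) d≡))))))))
    where
    shuffle : ∀ f i r e → f * i * r * e ≡ f * (e * i * r)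
    shuffle = solve-∀
  k⇒r : ∀ {D} → Period n D k → Period n D r
  k⇒r {D} P with coprime-Bézout coprime
  ... | Bézout.+- x y e = period-mod n (x * k) r 0 y (trans (ℕₚ.+-identityʳ (x * k)) (trans (cong (x *_) k≡) (trans (sym (ℕₚ.*-assoc x c r))
    (trans (cong (_* r) (sym e)) (trans (expand r y d) (cong (λ z → r + y * z) (sym N≡))))))) (period-multiple n k x P)
    where
    expand : ∀ r y d → (1 + y * d) * r ≡ r + y * (d * r)
    expand = solve-∀
  -- In this form of the identity `x * k` is -r modulo N. Taking it d - 1 times gives r, because d r
  -- = N.
  ... | Bézout.-+ x y e = period-mod n (pred d * (x * k)) r y (x * c)
    (trans (cong (λ z → pred d * (x * z) + y * N) k≡) (trans (cong (λ z → pred d * (x * (c * r)) + y * z) N≡)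
      (trans (cong (pred d * (x * (c * r)) +_) (trans (sym (ℕₚ.*-assoc y d r)) (cong (_* r) (sym e))))
        (trans (expand (pred d) x c r) (cong (λ z → r + x * c * z) (trans (cong (_* r) (ℕₚ.suc-pred d {{>-nonZero 0<d}})) (sym N≡)))))))
    (period-multiple n (x * k) (pred d) (period-multiple n k x P))
    where
    expand : ∀ p x c r → p * (x * (c * r)) + (1 + x * c) * r ≡ r + x * c * (suc p * r)
    expand = solve-∀

fixCount-identity : ∀ n lam → fixCount n lam 0 ≡ length (Slam n lam)
fixCount-identity n lam = length-≡-≅ (Unique-filterᵇ {p = fixedBy n 0} (Slam-Unique n lam)) (Slam-Unique n lam)
  ((λ q → proj₁ (∈-filterᵇ⁻ {p = fixedBy n 0} {xs = Slam n lam} q)) ,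
   (λ {D} q → ∈-filterᵇ⁺ {p = fixedBy n 0} q (fixedBy⁺ n 0 D (InSlam.wellFormed (Slam⁻ n lam q)) (λ a b h → h))))

-- The polynomial ring ℤ[q]

coeff : Poly → ℕ → ℤ
coeff [] i = 0ℤ
coeff (a ∷ p) zero = a
coeff (a ∷ p) (suc i) = coeff p i

infix 4 _≋_
-- `coeff` is 0 beyond the end of a list, so trailing zeros do not matter. A record, unlike a bare
-- function type, lets `p` and `q` be inferred.
record _≋_ (p q : Poly) : Set where
  constructor coeffwise
  field
    at : ∀ i → coeff p i ≡ coeff q i
open _≋_ public

≋-refl : ∀ {p} → p ≋ p
≋-refl = coeffwise λ i → refl

≋-sym : ∀ {p q} → p ≋ q → q ≋ p
≋-sym e = coeffwise λ i → sym (at e i)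

≋-trans : ∀ {p q r} → p ≋ q → q ≋ r → p ≋ r
≋-trans e f = coeffwise λ i → trans (at e i) (at f i)

≋-reflexive : ∀ {p q} → p ≡ q → p ≋ q
≋-reflexive refl = ≋-refl

coeff-+ : ∀ p q i → coeff (p +ₚ q) i ≡ coeff p i ℤ.+ coeff q i
coeff-+ [] q i = sym (ℤₚ.+-identityˡ _)
coeff-+ (a ∷ p) [] i = sym (ℤₚ.+-identityʳ _)
coeff-+ (a ∷ p) (b ∷ q) zero = refl
coeff-+ (a ∷ p) (b ∷ q) (suc i) = coeff-+ p q i

coeff-neg : ∀ p i → coeff (negₚ p) i ≡ ℤ.- coeff p i
coeff-neg [] i = refl
coeff-neg (a ∷ p) zero = refl
coeff-neg (a ∷ p) (suc i) = coeff-neg p i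

coeff-scale : ∀ c p i → coeff (scaleₚ c p) i ≡ c ℤ.* coeff p i
coeff-scale c [] i = sym (ℤₚ.*-zeroʳ c)
coeff-scale c (a ∷ p) zero = refl
coeff-scale c (a ∷ p) (suc i) = coeff-scale c p i

coeff⇒IsZero : ∀ p → (∀ i → coeff p i ≡ 0ℤ) → IsZeroₚ p
coeff⇒IsZero [] h = []
coeff⇒IsZero (a ∷ p) h = h 0 ∷ coeff⇒IsZero p (h ∘ suc)

coeff-sub : ∀ p q i → coeff (p -ₚ q) i ≡ coeff p i ℤ.- coeff q i
coeff-sub p q i = trans (coeff-+ p (negₚ q) i) (cong (λ z → coeff p i ℤ.+ z) (coeff-neg q i))

≋⇒≈ : ∀ {p q} → p ≋ q → p ≈ₚ q
≋⇒≈ {p} {q} e = coeff⇒IsZero (p -ₚ q) λ i → trans (coeff-sub p q i) (ℤₚ.i≡j⇒i-j≡0 (at e i))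

+-cong : ∀ {p p′ q q′} → p ≋ p′ → q ≋ q′ → p +ₚ q ≋ p′ +ₚ q′
+-cong {p} {p′} {q} {q′} e f = coeffwise λ i → trans (coeff-+ p q i) (trans (cong₂ ℤ._+_ (at e i) (at f i)) (sym (coeff-+ p′ q′ i)))

neg-cong : ∀ {p q} → p ≋ q → negₚ p ≋ negₚ q
neg-cong {p} {q} e = coeffwise λ i → trans (coeff-neg p i) (trans (cong ℤ.-_ (at e i)) (sym (coeff-neg q i)))

scale-cong : ∀ c {p q} → p ≋ q → scaleₚ c p ≋ scaleₚ c q
scale-cong c {p} {q} e = coeffwise λ i → trans (coeff-scale c p i) (trans (cong (c ℤ.*_) (at e i)) (sym (coeff-scale c q i)))

∷-cong : ∀ {a b p q} → a ≡ b → p ≋ q → a ∷ p ≋ b ∷ q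
∷-cong e f = coeffwise λ { zero → e ; (suc i) → at f i }

+-assoc : ∀ p q r → (p +ₚ q) +ₚ r ≋ p +ₚ (q +ₚ r)
+-assoc p q r = coeffwise λ i → trans (coeff-+ (p +ₚ q) r i) (trans (cong (ℤ._+ coeff r i) (coeff-+ p q i))
  (trans (ℤₚ.+-assoc (coeff p i) (coeff q i) (coeff r i)) (sym (trans (coeff-+ p (q +ₚ r) i) (cong (λ z → coeff p i ℤ.+ z) (coeff-+ q r i))))))

+-comm : ∀ p q → p +ₚ q ≋ q +ₚ p
+-comm p q = coeffwise λ i → trans (coeff-+ p q i) (trans (ℤₚ.+-comm (coeff p i) (coeff q i)) (sym (coeff-+ q p i)))

+-identityˡ : ∀ p → [] +ₚ p ≋ p
+-identityˡ p = ≋-refl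

+-identityʳ : ∀ p → p +ₚ [] ≋ p
+-identityʳ p = +-comm p []

+-inverseˡ : ∀ p → negₚ p +ₚ p ≋ []
+-inverseˡ p = coeffwise λ i → trans (coeff-+ (negₚ p) p i) (trans (cong (ℤ._+ coeff p i) (coeff-neg p i)) (ℤₚ.+-inverseˡ (coeff p i)))

+-inverseʳ : ∀ p → p +ₚ negₚ p ≋ []
+-inverseʳ p = ≋-trans (+-comm p (negₚ p)) (+-inverseˡ p)

0∷[] : 0ℤ ∷ [] ≋ []
0∷[] = coeffwise λ { zero → refl ; (suc i) → refl }

scale-+ : ∀ c p q → scaleₚ c (p +ₚ q) ≋ scaleₚ c p +ₚ scaleₚ c q
scale-+ c p q = coeffwise λ i → trans (coeff-scale c (p +ₚ q) i) (trans (cong (c ℤ.*_) (coeff-+ p q i))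
  (trans (ℤₚ.*-distribˡ-+ c (coeff p i) (coeff q i)) (sym (trans (coeff-+ (scaleₚ c p) (scaleₚ c q) i) (cong₂ ℤ._+_ (coeff-scale c p i) (coeff-scale c q i))))))

+-scale : ∀ a b p → scaleₚ (a ℤ.+ b) p ≋ scaleₚ a p +ₚ scaleₚ b p
+-scale a b p = coeffwise λ i → trans (coeff-scale (a ℤ.+ b) p i) (trans (ℤₚ.*-distribʳ-+ (coeff p i) a b)
  (sym (trans (coeff-+ (scaleₚ a p) (scaleₚ b p) i) (cong₂ ℤ._+_ (coeff-scale a p i) (coeff-scale b p i)))))

scale-scale : ∀ a b p → scaleₚ a (scaleₚ b p) ≋ scaleₚ (a ℤ.* b) p
scale-scale a b p = coeffwise λ i → trans (coeff-scale a (scaleₚ b p) i) (trans (cong (a ℤ.*_) (coeff-scale b p i))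
  (trans (sym (ℤₚ.*-assoc a b (coeff p i))) (sym (coeff-scale (a ℤ.* b) p i))))

scale-zero : ∀ p → scaleₚ 0ℤ p ≋ []
scale-zero p = coeffwise λ i → trans (coeff-scale 0ℤ p i) (ℤₚ.*-zeroˡ (coeff p i))

scale-one : ∀ p → scaleₚ 1ℤ p ≋ p
scale-one p = coeffwise λ i → trans (coeff-scale 1ℤ p i) (ℤₚ.*-identityˡ (coeff p i))

scale-∷ : ∀ c p → scaleₚ c (0ℤ ∷ p) ≋ 0ℤ ∷ scaleₚ c p
scale-∷ c p = ∷-cong (ℤₚ.*-zeroʳ c) ≋-refl

∷-+ : ∀ p q → 0ℤ ∷ (p +ₚ q) ≋ (0ℤ ∷ p) +ₚ (0ℤ ∷ q)
∷-+ p q = ∷-cong refl ≋-refl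

interchange : ∀ p q r s → (p +ₚ q) +ₚ (r +ₚ s) ≋ (p +ₚ r) +ₚ (q +ₚ s)
interchange p q r s = coeffwise λ i → trans (split p q r s i) (trans (shuffle (coeff p i) (coeff q i) (coeff r i) (coeff s i)) (sym (split p r q s i)))
  where
  split : ∀ p q r s i → coeff ((p +ₚ q) +ₚ (r +ₚ s)) i ≡ (coeff p i ℤ.+ coeff q i) ℤ.+ (coeff r i ℤ.+ coeff s i)
  split p q r s i = trans (coeff-+ (p +ₚ q) (r +ₚ s) i) (cong₂ ℤ._+_ (coeff-+ p q i) (coeff-+ r s i))
  shuffle : ∀ a b c d → (a ℤ.+ b) ℤ.+ (c ℤ.+ d) ≡ (a ℤ.+ c) ℤ.+ (b ℤ.+ d)
  shuffle = ℤSolver.solve-∀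

*-zeroʳ : ∀ p → p *ₚ [] ≋ []
*-zeroʳ [] = ≋-refl
*-zeroʳ (a ∷ p) = ≋-trans (∷-cong refl (*-zeroʳ p)) 0∷[]

-- The expansion along the right factor, mirroring the defining one along the left; commutativity
-- follows by comparing the two.
*-∷ : ∀ p b q → p *ₚ (b ∷ q) ≋ scaleₚ b p +ₚ (0ℤ ∷ (p *ₚ q))
*-∷ [] b q = ≋-sym 0∷[]
*-∷ (a ∷ p) b q = ∷-cong (cong (ℤ._+ 0ℤ) (ℤₚ.*-comm a b))
  (≋-trans (+-cong (≋-refl {scaleₚ a q}) (*-∷ p b q))
    (≋-trans (≋-sym (+-assoc (scaleₚ a q) (scaleₚ b p) (0ℤ ∷ (p *ₚ q))))
      (≋-trans (+-cong (+-comm (scaleₚ a q) (scaleₚ b p)) (≋-refl {0ℤ ∷ (p *ₚ q)})) (+-assoc (scaleₚ b p) (scaleₚ a q) (0ℤ ∷ (p *ₚ q))))))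

*-comm : ∀ p q → p *ₚ q ≋ q *ₚ p
*-comm [] q = ≋-sym (*-zeroʳ q)
*-comm (a ∷ p) q = ≋-trans (+-cong (≋-refl {scaleₚ a q}) (∷-cong refl (*-comm p q))) (≋-sym (*-∷ q a p))

*-congˡ : ∀ p {q q′} → q ≋ q′ → p *ₚ q ≋ p *ₚ q′
*-congˡ [] e = ≋-refl
*-congˡ (a ∷ p) e = +-cong (scale-cong a e) (∷-cong refl (*-congˡ p e))

*-cong : ∀ {p p′ q q′} → p ≋ p′ → q ≋ q′ → p *ₚ q ≋ p′ *ₚ q′
*-cong {p} {p′} {q} {q′} e f = ≋-trans (*-congˡ p f) (≋-trans (*-comm p q′) (≋-trans (*-congˡ q′ e) (*-comm q′ p′)))

+-congˡ : ∀ p {q q′} → q ≋ q′ → p +ₚ q ≋ p +ₚ q′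
+-congˡ p e = +-cong (≋-refl {p}) e

+-congʳ : ∀ p {q q′} → q ≋ q′ → q +ₚ p ≋ q′ +ₚ p
+-congʳ p e = +-cong e (≋-refl {p})

*-congʳ : ∀ p {q q′} → q ≋ q′ → q *ₚ p ≋ q′ *ₚ p
*-congʳ p e = *-cong e (≋-refl {p})

*-distribʳ : ∀ r p q → (p +ₚ q) *ₚ r ≋ (p *ₚ r) +ₚ (q *ₚ r)
*-distribʳ r [] q = ≋-refl
*-distribʳ r (a ∷ p) [] = ≋-sym (+-identityʳ _)
*-distribʳ r (a ∷ p) (b ∷ q) = ≋-trans (+-cong (+-scale a b r) (≋-trans (∷-cong refl (*-distribʳ r p q)) (∷-+ (p *ₚ r) (q *ₚ r))))
  (interchange (scaleₚ a r) (scaleₚ b r) (0ℤ ∷ (p *ₚ r)) (0ℤ ∷ (q *ₚ r)))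

*-distribˡ : ∀ r p q → r *ₚ (p +ₚ q) ≋ (r *ₚ p) +ₚ (r *ₚ q)
*-distribˡ r p q = ≋-trans (*-comm r (p +ₚ q)) (≋-trans (*-distribʳ r p q) (+-cong (*-comm p r) (*-comm q r)))

scale-* : ∀ c p q → scaleₚ c p *ₚ q ≋ scaleₚ c (p *ₚ q)
scale-* c [] q = ≋-refl
scale-* c (a ∷ p) q = ≋-trans (+-cong (≋-sym (scale-scale c a q)) (≋-trans (∷-cong refl (scale-* c p q)) (≋-sym (scale-∷ c (p *ₚ q)))))
  (≋-sym (scale-+ c (scaleₚ a q) (0ℤ ∷ (p *ₚ q))))

∷-* : ∀ p q → (0ℤ ∷ p) *ₚ q ≋ 0ℤ ∷ (p *ₚ q)
∷-* p q = +-cong (scale-zero q) (≋-refl {0ℤ ∷ (p *ₚ q)})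

*-assoc : ∀ p q r → (p *ₚ q) *ₚ r ≋ p *ₚ (q *ₚ r)
*-assoc [] q r = ≋-refl
*-assoc (a ∷ p) q r = ≋-trans (*-distribʳ r (scaleₚ a q) (0ℤ ∷ (p *ₚ q)))
  (+-cong (scale-* a q r) (≋-trans (∷-* (p *ₚ q) r) (∷-cong refl (*-assoc p q r))))

*-identityˡ : ∀ p → oneₚ *ₚ p ≋ p
*-identityˡ p = ≋-trans (+-cong (scale-one p) 0∷[]) (+-identityʳ p)

*-identityʳ : ∀ p → p *ₚ oneₚ ≋ p
*-identityʳ p = ≋-trans (*-comm p oneₚ) (*-identityˡ p)

polynomials : CommutativeRing 0ℓ 0ℓ
polynomials = record
  { Carrier = Poly ; _≈_ = _≋_ ; _+_ = _+ₚ_ ; _*_ = _*ₚ_ ; -_ = negₚ ; 0# = [] ; 1# = oneₚ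
  ; isCommutativeRing = record
    { isRing = record
      { +-isAbelianGroup = record
        { isGroup = record
          { isMonoid = record
            { isSemigroup = record
              { isMagma = record
                { isEquivalence = record { refl = ≋-refl ; sym = ≋-sym ; trans = ≋-trans }
                ; ∙-cong = +-cong }
              ; assoc = +-assoc }
            ; identity = +-identityˡ , +-identityʳ }
          ; inverse = +-inverseˡ , +-inverseʳ
          ; ⁻¹-cong = neg-cong }
        ; comm = +-comm }
      ; *-cong = *-cong
      ; *-assoc = *-assoc
      ; *-identity = *-identityˡ , *-identityʳ
      ; distrib = *-distribˡ , *-distribʳ }
    ; *-comm = *-comm } }

polynomialRing : AlmostCommutativeRing 0ℓ 0ℓ
polynomialRing = fromCommutativeRing polynomials isZero
  where
  isZero : ∀ p → Maybe ([] ≋ p)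
  isZero [] = just ≋-refl
  isZero (a ∷ p) with a ℤ.≟ 0ℤ | isZero p
  ... | yes e | just h = just (≋-trans (≋-sym 0∷[]) (∷-cong (sym e) h))
  ... | _ | _ = nothing

-- Divisibility in ℤ[q]

module ≋-Reasoning = SetoidReasoning (CommutativeRing.setoid polynomials)

int : ℤ → Poly
int c = [ c ]

int-* : ∀ a b → int (a ℤ.* b) ≋ int a *ₚ int b
int-* a b = ∷-cong (sym (ℤₚ.+-identityʳ (a ℤ.* b))) ≋-refl

int-scale : ∀ c p → int c *ₚ p ≋ scaleₚ c p
int-scale c p = ≋-trans (+-congˡ (scaleₚ c p) 0∷[]) (+-identityʳ (scaleₚ c p))

X : Poly
X = Xpow 1

X-* : ∀ p → X *ₚ p ≋ 0ℤ ∷ p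
X-* p = ≋-trans (∷-* oneₚ p) (∷-cong refl (*-identityˡ p))

∷-X : ∀ c p → c ∷ p ≋ int c +ₚ X *ₚ p
∷-X c p = ≋-sym (≋-trans (+-congˡ (int c) (X-* p)) (∷-cong (ℤₚ.+-identityʳ c) ≋-refl))

Xpow-+ : ∀ a b → Xpow (a + b) ≋ Xpow a *ₚ Xpow b
Xpow-+ zero b = ≋-sym (*-identityˡ (Xpow b))
Xpow-+ (suc a) b = ≋-trans (∷-cong refl (Xpow-+ a b)) (≋-sym (∷-* (Xpow a) (Xpow b)))

Xpow-suc : ∀ a → Xpow (suc a) ≋ X *ₚ Xpow a
Xpow-suc = Xpow-+ 1

Xpow-1 : ℕ → Poly
Xpow-1 n = Xpow n -ₚ oneₚ

qint-suc : ∀ a → qint (suc a) ≋ oneₚ +ₚ X *ₚ qint a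
qint-suc a = ∷-X 1ℤ (qint a)

qint-+ : ∀ a b → qint (a + b) ≋ qint a +ₚ Xpow a *ₚ qint b
qint-+ zero b = ≋-sym (*-identityˡ (qint b))
qint-+ (suc a) b = begin
  qint (suc (a + b))                                       ≈⟨ qint-suc (a + b) ⟩
  oneₚ +ₚ X *ₚ qint (a + b)                                ≈⟨ +-congˡ oneₚ (*-congˡ X (qint-+ a b)) ⟩
  oneₚ +ₚ X *ₚ (qint a +ₚ Xpow a *ₚ qint b)                ≈⟨ expand X (qint a) (Xpow a) (qint b) ⟩
  (oneₚ +ₚ X *ₚ qint a) +ₚ (X *ₚ Xpow a) *ₚ qint b         ≈⟨ +-cong (qint-suc a) (*-cong (Xpow-suc a) (≋-refl {qint b})) ⟨
  qint (suc a) +ₚ Xpow (suc a) *ₚ qint b                   ∎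
  where
  open ≋-Reasoning
  expand : ∀ x q y r → oneₚ +ₚ x *ₚ (q +ₚ y *ₚ r) ≋ (oneₚ +ₚ x *ₚ q) +ₚ (x *ₚ y) *ₚ r
  expand = RingSolver.solve-∀ polynomialRing

Xpow-1-+ : ∀ a b → Xpow-1 (a + b) ≋ Xpow a *ₚ Xpow-1 b +ₚ Xpow-1 a
Xpow-1-+ a b = ≋-trans (+-congʳ (negₚ oneₚ) (Xpow-+ a b)) (expand (Xpow a) (Xpow b))
  where
  expand : ∀ x y → x *ₚ y +ₚ negₚ oneₚ ≋ x *ₚ (y +ₚ negₚ oneₚ) +ₚ (x +ₚ negₚ oneₚ)
  expand = RingSolver.solve-∀ polynomialRing

Xpow-1-qint : ∀ a → Xpow-1 1 *ₚ qint a ≋ Xpow-1 a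
Xpow-1-qint zero = ≋-trans (*-zeroʳ (Xpow-1 1)) (≋-sym (+-inverseʳ oneₚ))
Xpow-1-qint (suc a) = begin
  Xpow-1 1 *ₚ qint (suc a)                     ≈⟨ *-congˡ (Xpow-1 1) (qint-suc a) ⟩
  Xpow-1 1 *ₚ (oneₚ +ₚ X *ₚ qint a)            ≈⟨ expand (Xpow-1 1) X (qint a) ⟩
  X *ₚ (Xpow-1 1 *ₚ qint a) +ₚ Xpow-1 1        ≈⟨ +-congʳ (Xpow-1 1) (*-congˡ X (Xpow-1-qint a)) ⟩
  X *ₚ Xpow-1 a +ₚ Xpow-1 1                    ≈⟨ Xpow-1-+ 1 a ⟨
  Xpow-1 (suc a)                               ∎
  where
  open ≋-Reasoning
  expand : ∀ y x q → y *ₚ (oneₚ +ₚ x *ₚ q) ≋ x *ₚ (y *ₚ q) +ₚ y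
  expand = RingSolver.solve-∀ polynomialRing

Divides : Poly → Poly → Set
Divides f g = Σ Poly λ k → f *ₚ k ≋ g

divides-trans : ∀ {f g h} → Divides f g → Divides g h → Divides f h
divides-trans {f} (k , e) (l , e′) = k *ₚ l , ≋-trans (≋-sym (*-assoc f k l)) (≋-trans (*-congʳ l e) e′)

Xpow-1-multiple : ∀ e x → Divides (Xpow-1 e) (Xpow-1 (x * e))
Xpow-1-multiple e zero = [] , ≋-trans (*-zeroʳ (Xpow-1 e)) (≋-sym (+-inverseʳ oneₚ))
Xpow-1-multiple e (suc x) with Xpow-1-multiple e x
... | k , h = Xpow e *ₚ k +ₚ oneₚ , ≋-trans (expand (Xpow-1 e) (Xpow e) k) (≋-trans (+-congʳ (Xpow-1 e) (*-congˡ (Xpow e) h)) (≋-sym (Xpow-1-+ e (x * e))))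
  where
  expand : ∀ y x k → y *ₚ (x *ₚ k +ₚ oneₚ) ≋ x *ₚ (y *ₚ k) +ₚ y
  expand = RingSolver.solve-∀ polynomialRing

-- `G` is 1 + X^g + ... + X^((c - 1) g), and each summand is 1 modulo X^g - 1. The integer `c`
-- obtained here is the one that `cyclotomic-independent` exhibits in its ideal.
geometric : ∀ g c → ∃ λ G → Xpow-1 g *ₚ G ≋ Xpow-1 (c * g) × (∃ λ S → G ≋ int (ℤ.+ c) +ₚ Xpow-1 g *ₚ S)
geometric g zero = [] , ≋-trans (*-zeroʳ (Xpow-1 g)) (≋-sym (+-inverseʳ oneₚ)) , [] , ≋-sym (+-cong 0∷[] (*-zeroʳ (Xpow-1 g)))
geometric g (suc c) with geometric g c
... | G , e , S , f = Xpow g *ₚ G +ₚ oneₚ ,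
  ≋-trans (expand (Xpow-1 g) (Xpow g) G) (≋-trans (+-congʳ (Xpow-1 g) (*-congˡ (Xpow g) e)) (≋-sym (Xpow-1-+ g (c * g)))) ,
  S +ₚ G ,
  (begin
    Xpow g *ₚ G +ₚ oneₚ                                      ≈⟨ split (Xpow g) G ⟩
    G +ₚ Xpow-1 g *ₚ G +ₚ oneₚ                               ≈⟨ +-congʳ oneₚ (+-congʳ (Xpow-1 g *ₚ G) f) ⟩
    (int (ℤ.+ c) +ₚ Xpow-1 g *ₚ S) +ₚ Xpow-1 g *ₚ G +ₚ oneₚ  ≈⟨ collect (int (ℤ.+ c)) (Xpow-1 g) S G ⟩
    (oneₚ +ₚ int (ℤ.+ c)) +ₚ Xpow-1 g *ₚ (S +ₚ G)            ∎)
  where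
  open ≋-Reasoning
  expand : ∀ y x k → y *ₚ (x *ₚ k +ₚ oneₚ) ≋ x *ₚ (y *ₚ k) +ₚ y
  expand = RingSolver.solve-∀ polynomialRing
  split : ∀ x g → x *ₚ g +ₚ oneₚ ≋ g +ₚ (x +ₚ negₚ oneₚ) *ₚ g +ₚ oneₚ
  split = RingSolver.solve-∀ polynomialRing
  collect : ∀ c y s g → (c +ₚ y *ₚ s) +ₚ y *ₚ g +ₚ oneₚ ≋ (oneₚ +ₚ c) +ₚ y *ₚ (s +ₚ g)
  collect = RingSolver.solve-∀ polynomialRing

-- polynomials with constant term ±1
Unit : Poly → Set
Unit p = ∃ λ b → b ℤ.* coeff p 0 ≡ 1ℤ

coeff-*-0 : ∀ p q → coeff (p *ₚ q) 0 ≡ coeff p 0 ℤ.* coeff q 0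
coeff-*-0 [] q = sym (ℤₚ.*-zeroˡ (coeff q 0))
coeff-*-0 (a ∷ p) q = trans (coeff-+ (scaleₚ a q) (0ℤ ∷ (p *ₚ q)) 0) (trans (ℤₚ.+-identityʳ _) (coeff-scale a q 0))

unit-* : ∀ {p q} → Unit p → Unit q → Unit (p *ₚ q)
unit-* {p} {q} (a , e) (b , f) = a ℤ.* b , trans (cong (λ z → a ℤ.* b ℤ.* z) (coeff-*-0 p q))
  (trans (shuffle a b (coeff p 0) (coeff q 0)) (cong₂ ℤ._*_ e f))
  where
  shuffle : ∀ a b c d → a ℤ.* b ℤ.* (c ℤ.* d) ≡ a ℤ.* c ℤ.* (b ℤ.* d)
  shuffle = ℤSolver.solve-∀

unit-factor : ∀ {p q} → Unit (p *ₚ q) → Unit p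
unit-factor {p} {q} (b , e) = b ℤ.* coeff q 0 , trans (shuffle b (coeff p 0) (coeff q 0)) (trans (cong (b ℤ.*_) (sym (coeff-*-0 p q))) e)
  where
  shuffle : ∀ b c d → b ℤ.* d ℤ.* c ≡ b ℤ.* (c ℤ.* d)
  shuffle = ℤSolver.solve-∀

unit-cong : ∀ {p q} → p ≋ q → Unit p → Unit q
unit-cong e (b , f) = b , trans (cong (b ℤ.*_) (sym (at e 0))) f

unit-Xpow-1 : ∀ n → 0 < n → Unit (Xpow-1 n)
unit-Xpow-1 (suc n) _ = ℤ.- 1ℤ , refl

tail : Poly → Poly
tail [] = []
tail (_ ∷ p) = p

coeff-tail : ∀ p i → coeff (tail p) i ≡ coeff p (suc i)
coeff-tail [] i = refl
coeff-tail (_ ∷ p) i = refl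

coeff-*-∷ : ∀ g c k i → coeff (g *ₚ (c ∷ k)) (suc i) ≡ c ℤ.* coeff g (suc i) ℤ.+ coeff (g *ₚ k) i
coeff-*-∷ g c k i = trans (at (*-∷ g c k) (suc i)) (trans (coeff-+ (scaleₚ c g) (0ℤ ∷ (g *ₚ k)) (suc i)) (cong (ℤ._+ coeff (g *ₚ k) i) (coeff-scale c g (suc i))))

coeff-*-∷-0 : ∀ g c k → coeff (g *ₚ (c ∷ k)) 0 ≡ coeff g 0 ℤ.* c
coeff-*-∷-0 g c k = coeff-*-0 g (c ∷ k)

-- A polynomial with constant term ±1 is invertible as a power series, hence no zero divisor modulo
-- `M`. The induction removes the coefficients of `k` from the lowest upwards. The case `M` = 0 is
-- ordinary cancellation.
unit-scale : ∀ M g k f → Unit g → g *ₚ k ≋ scaleₚ M f → ∃ λ k′ → k ≋ scaleₚ M k′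
unit-scale M g [] f u e = [] , ≋-refl
unit-scale M g (c ∷ k) f (b , u) e with unit-scale M g k f′ (b , u) step
  where
  c′ = b ℤ.* coeff f 0
  f′ = tail (f -ₚ scaleₚ c′ g)
  c≡ : c ≡ M ℤ.* c′
  c≡ = trans (sym (ℤₚ.*-identityˡ c)) (trans (cong (ℤ._* c) (sym u)) (trans (ℤₚ.*-assoc b (coeff g 0) c)
    (trans (cong (b ℤ.*_) (trans (sym (coeff-*-∷-0 g c k)) (trans (at e 0) (coeff-scale M f 0)))) (shuffle b M (coeff f 0)))))
    where
    shuffle : ∀ b m x → b ℤ.* (m ℤ.* x) ≡ m ℤ.* (b ℤ.* x)
    shuffle = ℤSolver.solve-∀
  step : g *ₚ k ≋ scaleₚ M f′
  step = coeffwise λ i → trans (isolate (c ℤ.* coeff g (suc i)) (coeff (g *ₚ k) i)) (trans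
    (cong (ℤ._- c ℤ.* coeff g (suc i)) (trans (sym (coeff-*-∷ g c k i)) (trans (at e (suc i)) (coeff-scale M f (suc i)))))
    (trans (cong (λ z → M ℤ.* coeff f (suc i) ℤ.- z ℤ.* coeff g (suc i)) c≡) (trans (factor M (coeff f (suc i)) c′ (coeff g (suc i)))
      (sym (trans (coeff-scale M f′ i) (cong (M ℤ.*_) (trans (coeff-tail (f -ₚ scaleₚ c′ g) i) (trans (coeff-sub f (scaleₚ c′ g) (suc i))
        (cong (λ z → coeff f (suc i) ℤ.- z) (coeff-scale c′ g (suc i)))))))))))
    where
    isolate : ∀ x y → y ≡ (x ℤ.+ y) ℤ.- x
    isolate = ℤSolver.solve-∀
    factor : ∀ m x c g → m ℤ.* x ℤ.- m ℤ.* c ℤ.* g ≡ m ℤ.* (x ℤ.- c ℤ.* g)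
    factor = ℤSolver.solve-∀
... | k′ , h = b ℤ.* coeff f 0 ∷ k′ , ∷-cong
  (trans (sym (ℤₚ.*-identityˡ c)) (trans (cong (ℤ._* c) (sym u)) (trans (ℤₚ.*-assoc b (coeff g 0) c)
    (trans (cong (b ℤ.*_) (trans (sym (coeff-*-∷-0 g c k)) (trans (at e 0) (coeff-scale M f 0)))) (shuffle b M (coeff f 0))))))
  h
  where
  shuffle : ∀ b m x → b ℤ.* (m ℤ.* x) ≡ m ℤ.* (b ℤ.* x)
  shuffle = ℤSolver.solve-∀

unit-cancel : ∀ g k → Unit g → g *ₚ k ≋ [] → k ≋ []
unit-cancel g k u e with unit-scale 0ℤ g k [] u e
... | k′ , h = ≋-trans h (scale-zero k′)

difference : ∀ {p q} → p +ₚ negₚ q ≋ [] → p ≋ q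
difference {p} {q} e = ≋-trans (expand p q) (+-congʳ q e)
  where
  expand : ∀ p q → p ≋ (p +ₚ negₚ q) +ₚ q
  expand = RingSolver.solve-∀ polynomialRing

difference⁻ : ∀ {p q} → p ≋ q → p +ₚ negₚ q ≋ []
difference⁻ {p} {q} e = ≋-trans (+-congʳ (negₚ q) e) (+-inverseʳ q)

unit-cancelˡ : ∀ g {p q} → Unit g → g *ₚ p ≋ g *ₚ q → p ≋ q
unit-cancelˡ g {p} {q} u e = difference (unit-cancel g (p +ₚ negₚ q) u (≋-trans (expand g p q) (difference⁻ e)))
  where
  expand : ∀ g p q → g *ₚ (p +ₚ negₚ q) ≋ g *ₚ p +ₚ negₚ (g *ₚ q)
  expand = RingSolver.solve-∀ polynomialRing

scale-injective : ∀ M {p q} → .{{ℤ.NonZero M}} → scaleₚ M p ≋ scaleₚ M q → p ≋ q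
scale-injective M {p} {q} e = coeffwise λ i → ℤₚ.*-cancelˡ-≡ M _ _ (trans (sym (coeff-scale M p i)) (trans (at e i) (coeff-scale M q i)))

unit-torsion : ∀ c g f → Unit g → Divides g (int (ℤ.+ suc c) *ₚ f) → Divides g f
unit-torsion c g f u (k , e) with unit-scale (ℤ.+ suc c) g k f u (≋-trans e (int-scale (ℤ.+ suc c) f))
... | k′ , h = k′ , scale-injective (ℤ.+ suc c) (≋-trans (≋-sym (≋-trans (*-congˡ g h) (scale-*ʳ g (ℤ.+ suc c) k′))) (≋-trans e (int-scale (ℤ.+ suc c) f)))
  where
  scale-*ʳ : ∀ g c k → g *ₚ scaleₚ c k ≋ scaleₚ c (g *ₚ k)
  scale-*ʳ g c k = ≋-trans (*-comm g (scaleₚ c k)) (≋-trans (scale-* c k g) (scale-cong c (*-comm k g)))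

-- The ideal (f , g) contains a positive integer, which need not be 1: q - 1 and q + 1 generate a
-- proper ideal containing 2. This is coprimality over ℚ with its denominators cleared.
record Independent (f g : Poly) : Set where
  constructor independent
  field
    c : ℕ
    u v : Poly
    combination : u *ₚ f +ₚ v *ₚ g ≋ int (ℤ.+ suc c)

independent-* : ∀ {f g h} → Independent f g → Independent f h → Independent f (g *ₚ h)
independent-* {f} {g} {h} (independent c u v e) (independent c′ u′ v′ e′) =
  independent (c′ + c * suc c′) (u *ₚ u′ *ₚ f +ₚ u *ₚ v′ *ₚ h +ₚ v *ₚ g *ₚ u′) (v *ₚ v′)
    (≋-trans (expand f g h u v u′ v′) (≋-trans (*-cong e e′) (≋-trans (≋-sym (int-* (ℤ.+ suc c) (ℤ.+ suc c′))) (≋-reflexive (cong int (sym (ℤₚ.pos-* (suc c) (suc c′))))))))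
  where
  expand : ∀ f g h u v u′ v′ → (u *ₚ u′ *ₚ f +ₚ u *ₚ v′ *ₚ h +ₚ v *ₚ g *ₚ u′) *ₚ f +ₚ (v *ₚ v′) *ₚ (g *ₚ h) ≋ (u *ₚ f +ₚ v *ₚ g) *ₚ (u′ *ₚ f +ₚ v′ *ₚ h)
  expand = RingSolver.solve-∀ polynomialRing

independent-factor : ∀ {f g h} → Divides g h → Independent f h → Independent f g
independent-factor {f} {g} {h} (k , e) (independent c u v e′) = independent c u (v *ₚ k)
  (≋-trans (+-congˡ (u *ₚ f) (≋-trans (expand v k g) (*-congˡ v e))) e′)
  where
  expand : ∀ v k g → v *ₚ k *ₚ g ≋ v *ₚ (g *ₚ k)
  expand = RingSolver.solve-∀ polynomialRing

independent-one : ∀ f → Independent f oneₚ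
independent-one f = independent 0 [] oneₚ (*-identityˡ oneₚ)

independent-cancel : ∀ {f g h} → Unit f → Independent f g → Divides f (g *ₚ h) → Divides f h
independent-cancel {f} {g} {h} unit (independent c u v e) (k , e′) = unit-torsion c f h unit (u *ₚ h +ₚ v *ₚ k , (begin
  f *ₚ (u *ₚ h +ₚ v *ₚ k)             ≈⟨ expand f u h v k ⟩
  u *ₚ f *ₚ h +ₚ v *ₚ (f *ₚ k)        ≈⟨ +-congˡ (u *ₚ f *ₚ h) (*-congˡ v e′) ⟩
  u *ₚ f *ₚ h +ₚ v *ₚ (g *ₚ h)        ≈⟨ collect f u h v g ⟩
  (u *ₚ f +ₚ v *ₚ g) *ₚ h             ≈⟨ *-congʳ h e ⟩
  int (ℤ.+ suc c) *ₚ h                ∎))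
  where
  open ≋-Reasoning
  expand : ∀ f u h v k → f *ₚ (u *ₚ h +ₚ v *ₚ k) ≋ u *ₚ f *ₚ h +ₚ v *ₚ (f *ₚ k)
  expand = RingSolver.solve-∀ polynomialRing
  collect : ∀ f u h v g → u *ₚ f *ₚ h +ₚ v *ₚ (g *ₚ h) ≋ (u *ₚ f +ₚ v *ₚ g) *ₚ h
  collect = RingSolver.solve-∀ polynomialRing

-- Plays the part of unique factorisation: `f` divides `g k` and the integer in (f , g) can be
-- cancelled, so `f` divides the cofactor `k`.
independent-product : ∀ {f g h} → Unit f → Independent f g → Divides f h → Divides g h → Divides (g *ₚ f) h
independent-product {f} {g} {h} unit i d (k , e) = proj₁ quotient , ≋-trans (*-assoc g f (proj₁ quotient)) (≋-trans (*-congˡ g (proj₂ quotient)) e)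
  where
  f∣gk : Divides f (g *ₚ k)
  f∣gk = divides-trans {f} {h} d (oneₚ , ≋-trans (*-identityʳ h) (≋-sym e))
  quotient : Divides f k
  quotient = independent-cancel {f} {g} {k} unit i f∣gk

-- Division with remainder.  highDiv, subtractFront and table are private in Defs: unification recovers them
-- once the functions applied to them are abstracted.

mutual
  highDiv : ℕ → List ℤ → List ℤ → List ℤ
  highDiv = _

  divMonic-highDiv : ∀ f g → divMonic f g ≡ reverse (highDiv (length f) (reverse f) (drop 1 (reverse g)))
  divMonic-highDiv f g with length f | reverse f | drop 1 (reverse g)
  ... | k | F | G with List.foldl (λ (y : List ℤ) x → x ∷ y) []
  ... | h = refl

mutual
  subtractFront : List ℤ → List ℤ → List ℤ
  subtractFront = _

  highDiv-step : ∀ k c F gt → highDiv (suc k) (c ∷ F) gt ≡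
    (if length F <ᵇ length gt then [] else c ∷ highDiv k (subtractFront F (scaleₚ c gt)) gt)
  highDiv-step k c F gt with scaleₚ c gt
  ... | G = refl

mutual
  table : ℕ → List (ℕ × Poly)
  table = _

  cyclotomic-table : ∀ n → cyclotomic (suc n) ≡
    divMonic (Xpow-1 (suc n)) (prodₚ (map proj₂ (filter (λ p → proj₁ p ∣? suc n) (table n))))
  cyclotomic-table n with filter {A = ℕ × Poly} (λ p → proj₁ p ∣? suc n)
  ... | h = refl

-- the polynomial with the given coefficients, highest degree first
val : List ℤ → Poly
val [] = []
val (c ∷ fs) = val fs +ₚ scaleₚ c (Xpow (length fs))

append-top : ∀ p c → p ++ [ c ] ≋ p +ₚ scaleₚ c (Xpow (length p))
append-top [] c = ∷-cong (sym (ℤₚ.*-identityʳ c)) ≋-refl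
append-top (a ∷ p) c = ∷-cong (sym (trans (cong (λ z → a ℤ.+ z) (ℤₚ.*-zeroʳ c)) (ℤₚ.+-identityʳ a))) (append-top p c)

reverse-val : ∀ fs → reverse fs ≋ val fs
reverse-val [] = ≋-refl
reverse-val (c ∷ fs) = ≋-trans (≋-reflexive (Listₚ.unfold-reverse c fs)) (≋-trans (append-top (reverse fs) c)
  (≋-trans (≋-reflexive (cong (λ k → reverse fs +ₚ scaleₚ c (Xpow k)) (Listₚ.length-reverse fs))) (+-congʳ (scaleₚ c (Xpow (length fs))) (reverse-val fs))))

length-subtractFront : ∀ xs ys → length ys ≤ length xs → length (subtractFront xs ys) ≡ length xs
length-subtractFront xs [] h = refl
length-subtractFront (x ∷ xs) (y ∷ ys) h = cong suc (length-subtractFront xs ys (s≤s⁻¹ h))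

scale-shift : ∀ c a b → scaleₚ c (Xpow (a + b)) ≋ Xpow a *ₚ scaleₚ c (Xpow b)
scale-shift c a b = ≋-trans (scale-cong c (Xpow-+ a b)) (≋-sym (≋-trans (*-comm (Xpow a) (scaleₚ c (Xpow b)))
  (≋-trans (scale-* c (Xpow b) (Xpow a)) (scale-cong c (*-comm (Xpow b) (Xpow a))))))

scale-sub : ∀ x y p → scaleₚ (x ℤ.- y) p ≋ scaleₚ x p +ₚ negₚ (scaleₚ y p)
scale-sub x y p = coeffwise λ i → trans (coeff-scale (x ℤ.- y) p i) (trans (distribute x y (coeff p i))
  (sym (trans (coeff-+ (scaleₚ x p) (negₚ (scaleₚ y p)) i) (cong₂ ℤ._+_ (coeff-scale x p i) (trans (coeff-neg (scaleₚ y p) i) (cong ℤ.-_ (coeff-scale y p i)))))))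
  where
  distribute : ∀ x y z → (x ℤ.- y) ℤ.* z ≡ x ℤ.* z ℤ.+ ℤ.- (y ℤ.* z)
  distribute = ℤSolver.solve-∀

val-subtractFront : ∀ m xs ys → length xs ≡ m + length ys → val (subtractFront xs ys) ≋ val xs +ₚ negₚ (Xpow m *ₚ val ys)
val-subtractFront m xs [] e = ≋-sym (≋-trans (+-congˡ (val xs) (neg-cong (*-zeroʳ (Xpow m)))) (+-identityʳ (val xs)))
val-subtractFront m [] (y ∷ ys) e = case trans e (ℕₚ.+-suc m (length ys)) of λ ()
val-subtractFront m (x ∷ xs) (y ∷ ys) e = begin
  val (subtractFront xs ys) +ₚ scaleₚ (x ℤ.- y) (Xpow (length (subtractFront xs ys)))
    ≈⟨ +-cong (val-subtractFront m xs ys len) (≋-trans (≋-reflexive (cong (λ k → scaleₚ (x ℤ.- y) (Xpow k)) (length-subtractFront xs ys shorter))) (scale-sub x y (Xpow (length xs)))) ⟩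
  (val xs +ₚ negₚ (Xpow m *ₚ val ys)) +ₚ (scaleₚ x (Xpow (length xs)) +ₚ negₚ (scaleₚ y (Xpow (length xs))))
    ≈⟨ +-congˡ (val xs +ₚ negₚ (Xpow m *ₚ val ys)) (+-congˡ (scaleₚ x (Xpow (length xs)))
        (neg-cong (≋-trans (≋-reflexive (cong (λ k → scaleₚ y (Xpow k)) len)) (scale-shift y m (length ys))))) ⟩
  (val xs +ₚ negₚ (Xpow m *ₚ val ys)) +ₚ (scaleₚ x (Xpow (length xs)) +ₚ negₚ (Xpow m *ₚ scaleₚ y (Xpow (length ys))))
    ≈⟨ collect (val xs) (Xpow m) (val ys) (scaleₚ x (Xpow (length xs))) (scaleₚ y (Xpow (length ys))) ⟩
  (val xs +ₚ scaleₚ x (Xpow (length xs))) +ₚ negₚ (Xpow m *ₚ (val ys +ₚ scaleₚ y (Xpow (length ys)))) ∎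
  where
  open ≋-Reasoning
  len : length xs ≡ m + length ys
  len = ℕₚ.suc-injective (trans e (ℕₚ.+-suc m (length ys)))
  shorter : length ys ≤ length xs
  shorter = subst (length ys ≤_) (sym len) (ℕₚ.m≤n+m (length ys) m)
  collect : ∀ a x b c d → (a +ₚ negₚ (x *ₚ b)) +ₚ (c +ₚ negₚ (x *ₚ d)) ≋ (a +ₚ c) +ₚ negₚ (x *ₚ (b +ₚ d))
  collect = RingSolver.solve-∀ polynomialRing

val-scale : ∀ c fs → val (scaleₚ c fs) ≋ scaleₚ c (val fs)
val-scale c [] = ≋-refl
val-scale c (a ∷ fs) = ≋-trans (+-cong (val-scale c fs) (≋-trans (≋-reflexive (cong (λ k → scaleₚ (c ℤ.* a) (Xpow k)) (Listₚ.length-map (λ x → c ℤ.* x) fs))) (≋-sym (scale-scale c a (Xpow (length fs))))))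
  (≋-sym (scale-+ c (val fs) (scaleₚ a (Xpow (length fs)))))

Degree< : Poly → ℕ → Set
Degree< p n = ∀ i → n ≤ i → coeff p i ≡ 0ℤ

degree-+ : ∀ {p q n} → Degree< p n → Degree< q n → Degree< (p +ₚ q) n
degree-+ {p} {q} h k i n≤i = trans (coeff-+ p q i) (cong₂ ℤ._+_ (h i n≤i) (k i n≤i))

degree-scale : ∀ {p n} c → Degree< p n → Degree< (scaleₚ c p) n
degree-scale {p} c h i n≤i = trans (coeff-scale c p i) (trans (cong (c ℤ.*_) (h i n≤i)) (ℤₚ.*-zeroʳ c))

degree-weaken : ∀ {p m n} → m ≤ n → Degree< p m → Degree< p n
degree-weaken m≤n h i n≤i = h i (ℕₚ.≤-trans m≤n n≤i)

degree-Xpow : ∀ k → Degree< (Xpow k) (suc k)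
degree-Xpow zero (suc i) h = refl
degree-Xpow (suc k) (suc i) h = degree-Xpow k i (s≤s⁻¹ h)

coeff-Xpow : ∀ k → coeff (Xpow k) k ≡ 1ℤ
coeff-Xpow zero = refl
coeff-Xpow (suc k) = coeff-Xpow k

degree-val : ∀ fs → Degree< (val fs) (length fs)
degree-val [] i h = refl
degree-val (c ∷ fs) = degree-+ {val fs} {scaleₚ c (Xpow (length fs))} (degree-weaken {val fs} (ℕₚ.n≤1+n _) (degree-val fs)) (degree-scale {Xpow (length fs)} c (degree-Xpow (length fs)))

degree-* : ∀ p q m n → Degree< p m → Degree< q n → Degree< (p *ₚ q) (m + n)
degree-* [] q m n h k i _ = refl
degree-* (a ∷ p) q zero n h k i n≤i = trans (at (≋-trans (*-congʳ q zero≋) ≋-refl) i) refl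
  where
  zero≋ : a ∷ p ≋ []
  zero≋ = coeffwise λ j → h j z≤n
degree-* (a ∷ p) q (suc m) n h k zero ()
degree-* (a ∷ p) q (suc m) n h k (suc i) le = trans (coeff-+ (scaleₚ a q) (0ℤ ∷ (p *ₚ q)) (suc i))
  (cong₂ ℤ._+_ (degree-scale {q} a k (suc i) (ℕₚ.≤-trans (ℕₚ.m≤n+m n (suc m)) le)) (degree-* p q m n (λ j m≤j → h (suc j) (s≤s m≤j)) k i (s≤s⁻¹ le)))

coeff-shift : ∀ k p i → coeff (Xpow k *ₚ p) (k + i) ≡ coeff p i
coeff-shift zero p i = at (*-identityˡ p) i
coeff-shift (suc k) p i = trans (at (∷-* (Xpow k) p) (suc (k + i))) (coeff-shift k p i)

-- Multiplication by a monic polynomial preserves the leading coefficient, so the coefficients of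
-- `fs` are seen to vanish from the top down. This is uniqueness of the quotient.
monic-cancel : ∀ gt fs → Degree< (val (1ℤ ∷ gt) *ₚ val fs) (length gt) → val fs ≋ []
monic-cancel gt [] h = ≋-refl
monic-cancel gt (c ∷ fs) h = ≋-trans drop-top (monic-cancel gt fs (λ i le → trans (at (*-congˡ (val (1ℤ ∷ gt)) (≋-sym drop-top)) i) (h i le)))
  where
  L = length gt
  l = length fs
  top : coeff (val (1ℤ ∷ gt) *ₚ val (c ∷ fs)) (L + l) ≡ c
  top = trans (at (expand (val gt) (scaleₚ 1ℤ (Xpow L)) (val fs) (scaleₚ c (Xpow l))) (L + l))
    (trans (coeff-+ (val gt *ₚ val fs) _ (L + l))
      (trans (cong₂ ℤ._+_ (degree-* (val gt) (val fs) L l (degree-val gt) (degree-val fs) (L + l) ℕₚ.≤-refl)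
        (trans (coeff-+ (scaleₚ c (Xpow l) *ₚ val gt) _ (L + l)) (cong₂ ℤ._+_ left
          (trans (coeff-+ (scaleₚ 1ℤ (Xpow L) *ₚ val fs) _ (L + l)) (cong₂ ℤ._+_ (trans (at (*-congʳ (val fs) (scale-one (Xpow L))) (L + l)) (trans (coeff-shift L (val fs) l) (degree-val fs l ℕₚ.≤-refl))) right)))))
        (trans (ℤₚ.+-identityˡ _) (trans (ℤₚ.+-identityˡ _) (ℤₚ.+-identityˡ c)))))
    where
    expand : ∀ a b c d → (a +ₚ b) *ₚ (c +ₚ d) ≋ a *ₚ c +ₚ (d *ₚ a +ₚ (b *ₚ c +ₚ b *ₚ d))
    expand = RingSolver.solve-∀ polynomialRing
    left : coeff (scaleₚ c (Xpow l) *ₚ val gt) (L + l) ≡ 0ℤ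
    left = trans (at (scale-* c (Xpow l) (val gt)) (L + l)) (trans (coeff-scale c (Xpow l *ₚ val gt) (L + l)) (trans (cong (c ℤ.*_)
      (trans (cong (coeff (Xpow l *ₚ val gt)) (ℕₚ.+-comm L l)) (trans (coeff-shift l (val gt) L) (degree-val gt L ℕₚ.≤-refl)))) (ℤₚ.*-zeroʳ c)))
    right : coeff (scaleₚ 1ℤ (Xpow L) *ₚ scaleₚ c (Xpow l)) (L + l) ≡ c
    right = trans (at (*-congʳ (scaleₚ c (Xpow l)) (scale-one (Xpow L))) (L + l)) (trans (coeff-shift L (scaleₚ c (Xpow l)) l)
      (trans (coeff-scale c (Xpow l) l) (trans (cong (c ℤ.*_) (coeff-Xpow l)) (ℤₚ.*-identityʳ c))))
  c≡0 : c ≡ 0ℤ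
  c≡0 = trans (sym top) (h (L + l) (ℕₚ.m≤m+n L l))
  drop-top : val (c ∷ fs) ≋ val fs
  drop-top = ≋-trans (+-congˡ (val fs) (≋-trans (≋-reflexive (cong (λ z → scaleₚ z (Xpow l)) c≡0)) (scale-zero (Xpow l)))) (+-identityʳ (val fs))

record Division (F gt q : List ℤ) : Set where
  constructor division
  field
    rest : Poly
    equation : val F ≋ val (1ℤ ∷ gt) *ₚ val q +ₚ rest
    small : Degree< rest (length gt)
    degree : length q ≡ length F ∸ length gt

-- Each round subtracts c X^m times the divisor, where m is the excess length, and thereby clears
-- the leading coefficient `c`; the remainder is whatever stays once the dividend is too short.
highDiv-division : ∀ k F gt → length F ≡ k → Division F gt (highDiv k F gt)
highDiv-division zero [] gt e = division [] (≋-sym (≋-trans (+-identityʳ _) (*-zeroʳ (val (1ℤ ∷ gt))))) (λ i _ → refl) (sym (ℕₚ.0∸n≡0 (length gt)))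
highDiv-division (suc k) (c ∷ F) gt e = subst (Division (c ∷ F) gt) (sym (highDiv-step k c F gt)) (go (length F <ᵇ length gt) refl)
  where
  F′ = subtractFront F (scaleₚ c gt)
  go : ∀ b → (length F <ᵇ length gt) ≡ b → Division (c ∷ F) gt (if b then [] else c ∷ highDiv k F′ gt)
  go true t = division (val (c ∷ F)) (≋-sym (+-congʳ (val (c ∷ F)) (*-zeroʳ (val (1ℤ ∷ gt)))))
    (degree-weaken {val (c ∷ F)} F<gt (degree-val (c ∷ F))) (sym (ℕₚ.m≤n⇒m∸n≡0 F<gt))
    where
    F<gt : length F < length gt
    F<gt = ℕₚ.<ᵇ⇒< (length F) (length gt) (subst T (sym t) tt)
  go false t = division (Division.rest R) equation (Division.small R) (trans (cong suc lenq) (sym (ℕₚ.+-∸-assoc 1 gt≤F)))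
    where
    gt≤F : length gt ≤ length F
    gt≤F = ℕₚ.≮⇒≥ (λ h → subst T t (ℕₚ.<⇒<ᵇ h))
    lenc : length (scaleₚ c gt) ≡ length gt
    lenc = Listₚ.length-map (λ x → c ℤ.* x) gt
    lenF′ : length F′ ≡ length F
    lenF′ = length-subtractFront F (scaleₚ c gt) (subst (_≤ length F) (sym lenc) gt≤F)
    q = highDiv k F′ gt
    R : Division F′ gt q
    R = highDiv-division k F′ gt (trans lenF′ (ℕₚ.suc-injective e))
    lenq : length q ≡ length F ∸ length gt
    lenq = trans (Division.degree R) (cong (_∸ length gt) lenF′)
    m = length F ∸ length gt
    open ≋-Reasoning
    G = scaleₚ 1ℤ (Xpow (length gt))
    one-shift : Xpow m *ₚ G ≋ Xpow (length F)
    one-shift = ≋-trans (*-congˡ (Xpow m) (scale-one (Xpow (length gt)))) (≋-trans (≋-sym (Xpow-+ m (length gt))) (≋-reflexive (cong Xpow (ℕₚ.m∸n+n≡m gt≤F))))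
    equation : val (c ∷ F) ≋ val (1ℤ ∷ gt) *ₚ val (c ∷ q) +ₚ Division.rest R
    equation = ≋-sym (begin
      (val gt +ₚ G) *ₚ (val q +ₚ scaleₚ c (Xpow (length q))) +ₚ Division.rest R
        ≈⟨ +-congʳ (Division.rest R) (*-congˡ (val gt +ₚ G) (+-congˡ (val q) (≋-trans (≋-reflexive (cong (λ z → scaleₚ c (Xpow z)) lenq)) (≋-sym (int-scale c (Xpow m)))))) ⟩
      (val gt +ₚ G) *ₚ (val q +ₚ int c *ₚ Xpow m) +ₚ Division.rest R
        ≈⟨ expand (val gt) G (val q) (int c) (Xpow m) (Division.rest R) ⟩
      ((val gt +ₚ G) *ₚ val q +ₚ Division.rest R) +ₚ (Xpow m *ₚ (int c *ₚ val gt) +ₚ int c *ₚ (Xpow m *ₚ G))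
        ≈⟨ +-cong (≋-trans (≋-sym (Division.equation R)) (val-subtractFront m F (scaleₚ c gt) (trans (sym (ℕₚ.m∸n+n≡m gt≤F)) (cong (m +_) (sym lenc)))))
                  (+-cong (*-congˡ (Xpow m) (≋-trans (int-scale c (val gt)) (≋-sym (val-scale c gt)))) (≋-trans (*-congˡ (int c) one-shift) (int-scale c (Xpow (length F))))) ⟩
      (val F +ₚ negₚ (Xpow m *ₚ val (scaleₚ c gt))) +ₚ (Xpow m *ₚ val (scaleₚ c gt) +ₚ scaleₚ c (Xpow (length F)))
        ≈⟨ cancel (val F) (Xpow m *ₚ val (scaleₚ c gt)) (scaleₚ c (Xpow (length F))) ⟩
      val F +ₚ scaleₚ c (Xpow (length F)) ∎)
      where
      expand : ∀ a g q c x r → (a +ₚ g) *ₚ (q +ₚ c *ₚ x) +ₚ r ≋ ((a +ₚ g) *ₚ q +ₚ r) +ₚ (x *ₚ (c *ₚ a) +ₚ c *ₚ (x *ₚ g))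
      expand = RingSolver.solve-∀ polynomialRing
      cancel : ∀ f y z → (f +ₚ negₚ y) +ₚ (y +ₚ z) ≋ f +ₚ z
      cancel = RingSolver.solve-∀ polynomialRing

Monic : Poly → Set
Monic p = ∃ λ p′ → p ≡ p′ ++ [ 1ℤ ]

monic-reverse : ∀ {p} → Monic p → reverse p ≡ 1ℤ ∷ drop 1 (reverse p)
monic-reverse {p} (p′ , refl) rewrite Listₚ.reverse-++ p′ [ 1ℤ ] = refl

monic-val : ∀ {p} → Monic p → p ≋ val (1ℤ ∷ drop 1 (reverse p))
monic-val {p} m = ≋-trans (≋-reflexive (sym (Listₚ.reverse-involutive p))) (≋-trans (reverse-val (reverse p)) (≋-reflexive (cong val (monic-reverse m))))

module _ (f g : Poly) (mf : Monic f) (mg : Monic g) (g∣f : Divides g f) where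

  private
    F = reverse f
    gt = drop 1 (reverse g)
    q = highDiv (length f) F gt
    K = proj₁ g∣f
    R : Division F gt q
    R = highDiv-division (length f) F gt (Listₚ.length-reverse f)
    G = val (1ℤ ∷ gt)
    f≋ : f ≋ val F
    f≋ = ≋-trans (≋-reflexive (sym (Listₚ.reverse-involutive f))) (reverse-val F)
    GK : G *ₚ K ≋ G *ₚ val q +ₚ Division.rest R
    GK = ≋-trans (*-congʳ K (≋-sym (monic-val mg))) (≋-trans (proj₂ g∣f) (≋-trans f≋ (Division.equation R)))
    D = K +ₚ negₚ (val q)
    GD : G *ₚ D ≋ Division.rest R
    GD = ≋-trans (expand G K (val q)) (≋-trans (+-congʳ (negₚ (G *ₚ val q)) GK) (cancel (G *ₚ val q) (Division.rest R)))
      where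
      expand : ∀ g k q → g *ₚ (k +ₚ negₚ q) ≋ g *ₚ k +ₚ negₚ (g *ₚ q)
      expand = RingSolver.solve-∀ polynomialRing
      cancel : ∀ x r → (x +ₚ r) +ₚ negₚ x ≋ r
      cancel = RingSolver.solve-∀ polynomialRing
    D-val : D ≋ val (reverse D)
    D-val = ≋-trans (≋-reflexive (sym (Listₚ.reverse-involutive D))) (reverse-val (reverse D))
    K≋q : K ≋ val q
    K≋q = difference (≋-trans D-val (monic-cancel gt (reverse D) λ i le → trans (at (≋-trans (*-congˡ G (≋-sym D-val)) GD) i) (Division.small R i le)))

  -- Some cofactor `K` is known to exist. Uniqueness of division by a monic polynomial identifies it
  -- with the computed quotient.
  divMonic-exact : g *ₚ divMonic f g ≋ f
  divMonic-exact = ≋-trans (*-congˡ g (≋-trans (≋-reflexive (divMonic-highDiv f g)) (≋-trans (reverse-val q) (≋-sym K≋q)))) (proj₂ g∣f)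

  divMonic-monic : Monic (divMonic f g)
  divMonic-monic = subst Monic (sym (divMonic-highDiv f g)) (go (length f) F (trans (Listₚ.length-reverse f) refl) (monic-reverse mf) q≢[])
    where
    q≢[] : q ≢ []
    q≢[] e = case trans (sym top) (at f≋0 (length (proj₁ mf))) of λ ()
      where
      f≋0 : f ≋ []
      f≋0 = ≋-trans (≋-sym (proj₂ g∣f)) (≋-trans (*-congˡ g (≋-trans K≋q (≋-reflexive (cong val e)))) (*-zeroʳ g))
      top : coeff f (length (proj₁ mf)) ≡ 1ℤ
      top = subst (λ z → coeff z (length (proj₁ mf)) ≡ 1ℤ) (sym (proj₂ mf)) (last (proj₁ mf))
        where
        last : ∀ p → coeff (p ++ [ 1ℤ ]) (length p) ≡ 1ℤ
        last [] = refl
        last (_ ∷ p) = last p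
    go : ∀ k F → length F ≡ k → F ≡ 1ℤ ∷ drop 1 F → highDiv k F gt ≢ [] → Monic (reverse (highDiv k F gt))
    go (suc k) (c ∷ F) e h nonempty rewrite highDiv-step k c F gt with length F <ᵇ length gt
    ... | true = ⊥-elim (nonempty refl)
    ... | false = reverse (highDiv k (subtractFront F (scaleₚ c gt)) gt) ,
      trans (Listₚ.unfold-reverse c (highDiv k (subtractFront F (scaleₚ c gt)) gt)) (cong (λ z → reverse (highDiv k (subtractFront F (scaleₚ c gt)) gt) ++ [ z ]) (Listₚ.∷-injectiveˡ h))

monic-one : Monic oneₚ
monic-one = [] , refl

monic-Xpow-1 : ∀ n → Monic (Xpow-1 (suc n))
monic-Xpow-1 n = (ℤ.- 1ℤ) ∷ replicate n 0ℤ , cong (ℤ.- 1ℤ ∷_) (unit-right (Xpow n))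
  where
  unit-right : ∀ p → p +ₚ [] ≡ p
  unit-right [] = refl
  unit-right (_ ∷ p) = refl

monic-+ : ∀ xs ys → length xs ≤ length ys → ∃ λ zs → xs +ₚ (ys ++ [ 1ℤ ]) ≡ zs ++ [ 1ℤ ] × length zs ≡ length ys
monic-+ [] ys h = ys , refl , refl
monic-+ (x ∷ xs) (y ∷ ys) h with monic-+ xs ys (s≤s⁻¹ h)
... | zs , e , l = (x ℤ.+ y) ∷ zs , cong ((x ℤ.+ y) ∷_) e , cong suc l

monic-*′ : ∀ p q → ∃ λ r → (p ++ [ 1ℤ ]) *ₚ (q ++ [ 1ℤ ]) ≡ r ++ [ 1ℤ ] × length r ≡ length p + length q
monic-*′ [] q = q , base q , refl
  where
  base : ∀ q → scaleₚ 1ℤ (q ++ [ 1ℤ ]) +ₚ (0ℤ ∷ []) ≡ q ++ [ 1ℤ ]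
  base [] = refl
  base (x ∷ q) = cong₂ _∷_ (trans (ℤₚ.+-identityʳ (1ℤ ℤ.* x)) (ℤₚ.*-identityˡ x)) (trans (unit-right (scaleₚ 1ℤ (q ++ [ 1ℤ ]))) (trans (Listₚ.map-cong ℤₚ.*-identityˡ (q ++ [ 1ℤ ])) (Listₚ.map-id (q ++ [ 1ℤ ]))))
    where
    unit-right : ∀ p → p +ₚ [] ≡ p
    unit-right [] = refl
    unit-right (_ ∷ p) = refl
monic-*′ (a ∷ p) q with monic-*′ p q
... | r , e , l with monic-+ (scaleₚ a (q ++ [ 1ℤ ])) (0ℤ ∷ r)
        (subst₂ _≤_ (sym (trans (Listₚ.length-map (λ x → a ℤ.* x) (q ++ [ 1ℤ ])) (trans (Listₚ.length-++ q) (ℕₚ.+-comm (length q) 1)))) (cong suc (sym l)) (s≤s (ℕₚ.m≤n+m (length q) (length p))))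
... | zs , e′ , l′ = zs , trans (cong (λ z → scaleₚ a (q ++ [ 1ℤ ]) +ₚ (0ℤ ∷ z)) e) e′ , trans l′ (cong suc l)

monic-* : ∀ {p q} → Monic p → Monic q → Monic (p *ₚ q)
monic-* (p , refl) (q , refl) with monic-*′ p q
... | r , e , _ = r , e

-- Cyclotomic polynomials

prodₚ-++ : ∀ ps qs → prodₚ (ps ++ qs) ≋ prodₚ ps *ₚ prodₚ qs
prodₚ-++ [] qs = ≋-sym (*-identityˡ (prodₚ qs))
prodₚ-++ (p ∷ ps) qs = ≋-trans (*-congˡ p (prodₚ-++ ps qs)) (≋-sym (*-assoc p (prodₚ ps) (prodₚ qs)))

-- the product of Φ_e over the divisors e ≤ m of n
divisorProduct : ℕ → ℕ → Poly
divisorProduct m n = prodₚ (map proj₂ (filter (λ p → proj₁ p ∣? n) (table m)))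

divisorProduct-suc : ∀ m n → divisorProduct (suc m) n ≋ divisorProduct m n *ₚ prodₚ (map proj₂ (filter (λ p → proj₁ p ∣? n) [ (suc m , cyclotomic (suc m)) ]))
divisorProduct-suc m n = ≋-trans (≋-reflexive (cong prodₚ (trans
    (cong (map proj₂) (Listₚ.filter-++ (λ p → proj₁ p ∣? n) (table m) [ (suc m , cyclotomic (suc m)) ]))
    (Listₚ.map-++ proj₂ (filter (λ p → proj₁ p ∣? n) (table m)) (filter (λ p → proj₁ p ∣? n) [ (suc m , cyclotomic (suc m)) ])))))
  (prodₚ-++ (map proj₂ (filter (λ p → proj₁ p ∣? n) (table m))) (map proj₂ (filter (λ p → proj₁ p ∣? n) [ (suc m , cyclotomic (suc m)) ])))

last-factor : ∀ m n Φ → (suc m ∣ n → prodₚ (map proj₂ (filter (λ p → proj₁ p ∣? n) [ (suc m , Φ) ])) ≋ Φ) ×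
  (¬ suc m ∣ n → prodₚ (map proj₂ (filter (λ p → proj₁ p ∣? n) [ (suc m , Φ) ])) ≋ oneₚ)
last-factor m n Φ =
  (λ h → ≋-trans (≋-reflexive (cong (prodₚ ∘ map proj₂) (Listₚ.filter-accept (λ p → proj₁ p ∣? n) {suc m , Φ} {[]} h))) (*-identityʳ Φ)) ,
  (λ h → ≋-reflexive (cong (prodₚ ∘ map proj₂) (Listₚ.filter-reject (λ p → proj₁ p ∣? n) {suc m , Φ} {[]} h)))

divisorProduct-∣ : ∀ m n → suc m ∣ n → divisorProduct (suc m) n ≋ divisorProduct m n *ₚ cyclotomic (suc m)
divisorProduct-∣ m n h = ≋-trans (divisorProduct-suc m n) (*-congˡ (divisorProduct m n) (proj₁ (last-factor m n (cyclotomic (suc m))) h))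

divisorProduct-∤ : ∀ m n → ¬ suc m ∣ n → divisorProduct (suc m) n ≋ divisorProduct m n
divisorProduct-∤ m n h = ≋-trans (divisorProduct-suc m n) (≋-trans (*-congˡ (divisorProduct m n) (proj₂ (last-factor m n (cyclotomic (suc m))) h)) (*-identityʳ (divisorProduct m n)))

record Cyclotomic (n : ℕ) : Set where
  field
    monic : Monic (cyclotomic n)
    unit : Unit (cyclotomic n)
    divisors : divisorProduct n n ≋ Xpow-1 n

divisorProduct-monic : ∀ m n → (∀ e → e < m → Monic (cyclotomic (suc e))) → Monic (divisorProduct m n)
divisorProduct-monic m n h = all-monic (map proj₂ (filter (λ p → proj₁ p ∣? n) (table m))) λ q → case ∈-map⁻ proj₂ q of λ
  { (p , p∈ , refl) → table-monic m h (proj₁ (∈-filter⁻ (λ p → proj₁ p ∣? n) {xs = table m} p∈)) }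
  where
  all-monic : ∀ ps → (∀ {p} → p ∈ ps → Monic p) → Monic (prodₚ ps)
  all-monic [] h = monic-one
  all-monic (p ∷ ps) h = monic-* (h (here refl)) (all-monic ps (h ∘ there))
  table-monic : ∀ m → (∀ e → e < m → Monic (cyclotomic (suc e))) → ∀ {p} → p ∈ table m → Monic (proj₂ p)
  table-monic zero h ()
  table-monic (suc m) h q with ∈-++⁻ (table m) q
  ... | inj₁ q′ = table-monic m (λ e e<m → h e (ℕₚ.m<n⇒m<1+n e<m)) q′
  ... | inj₂ (here refl) = h m ℕₚ.≤-refl

divisorProduct-stable : ∀ k g → 0 < g → divisorProduct (k + g) g ≋ divisorProduct g g
divisorProduct-stable zero g h = ≋-refl
divisorProduct-stable (suc k) g h = ≋-trans (divisorProduct-∤ (k + g) g (λ d → ℕₚ.<⇒≱ (s≤s (ℕₚ.m≤n+m g k)) (Div.∣⇒≤ {{>-nonZero h}} d)))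
  (divisorProduct-stable k g h)

divisorProduct-factor : ∀ m g n → g ∣ n → Divides (divisorProduct m g) (divisorProduct m n)
divisorProduct-factor zero g n h = oneₚ , *-identityʳ oneₚ
divisorProduct-factor (suc m) g n h = go (suc m ∣? g) (suc m ∣? n)
  where
  R = proj₁ (divisorProduct-factor m g n h)
  e : divisorProduct m g *ₚ R ≋ divisorProduct m n
  e = proj₂ (divisorProduct-factor m g n h)
  Φ = cyclotomic (suc m)
  swap : ∀ d φ r → (d *ₚ φ) *ₚ r ≋ (d *ₚ r) *ₚ φ
  swap = RingSolver.solve-∀ polynomialRing
  go : Dec (suc m ∣ g) → Dec (suc m ∣ n) → Divides (divisorProduct (suc m) g) (divisorProduct (suc m) n)
  go (yes p) (no q) = ⊥-elim (q (∣-trans p h))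
  go (yes p) (yes q) = R , ≋-trans (*-congʳ R (divisorProduct-∣ m g p)) (≋-trans (swap (divisorProduct m g) Φ R)
    (≋-trans (*-congʳ Φ e) (≋-sym (divisorProduct-∣ m n q))))
  go (no p) (yes q) = R *ₚ Φ , ≋-trans (*-congʳ (R *ₚ Φ) (divisorProduct-∤ m g p)) (≋-trans (≋-sym (*-assoc (divisorProduct m g) R Φ))
    (≋-trans (*-congʳ Φ e) (≋-sym (divisorProduct-∣ m n q))))
  go (no p) (no q) = R , ≋-trans (*-congʳ R (divisorProduct-∤ m g p)) (≋-trans e (≋-sym (divisorProduct-∤ m n q)))

-- If g + y b = x a, then X^g - 1 = (X^(x a) - 1) - X^g (X^(y b) - 1), and the two differences are
-- multiples of X^a - 1 and X^b - 1.
Xpow-1-bézout : ∀ a b g → Bézout.Identity g a b → ∃ λ A → ∃ λ B → Xpow-1 g ≋ Xpow-1 a *ₚ A +ₚ Xpow-1 b *ₚ B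
Xpow-1-bézout a b g (Bézout.+- x y e) = proj₁ ma , negₚ (Xpow g *ₚ proj₁ mb) , step (Xpow-1 a) (proj₁ ma) (Xpow-1 b) (proj₁ mb) (proj₂ ma) (proj₂ mb)
  where
  ma = Xpow-1-multiple a x
  mb = Xpow-1-multiple b y
  open ≋-Reasoning
  isolate : ∀ x p q → p ≋ (x *ₚ q +ₚ p) +ₚ negₚ (x *ₚ q)
  isolate = RingSolver.solve-∀ polynomialRing
  rearrange : ∀ pa ka pb kb x → pa *ₚ ka +ₚ negₚ (x *ₚ (pb *ₚ kb)) ≋ pa *ₚ ka +ₚ pb *ₚ (negₚ (x *ₚ kb))
  rearrange = RingSolver.solve-∀ polynomialRing
  step : ∀ pa ka pb kb → pa *ₚ ka ≋ Xpow-1 (x * a) → pb *ₚ kb ≋ Xpow-1 (y * b) → Xpow-1 g ≋ pa *ₚ ka +ₚ pb *ₚ negₚ (Xpow g *ₚ kb)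
  step pa ka pb kb h k = begin
    Xpow-1 g                                                             ≈⟨ isolate (Xpow g) (Xpow-1 g) (Xpow-1 (y * b)) ⟩
    (Xpow g *ₚ Xpow-1 (y * b) +ₚ Xpow-1 g) +ₚ negₚ (Xpow g *ₚ Xpow-1 (y * b))
      ≈⟨ +-cong (≋-trans (≋-sym (Xpow-1-+ g (y * b))) (≋-trans (≋-reflexive (cong Xpow-1 e)) (≋-sym h))) (neg-cong (*-congˡ (Xpow g) (≋-sym k))) ⟩
    pa *ₚ ka +ₚ negₚ (Xpow g *ₚ (pb *ₚ kb))                              ≈⟨ rearrange pa ka pb kb (Xpow g) ⟩
    pa *ₚ ka +ₚ pb *ₚ negₚ (Xpow g *ₚ kb)                                ∎
Xpow-1-bézout a b g (Bézout.-+ x y e) = proj₁ swapped , proj₁ (proj₂ swapped) , proj₂ (proj₂ swapped)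
  where
  other = Xpow-1-bézout b a g (Bézout.+- y x e)
  swapped : ∃ λ A → ∃ λ B → Xpow-1 g ≋ Xpow-1 a *ₚ A +ₚ Xpow-1 b *ₚ B
  swapped = proj₁ (proj₂ other) , proj₁ other , ≋-trans (proj₂ (proj₂ other)) (+-comm (Xpow-1 b *ₚ proj₁ other) (Xpow-1 a *ₚ proj₁ (proj₂ other)))

cyclotomic-split : ∀ {m} → Cyclotomic (suc m) → divisorProduct m (suc m) *ₚ cyclotomic (suc m) ≋ Xpow-1 (suc m)
cyclotomic-split {m} C = ≋-trans (≋-sym (divisorProduct-∣ m (suc m) Div.∣-refl)) (Cyclotomic.divisors C)

cyclotomic-divides : ∀ {m} → Cyclotomic (suc m) → Divides (cyclotomic (suc m)) (Xpow-1 (suc m))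
cyclotomic-divides {m} C = divisorProduct m (suc m) , ≋-trans (*-comm (cyclotomic (suc m)) (divisorProduct m (suc m))) (cyclotomic-split C)

-- X^g - 1 is the product of the Φ_e with e dividing `g`. As `g` is a proper divisor of m + 1, these
-- are among the factors of X^(m + 1) - 1 other than Φ_(m + 1).
cyclotomic-quotient : ∀ {m} g → Cyclotomic (suc m) → Cyclotomic g → 0 < g → g ≤ m → g ∣ suc m →
  ∃ λ R → Xpow-1 g *ₚ (R *ₚ cyclotomic (suc m)) ≋ Xpow-1 (suc m)
cyclotomic-quotient {m} g C Cg 0<g g≤m g∣ = R , ≋-trans (≋-sym (*-assoc (Xpow-1 g) R (cyclotomic (suc m))))
  (≋-trans (*-congʳ (cyclotomic (suc m)) (≋-trans (*-congʳ R (≋-sym (≋-trans stable (Cyclotomic.divisors Cg)))) (proj₂ factor))) (cyclotomic-split C))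
  where
  factor = divisorProduct-factor m g (suc m) g∣
  R = proj₁ factor
  stable : divisorProduct m g ≋ divisorProduct g g
  stable = ≋-trans (≋-reflexive (cong (λ z → divisorProduct z g) (sym (ℕₚ.m∸n+n≡m g≤m)))) (divisorProduct-stable (m ∸ g) g 0<g)

-- With g = gcd (m + 1 , a) and c = (m + 1) / g, the quotient of X^(m + 1) - 1 by X^g - 1 is a
-- multiple of Φ and is congruent to `c` modulo X^g - 1. Since X^g - 1 lies in the ideal of X^(m +
-- 1) - 1 and X^a - 1, and Φ divides the former, `c` lies in (Φ , X^a - 1).
cyclotomic-independent : ∀ {m} a → (∀ g → g ≤ suc m → 0 < g → Cyclotomic g) → ¬ suc m ∣ a → Independent (cyclotomic (suc m)) (Xpow-1 a)
cyclotomic-independent {m} a all h = conclude c c≡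
  where
  g = gcd (suc m) a
  g∣m = gcd[m,n]∣m (suc m) a
  0<g : 0 < g
  0<g = ℕₚ.n≢0⇒n>0 λ e → case Div.0∣⇒≡0 (subst (_∣ suc m) e g∣m) of λ ()
  g≤ : g ≤ suc m
  g≤ = Div.∣⇒≤ g∣m
  g≤m : g ≤ m
  g≤m = s≤s⁻¹ (ℕₚ.≤∧≢⇒< g≤ (λ e → h (subst (_∣ a) e (gcd[m,n]∣n (suc m) a))))
  c = Div.quotient g∣m
  c≡ : suc m ≡ c * g
  c≡ = _∣_.equality g∣m
  C = all (suc m) ℕₚ.≤-refl (s≤s z≤n)
  Q = cyclotomic-quotient g C (all g g≤ 0<g) 0<g g≤m g∣m
  Φ = cyclotomic (suc m)
  B = Xpow-1-bézout (suc m) a g (Bézout.identity (gcd-GCD (suc m) a))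
  conclude : ∀ c → suc m ≡ c * g → Independent Φ (Xpow-1 a)
  conclude (suc c) e = independent c (R +ₚ negₚ (S *ₚ (D *ₚ A))) (negₚ (S *ₚ A′)) final-step
    where
    geo = geometric g (suc c)
    G = proj₁ geo
    S = proj₁ (proj₂ (proj₂ geo))
    R = proj₁ Q
    A = proj₁ B
    A′ = proj₁ (proj₂ B)
    D = divisorProduct m (suc m)
    G≋ : G ≋ R *ₚ Φ
    G≋ = unit-cancelˡ (Xpow-1 g) (unit-Xpow-1 g 0<g) (≋-trans (proj₁ (proj₂ geo)) (≋-trans (≋-reflexive (cong Xpow-1 (sym e))) (≋-sym (proj₂ Q))))
    open ≋-Reasoning
    expand : ∀ r s d a φ a′ p → (r +ₚ negₚ (s *ₚ (d *ₚ a))) *ₚ φ +ₚ negₚ (s *ₚ a′) *ₚ p ≋ r *ₚ φ +ₚ negₚ (s *ₚ ((d *ₚ φ) *ₚ a +ₚ p *ₚ a′))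
    expand = RingSolver.solve-∀ polynomialRing
    cancel : ∀ c p s → (c +ₚ p *ₚ s) +ₚ negₚ (s *ₚ p) ≋ c
    cancel = RingSolver.solve-∀ polynomialRing
    final-step : (R +ₚ negₚ (S *ₚ (D *ₚ A))) *ₚ Φ +ₚ negₚ (S *ₚ A′) *ₚ Xpow-1 a ≋ int (ℤ.+ suc c)
    final-step = begin
      (R +ₚ negₚ (S *ₚ (D *ₚ A))) *ₚ Φ +ₚ negₚ (S *ₚ A′) *ₚ Xpow-1 a  ≈⟨ expand R S D A Φ A′ (Xpow-1 a) ⟩
      R *ₚ Φ +ₚ negₚ (S *ₚ ((D *ₚ Φ) *ₚ A +ₚ Xpow-1 a *ₚ A′))
        ≈⟨ +-cong (≋-trans (≋-sym G≋) (proj₂ (proj₂ (proj₂ geo)))) (neg-cong (*-congˡ S (≋-trans (+-congʳ (Xpow-1 a *ₚ A′) (*-congʳ A (cyclotomic-split C))) (≋-sym (proj₂ (proj₂ B)))))) ⟩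
      (int (ℤ.+ suc c) +ₚ Xpow-1 g *ₚ S) +ₚ negₚ (S *ₚ Xpow-1 g)       ≈⟨ cancel (int (ℤ.+ suc c)) (Xpow-1 g) S ⟩
      int (ℤ.+ suc c)                                                  ∎

-- Exactness of the division defining Φ_n amounts to the product of the Φ_e over proper divisors e
-- of n dividing X^n - 1. Each factor divides it, and the factors are independent: for k < e, Φ_(k +
-- 1) divides X^(k + 1) - 1, which is independent of Φ_(e + 1). Only smaller indices are involved.
cyclotomic-step : ∀ m → (∀ e → e < m → Cyclotomic (suc e)) → Cyclotomic (suc m)
cyclotomic-step m below = record { monic = subst Monic (sym (cyclotomic-table m)) (divMonic-monic (Xpow-1 n) P (monic-Xpow-1 m) monicP P∣)
  ; unit = unit-factor {cyclotomic n} {P} (unit-cong (≋-trans (≋-sym exact) (*-comm P (cyclotomic n))) (unit-Xpow-1 n (s≤s z≤n)))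
  ; divisors = ≋-trans (divisorProduct-∣ m n Div.∣-refl) exact }
  where
  n = suc m
  P = divisorProduct m n
  monicP : Monic P
  monicP = divisorProduct-monic m n (λ e e<m → Cyclotomic.monic (below e e<m))
  smaller : ∀ e → e < m → ∀ g → g ≤ suc e → 0 < g → Cyclotomic g
  smaller e e<m (suc g) (s≤s g≤e) _ = below g (ℕₚ.≤-<-trans g≤e e<m)
  pairwise : ∀ e → e < m → ∀ k → k ≤ e → Independent (cyclotomic (suc e)) (divisorProduct k n)
  pairwise e e<m zero k≤e = independent-one (cyclotomic (suc e))
  pairwise e e<m (suc k) k<e = go (suc k ∣? n)
    where
    IH : Independent (cyclotomic (suc e)) (divisorProduct k n)
    IH = pairwise e e<m k (ℕₚ.<⇒≤ k<e)
    conv : ∀ {f g h} → g ≋ h → Independent f h → Independent f g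
    conv {f} {g} {h} e i = independent-factor {f} {g} {h} (oneₚ , ≋-trans (*-identityʳ g) e) i
    go : Dec (suc k ∣ n) → Independent (cyclotomic (suc e)) (divisorProduct (suc k) n)
    go (no p) = conv (divisorProduct-∤ k n p) IH
    go (yes p) = conv (divisorProduct-∣ k n p) (independent-* IH (independent-factor (cyclotomic-divides (below k (ℕₚ.<-trans k<e e<m)))
      (cyclotomic-independent (suc k) (smaller e e<m) (λ d → ℕₚ.<⇒≱ (s≤s k<e) (Div.∣⇒≤ d)))))
  divides-upto : ∀ k → k ≤ m → Divides (divisorProduct k n) (Xpow-1 n)
  divides-upto zero _ = Xpow-1 n , *-identityˡ (Xpow-1 n)
  divides-upto (suc k) k<m = go (suc k ∣? n)
    where
    IH : Divides (divisorProduct k n) (Xpow-1 n)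
    IH = divides-upto k (ℕₚ.<⇒≤ k<m)
    conv : ∀ {f g h} → f ≋ g → Divides g h → Divides f h
    conv e (k , e′) = k , ≋-trans (*-congʳ k e) e′
    go : Dec (suc k ∣ n) → Divides (divisorProduct (suc k) n) (Xpow-1 n)
    go (no p) = conv (divisorProduct-∤ k n p) IH
    go (yes p) = conv (divisorProduct-∣ k n p) (independent-product (Cyclotomic.unit (below k k<m)) (pairwise k k<m k ℕₚ.≤-refl) Φ∣ IH)
      where
      Φ∣ : Divides (cyclotomic (suc k)) (Xpow-1 n)
      Φ∣ = divides-trans {cyclotomic (suc k)} {Xpow-1 (suc k)} {Xpow-1 n} (cyclotomic-divides (below k k<m)) (subst (λ z → Divides (Xpow-1 (suc k)) (Xpow-1 z)) (sym (_∣_.equality p)) (Xpow-1-multiple (suc k) (Div.quotient p)))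
  P∣ : Divides P (Xpow-1 n)
  P∣ = divides-upto m ℕₚ.≤-refl
  exact : P *ₚ cyclotomic n ≋ Xpow-1 n
  exact = ≋-trans (*-congˡ P (≋-reflexive (cyclotomic-table m))) (divMonic-exact (Xpow-1 n) P (monic-Xpow-1 m) monicP P∣)

cyclotomic-all : ∀ m → Cyclotomic (suc m)
cyclotomic-all = <-rec (λ m → Cyclotomic (suc m)) (λ m ih → cyclotomic-step m (λ e e<m → ih e<m))

cyclotomic-positive : ∀ n → 0 < n → Cyclotomic n
cyclotomic-positive (suc n) _ = cyclotomic-all n

-- The case g = 1 of `cyclotomic-quotient`, with the factor X - 1 cancelled from X^d - 1 = (X - 1)
-- [d].
cyclotomic-∣-qint : ∀ d → 2 ≤ d → Divides (cyclotomic d) (qint d)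
cyclotomic-∣-qint (suc m) (s≤s 1≤m) = proj₁ Q , ≋-trans (*-comm (cyclotomic (suc m)) (proj₁ Q))
  (unit-cancelˡ (Xpow-1 1) (unit-Xpow-1 1 (s≤s z≤n)) (≋-trans (proj₂ Q) (≋-sym (Xpow-1-qint (suc m)))))
  where
  Q = cyclotomic-quotient 1 (cyclotomic-all m) (cyclotomic-all 0) (s≤s z≤n) 1≤m (Div.1∣ suc m)

cyclotomic-independent-qint : ∀ d a → 0 < d → ¬ d ∣ a → Independent (cyclotomic d) (qint a)
cyclotomic-independent-qint (suc m) a _ h = independent-factor (Xpow-1 1 , ≋-trans (*-comm (qint a) (Xpow-1 1)) (Xpow-1-qint a))
  (cyclotomic-independent a (λ g _ 0<g → cyclotomic-positive g 0<g) h)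

-- The polynomial μ_λ

qfactorials : List ℕ → Poly
qfactorials m = prodₚ (map qfact m)

-- The q-Pascal recursion, obtained by splitting the last factor of the factorial as [a + 1] + X^(a
-- + 1) [b + 1].
qbinomial : ∀ a b → Divides (qfact a *ₚ qfact b) (qfact (a + b))
qbinomial zero b = oneₚ , ≋-trans (*-identityʳ (oneₚ *ₚ qfact b)) (*-identityˡ (qfact b))
qbinomial (suc a) zero = oneₚ , ≋-trans (*-identityʳ (qfact (suc a) *ₚ oneₚ)) (≋-trans (*-identityʳ (qfact (suc a))) (≋-reflexive (cong qfact (sym (ℕₚ.+-identityʳ (suc a))))))
qbinomial (suc a) (suc b) = proj₁ left +ₚ Xpow (suc a) *ₚ proj₁ right , ≋-sym (begin
  qfact (a + suc b) *ₚ qint (suc a + suc b)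
    ≈⟨ *-congˡ (qfact (a + suc b)) (qint-+ (suc a) (suc b)) ⟩
  qfact (a + suc b) *ₚ (qint (suc a) +ₚ Xpow (suc a) *ₚ qint (suc b))
    ≈⟨ distribute (qfact (a + suc b)) (qint (suc a)) (Xpow (suc a)) (qint (suc b)) ⟩
  qfact (a + suc b) *ₚ qint (suc a) +ₚ Xpow (suc a) *ₚ (qfact (a + suc b) *ₚ qint (suc b))
    ≈⟨ +-cong (*-congʳ (qint (suc a)) (≋-sym (proj₂ left))) (*-congˡ (Xpow (suc a)) (*-congʳ (qint (suc b)) (≋-sym (≋-trans (proj₂ right) (≋-reflexive (cong qfact (sym (ℕₚ.+-suc a b)))))))) ⟩
  (qfact a *ₚ (qfact b *ₚ qint (suc b))) *ₚ proj₁ left *ₚ qint (suc a) +ₚ Xpow (suc a) *ₚ ((qfact a *ₚ qint (suc a)) *ₚ qfact b *ₚ proj₁ right *ₚ qint (suc b))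
    ≈⟨ collect (qfact a) (qfact b) (qint (suc a)) (qint (suc b)) (proj₁ left) (Xpow (suc a)) (proj₁ right) ⟩
  (qfact a *ₚ qint (suc a)) *ₚ (qfact b *ₚ qint (suc b)) *ₚ (proj₁ left +ₚ Xpow (suc a) *ₚ proj₁ right) ∎)
  where
  open ≋-Reasoning
  left : Divides (qfact a *ₚ qfact (suc b)) (qfact (a + suc b))
  left = qbinomial a (suc b)
  right : Divides (qfact (suc a) *ₚ qfact b) (qfact (suc a + b))
  right = qbinomial (suc a) b
  distribute : ∀ f i x j → f *ₚ (i +ₚ x *ₚ j) ≋ f *ₚ i +ₚ x *ₚ (f *ₚ j)
  distribute = RingSolver.solve-∀ polynomialRing
  collect : ∀ a b i j l x r → (a *ₚ (b *ₚ j)) *ₚ l *ₚ i +ₚ x *ₚ ((a *ₚ i) *ₚ b *ₚ r *ₚ j) ≋ (a *ₚ i) *ₚ (b *ₚ j) *ₚ (l +ₚ x *ₚ r)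
  collect = RingSolver.solve-∀ polynomialRing

qmultinomial : ∀ m → Divides (qfactorials m) (qfact (sum m))
qmultinomial [] = oneₚ , *-identityʳ oneₚ
qmultinomial (a ∷ m) = proj₁ Q *ₚ proj₁ B , ≋-trans (rearrange (qfact a) (qfactorials m) (proj₁ Q) (proj₁ B))
  (≋-trans (*-congʳ (proj₁ B) (*-congˡ (qfact a) (proj₂ Q))) (proj₂ B))
  where
  Q : Divides (qfactorials m) (qfact (sum m))
  Q = qmultinomial m
  B : Divides (qfact a *ₚ qfact (sum m)) (qfact (a + sum m))
  B = qbinomial a (sum m)
  rearrange : ∀ f p q b → (f *ₚ p) *ₚ (q *ₚ b) ≋ (f *ₚ (p *ₚ q)) *ₚ b
  rearrange = RingSolver.solve-∀ polynomialRing

removals-qfactorials : ∀ {j m′} m → (j , m′) ∈ removals m → qfactorials m ≋ qint (nth j m) *ₚ qfactorials m′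
removals-qfactorials (zero ∷ m) h with ∈-map⁻ (λ c → lower c zero) h
... | (j , m′) , c∈ , refl = ≋-trans (*-congˡ (qfact 0) (removals-qfactorials m c∈)) (swap (qfact 0) (qint (nth j m)) (qfactorials m′))
  where
  swap : ∀ a b c → a *ₚ (b *ₚ c) ≋ b *ₚ (a *ₚ c)
  swap = RingSolver.solve-∀ polynomialRing
removals-qfactorials (suc a ∷ m) (here refl) = rearrange (qfact a) (qint (suc a)) (qfactorials m)
  where
  rearrange : ∀ a b c → a *ₚ b *ₚ c ≋ b *ₚ (a *ₚ c)
  rearrange = RingSolver.solve-∀ polynomialRing
removals-qfactorials (suc a ∷ m) (there h) with ∈-map⁻ (λ c → lower c (suc a)) h
... | (j , m′) , c∈ , refl = ≋-trans (*-congˡ (qfact (suc a)) (removals-qfactorials m c∈)) (swap (qfact (suc a)) (qint (nth j m)) (qfactorials m′))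
  where
  swap : ∀ a b c → a *ₚ (b *ₚ c) ≋ b *ₚ (a *ₚ c)
  swap = RingSolver.solve-∀ polynomialRing

denominator : ℕ → List ℕ → Poly
denominator n m = qint (suc n) *ₚ qfactorials m *ₚ qfact n

-- The a for which the denominator divides [a] [n + l]! form an ideal, which contains n + 1 and the
-- multiplicities, hence n, hence 1.
module _ (n : ℕ) (m : List ℕ) (n≡ : weight m ≡ n) where

  private
    Den = denominator n m
    Num = qfact (n + sum m)
    I : ℕ → Set
    I a = Divides Den (qint a *ₚ Num)

    I-+ : ∀ a b → I a → I b → I (a + b)
    I-+ a b (k , e) (l , f) = k +ₚ Xpow a *ₚ l , ≋-trans (expand Den k (Xpow a) l)
      (≋-trans (+-cong e (*-congˡ (Xpow a) f)) (≋-trans (collect (qint a) (Xpow a) (qint b) Num) (*-congʳ Num (≋-sym (qint-+ a b)))))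
      where
      expand : ∀ d k x l → d *ₚ (k +ₚ x *ₚ l) ≋ d *ₚ k +ₚ x *ₚ (d *ₚ l)
      expand = RingSolver.solve-∀ polynomialRing
      collect : ∀ a x b n → a *ₚ n +ₚ x *ₚ (b *ₚ n) ≋ (a +ₚ x *ₚ b) *ₚ n
      collect = RingSolver.solve-∀ polynomialRing

    I-0 : I 0
    I-0 = [] , *-zeroʳ Den

    I-n+1 : I (suc n)
    I-n+1 = proj₁ Q *ₚ proj₁ B , ≋-trans (rearrange (qint (suc n)) (qfactorials m) (qfact n) (proj₁ Q) (proj₁ B))
      (*-congˡ (qint (suc n)) (≋-trans (*-congʳ (proj₁ B) (*-congˡ (qfact n) (proj₂ Q))) (proj₂ B)))
      where
      Q : Divides (qfactorials m) (qfact (sum m))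
      Q = qmultinomial m
      B : Divides (qfact n *ₚ qfact (sum m)) (qfact (n + sum m))
      B = qbinomial n (sum m)
      rearrange : ∀ i p f q b → (i *ₚ p *ₚ f) *ₚ (q *ₚ b) ≋ i *ₚ ((f *ₚ (p *ₚ q)) *ₚ b)
      rearrange = RingSolver.solve-∀ polynomialRing

    I-nth : ∀ j → I (nth j m)
    I-nth j = go (nth j m) refl
      where
      go : ∀ a → nth j m ≡ a → I a
      go zero _ = I-0
      go (suc a) e = proj₁ Q *ₚ proj₁ B , ≋-trans (*-congʳ (proj₁ Q *ₚ proj₁ B) (*-congʳ (qfact n) (*-congˡ (qint (suc n)) (≋-trans (removals-qfactorials m m′∈) (≋-reflexive (cong (λ z → qint z *ₚ qfactorials m′) e))))))
        (≋-trans (rearrange (qint (suc n)) (qint (suc a)) (qfactorials m′) (qfact n) (proj₁ Q) (proj₁ B))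
          (*-congˡ (qint (suc a)) (≋-trans (*-congʳ (proj₁ B) (*-congˡ (qfact (suc n)) (proj₂ Q))) (≋-trans (proj₂ B) (≋-reflexive (cong qfact size))))))
        where
        removal = removals-complete j m (subst (0 <_) (sym e) (s≤s z≤n))
        m′ = proj₁ removal
        m′∈ = proj₂ removal
        Q : Divides (qfactorials m′) (qfact (sum m′))
        Q = qmultinomial m′
        B : Divides (qfact (suc n) *ₚ qfact (sum m′)) (qfact (suc n + sum m′))
        B = qbinomial (suc n) (sum m′)
        size : suc n + sum m′ ≡ n + sum m
        size = trans (sym (ℕₚ.+-suc n (sum m′))) (cong (n +_) (sym (removals-sum m m′∈)))
        rearrange : ∀ i a p f q b → (i *ₚ (a *ₚ p) *ₚ f) *ₚ (q *ₚ b) ≋ a *ₚ (((f *ₚ i) *ₚ (p *ₚ q)) *ₚ b)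
        rearrange = RingSolver.solve-∀ polynomialRing

    I-sums : ∀ xs → (∀ j → I (nth j xs)) → I (sum xs) × I (weight xs)
    I-sums [] h = I-0 , I-0
    I-sums (x ∷ xs) h = I-+ x (sum xs) (h 0) (proj₁ rest) , I-+ x (sum xs + weight xs) (h 0) (I-+ (sum xs) (weight xs) (proj₁ rest) (proj₂ rest))
      where
      rest : I (sum xs) × I (weight xs)
      rest = I-sums xs (h ∘ suc)

    I-n : I n
    I-n = subst I n≡ (proj₂ (I-sums m I-nth))

  denominator-divides : Divides Den Num
  denominator-divides = proj₁ I-n+1 +ₚ negₚ (X *ₚ proj₁ I-n) , ≋-trans (expand Den (proj₁ I-n+1) X (proj₁ I-n))
    (≋-trans (+-cong (≋-trans (proj₂ I-n+1) (*-congʳ Num (qint-suc n))) (neg-cong (*-congˡ X (proj₂ I-n)))) (cancel X (qint n) Num))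
    where
    expand : ∀ d k x l → d *ₚ (k +ₚ negₚ (x *ₚ l)) ≋ d *ₚ k +ₚ negₚ (x *ₚ (d *ₚ l))
    expand = RingSolver.solve-∀ polynomialRing
    cancel : ∀ x q n → (oneₚ +ₚ x *ₚ q) *ₚ n +ₚ negₚ (x *ₚ (q *ₚ n)) ≋ n
    cancel = RingSolver.solve-∀ polynomialRing

-- Congruences

record Mod (Φ f g : Poly) : Set where
  constructor modulo
  field
    quotient : Poly
    equation : f ≋ g +ₚ Φ *ₚ quotient

module Congruence (Φ : Poly) where

  mod-≋ : ∀ {f g} → f ≋ g → Mod Φ f g
  mod-≋ {f} {g} e = modulo [] (≋-trans e (≋-sym (≋-trans (+-congˡ g (*-zeroʳ Φ)) (+-identityʳ g))))

  mod-refl : ∀ {f} → Mod Φ f f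
  mod-refl = mod-≋ ≋-refl

  mod-trans : ∀ {f g h} → Mod Φ f g → Mod Φ g h → Mod Φ f h
  mod-trans {f} {g} {h} (modulo k e) (modulo l e′) = modulo (l +ₚ k) (≋-trans e (≋-trans (+-congʳ (Φ *ₚ k) e′) (collect h Φ l k)))
    where
    collect : ∀ h p l k → (h +ₚ p *ₚ l) +ₚ p *ₚ k ≋ h +ₚ p *ₚ (l +ₚ k)
    collect = RingSolver.solve-∀ polynomialRing

  mod-sym : ∀ {f g} → Mod Φ f g → Mod Φ g f
  mod-sym {f} {g} (modulo k e) = modulo (negₚ k) (≋-trans (expand g Φ k) (+-congʳ (Φ *ₚ negₚ k) (≋-sym e)))
    where
    expand : ∀ g p k → g ≋ (g +ₚ p *ₚ k) +ₚ p *ₚ negₚ k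
    expand = RingSolver.solve-∀ polynomialRing

  mod-+ : ∀ {f g f′ g′} → Mod Φ f g → Mod Φ f′ g′ → Mod Φ (f +ₚ f′) (g +ₚ g′)
  mod-+ {f} {g} {f′} {g′} (modulo k e) (modulo l e′) = modulo (k +ₚ l) (≋-trans (+-cong e e′) (collect g Φ k g′ l))
    where
    collect : ∀ g p k h l → (g +ₚ p *ₚ k) +ₚ (h +ₚ p *ₚ l) ≋ (g +ₚ h) +ₚ p *ₚ (k +ₚ l)
    collect = RingSolver.solve-∀ polynomialRing

  mod-* : ∀ {f g f′ g′} → Mod Φ f g → Mod Φ f′ g′ → Mod Φ (f *ₚ f′) (g *ₚ g′)
  mod-* {f} {g} {f′} {g′} (modulo k e) (modulo l e′) = modulo (k *ₚ g′ +ₚ g *ₚ l +ₚ Φ *ₚ k *ₚ l) (≋-trans (*-cong e e′) (collect g Φ k g′ l))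
    where
    collect : ∀ g p k h l → (g +ₚ p *ₚ k) *ₚ (h +ₚ p *ₚ l) ≋ g *ₚ h +ₚ p *ₚ (k *ₚ h +ₚ g *ₚ l +ₚ p *ₚ k *ₚ l)
    collect = RingSolver.solve-∀ polynomialRing

  mod-*ˡ : ∀ h {f g} → Mod Φ f g → Mod Φ (h *ₚ f) (h *ₚ g)
  mod-*ˡ h = mod-* {h} {h} mod-refl

  mod-*ʳ : ∀ h {f g} → Mod Φ f g → Mod Φ (f *ₚ h) (g *ₚ h)
  mod-*ʳ h e = mod-* e (mod-refl {h})

  mod-divides : ∀ {f} → Divides Φ f → Mod Φ f []
  mod-divides (k , e) = modulo k (≋-sym e)

  divides-mod : ∀ {f} → Mod Φ f [] → Divides Φ f
  divides-mod (modulo k e) = k , ≋-sym e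

  mod-difference : ∀ {f g} → Mod Φ f g → Divides Φ (f +ₚ negₚ g)
  mod-difference {f} {g} (modulo k e) = k , ≋-sym (≋-trans (+-congʳ (negₚ g) e) (cancel g (Φ *ₚ k)))
    where
    cancel : ∀ g x → (g +ₚ x) +ₚ negₚ g ≋ x
    cancel = RingSolver.solve-∀ polynomialRing

  difference-mod : ∀ {f g} → Divides Φ (f +ₚ negₚ g) → Mod Φ f g
  difference-mod {f} {g} (k , e) = modulo k (≋-trans (expand f g) (+-congˡ g (≋-sym e)))
    where
    expand : ∀ f g → f ≋ g +ₚ (f +ₚ negₚ g)
    expand = RingSolver.solve-∀ polynomialRing

  Regular : Poly → Set
  Regular f = ∀ h → Divides Φ (f *ₚ h) → Divides Φ h

  divides-≋ : ∀ {f g} → f ≋ g → Divides Φ f → Divides Φ g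
  divides-≋ e (k , e′) = k , ≋-trans e′ e

  regular-* : ∀ {f g} → Regular f → Regular g → Regular (f *ₚ g)
  regular-* {f} {g} r s h d = s h (r (g *ₚ h) (divides-≋ (*-assoc f g h) d))

  regular-one : Regular oneₚ
  regular-one h = divides-≋ (*-identityˡ h)

  regular-cancel : ∀ f {g h} → Regular f → Mod Φ (f *ₚ g) (f *ₚ h) → Mod Φ g h
  regular-cancel f {g} {h} r e = difference-mod (r (g +ₚ negₚ h) (divides-≋ (expand f g h) (mod-difference e)))
    where
    expand : ∀ f g h → f *ₚ g +ₚ negₚ (f *ₚ h) ≋ f *ₚ (g +ₚ negₚ h)
    expand = RingSolver.solve-∀ polynomialRing

  regular-int : Unit Φ → ∀ c → Regular (int (ℤ.+ suc c))
  regular-int u c h d = unit-torsion c Φ h u d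

  regular-posint : Unit Φ → ∀ c → 0 < c → Regular (int (ℤ.+ c))
  regular-posint u (suc c) _ = regular-int u c

  -- Reads off an integer value given as a quotient of factorials: the denominator `a` is a
  -- nonzerodivisor modulo Φ.
  mod-int : Unit Φ → ∀ P a b c → 0 < a → c * a ≡ b → Mod Φ (P *ₚ int (ℤ.+ a)) (int (ℤ.+ b)) → Mod Φ P (int (ℤ.+ c))
  mod-int u P a b c 0<a e h = regular-cancel (int (ℤ.+ a)) (regular-posint u a 0<a)
    (mod-trans (mod-≋ (*-comm (int (ℤ.+ a)) P)) (mod-trans h (mod-≋ (≋-trans
      (≋-trans (≋-reflexive (cong int (trans (cong ℤ.+_ (sym e)) (ℤₚ.pos-* c a)))) (int-* (ℤ.+ c) (ℤ.+ a))) (*-comm (int (ℤ.+ c)) (int (ℤ.+ a)))))))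

int-pos-* : ∀ a b → int (ℤ.+ (a * b)) ≋ int (ℤ.+ a) *ₚ int (ℤ.+ b)
int-pos-* a b = ≋-trans (≋-reflexive (cong int (ℤₚ.pos-* a b))) (int-* (ℤ.+ a) (ℤ.+ b))

-- The value at q = 1

module AtOne (Φ : Poly) (Φ≋ : Φ ≋ Xpow-1 1) where
  open Congruence Φ

  X≡1 : Mod Φ X oneₚ
  X≡1 = modulo oneₚ (≋-trans (expand X) (+-congˡ oneₚ (≋-trans (≋-sym Φ≋) (≋-sym (*-identityʳ Φ)))))
    where
    expand : ∀ x → x ≋ oneₚ +ₚ (x +ₚ negₚ oneₚ)
    expand = RingSolver.solve-∀ polynomialRing

  qint≡ : ∀ a → Mod Φ (qint a) (int (ℤ.+ a))
  qint≡ zero = mod-≋ (≋-sym 0∷[])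
  qint≡ (suc a) = mod-trans (mod-≋ (qint-suc a)) (mod-+ (mod-refl {oneₚ}) (mod-trans (mod-* X≡1 (qint≡ a)) (mod-≋ (*-identityˡ (int (ℤ.+ a))))))

  qfact≡ : ∀ a → Mod Φ (qfact a) (int (ℤ.+ (a !)))
  qfact≡ zero = mod-refl
  qfact≡ (suc a) = mod-trans (mod-* (qfact≡ a) (qint≡ (suc a))) (mod-≋ (≋-trans (*-comm (int (ℤ.+ (a !))) (int (ℤ.+ suc a))) (≋-sym (int-pos-* (suc a) (a !)))))

  qfactorials≡ : ∀ m → Mod Φ (qfactorials m) (int (ℤ.+ factorials m))
  qfactorials≡ [] = mod-refl
  qfactorials≡ (a ∷ m) = mod-trans (mod-* (qfact≡ a) (qfactorials≡ m)) (mod-≋ (≋-sym (int-pos-* (a !) (factorials m))))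

  denominator≡ : ∀ n m → Mod Φ (denominator n m) (int (ℤ.+ (suc n * factorials m * n !)))
  denominator≡ n m = mod-trans (mod-* (mod-* (qint≡ (suc n)) (qfactorials≡ m)) (qfact≡ n))
    (mod-≋ (≋-sym (≋-trans (int-pos-* (suc n * factorials m) (n !)) (*-congʳ (int (ℤ.+ (n !))) (int-pos-* (suc n) (factorials m))))))

-- Evaluation at primitive d-th roots of unity, d ≥ 2

infixr 8 _^ₚ_
_^ₚ_ : Poly → ℕ → Poly
p ^ₚ zero = oneₚ
p ^ₚ suc k = p *ₚ p ^ₚ k

^ₚ-+ : ∀ p a b → p ^ₚ (a + b) ≋ p ^ₚ a *ₚ p ^ₚ b
^ₚ-+ p zero b = ≋-sym (*-identityˡ (p ^ₚ b))
^ₚ-+ p (suc a) b = ≋-trans (*-congˡ p (^ₚ-+ p a b)) (≋-sym (*-assoc p (p ^ₚ a) (p ^ₚ b)))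

unit-^ : ∀ p k → Unit p → Unit (p ^ₚ k)
unit-^ p zero u = 1ℤ , refl
unit-^ p (suc k) u = unit-* {p} {p ^ₚ k} u (unit-^ p k u)

quotients remainders : (d : ℕ) → .{{NonZero d}} → List ℕ → List ℕ
quotients d = map (_/ d)
remainders d = map (_% d)

sum-division : ∀ d .{{_ : NonZero d}} m → sum m ≡ sum (quotients d m) * d + sum (remainders d m)
sum-division d [] = refl
sum-division d (a ∷ m) = trans (cong₂ _+_ (m≡m%n+[m/n]*n a d) (sum-division d m)) (shuffle (a % d) (a / d) d (sum (quotients d m)) (sum (remainders d m)))
  where
  shuffle : ∀ x q d s t → (x + q * d) + (s * d + t) ≡ (q + s) * d + (x + t)
  shuffle = solve-∀

weight-division : ∀ d .{{_ : NonZero d}} m → weight m ≡ weight (quotients d m) * d + weight (remainders d m)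
weight-division d [] = refl
weight-division d (a ∷ m) = trans (cong₂ _+_ (m≡m%n+[m/n]*n a d) (cong₂ _+_ (sum-division d m) (weight-division d m)))
  (shuffle (a % d) (a / d) d (sum (quotients d m)) (sum (remainders d m)) (weight (quotients d m)) (weight (remainders d m)))
  where
  shuffle : ∀ x q d s t v w → (x + q * d) + ((s * d + t) + (v * d + w)) ≡ (q + (s + v)) * d + (x + (t + w))
  shuffle = solve-∀

factorials-positive : ∀ m → 0 < factorials m
factorials-positive [] = s≤s z≤n
factorials-positive (b ∷ m) = ℕₚ.*-mono-< {0} {b !} {0} {factorials m} (ℕₚ.1≤n! b) (factorials-positive m)

module AtRoot (e : ℕ) where

  d : ℕ
  d = suc (suc e)

  Φ : Poly
  Φ = cyclotomic d

  open Congruence Φ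

  unit-Φ : Unit Φ
  unit-Φ = Cyclotomic.unit (cyclotomic-all (suc e))

  qd : Poly
  qd = qint d

  qd≡0 : Mod Φ qd []
  qd≡0 = mod-divides (cyclotomic-∣-qint d (s≤s (s≤s z≤n)))

  Xd≡1 : Mod Φ (Xpow d) oneₚ
  Xd≡1 = mod-trans (mod-≋ (≋-trans (expand (Xpow d)) (+-congˡ oneₚ (≋-sym (Xpow-1-qint d)))))
    (mod-trans (mod-+ (mod-refl {oneₚ}) (mod-*ˡ (Xpow-1 1) qd≡0)) (mod-≋ (≋-trans (+-congˡ oneₚ (*-zeroʳ (Xpow-1 1))) (+-identityʳ oneₚ))))
    where
    expand : ∀ x → x ≋ oneₚ +ₚ (x +ₚ negₚ oneₚ)
    expand = RingSolver.solve-∀ polynomialRing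

  qint-period : ∀ b x → Mod Φ (qint (b * d + x)) (qint x)
  qint-period zero x = mod-refl
  qint-period (suc b) x = mod-trans (mod-≋ (≋-trans (≋-reflexive (cong qint (ℕₚ.+-assoc d (b * d) x))) (qint-+ d (b * d + x))))
    (mod-trans (mod-+ qd≡0 (mod-* Xd≡1 (qint-period b x))) (mod-≋ (*-identityˡ (qint x))))

  -- [b d] / [d] is 1 + X^d + ... + X^((b - 1) d), and X^d is 1 modulo Φ_d.
  qint-multiple : ∀ b → ∃ λ H → qint (b * d) ≋ qd *ₚ H × Mod Φ H (int (ℤ.+ b))
  qint-multiple zero = [] , ≋-sym (*-zeroʳ qd) , mod-≋ (≋-sym 0∷[])
  qint-multiple (suc b) = oneₚ +ₚ Xpow d *ₚ proj₁ IH , ≋-trans (qint-+ d (b * d)) (≋-trans (+-congˡ qd (*-congˡ (Xpow d) (proj₁ (proj₂ IH)))) (factor qd (Xpow d) (proj₁ IH))) ,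
    mod-+ (mod-refl {oneₚ}) (mod-trans (mod-* Xd≡1 (proj₂ (proj₂ IH))) (mod-≋ (*-identityˡ (int (ℤ.+ b)))))
    where
    IH : ∃ λ H → qint (b * d) ≋ qd *ₚ H × Mod Φ H (int (ℤ.+ b))
    IH = qint-multiple b
    factor : ∀ q x h → q +ₚ x *ₚ (q *ₚ h) ≋ q *ₚ (oneₚ +ₚ x *ₚ h)
    factor = RingSolver.solve-∀ polynomialRing

  F : Poly
  F = qfact (suc e)

  -- The power of [d] is split off by an exact equation, since modulo Φ it is 0 for k > 0 and could
  -- not be cancelled any more; only the cofactor is reduced.
  record Factored (p : Poly) (k : ℕ) (value : Poly) : Set where
    constructor factored
    field
      E : Poly
      splits : p ≋ qd ^ₚ k *ₚ E
      value≡ : Mod Φ E value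

  factored-suc : ∀ b ρ → Factored (qfact (b * d + ρ)) b (F ^ₚ b *ₚ int (ℤ.+ (b !)) *ₚ qfact ρ) → Factored (qfact (b * d + suc ρ)) b (F ^ₚ b *ₚ int (ℤ.+ (b !)) *ₚ qfact (suc ρ))
  factored-suc b ρ IH = factored (Factored.E IH *ₚ qint (b * d + suc ρ))
    (≋-trans (≋-reflexive (trans (cong qfact (ℕₚ.+-suc (b * d) ρ)) (cong (λ z → qfact (b * d + ρ) *ₚ qint z) (sym (ℕₚ.+-suc (b * d) ρ)))))
      (≋-trans (*-congʳ (qint (b * d + suc ρ)) (Factored.splits IH)) (*-assoc (qd ^ₚ b) (Factored.E IH) (qint (b * d + suc ρ)))))
    (mod-trans (mod-* (Factored.value≡ IH) (qint-period b (suc ρ))) (mod-≋ (*-assoc (F ^ₚ b *ₚ int (ℤ.+ (b !))) (qfact ρ) (qint (suc ρ)))))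

  -- In a block of `d` consecutive factors the nonmultiples of `d` reduce to [1], ..., [d - 1],
  -- while [j d] contributes [d] and a cofactor congruent to j.
  qfact-factored : ∀ b ρ → ρ < d → Factored (qfact (b * d + ρ)) b (F ^ₚ b *ₚ int (ℤ.+ (b !)) *ₚ qfact ρ)
  qfact-factored zero ρ h = factored (qfact ρ) (≋-sym (*-identityˡ (qfact ρ))) (mod-≋ (≋-sym (≋-trans (*-congʳ (qfact ρ) (*-identityˡ oneₚ)) (*-identityˡ (qfact ρ)))))
  qfact-factored (suc b) zero h = factored (Factored.E IH *ₚ proj₁ Q)
    (≋-trans (≋-reflexive (cong qfact (ℕₚ.+-identityʳ (suc b * d)))) (≋-trans (*-cong (≋-trans (≋-reflexive (cong qfact (ℕₚ.+-comm (suc e) (b * d)))) (Factored.splits IH)) (proj₁ (proj₂ Q)))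
      (rearrange (qd ^ₚ b) (Factored.E IH) qd (proj₁ Q))))
    (mod-trans (mod-* (Factored.value≡ IH) (proj₂ (proj₂ Q))) (mod-≋ (≋-trans (rearrange′ (F ^ₚ b) (int (ℤ.+ (b !))) F (int (ℤ.+ suc b)))
      (*-congʳ oneₚ (*-congˡ (F *ₚ F ^ₚ b) (≋-sym (int-pos-* (suc b) (b !))))))))
    where
    IH : Factored (qfact (b * d + suc e)) b (F ^ₚ b *ₚ int (ℤ.+ (b !)) *ₚ F)
    IH = qfact-factored b (suc e) ℕₚ.≤-refl
    Q : ∃ λ H → qint (suc b * d) ≋ qd *ₚ H × Mod Φ H (int (ℤ.+ suc b))
    Q = qint-multiple (suc b)
    rearrange : ∀ p e q h → (p *ₚ e) *ₚ (q *ₚ h) ≋ (q *ₚ p) *ₚ (e *ₚ h)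
    rearrange = RingSolver.solve-∀ polynomialRing
    rearrange′ : ∀ p i f j → (p *ₚ i *ₚ f) *ₚ j ≋ (f *ₚ p) *ₚ (j *ₚ i) *ₚ oneₚ
    rearrange′ = RingSolver.solve-∀ polynomialRing
  qfact-factored (suc b) (suc ρ) h = factored-suc (suc b) ρ (qfact-factored (suc b) ρ (ℕₚ.<-trans ℕₚ.≤-refl h))

  qfactorials-factored : ∀ m → Factored (qfactorials m) (sum (quotients d m))
    (F ^ₚ sum (quotients d m) *ₚ int (ℤ.+ factorials (quotients d m)) *ₚ qfactorials (remainders d m))
  qfactorials-factored [] = factored oneₚ (≋-sym (*-identityˡ oneₚ)) (mod-≋ (≋-sym (≋-trans (*-congʳ oneₚ (*-identityˡ oneₚ)) (*-identityˡ oneₚ))))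
  qfactorials-factored (a ∷ m) = factored (Factored.E A *ₚ Factored.E B)
    (≋-trans (*-cong (≋-trans (≋-reflexive (cong qfact (trans (m≡m%n+[m/n]*n a d) (ℕₚ.+-comm (a % d) (a / d * d))))) (Factored.splits A)) (Factored.splits B))
      (≋-trans (interleave (qd ^ₚ (a / d)) (Factored.E A) (qd ^ₚ s) (Factored.E B)) (*-congʳ (Factored.E A *ₚ Factored.E B) (≋-sym (^ₚ-+ qd (a / d) s)))))
    (mod-trans (mod-* (Factored.value≡ A) (Factored.value≡ B))
      (mod-≋ (≋-trans (collect (F ^ₚ (a / d)) (int (ℤ.+ ((a / d) !))) (qfact (a % d)) (F ^ₚ s) (int (ℤ.+ factorials (quotients d m))) (qfactorials (remainders d m)))
        (*-congʳ (qfact (a % d) *ₚ qfactorials (remainders d m)) (*-cong (≋-sym (^ₚ-+ F (a / d) s)) (≋-sym (int-pos-* ((a / d) !) (factorials (quotients d m)))))))))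
    where
    s = sum (quotients d m)
    A : Factored (qfact (a / d * d + a % d)) (a / d) (F ^ₚ (a / d) *ₚ int (ℤ.+ ((a / d) !)) *ₚ qfact (a % d))
    A = qfact-factored (a / d) (a % d) (m%n<n a d)
    B : Factored (qfactorials m) s (F ^ₚ s *ₚ int (ℤ.+ factorials (quotients d m)) *ₚ qfactorials (remainders d m))
    B = qfactorials-factored m
    interleave : ∀ p a q b → (p *ₚ a) *ₚ (q *ₚ b) ≋ (p *ₚ q) *ₚ (a *ₚ b)
    interleave = RingSolver.solve-∀ polynomialRing
    collect : ∀ f i x g j y → (f *ₚ i *ₚ x) *ₚ (g *ₚ j *ₚ y) ≋ (f *ₚ g) *ₚ (i *ₚ j) *ₚ (x *ₚ y)
    collect = RingSolver.solve-∀ polynomialRing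

  regular-qint : ∀ a → 0 < a → a < d → Regular (qint a)
  regular-qint a 0<a a<d h = independent-cancel unit-Φ (cyclotomic-independent-qint d a (s≤s z≤n) (λ d∣a → ℕₚ.<⇒≱ a<d (Div.∣⇒≤ {{>-nonZero 0<a}} d∣a)))

  regular-qfact : ∀ a → a < d → Regular (qfact a)
  regular-qfact zero _ = regular-one
  regular-qfact (suc a) h = regular-* {qfact a} {qint (suc a)} (regular-qfact a (ℕₚ.<-trans ℕₚ.≤-refl h)) (regular-qint (suc a) (s≤s z≤n) h)

  regular-^ : ∀ {p} k → Regular p → Regular (p ^ₚ k)
  regular-^ zero r = regular-one
  regular-^ {p} (suc k) r = regular-* {p} {p ^ₚ k} r (regular-^ k r)

  regular-qfactorials : ∀ m → (∀ {a} → a ∈ m → a < d) → Regular (qfactorials m)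
  regular-qfactorials [] h = regular-one
  regular-qfactorials (a ∷ m) h = regular-* {qfact a} {qfactorials m} (regular-qfact a (h (here refl))) (regular-qfactorials m (h ∘ there))

  regular-F : Regular F
  regular-F = regular-qfact (suc e) ℕₚ.≤-refl

  module _ (a : ℕ) (m : List ℕ) (P : Poly) where

    private
      -- From n + 2 = d (a + 1) the remainder of `n` modulo `d` is d - 2 = `e`. Hence [n + 1]
      -- reduces to [d - 1], which completes the leftover [d - 2]! of [n]! to `F`.
      n = a * d + e
      p = sum (quotients d m)
      σ = sum (remainders d m)
      M : Factored (qfactorials m) p (F ^ₚ p *ₚ int (ℤ.+ factorials (quotients d m)) *ₚ qfactorials (remainders d m))
      M = qfactorials-factored m
      G : Factored (qfact n) a (F ^ₚ a *ₚ int (ℤ.+ (a !)) *ₚ qfact e)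
      G = qfact-factored a e (ℕₚ.<-trans ℕₚ.≤-refl ℕₚ.≤-refl)
      q = qint (suc n)
      q≡ : Mod Φ q (qint (suc e))
      q≡ = mod-trans (mod-≋ (≋-reflexive (cong qint (sym (ℕₚ.+-suc (a * d) e))))) (qint-period a (suc e))
      A = factorials (quotients d m) * a !
      rest : Poly
      rest = q *ₚ Factored.E M *ₚ Factored.E G
      R = qfactorials (remainders d m)
      rest≡ : Mod Φ rest (F ^ₚ (a + p) *ₚ F *ₚ R *ₚ int (ℤ.+ A))
      rest≡ = mod-trans (mod-* (mod-* q≡ (Factored.value≡ M)) (Factored.value≡ G))
        (mod-≋ (≋-trans (collect (qint (suc e)) (F ^ₚ p) (int (ℤ.+ factorials (quotients d m))) R (F ^ₚ a) (int (ℤ.+ (a !))) (qfact e))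
          (*-cong (*-congʳ R (*-congʳ F (≋-sym (^ₚ-+ F a p)))) (≋-sym (int-pos-* (factorials (quotients d m)) (a !))))))
        where
        collect : ∀ i f x r g y k → (i *ₚ (f *ₚ x *ₚ r)) *ₚ (g *ₚ y *ₚ k) ≋ (g *ₚ f) *ₚ (k *ₚ i) *ₚ r *ₚ (x *ₚ y)
        collect = RingSolver.solve-∀ polynomialRing
      denominator-splits : denominator n m ≋ qd ^ₚ (a + p) *ₚ rest
      denominator-splits = ≋-trans (*-cong (*-congˡ q (Factored.splits M)) (Factored.splits G))
        (≋-trans (collect q (qd ^ₚ p) (Factored.E M) (qd ^ₚ a) (Factored.E G)) (*-congʳ rest (≋-sym (^ₚ-+ qd a p))))
        where
        collect : ∀ q x e y g → q *ₚ (x *ₚ e) *ₚ (y *ₚ g) ≋ (y *ₚ x) *ₚ (q *ₚ e *ₚ g)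
        collect = RingSolver.solve-∀ polynomialRing
      cancel-qd : ∀ {Num E} → P *ₚ denominator n m ≋ Num → Num ≋ qd ^ₚ (a + p) *ₚ E → P *ₚ rest ≋ E
      -- [d] has constant term 1, so its power cancels in ℤ[q] itself.
      cancel-qd {Num} {E} h k = unit-cancelˡ (qd ^ₚ (a + p)) (unit-^ qd (a + p) (1ℤ , refl))
        (≋-trans (swap (qd ^ₚ (a + p)) P rest) (≋-trans (*-congˡ P (≋-sym denominator-splits)) (≋-trans h k)))
        where
        swap : ∀ x p r → x *ₚ (p *ₚ r) ≋ p *ₚ (x *ₚ r)
        swap = RingSolver.solve-∀ polynomialRing
      total : n + sum m ≡ (a + p) * d + (e + σ)
      total = trans (cong (n +_) (sum-division d m)) (shuffle a d e p σ)
        where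
        shuffle : ∀ a d e p s → (a * d + e) + (p * d + s) ≡ (a + p) * d + (e + s)
        shuffle = solve-∀
      A>0 : 0 < A
      A>0 = ℕₚ.*-mono-< {0} {factorials (quotients d m)} {0} {a !} (factorials-positive (quotients d m)) (ℕₚ.1≤n! a)
      remainder-bound : ∀ {x} → x ∈ remainders d m → x < d
      remainder-bound h with ∈-map⁻ (_% d) h
      ... | y , _ , refl = m%n<n y d

    -- For σ ≥ 2 the leftover e + σ of the numerator reaches `d`, so the numerator keeps at least
    -- one factor [d] more than the denominator.
    evaluate-zero : P *ₚ denominator n m ≋ qfact (n + sum m) → 2 ≤ σ → Divides Φ P
    evaluate-zero h 2≤σ = regular-^ (a + p) regular-F P (regular-F ((F ^ₚ (a + p)) *ₚ P)
        (regular-qfactorials (remainders d m) remainder-bound (F *ₚ ((F ^ₚ (a + p)) *ₚ P)) (regular-posint unit-Φ A A>0 (R *ₚ (F *ₚ ((F ^ₚ (a + p)) *ₚ P)))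
          (divides-mod (mod-trans (mod-≋ (rearrange (int (ℤ.+ A)) R F (F ^ₚ (a + p)) P)) (mod-trans (mod-*ˡ P (mod-sym rest≡)) (mod-trans (mod-≋ (cancel-qd h splits)) vanishes)))))))
      where
      rearrange : ∀ i r f g p → i *ₚ (r *ₚ (f *ₚ (g *ₚ p))) ≋ p *ₚ (g *ₚ f *ₚ r *ₚ i)
      rearrange = RingSolver.solve-∀ polynomialRing
      τ = e + σ ∸ d
      τ≡ : d + τ ≡ e + σ
      τ≡ = ℕₚ.m+[n∸m]≡n (subst (_≤ e + σ) (ℕₚ.+-comm e 2) (ℕₚ.+-monoʳ-≤ e 2≤σ))
      t = τ / d
      N : Factored (qfact ((a + p + suc t) * d + τ % d)) (a + p + suc t) (F ^ₚ (a + p + suc t) *ₚ int (ℤ.+ ((a + p + suc t) !)) *ₚ qfact (τ % d))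
      N = qfact-factored (a + p + suc t) (τ % d) (m%n<n τ d)
      size : n + sum m ≡ (a + p + suc t) * d + τ % d
      size = trans total (trans (cong ((a + p) * d +_) (trans (sym τ≡) (cong (d +_) (m≡m%n+[m/n]*n τ d)))) (shuffle (a + p) d (τ % d) t))
        where
        shuffle : ∀ x d r t → x * d + (d + (r + t * d)) ≡ (x + suc t) * d + r
        shuffle = solve-∀
      splits : qfact (n + sum m) ≋ qd ^ₚ (a + p) *ₚ (qd ^ₚ suc t *ₚ Factored.E N)
      splits = ≋-trans (≋-reflexive (cong qfact size)) (≋-trans (Factored.splits N)
        (≋-trans (*-congʳ (Factored.E N) (^ₚ-+ qd (a + p) (suc t))) (*-assoc (qd ^ₚ (a + p)) (qd ^ₚ suc t) (Factored.E N))))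
      vanishes : Mod Φ (qd ^ₚ suc t *ₚ Factored.E N) []
      vanishes = mod-*ʳ (Factored.E N) (mod-*ʳ (qd ^ₚ t) qd≡0)

    -- Both sides carry the same power of [d], and what must still agree is the leftover [e + σ]! of
    -- the numerator with `F` = [e + 1]!. This holds for σ = 1, and for σ = 0 when d = 2, where both
    -- are 1: the case of a central diameter.
    evaluate : P *ₚ denominator n m ≋ qfact (n + sum m) → σ ≤ 1 → σ ≡ 1 ⊎ e ≡ 0 → ∀ c → c * A ≡ (a + p) ! → Mod Φ P (int (ℤ.+ c))
    evaluate h σ≤1 σ≡1⊎e≡0 c cA = mod-int unit-Φ P A ((a + p) !) c A>0 cA
      (regular-cancel (F ^ₚ (a + p) *ₚ F) (regular-* {F ^ₚ (a + p)} {F} (regular-^ (a + p) regular-F) regular-F)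
        (mod-trans (mod-≋ (≋-trans (rearrange (F ^ₚ (a + p)) F P (int (ℤ.+ A))) (*-congˡ P (*-congʳ (int (ℤ.+ A)) (*-congˡ (F ^ₚ (a + p) *ₚ F) (≋-sym (trivial (remainders d m) σ≤1)))))))
          (mod-trans (mod-*ˡ P (mod-sym rest≡)) (mod-trans (mod-≋ (cancel-qd h (≋-trans (≋-reflexive (cong qfact total)) (Factored.splits N))))
            (mod-trans (Factored.value≡ N) (mod-≋ (≋-trans (*-congˡ (F ^ₚ (a + p) *ₚ int (ℤ.+ ((a + p) !))) last) (swap (F ^ₚ (a + p)) (int (ℤ.+ ((a + p) !))) F))))))))
      where
      rearrange : ∀ g f p i → (g *ₚ f) *ₚ (p *ₚ i) ≋ p *ₚ (g *ₚ f *ₚ oneₚ *ₚ i)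
      rearrange = RingSolver.solve-∀ polynomialRing
      swap : ∀ g i f → g *ₚ i *ₚ f ≋ (g *ₚ f) *ₚ i
      swap = RingSolver.solve-∀ polynomialRing
      trivial : ∀ ρs → sum ρs ≤ 1 → qfactorials ρs ≋ oneₚ
      trivial [] _ = ≋-refl
      trivial (zero ∷ ρs) h = ≋-trans (*-identityˡ (qfactorials ρs)) (trivial ρs h)
      trivial (suc zero ∷ ρs) (s≤s h) = ≋-trans (*-cong (*-identityˡ oneₚ) (trivial ρs (ℕₚ.m≤n⇒m≤1+n h))) (*-identityˡ oneₚ)
      trivial (suc (suc a) ∷ ρs) (s≤s ())
      N : Factored (qfact ((a + p) * d + (e + σ))) (a + p) (F ^ₚ (a + p) *ₚ int (ℤ.+ ((a + p) !)) *ₚ qfact (e + σ))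
      N = qfact-factored (a + p) (e + σ) (s≤s (subst (e + σ ≤_) (ℕₚ.+-comm e 1) (ℕₚ.+-monoʳ-≤ e σ≤1)))
      last : qfact (e + σ) ≋ F
      last = go e σ σ≤1 σ≡1⊎e≡0
        where
        go : ∀ e σ → σ ≤ 1 → σ ≡ 1 ⊎ e ≡ 0 → qfact (e + σ) ≋ qfact (suc e)
        go e .1 _ (inj₁ refl) = ≋-reflexive (cong qfact (ℕₚ.+-comm e 1))
        go .0 zero _ (inj₂ refl) = ≋-sym (*-identityˡ oneₚ)
        go .0 (suc zero) _ (inj₂ refl) = ≋-refl
        go .0 (suc (suc σ)) (s≤s ()) (inj₂ refl)

-- Comparison of the values of μ with the fixed points

sum-indicators : ∀ {A : Set} (f : A → Bool) xs → sum (map (indicator ∘ f) xs) ≡ length (filterᵇ f xs)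
sum-indicators f [] = refl
sum-indicators f (x ∷ xs) with f x
... | true = cong suc (sum-indicators f xs)
... | false = sum-indicators f xs

sum≡1⇒nth : ∀ m → sum m ≡ 1 → ∃ λ j → (∀ i → nth i m ≡ indicator (j ≡ᵇ i)) × weight m ≡ suc j
sum≡1⇒nth (zero ∷ m) e with sum≡1⇒nth m e
... | j , h , w = suc j , (λ { zero → refl ; (suc i) → h i }) , cong₂ _+_ e w
sum≡1⇒nth (suc zero ∷ m) e = 0 , (λ { zero → refl ; (suc i) → sum≡0⇒nth m (ℕₚ.suc-injective e) i }) ,
  cong suc (cong₂ _+_ (ℕₚ.suc-injective e) (sum≡0⇒weight m (ℕₚ.suc-injective e)))

module Sieving (n : ℕ) (lam : List ℕ) (1≤n : 1 ≤ n) (part : IsPartition n lam) where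

  m : List ℕ
  m = mults n lam

  private
    integrality : Divides (denominator n m) (qfact (n + sum m))
    integrality = denominator-divides n m (proj₁ (partition-stats part))

  μ : Poly
  μ = proj₁ integrality

  μ-denominator : μ *ₚ denominator n m ≋ qfact (n + sum m)
  μ-denominator = ≋-trans (*-comm μ (denominator n m)) (proj₂ integrality)

  μ-equation : μ *ₚ muDen n lam ≈ₚ muNum n lam
  μ-equation = ≋⇒≈ (≋-trans (≋-reflexive (cong (λ z → μ *ₚ (qint (suc n) *ₚ prodₚ z *ₚ qfact n)) (Listₚ.map-∘ (upTo n))))
    (≋-trans μ-denominator (≋-reflexive (cong (λ z → qfact (n + z)) (proj₂ (partition-stats part))))))

  cyclotomic-1 : cyclotomic 1 ≋ Xpow-1 1
  cyclotomic-1 = ≋-trans (≋-sym (≋-trans (divisorProduct-∣ 0 1 Div.∣-refl) (*-identityˡ (cyclotomic 1)))) (Cyclotomic.divisors (cyclotomic-all 0))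

  at-one : Mod (cyclotomic 1) μ (int (ℤ.+ fixCount n lam 0))
  at-one = mod-int (Cyclotomic.unit (cyclotomic-all 0)) μ (suc n * factorials m * n !) ((n + sum m) !) (fixCount n lam 0)
    (ℕₚ.*-mono-< {0} {suc n * factorials m} {0} {n !} (ℕₚ.*-mono-< {0} {suc n} {0} {factorials m} (s≤s z≤n) (factorials-positive m)) (ℕₚ.1≤n! n))
    (trans (cong (_* (suc n * factorials m * n !)) (fixCount-identity n lam)) (trans (rearrange (length (Slam n lam)) n (factorials m) (n !))
      (trans (Slam-number 1≤n part) (cong (λ z → (n + z) !) (sym (proj₂ (partition-stats part)))))))
    (mod-trans (mod-*ˡ μ (mod-sym (denominator≡ n m))) (mod-trans (mod-≋ μ-denominator) (qfact≡ (n + sum m))))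
    where
    open Congruence (cyclotomic 1)
    open AtOne (cyclotomic 1) cyclotomic-1
    rearrange : ∀ l n f g → l * (suc n * f * g) ≡ l * (suc n * g) * f
    rearrange = solve-∀

  module _ (e a k : ℕ) (N≡ : suc (suc n) ≡ suc (suc e) * suc a)
    (k⇒r : ∀ {D} → Period n D k → Period n D (suc a)) (r⇒k : ∀ {D} → Period n D (suc a) → Period n D k) where

    open AtRoot e
    open Congruence Φ
    open Averaging n d (suc a) N≡ (s≤s (s≤s z≤n)) 1≤n lam part k k⇒r r⇒k hiding (d-nonZero; quotient)

    private
      cnt : ℕ → ℕ
      cnt j = count (suc j) lam

      n≡ : n ≡ a * d + e
      n≡ = ℕₚ.suc-injective (ℕₚ.suc-injective (trans N≡ (shuffle e a)))
        where
        shuffle : ∀ e a → suc (suc e) * suc a ≡ suc (suc (a * suc (suc e) + e))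
        shuffle = solve-∀

      equation : μ *ₚ denominator (a * d + e) m ≋ qfact (a * d + e + sum m)
      equation = subst (λ z → μ *ₚ denominator z m ≋ qfact (z + sum m)) n≡ μ-denominator

      σ : ℕ
      σ = sum (remainders d m)

      b≡ : b ≡ quotients d m
      b≡ = Listₚ.map-∘ (upTo n)

      remainders≡ : remainders d m ≡ map (λ j → cnt j % d) (upTo n)
      remainders≡ = sym (Listₚ.map-∘ (upTo n))

      nth-remainder : ∀ j → j < n → cnt j % d ≡ nth j (remainders d m)
      nth-remainder j j<n = trans (sym (nth-map-applyUpTo (λ j → cnt j % d) id n j j<n)) (cong (nth j) (sym remainders≡))

      -- By `typed` the multiplicity of label j + 1 leaves remainder 1 modulo `d` if d u = j + 3 and
      -- remainder 0 otherwise; the only candidate is j = d u - 3.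
      compatible⇒σ≤1 : ∀ {u} → Compatible u → σ ≤ 1
      compatible⇒σ≤1 {u} (compatible _ typed _) = subst (_≤ 1) (sym σ≡)
        (length-≤-⊑ {ys = [ d * u ∸ 3 ]} (Unique-filterᵇ {p = f} (Increasing⇒Unique (upTo-increasing n)))
          (λ {j} q → here (sym (cong (_∸ 3) (ℕₚ.≡ᵇ⇒≡ (d * u) (3 + j) (proj₂ (∈-filterᵇ⁻ {p = f} {xs = upTo n} q)))))))
        where
        f : ℕ → Bool
        f j = d * u ≡ᵇ suc (suc (suc j))
        remainder : ∀ j → j < n → cnt j % d ≡ indicator (f j)
        remainder j j<n = ℕₚ.+-cancelʳ-≡ (cnt j / d * d) _ _ (trans (sym (m≡m%n+[m/n]*n (cnt j) d))
          (trans (typed j j<n) (trans (ℕₚ.+-comm (d * (cnt j / d)) _) (cong (indicator (f j) +_) (ℕₚ.*-comm d (cnt j / d))))))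
        σ≡ : σ ≡ length (filterᵇ f (upTo n))
        σ≡ = trans (cong sum (trans remainders≡ (Listₚ.map-cong-local (All.tabulate (λ q → remainder _ (∈-upTo⁻ q)))))) (sum-indicators f (upTo n))

      u : ℕ
      u = suc a ∸ weight b

      divided : suc (suc (weight b * d + weight (remainders d m))) ≡ d * suc a
      divided = trans (cong (λ z → suc (suc z)) (trans (cong (λ z → weight z * d + weight (remainders d m)) b≡)
        (trans (sym (weight-division d m)) (proj₁ (partition-stats part))))) N≡

      u-size : u + weight b ≡ suc a
      u-size = ℕₚ.m∸n+n≡m {suc a} {weight b} (ℕₚ.≮⇒≥ λ h → ℕₚ.<⇒≱ (ℕₚ.≤-trans (s≤s (ℕₚ.*-monoʳ-≤ d (ℕₚ.<⇒≤ h)))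
        (s≤s (ℕₚ.≤-trans (ℕₚ.≤-reflexive (ℕₚ.*-comm d (weight b))) (ℕₚ.≤-trans (ℕₚ.m≤m+n _ _) (ℕₚ.n≤1+n _))))) (ℕₚ.≤-reflexive divided))

      -- Subtracting `d` times `weight b` from n + 2 = d (a + 1). The remainders alone thus dictate
      -- the size of the centre: j + 3 for a single remainder 1 at label j + 1, and 2 if there is
      -- none.
      du≡ : d * u ≡ suc (suc (weight (remainders d m)))
      du≡ = ℕₚ.+-cancelʳ-≡ (weight b * d) _ _ (trans (cong (d * u +_) (ℕₚ.*-comm (weight b) d)) (trans (sym (ℕₚ.*-distribˡ-+ d u (weight b)))
        (trans (cong (d *_) u-size) (trans (sym divided) (cong (λ z → suc (suc z)) (ℕₚ.+-comm (weight b * d) _))))))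

      u-compatible : (∀ j → j < n → cnt j % d ≡ indicator (d * u ≡ᵇ suc (suc (suc j)))) → Compatible u
      u-compatible h = compatible
        (ℕₚ.n≢0⇒n>0 (λ u≡0 → ℕₚ.0≢1+n (trans (sym (trans (cong (d *_) u≡0) (ℕₚ.*-zeroʳ d))) du≡)))
        (λ j j<n → trans (m≡m%n+[m/n]*n (cnt j) d) (trans (ℕₚ.+-comm (cnt j % d) _) (cong₂ _+_ (ℕₚ.*-comm (cnt j / d) d) (h j j<n))))
        u-size

      -- Without remainders d u = 2, so d = 2 and the centre is a diameter. The combination σ = 0, d
      -- > 2, which `evaluate` does not cover, is therefore impossible.
      split-compatible : σ ≤ 1 → Compatible u × (σ ≡ 1 ⊎ e ≡ 0)
      split-compatible σ≤1 with ℕₚ.m≤n⇒m<n∨m≡n σ≤1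
      ... | inj₂ σ≡1 = u-compatible (λ i i<n → trans (nth-remainder i i<n) (trans (proj₁ (proj₂ single) i)
          (sym (cong (λ z → indicator (z ≡ᵇ suc (suc (suc i)))) (trans du≡ (cong (λ z → suc (suc z)) (proj₂ (proj₂ single)))))))) , inj₁ σ≡1
        where
        single = sum≡1⇒nth (remainders d m) σ≡1
      ... | inj₁ σ<1 = u-compatible (λ i i<n → trans (nth-remainder i i<n) (trans (sum≡0⇒nth (remainders d m) σ≡0 i)
          (sym (cong (λ z → indicator (z ≡ᵇ suc (suc (suc i)))) du≡2)))) , inj₂ (only-two e u du≡2)
        where
        σ≡0 = ℕₚ.n<1⇒n≡0 σ<1
        du≡2 : d * u ≡ 2
        du≡2 = trans du≡ (cong (λ z → suc (suc z)) (sum≡0⇒weight (remainders d m) σ≡0))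
        only-two : ∀ e u → suc (suc e) * u ≡ 2 → e ≡ 0
        only-two e zero h = ⊥-elim (ℕₚ.0≢1+n (trans (sym (ℕₚ.*-zeroʳ e)) h))
        only-two e (suc u) h = ℕₚ.n≤0⇒n≡0 (s≤s⁻¹ (s≤s⁻¹ (ℕₚ.≤-trans (ℕₚ.m≤m*n (suc (suc e)) (suc u)) (ℕₚ.≤-reflexive h))))

      vanishing : 2 ≤ σ → fixCount n lam k ≡ 0
      vanishing 2≤σ = go fixed refl
        where
        go : ∀ F → fixed ≡ F → length F ≡ 0
        go [] _ = refl
        go (D ∷ F) e = ⊥-elim (ℕₚ.<⇒≱ 2≤σ (compatible⇒σ≤1 (proj₂ (fixed-compatible (subst (D ∈_) (sym e) (here refl))))))

    -- Here d = `e + 2` and N / d = `a + 1`. For σ ≥ 2 both sides vanish, as no compatible centre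
    -- exists; otherwise `fixed-number` and `evaluate` yield the same quotient of factorials.
    at-root : Mod Φ μ (int (ℤ.+ fixCount n lam k))
    at-root with ℕₚ.<-≤-connex 1 σ
    ... | inj₁ 2≤σ = mod-trans (mod-divides (evaluate-zero a m μ equation 2≤σ)) (mod-≋ (≋-trans (≋-sym 0∷[]) (≋-reflexive (cong (λ z → int (ℤ.+ z)) (sym (vanishing 2≤σ))))))
    ... | inj₂ σ≤1 = evaluate a m μ equation σ≤1 (proj₂ (split-compatible σ≤1)) (fixCount n lam k)
      (trans (rearrange (fixCount n lam k) (factorials (quotients d m)) (a !)) (subst (λ z → fixCount n lam k * a ! * factorials z ≡ (a + sum z) !) b≡ (fixed-number (proj₁ (split-compatible σ≤1)))))
      where
      rearrange : ∀ c f g → c * (f * g) ≡ c * g * f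
      rearrange = solve-∀

  μ-at : ∀ k → k < suc (suc n) → ∀ d → IsOrderOf n k d → Mod (cyclotomic d) μ (int (ℤ.+ fixCount n lam k))
  μ-at k k<N zero (() , _)
  μ-at zero k<N (suc zero) o = at-one
  μ-at (suc k) k<N (suc zero) (_ , N∣k , _) = ⊥-elim (ℕₚ.<⇒≱ k<N (Div.∣⇒≤ (subst (suc (suc n) ∣_) (ℕₚ.*-identityʳ (suc k)) N∣k)))
  μ-at k k<N (suc (suc e)) o = go (proj₁ divisor) (proj₂ divisor)
    where
    divisor : ∃ λ r → suc (suc n) ≡ suc (suc e) * r
    divisor = order-divides {n} {k} o
    go : ∀ r → suc (suc n) ≡ suc (suc e) * r → Mod (cyclotomic (suc (suc e))) μ (int (ℤ.+ fixCount n lam k))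
    go zero N≡ = ⊥-elim (ℕₚ.0≢1+n (sym (trans N≡ (ℕₚ.*-zeroʳ e))))
    go (suc a) N≡ = at-root e a k N≡ (proj₁ (order-period {n} {k} {r = suc a} o N≡)) (proj₂ (order-period {n} {k} {r = suc a} o N≡))

theorem5p2 : (n : ℕ) (lam : List ℕ) → 1 ≤ n → IsPartition n lam →
    Σ Poly (λ P → (P *ₚ muDen n lam ≈ₚ muNum n lam) × CSP n lam P)
theorem5p2 n lam 1≤n part = μ , μ-equation , λ k k<N d o →
  let (Q , e) = Congruence.mod-difference (cyclotomic d) (μ-at k k<N d o) in Q , ≋⇒≈ e
  where open Sieving n lam 1≤n part
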